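{- Let $e_2,e_1,e_0\in\mathbb{Q}$. The polynomial $e_2t^2+e_1t+e_0\in\mathbb{Q}[t]$ is the Ehrhart polynomial of a pseudo-integral polygon $P\subseteq\mathbb{R}^2$ with $\mathrm{denom}(P)=2$ if and only if $e_0=1$ and there exists a pair \[(i,b)\in\{(0,3)\}\ \cup\ \{(x,y)\in\mathbb{Z}_{\geq 0}^2 \mid x>0,\ 2\leq y\leq 2x+7\}\] with $e_2=i+\frac{b}{2}-1$ and $e_1=\frac{b}{2}$.
   Context: A rational polygon is the convex hull of finitely many points of $\mathbb{Q}^2$ with nonempty interior. Its denominator $\mathrm{denom}(P)$ is the smallest positive integer $d$ such that $dP$ is a lattice polygon (all vertices in $\mathbb{Z}^2$). By Ehrhart's theorem there is a quasi-polynomial $L_P(t)=\sum_{k=0}^2 e_k(t)t^k$ with periodic coefficient functions (periods dividing $\mathrm{denom}(P)$) such that $L_P(k)=|kP\cap\mathbb{Z}^2|$ for all positive integers $k$; this is the Ehrhart quasi-polynomial of $P$. $P$ is called pseudo-integral if $L_P$ is a polynomial (all coefficient functions constant); it is then called the Ehrhart polynomial of $P$. -}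

module Defs where

open import Data.Nat as ℕ using (ℕ)
open import Data.Integer as ℤ using (ℤ; +_)
open import Data.Rational as ℚ using (ℚ; 0ℚ; 1ℚ; _/_)
open import Data.Product using (_×_; _,_; ∃; Σ)
open import Data.Vec using (Vec; []; _∷_; map)
open import Data.Vec.Relation.Unary.All using (All)
open import Data.List using (List; length)
open import Data.List.Relation.Unary.Unique.Propositional using (Unique)
open import Data.List.Membership.Propositional using (_∈_)
open import Function.Bundles using (_⇔_)
open import Relation.Binary.PropositionalEquality using (_≡_)

Point : Set
Point = ℚ × ℚ

LatticePoint : Set
LatticePoint = ℤ × ℤ

embed : LatticePoint → Point
embed (a , b) = (a / 1 , b / 1)

_+ᵖ_ : Point → Point → Point
(a , b) +ᵖ (c , d) = (a ℚ.+ c , b ℚ.+ d)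

scale : ℚ → Point → Point
scale r (a , b) = (r ℚ.* a , r ℚ.* b)

sumℚ : ∀ {n} → Vec ℚ n → ℚ
sumℚ [] = 0ℚ
sumℚ (w ∷ ws) = w ℚ.+ sumℚ ws

combo : ∀ {n} → Vec ℚ n → Vec Point n → Point
combo [] [] = (0ℚ , 0ℚ)
combo (w ∷ ws) (s ∷ ss) = scale w s +ᵖ combo ws ss

InConv : ∀ {n} → Vec Point n → Point → Set
InConv {n} S x = Σ (Vec ℚ n) λ w →
  All (0ℚ ℚ.≤_) w × sumℚ w ≡ 1ℚ × combo w S ≡ x

HasNonemptyInterior : ∀ {n} → Vec Point n → Set
HasNonemptyInterior S = Σ Point λ c → Σ ℚ λ ε → (0ℚ ℚ.< ε) ×
  (∀ (x : Point) → ℚ.∣ Data.Product.proj₁ x ℚ.- Data.Product.proj₁ c ∣ ℚ.< ε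
                 → ℚ.∣ Data.Product.proj₂ x ℚ.- Data.Product.proj₂ c ∣ ℚ.< ε
                 → InConv S x)
  where import Data.Product

-- conv(S) is a rational polygon (S a finite list of rational points)
RationalPolygon : ∀ {n} → Vec Point n → Set
RationalPolygon S = HasNonemptyInterior S

-- the scaled polygon d·conv(S) = conv(d·S)
scaledPts : ∀ {n} → ℕ → Vec Point n → Vec Point n
scaledPts d S = map (scale (+ d / 1)) S

IsLatticeAfterScaling : ∀ {n} → ℕ → Vec Point n → Set
IsLatticeAfterScaling d S = Σ ℕ λ m → Σ (Vec LatticePoint m) λ T →
  ∀ (x : Point) → InConv (scaledPts d S) x ⇔ InConv (map embed T) x

-- denom(conv S) = 2 : smallest positive d with d·P lattice is 2
HasDenom2 : ∀ {n} → Vec Point n → Set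
HasDenom2 S = IsLatticeAfterScaling 2 S × (IsLatticeAfterScaling 1 S → Data.Empty.⊥)
  where import Data.Empty

LatticeCount : ∀ {n} → Vec Point n → ℕ → ℕ → Set
LatticeCount S k c = Σ (List LatticePoint) λ L → Unique L ×
  (∀ (z : LatticePoint) → (z ∈ L) ⇔ InConv (scaledPts k S) (embed z)) × length L ≡ c

evalQuad : ℚ → ℚ → ℚ → ℕ → ℚ
evalQuad e₂ e₁ e₀ k = e₂ ℚ.* (kq ℚ.* kq) ℚ.+ e₁ ℚ.* kq ℚ.+ e₀
  where kq = + k / 1

-- e₂ t² + e₁ t + e₀ is the Ehrhart polynomial of conv(S): L_P(k) equals it for all k ≥ 1
-- (this makes L_P a polynomial, i.e. P pseudo-integral)
IsEhrhartPolynomial : ∀ {n} → Vec Point n → ℚ → ℚ → ℚ → Set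
IsEhrhartPolynomial S e₂ e₁ e₀ = ∀ (k : ℕ) → 1 ℕ.≤ k →
  Σ ℕ λ c → LatticeCount S k c × (+ c / 1) ≡ evalQuad e₂ e₁ e₀ k

Admissible : ℕ → ℕ → Set
Admissible i b = (i ≡ 0 × b ≡ 3) Data.Sum.⊎ (1 ℕ.≤ i × 2 ℕ.≤ b × b ℕ.≤ 2 ℕ.* i ℕ.+ 7)
  where import Data.Sum

{-# OPTIONS --safe #-}
-- With Q = 2P, a lattice polygon, follow the right and the left boundary of Q as
-- chains of edges from bottom to top and count row by row: twice the number of
-- lattice points of mQ is m²A + mB + 2, where A is twice the area of Q and B the
-- number of its boundary points. Comparing with L_P at even arguments gives
-- e₀ = 1, 8 e₂ = A and 4 e₁ = B, so b = B/2 and i = L_P(1) − b.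
-- To bound b, Scott's argument applies shears and coordinate swaps until Q is at
-- least as wide as it is high; then the area beats the boundary once the height
-- is at least 4. For smaller heights the counts L_P(1) and L_P(3) are written with
-- floors and decided by residues; the exceptional equality cases turn out to be
-- polygons all of whose vertices are even, which denominator 2 excludes.
-- Conversely every admissible (i, b) is attained by an explicit polygon with at
-- most five vertices.
module Submission where

module Inequalities where

  open import Data.Integer
  import Data.Nat.Base
  open import Data.Integer.Properties
  open import Data.Integer.Tactic.RingSolver
  open import Data.Sum using (_⊎_; inj₁; inj₂)
  open import Data.Empty using (⊥-elim)
  open import Relation.Nullary using (¬_; yes; no)
  open import Relation.Binary.PropositionalEquality

  ≤-by : ∀ {a b x y} → x ≤ y → b + x ≡ a + y → a ≤ b
  ≤-by {a} {b} {x} {y} x≤y eq =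
    +-cancelʳ-≤ y a b (≤-trans (≤-reflexive (sym eq)) (+-monoʳ-≤ b x≤y))
    where
    +-cancelʳ-≤ : ∀ k i j → i + k ≤ j + k → i ≤ j
    +-cancelʳ-≤ k i j le = subst₂ _≤_ (shift i k) (shift j k) (+-monoˡ-≤ (- k) le)
      where
      shift : ∀ i k → i + k + - k ≡ i
      shift = solve-∀

  infixl 6 _⊕_
  _⊕_ : ∀ {a b c d} → a ≤ b → c ≤ d → a + c ≤ b + d
  _⊕_ = +-mono-≤

  infixr 7 _⊗_
  _⊗_ : ∀ {c a b} → 0ℤ ≤ c → a ≤ b → c * a ≤ c * b
  _⊗_ {c} 0≤c a≤b = *-monoˡ-≤-nonNeg c {{nonNegative 0≤c}} a≤b

  difference : ∀ {a b} → a ≤ b → 0ℤ ≤ b - a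
  difference = i≤j⇒0≤j-i

  -- (b − a)(d − c) ≥ 0, expanded.
  cross-≤ : ∀ {a b c d} → a ≤ b → c ≤ d → a * d + b * c ≤ b * d + a * c
  cross-≤ {a} {b} {c} {d} a≤b c≤d = ≤-by (difference a≤b ⊗ difference c≤d) (lem a b c d)
    where
    lem : ∀ a b c d → b * d + a * c + (b - a) * 0ℤ ≡ (a * d + b * c) + (b - a) * (d - c)
    lem = solve-∀

  cancel-≤ : ∀ {c a b} → 1ℤ ≤ c → c * a ≤ c * b → a ≤ b
  cancel-≤ {c} {a} {b} 1≤c = *-cancelˡ-≤-pos a b c {{positive (suc[i]≤j⇒i<j 1≤c)}}

  cancel-≡ : ∀ {c a b} → 1ℤ ≤ c → c * a ≡ c * b → a ≡ b
  cancel-≡ 1≤c eq = ≤-antisym (cancel-≤ 1≤c (≤-reflexive eq)) (cancel-≤ 1≤c (≤-reflexive (sym eq)))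

  weaken : ∀ {a} → 1ℤ ≤ a → 0ℤ ≤ a
  weaken = ≤-trans (+≤+ Data.Nat.Base.z≤n)

  1≤-* : ∀ {a b} → 1ℤ ≤ a → 1ℤ ≤ b → 1ℤ ≤ a * b
  1≤-* {a} {b} p q = ≤-by (cross-≤ p q ⊕ p ⊕ q) (lem a b)
    where
    lem : ∀ a b → a * b + (1ℤ * b + a * 1ℤ + 1ℤ + 1ℤ) ≡ 1ℤ + (a * b + 1ℤ * 1ℤ + a + b)
    lem = solve-∀

  ≰⇒1+≤ : ∀ {a b} → ¬ a ≤ b → 1ℤ + b ≤ a
  ≰⇒1+≤ p = i<j⇒suc[i]≤j (≰⇒> p)

  split-≤ : ∀ a b → (a ≤ b) ⊎ (1ℤ + b ≤ a)
  split-≤ a b with a ≤? b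
  ... | yes p = inj₁ p
  ... | no p  = inj₂ (≰⇒1+≤ p)

  +m-nonneg : ∀ m → 0ℤ ≤ + m
  +m-nonneg m = +≤+ z≤n
    where open import Data.Nat.Base using (z≤n)

  1≤+suc : ∀ m → 1ℤ ≤ + Data.Nat.Base.suc m
  1≤+suc m = +≤+ (Data.Nat.Base.s≤s Data.Nat.Base.z≤n)

  absurd-≤ : ∀ {a b} {A : Set} → a ≤ b → a ≡ 1ℤ + b → A
  absurd-≤ {b = b} a≤b refl = ⊥-elim (<-irrefl refl (suc[i]≤j⇒i<j a≤b))

module Convexity where

  open import Defs
  open import Data.Nat as ℕ using (ℕ)
  open import Data.Integer as ℤ using (ℤ; +_; 1ℤ)
  open import Data.Rational
  open import Data.Rational.Properties
  import Data.Rational.Unnormalised as ℚᵘ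
  import Data.Rational.Unnormalised.Properties as ℚᵘ
  import Data.Integer.Properties as ℤ
  open import Data.Integer.Tactic.RingSolver using (solve-∀)
  open import Data.Rational.Solver using (module +-*-Solver)
  open +-*-Solver
  open import Data.Product using (_,_; proj₁; proj₂)
  open import Data.Vec using (Vec; []; _∷_; map; zipWith; replicate)
  open import Data.Vec.Relation.Unary.All using (All; []; _∷_)
  open import Data.Vec.Relation.Unary.Any using (here; there)
  open import Data.Vec.Membership.Propositional using (_∈_)
  open import Relation.Binary.PropositionalEquality
  open ≡-Reasoning

  ι : ℤ → ℚ
  ι z = z / 1

  toℚᵘ-/ : ∀ z d → toℚᵘ (z / ℕ.suc d) ℚᵘ.≃ ℚᵘ.mkℚᵘ z d
  toℚᵘ-/ z d = toℚᵘ-fromℚᵘ (ℚᵘ.mkℚᵘ z d)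

  ι-+ : ∀ a b → ι (a ℤ.+ b) ≡ ι a + ι b
  ι-+ a b = toℚᵘ-injective (ℚᵘ.≃-trans (toℚᵘ-/ (a ℤ.+ b) 0) (ℚᵘ.≃-trans (ℚᵘ.*≡* (lem a b))
      (ℚᵘ.≃-sym (ℚᵘ.≃-trans (toℚᵘ-homo-+ (ι a) (ι b)) (ℚᵘ.+-cong (toℚᵘ-/ a 0) (toℚᵘ-/ b 0))))))
    where
    lem : ∀ a b → (a ℤ.+ b) ℤ.* (1ℤ ℤ.* 1ℤ) ≡ (a ℤ.* 1ℤ ℤ.+ b ℤ.* 1ℤ) ℤ.* 1ℤ
    lem = solve-∀

  ι-* : ∀ a b → ι (a ℤ.* b) ≡ ι a * ι b
  ι-* a b = toℚᵘ-injective (ℚᵘ.≃-trans (toℚᵘ-/ (a ℤ.* b) 0) (ℚᵘ.≃-trans (ℚᵘ.*≡* (lem a b))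
      (ℚᵘ.≃-sym (ℚᵘ.≃-trans (toℚᵘ-homo-* (ι a) (ι b)) (ℚᵘ.*-cong (toℚᵘ-/ a 0) (toℚᵘ-/ b 0))))))
    where
    lem : ∀ a b → (a ℤ.* b) ℤ.* (1ℤ ℤ.* 1ℤ) ≡ (a ℤ.* b) ℤ.* 1ℤ
    lem = solve-∀

  ι-mono : ∀ {a b} → a ℤ.≤ b → ι a ≤ ι b
  ι-mono {a} {b} a≤b = toℚᵘ-cancel-≤ (ℚᵘ.≤-respˡ-≃ (ℚᵘ.≃-sym (toℚᵘ-/ a 0))
    (ℚᵘ.≤-respʳ-≃ (ℚᵘ.≃-sym (toℚᵘ-/ b 0)) (ℚᵘ.*≤* (ℤ.*-monoʳ-≤-nonNeg 1ℤ a≤b))))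

  ι-cancel : ∀ {a b} → ι a ≤ ι b → a ℤ.≤ b
  ι-cancel {a} {b} le with ℚᵘ.≤-respˡ-≃ (toℚᵘ-/ a 0) (ℚᵘ.≤-respʳ-≃ (toℚᵘ-/ b 0) (toℚᵘ-mono-≤ le))
  ... | ℚᵘ.*≤* p = ℤ.*-cancelʳ-≤-pos a b 1ℤ p

  ι-injective : ∀ {a b} → ι a ≡ ι b → a ≡ b
  ι-injective eq = ℤ.≤-antisym (ι-cancel (≤-reflexive eq)) (ι-cancel (≤-reflexive (sym eq)))

  ι-pos : ∀ {a} → 1ℤ ℤ.≤ a → Positive (ι a)
  ι-pos p = positive (<-≤-trans {i = 0ℚ} {j = 1ℚ} (*<* (ℤ.+<+ (ℕ.s≤s ℕ.z≤n))) (ι-mono p))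

  2*half : ∀ a → ι (+ 2) * (a / 2) ≡ ι a
  2*half a = toℚᵘ-injective (ℚᵘ.≃-trans (ℚᵘ.≃-trans (toℚᵘ-homo-* (ι (+ 2)) (a / 2))
      (ℚᵘ.*-cong (toℚᵘ-/ (+ 2) 0) (toℚᵘ-/ a 1))) (ℚᵘ.≃-trans (ℚᵘ.*≡* (lem a)) (ℚᵘ.≃-sym (toℚᵘ-/ a 0))))
    where
    lem : ∀ a → (+ 2 ℤ.* a) ℤ.* 1ℤ ≡ a ℤ.* (1ℤ ℤ.* + 2)
    lem = solve-∀

  ι-neg : ∀ a → ι (ℤ.- a) ≡ - ι a
  ι-neg a = begin
    ι (ℤ.- a)                 ≡⟨ solve 2 (λ x y → x := (x :+ y) :+ :- y) refl (ι (ℤ.- a)) (ι a) ⟩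
    (ι (ℤ.- a) + ι a) + - ι a ≡⟨ cong (_+ - ι a) (trans (sym (ι-+ (ℤ.- a) a)) (cong ι (ℤ.+-inverseˡ a))) ⟩
    0ℚ + - ι a                ≡⟨ +-identityˡ (- ι a) ⟩
    - ι a                     ∎

  cancel-ι : ∀ {c} {p q : ℚ} → 1ℤ ℤ.≤ c → ι c * p ≡ ι c * q → p ≡ q
  cancel-ι {c} 1≤c eq = ≤-antisym (*-cancelˡ-≤-pos (ι c) (≤-reflexive eq)) (*-cancelˡ-≤-pos (ι c) (≤-reflexive (sym eq)))
    where instance _ = ι-pos 1≤c

  ≡-pair : ∀ {p q : Point} → proj₁ p ≡ proj₁ q → proj₂ p ≡ proj₂ q → p ≡ q
  ≡-pair refl refl = refl

  sumℚ-+ : ∀ {n} (w w′ : Vec ℚ n) → sumℚ (zipWith _+_ w w′) ≡ sumℚ w + sumℚ w′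
  sumℚ-+ [] [] = refl
  sumℚ-+ (a ∷ w) (b ∷ w′) rewrite sumℚ-+ w w′ =
    solve 4 (λ a b c d → (a :+ b) :+ (c :+ d) := (a :+ c) :+ (b :+ d)) refl a b (sumℚ w) (sumℚ w′)

  sumℚ-* : ∀ {n} r (w : Vec ℚ n) → sumℚ (map (r *_) w) ≡ r * sumℚ w
  sumℚ-* r [] = sym (*-zeroʳ r)
  sumℚ-* r (a ∷ w) rewrite sumℚ-* r w = sym (*-distribˡ-+ r a (sumℚ w))

  combo-+ : ∀ {n} (w w′ : Vec ℚ n) S → combo (zipWith _+_ w w′) S ≡ combo w S +ᵖ combo w′ S
  combo-+ [] [] [] = refl
  combo-+ (a ∷ w) (b ∷ w′) ((x , y) ∷ S) rewrite combo-+ w w′ S = ≡-pair (lem x) (lem y)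
    where
    lem : ∀ x {c d} → (a + b) * x + (c + d) ≡ (a * x + c) + (b * x + d)
    lem x {c} {d} = solve 5 (λ a b x c d → (a :+ b) :* x :+ (c :+ d) := (a :* x :+ c) :+ (b :* x :+ d)) refl a b x c d

  combo-* : ∀ {n} r (w : Vec ℚ n) S → combo (map (r *_) w) S ≡ scale r (combo w S)
  combo-* r [] [] = ≡-pair (sym (*-zeroʳ r)) (sym (*-zeroʳ r))
  combo-* r (a ∷ w) ((x , y) ∷ S) rewrite combo-* r w S = ≡-pair (lem x) (lem y)
    where
    lem : ∀ x {c} → r * a * x + r * c ≡ r * (a * x + c)
    lem x {c} = solve 4 (λ r a x c → r :* a :* x :+ r :* c := r :* (a :* x :+ c)) refl r a x c

  record Linear : Set where
    field
      fun   : Point → Point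
      fun-+ : ∀ p q → fun (p +ᵖ q) ≡ fun p +ᵖ fun q
      fun-* : ∀ r p → fun (scale r p) ≡ scale r (fun p)
      fun-0 : fun (0ℚ , 0ℚ) ≡ (0ℚ , 0ℚ)
  open Linear

  combo-map : ∀ (f : Linear) {n} (w : Vec ℚ n) S → combo w (map (fun f) S) ≡ fun f (combo w S)
  combo-map f [] [] = sym (fun-0 f)
  combo-map f (a ∷ w) (s ∷ S) rewrite combo-map f w S | fun-+ f (scale a s) (combo w S) | fun-* f a s = refl

  conv-map : ∀ (f : Linear) {n} {S : Vec Point n} {p} → InConv S p → InConv (map (fun f) S) (fun f p)
  conv-map f {S = S} (w , w≥0 , Σw , refl) = w , w≥0 , Σw , combo-map f w S

  0≤-* : ∀ {r a} → 0ℚ ≤ r → 0ℚ ≤ a → 0ℚ ≤ r * a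
  0≤-* {r} {a} p q = subst (_≤ r * a) (*-zeroʳ r) (*-monoˡ-≤-nonNeg r {{nonNegative p}} q)

  conv-closed : ∀ {n} {S : Vec Point n} {p q} r t → 0ℚ ≤ r → 0ℚ ≤ t → r + t ≡ 1ℚ →
    InConv S p → InConv S q → InConv S (scale r p +ᵖ scale t q)
  conv-closed {S = S} r t r≥0 t≥0 r+t (w , w≥0 , Σw , refl) (v , v≥0 , Σv , refl) =
    zipWith _+_ (map (r *_) w) (map (t *_) v) , nonneg w≥0 v≥0 , total , place
    where
    nonneg : ∀ {n} {w v : Vec ℚ n} → All (0ℚ ≤_) w → All (0ℚ ≤_) v →
      All (0ℚ ≤_) (zipWith _+_ (map (r *_) w) (map (t *_) v))
    nonneg [] [] = []
    nonneg (a ∷ as) (b ∷ bs) = +-mono-≤ (0≤-* r≥0 a) (0≤-* t≥0 b) ∷ nonneg as bs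
    total : sumℚ (zipWith _+_ (map (r *_) w) (map (t *_) v)) ≡ 1ℚ
    total rewrite sumℚ-+ (map (r *_) w) (map (t *_) v) | sumℚ-* r w | sumℚ-* t v | Σw | Σv
      | *-identityʳ r | *-identityʳ t = r+t
    place : combo (zipWith _+_ (map (r *_) w) (map (t *_) v)) S ≡ scale r (combo w S) +ᵖ scale t (combo v S)
    place rewrite combo-+ (map (r *_) w) (map (t *_) v) S | combo-* r w S | combo-* t v S = refl

  combo-0 : ∀ {n} (S : Vec Point n) → combo (replicate n 0ℚ) S ≡ (0ℚ , 0ℚ)
  combo-0 [] = refl
  combo-0 ((x , y) ∷ S) rewrite combo-0 S | *-zeroˡ x | *-zeroˡ y = refl

  zeros-nonneg : ∀ n → All (0ℚ ≤_) (replicate n 0ℚ)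
  zeros-nonneg ℕ.zero = []
  zeros-nonneg (ℕ.suc n) = ≤-refl ∷ zeros-nonneg n

  sumℚ-zeros : ∀ n → sumℚ (replicate n 0ℚ) ≡ 0ℚ
  sumℚ-zeros ℕ.zero = refl
  sumℚ-zeros (ℕ.suc n) rewrite sumℚ-zeros n = refl

  conv-vertex : ∀ {n} {S : Vec Point n} {s} → s ∈ S → InConv S s
  conv-vertex {S = _∷_ {n} _ S} (here {x = x , y} refl) = 1ℚ ∷ replicate n 0ℚ , *≤* (ℤ.+≤+ ℕ.z≤n) ∷ zeros-nonneg n , trans (cong (λ s → 1ℚ + s) (sumℚ-zeros n)) (+-identityʳ 1ℚ) , place
    where
    place : scale 1ℚ (x , y) +ᵖ combo (replicate n 0ℚ) S ≡ (x , y)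
    place rewrite combo-0 S = ≡-pair (lem x) (lem y)
      where
      lem : ∀ x → 1ℚ * x + 0ℚ ≡ x
      lem x rewrite *-identityˡ x = +-identityʳ x
  conv-vertex {S = (x , y) ∷ S} (there s∈S) with conv-vertex s∈S
  ... | w , w≥0 , Σw , refl = 0ℚ ∷ w , ≤-refl ∷ w≥0 , trans (+-identityˡ _) Σw , ≡-pair (lem x) (lem y)
    where
    lem : ∀ x {c} → 0ℚ * x + c ≡ c
    lem x {c} rewrite *-zeroˡ x = +-identityˡ c

  conv-≤ : ∀ {n} {S : Vec Point n} {p} α β γ → (∀ {s} → s ∈ S → α * proj₁ s + β * proj₂ s ≤ γ) →
    InConv S p → α * proj₁ p + β * proj₂ p ≤ γ
  conv-≤ {S = S} α β γ h (w , w≥0 , Σw , refl) =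
    subst (_ ≤_) (trans (cong (γ *_) Σw) (*-identityʳ γ)) (go w S w≥0 h)
    where
    go : ∀ {n} (w : Vec ℚ n) (S : Vec Point n) → All (0ℚ ≤_) w →
      (∀ {s} → s ∈ S → α * proj₁ s + β * proj₂ s ≤ γ) →
      α * proj₁ (combo w S) + β * proj₂ (combo w S) ≤ γ * sumℚ w
    go [] [] [] h = ≤-reflexive (solve 3 (λ α β γ → α :* con 0ℚ :+ β :* con 0ℚ := γ :* con 0ℚ) refl α β γ)
    go (a ∷ w) ((x , y) ∷ S) (a≥0 ∷ w≥0) h = subst₂ _≤_
      (solve 7 (λ α β a x y c d → a :* (α :* x :+ β :* y) :+ (α :* c :+ β :* d) := α :* (a :* x :+ c) :+ β :* (a :* y :+ d))
        refl α β a x y (proj₁ (combo w S)) (proj₂ (combo w S)))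
      (solve 3 (λ a γ s → a :* γ :+ γ :* s := γ :* (a :+ s)) refl a γ (sumℚ w))
      (+-mono-≤ (*-monoˡ-≤-nonNeg a {{nonNegative a≥0}} (h (here refl))) (go w S w≥0 (λ s∈ → h (there s∈))))

module Hulls where

  open Inequalities
  open Convexity
  open import Defs
  open import Data.Nat as ℕ using (ℕ)
  open import Data.Integer
  open import Data.Integer.Properties
  open import Data.Rational as ℚ using (ℚ; 0ℚ; 1ℚ)
  import Data.Rational.Properties as ℚ
  open import Data.Rational.Solver using (module +-*-Solver)
  open import Data.Product using (_×_; _,_; Σ; proj₁; proj₂)
  open import Data.Vec using (Vec; map)
  open import Data.Vec.Properties using (map-∘; map-id; map-cong)
  open import Data.Vec.Membership.Propositional using (_∈_)
  open import Data.Vec.Membership.Propositional.Properties using (∈-map⁺)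
  open import Data.Vec.Relation.Unary.Any using (here; there)
  open import Data.Vec using (_∷_)
  open import Function.Bundles using (_⇔_; mk⇔; Equivalence)
  open import Relation.Binary.PropositionalEquality
  open ≡-Reasoning

  private variable
    n : ℕ
    T : Vec LatticePoint n
    X Y K X₁ Y₁ X₂ Y₂ : ℤ

  -- (X/K, Y/K) ∈ conv T
  record Hull (T : Vec LatticePoint n) (X Y K : ℤ) : Set where
    constructor at
    field
      point   : Point
      inside  : InConv (map embed T) point
      scale-x : ι K ℚ.* proj₁ point ≡ ι X
      scale-y : ι K ℚ.* proj₂ point ≡ ι Y

  hull-vertex : ∀ {u} → u ∈ T → Hull T (proj₁ u) (proj₂ u) 1ℤ
  hull-vertex {u = u} u∈T = at (embed u) (conv-vertex (∈-map⁺ embed u∈T)) (ℚ.*-identityˡ _) (ℚ.*-identityˡ _)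

  ∈-map⁻ : ∀ {A B : Set} {f : A → B} {n} {xs : Vec A n} {y} → y ∈ map f xs → Σ A λ x → x ∈ xs × f x ≡ y
  ∈-map⁻ {xs = x ∷ xs} (here refl) = x , here refl , refl
  ∈-map⁻ {xs = x ∷ xs} (there y∈) with ∈-map⁻ y∈
  ... | x′ , x′∈ , eq = x′ , there x′∈ , eq

  ι-form : ∀ α β x y → ι (α * x + β * y) ≡ ι α ℚ.* ι x ℚ.+ ι β ℚ.* ι y
  ι-form α β x y rewrite ι-+ (α * x) (β * y) | ι-* α x | ι-* β y = refl

  hull-≤ : ∀ α β γ → (∀ {u} → u ∈ T → α * proj₁ u + β * proj₂ u ≤ γ) → 0ℤ ≤ K → Hull T X Y K → α * X + β * Y ≤ γ * K
  hull-≤ {T = T} {K} {X} {Y} α β γ h 0≤K (at (x , y) q∈ Kx Ky) = ι-cancel (subst₂ ℚ._≤_ left (trans (ℚ.*-comm (ι K) (ι γ)) (sym (ι-* γ K)))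
    (ℚ.*-monoˡ-≤-nonNeg (ι K) {{ℚ.nonNegative (ι-mono 0≤K)}} (conv-≤ (ι α) (ι β) (ι γ) h′ q∈)))
    where
    h′ : ∀ {s} → s ∈ map embed T → ι α ℚ.* proj₁ s ℚ.+ ι β ℚ.* proj₂ s ℚ.≤ ι γ
    h′ s∈ with ∈-map⁻ s∈
    ... | (a , b) , u∈ , refl = subst (ℚ._≤ ι γ) (ι-form α β a b) (ι-mono (h u∈))
    left : ι K ℚ.* (ι α ℚ.* x ℚ.+ ι β ℚ.* y) ≡ ι (α * X + β * Y)
    left = begin
      ι K ℚ.* (ι α ℚ.* x ℚ.+ ι β ℚ.* y) ≡⟨ solve 5 (λ k a b x y → k :* (a :* x :+ b :* y) := a :* (k :* x) :+ b :* (k :* y)) refl (ι K) (ι α) (ι β) x y ⟩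
      ι α ℚ.* (ι K ℚ.* x) ℚ.+ ι β ℚ.* (ι K ℚ.* y) ≡⟨ cong₂ (λ a b → ι α ℚ.* a ℚ.+ ι β ℚ.* b) Kx Ky ⟩
      ι α ℚ.* ι X ℚ.+ ι β ℚ.* ι Y ≡⟨ sym (ι-form α β X Y) ⟩
      ι (α * X + β * Y) ∎
      where open +-*-Solver

  hull-mix : ∀ a b → 0ℤ ≤ a → 0ℤ ≤ b → 1ℤ ≤ a + b → Hull T X₁ Y₁ K → Hull T X₂ Y₂ K →
    Hull T (a * X₁ + b * X₂) (a * Y₁ + b * Y₂) ((a + b) * K)
  hull-mix {K = K} a b 0≤a 0≤b 1≤c (at (x₁ , y₁) q₁∈ Kx₁ Ky₁) (at (x₂ , y₂) q₂∈ Kx₂ Ky₂) =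
    at _ (conv-closed (ι a ℚ.* i) (ι b ℚ.* i) (0≤-* (ι-mono 0≤a) 0≤i) (0≤-* (ι-mono 0≤b) 0≤i) total q₁∈ q₂∈)
      (place Kx₁ Kx₂) (place Ky₁ Ky₂)
    where
    open +-*-Solver
    c = ι (a + b)
    instance
      c-pos : ℚ.Positive c
      c-pos = ι-pos 1≤c
      c-nz : ℚ.NonZero c
      c-nz = ℚ.pos⇒nonZero c
    i = ℚ.1/ c
    ci : c ℚ.* i ≡ 1ℚ
    ci = ℚ.*-inverseʳ c
    0≤i : 0ℚ ℚ.≤ i
    0≤i = ℚ.<⇒≤ (ℚ.positive⁻¹ i {{ℚ.1/pos⇒pos c}})
    total : ι a ℚ.* i ℚ.+ ι b ℚ.* i ≡ 1ℚ
    total = trans (sym (ℚ.*-distribʳ-+ i (ι a) (ι b))) (trans (cong (ℚ._* i) (sym (ι-+ a b))) ci)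
    place : ∀ {s t X₁ X₂} → ι K ℚ.* s ≡ ι X₁ → ι K ℚ.* t ≡ ι X₂ →
      ι ((a + b) * K) ℚ.* (ι a ℚ.* i ℚ.* s ℚ.+ ι b ℚ.* i ℚ.* t) ≡ ι (a * X₁ + b * X₂)
    place {s} {t} {X₁} {X₂} p q = begin
      ι ((a + b) * K) ℚ.* (ι a ℚ.* i ℚ.* s ℚ.+ ι b ℚ.* i ℚ.* t) ≡⟨ cong (ℚ._* (ι a ℚ.* i ℚ.* s ℚ.+ ι b ℚ.* i ℚ.* t)) (ι-* (a + b) K) ⟩
      c ℚ.* ι K ℚ.* (ι a ℚ.* i ℚ.* s ℚ.+ ι b ℚ.* i ℚ.* t) ≡⟨ solve 7 (λ c k a b i s t → c :* k :* (a :* i :* s :+ b :* i :* t) := c :* i :* (a :* (k :* s) :+ b :* (k :* t))) refl c (ι K) (ι a) (ι b) i s t ⟩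
      c ℚ.* i ℚ.* (ι a ℚ.* (ι K ℚ.* s) ℚ.+ ι b ℚ.* (ι K ℚ.* t)) ≡⟨ cong₂ ℚ._*_ ci (cong₂ (λ x y → ι a ℚ.* x ℚ.+ ι b ℚ.* y) p q) ⟩
      1ℚ ℚ.* (ι a ℚ.* ι X₁ ℚ.+ ι b ℚ.* ι X₂) ≡⟨ ℚ.*-identityˡ _ ⟩
      ι a ℚ.* ι X₁ ℚ.+ ι b ℚ.* ι X₂ ≡⟨ sym (ι-form a b X₁ X₂) ⟩
      ι (a * X₁ + b * X₂) ∎

  hull-scale : ∀ c → Hull T X Y K → Hull T (c * X) (c * Y) (c * K)
  hull-scale {X = X} {Y} {K} c (at q q∈ Kx Ky) = at q q∈ (place Kx) (place Ky)
    where
    place : ∀ {s X} → ι K ℚ.* s ≡ ι X → ι (c * K) ℚ.* s ≡ ι (c * X)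
    place {s} {X} p rewrite ι-* c K | ι-* c X | sym p = ℚ.*-assoc (ι c) (ι K) s

  hull-unscale : ∀ c → 1ℤ ≤ c → Hull T (c * X) (c * Y) (c * K) → Hull T X Y K
  hull-unscale {X = X} {Y} {K} c 1≤c (at q q∈ Kx Ky) = at q q∈ (place Kx) (place Ky)
    where
    place : ∀ {s X} → ι (c * K) ℚ.* s ≡ ι (c * X) → ι K ℚ.* s ≡ ι X
    place {s} {X} p = cancel-ι 1≤c (begin
      ι c ℚ.* (ι K ℚ.* s) ≡⟨ sym (ℚ.*-assoc (ι c) (ι K) s) ⟩
      ι c ℚ.* ι K ℚ.* s ≡⟨ cong (ℚ._* s) (sym (ι-* c K)) ⟩
      ι (c * K) ℚ.* s ≡⟨ p ⟩
      ι (c * X) ≡⟨ ι-* c X ⟩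
      ι c ℚ.* ι X ∎)

  hull-cast : ∀ {X′ Y′ K′} → X ≡ X′ → Y ≡ Y′ → K ≡ K′ → Hull T X Y K → Hull T X′ Y′ K′
  hull-cast refl refl refl h = h

  scaling : ℚ → Linear
  scaling r = record
    { fun = scale r
    ; fun-+ = λ p q → ≡-pair (ℚ.*-distribˡ-+ r _ _) (ℚ.*-distribˡ-+ r _ _)
    ; fun-* = λ s p → ≡-pair (swap s _) (swap s _)
    ; fun-0 = ≡-pair (ℚ.*-zeroʳ r) (ℚ.*-zeroʳ r) }
    where
    open +-*-Solver
    swap : ∀ s x → r ℚ.* (s ℚ.* x) ≡ s ℚ.* (r ℚ.* x)
    swap s x = solve 3 (λ r s x → r :* (s :* x) := s :* (r :* x)) refl r s x

  dilate⇔hull : ∀ {m} {S : Vec Point m} → (∀ x → InConv (scaledPts 2 S) x ⇔ InConv (map embed T) x) →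
    ∀ k (z : LatticePoint) → InConv (scaledPts (ℕ.suc k) S) (embed z) ⇔ Hull T (+ 2 * proj₁ z) (+ 2 * proj₂ z) (+ ℕ.suc k)
  dilate⇔hull {T = T} {S = S} twice k (a , b) = mk⇔ to from
    where
    open +-*-Solver
    κ = ι (+ ℕ.suc k)
    to : InConv (scaledPts (ℕ.suc k) S) (ι a , ι b) → Hull T (+ 2 * a) (+ 2 * b) (+ ℕ.suc k)
    to (w , w≥0 , Σw , eq) = at (scale (ι (+ 2)) (combo w S))
      (Equivalence.to (twice _) (w , w≥0 , Σw , combo-map (scaling (ι (+ 2))) w S))
      (place a (cong proj₁ eq′)) (place b (cong proj₂ eq′))
      where
      eq′ : scale κ (combo w S) ≡ (ι a , ι b)
      eq′ = trans (sym (combo-map (scaling κ) w S)) eq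
      place : ∀ a {x} → κ ℚ.* x ≡ ι a → κ ℚ.* (ι (+ 2) ℚ.* x) ≡ ι (+ 2 * a)
      place a {x} p = begin
        κ ℚ.* (ι (+ 2) ℚ.* x) ≡⟨ solve 3 (λ k t x → k :* (t :* x) := t :* (k :* x)) refl κ (ι (+ 2)) x ⟩
        ι (+ 2) ℚ.* (κ ℚ.* x) ≡⟨ cong (ι (+ 2) ℚ.*_) p ⟩
        ι (+ 2) ℚ.* ι a ≡⟨ sym (ι-* (+ 2) a) ⟩
        ι (+ 2 * a) ∎
    from : Hull T (+ 2 * a) (+ 2 * b) (+ ℕ.suc k) → InConv (scaledPts (ℕ.suc k) S) (ι a , ι b)
    from (at q q∈ Kx Ky) with Equivalence.from (twice q) q∈
    ... | w , w≥0 , Σw , eq = w , w≥0 , Σw , trans (combo-map (scaling κ) w S) (≡-pair (place a (cong proj₁ eq′) Kx) (place b (cong proj₂ eq′) Ky))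
      where
      eq′ : scale (ι (+ 2)) (combo w S) ≡ q
      eq′ = trans (sym (combo-map (scaling (ι (+ 2))) w S)) eq
      place : ∀ a {x s} → ι (+ 2) ℚ.* x ≡ s → κ ℚ.* s ≡ ι (+ 2 * a) → κ ℚ.* x ≡ ι a
      place a {x} {s} refl p = cancel-ι {+ 2} (1≤+suc 1) (begin
        ι (+ 2) ℚ.* (κ ℚ.* x) ≡⟨ solve 3 (λ k t x → t :* (k :* x) := k :* (t :* x)) refl κ (ι (+ 2)) x ⟩
        κ ℚ.* (ι (+ 2) ℚ.* x) ≡⟨ p ⟩
        ι (+ 2 * a) ≡⟨ ι-* (+ 2) a ⟩
        ι (+ 2) ℚ.* ι a ∎)

  record Matrix : Set where
    constructor matrix
    field a b c d : ℤ

  act : Matrix → LatticePoint → LatticePoint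
  act (matrix a b c d) (x , y) = a * x + b * y , c * x + d * y

  linear : Matrix → Linear
  linear (matrix a b c d) = record
    { fun = λ (x , y) → ι a ℚ.* x ℚ.+ ι b ℚ.* y , ι c ℚ.* x ℚ.+ ι d ℚ.* y
    ; fun-+ = λ (x , y) (x′ , y′) → ≡-pair (add (ι a) (ι b) x y x′ y′) (add (ι c) (ι d) x y x′ y′)
    ; fun-* = λ r (x , y) → ≡-pair (mul (ι a) (ι b) r x y) (mul (ι c) (ι d) r x y)
    ; fun-0 = ≡-pair (null (ι a) (ι b)) (null (ι c) (ι d)) }
    where
    open +-*-Solver
    add : ∀ a b x y x′ y′ → a ℚ.* (x ℚ.+ x′) ℚ.+ b ℚ.* (y ℚ.+ y′) ≡ (a ℚ.* x ℚ.+ b ℚ.* y) ℚ.+ (a ℚ.* x′ ℚ.+ b ℚ.* y′)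
    add = solve 6 (λ a b x y x′ y′ → a :* (x :+ x′) :+ b :* (y :+ y′) := (a :* x :+ b :* y) :+ (a :* x′ :+ b :* y′)) refl
    mul : ∀ a b r x y → a ℚ.* (r ℚ.* x) ℚ.+ b ℚ.* (r ℚ.* y) ≡ r ℚ.* (a ℚ.* x ℚ.+ b ℚ.* y)
    mul = solve 5 (λ a b r x y → a :* (r :* x) :+ b :* (r :* y) := r :* (a :* x :+ b :* y)) refl
    null : ∀ a b → a ℚ.* 0ℚ ℚ.+ b ℚ.* 0ℚ ≡ 0ℚ
    null = solve 2 (λ a b → a :* con 0ℚ :+ b :* con 0ℚ := con 0ℚ) refl

  hull-act : ∀ M → Hull T X Y K → Hull (map (act M) T) (proj₁ (act M (X , Y))) (proj₂ (act M (X , Y))) K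
  hull-act {T = T} {X} {Y} {K} M@(matrix a b c d) (at (x , y) q∈ Kx Ky) =
    at (Linear.fun (linear M) (x , y)) (subst (λ S → InConv S _) commute (conv-map (linear M) q∈)) (place a b) (place c d)
    where
    open +-*-Solver
    commute : map (Linear.fun (linear M)) (map embed T) ≡ map embed (map (act M) T)
    commute = trans (sym (map-∘ _ _ T)) (trans (map-cong (λ (x , y) → ≡-pair (sym (ι-form a b x y)) (sym (ι-form c d x y))) T) (map-∘ _ _ T))
    place : ∀ a b → ι K ℚ.* (ι a ℚ.* x ℚ.+ ι b ℚ.* y) ≡ ι (a * X + b * Y)
    place a b = begin
      ι K ℚ.* (ι a ℚ.* x ℚ.+ ι b ℚ.* y) ≡⟨ solve 5 (λ k a b x y → k :* (a :* x :+ b :* y) := a :* (k :* x) :+ b :* (k :* y)) refl (ι K) (ι a) (ι b) x y ⟩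
      ι a ℚ.* (ι K ℚ.* x) ℚ.+ ι b ℚ.* (ι K ℚ.* y) ≡⟨ cong₂ (λ s t → ι a ℚ.* s ℚ.+ ι b ℚ.* t) Kx Ky ⟩
      ι a ℚ.* ι X ℚ.+ ι b ℚ.* ι Y ≡⟨ sym (ι-form a b X Y) ⟩
      ι (a * X + b * Y) ∎

  record Unimodular : Set where
    field
      mat inv  : Matrix
      inv-mat : ∀ z → act inv (act mat z) ≡ z
      mat-inv : ∀ z → act mat (act inv z) ≡ z

  map-inv : ∀ (G : Unimodular) → let open Unimodular G in map (act inv) (map (act mat) T) ≡ T
  map-inv {T = T} G = trans (sym (map-∘ _ _ T)) (trans (map-cong (Unimodular.inv-mat G) T) (map-id T))

module Chains where

  open Inequalities
  open Hulls
  open import Defs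
  open import Data.Nat as ℕ using (ℕ; zero; suc; z≤n; s≤s)
  import Data.Nat.Properties as ℕ
  open import Data.Integer hiding (suc)
  open import Data.Integer.Properties
  open import Data.Integer.Tactic.RingSolver using (solve-∀)
  open import Data.Bool using (T)
  open import Data.Product using (_×_; _,_; Σ; proj₁; proj₂)
  open import Data.Sum using (_⊎_; inj₁; inj₂)
  open import Data.Empty using (⊥-elim)
  open import Data.List using (List; []; _∷_)
  open import Data.Vec using (Vec; []; _∷_)
  open import Data.Vec.Membership.Propositional using (_∈_)
  open import Data.Vec.Relation.Unary.Any using (here; there)
  open import Relation.Nullary using (¬_; Dec; yes; no)
  open import Relation.Binary.PropositionalEquality

  Σ< : ℕ → (ℕ → ℤ) → ℤ
  Σ< zero f = 0ℤ
  Σ< (suc n) f = f 0 + Σ< n (λ t → f (suc t))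

  Σ<-split : ∀ m n f → Σ< (m ℕ.+ n) f ≡ Σ< m f + Σ< n (λ t → f (m ℕ.+ t))
  Σ<-split zero n f = sym (+-identityˡ _)
  Σ<-split (suc m) n f rewrite Σ<-split m n (λ t → f (suc t)) = sym (+-assoc (f 0) _ _)

  Σ<-cong : ∀ n {f g} → (∀ t → t ℕ.< n → f t ≡ g t) → Σ< n f ≡ Σ< n g
  Σ<-cong zero h = refl
  Σ<-cong (suc n) h = cong₂ _+_ (h 0 (s≤s z≤n)) (Σ<-cong n λ t t<n → h (suc t) (s≤s t<n))

  Σ<-mono : ∀ n {f g} → (∀ t → t ℕ.< n → f t ≤ g t) → Σ< n f ≤ Σ< n g
  Σ<-mono zero h = ≤-refl
  Σ<-mono (suc n) h = h 0 (s≤s z≤n) ⊕ Σ<-mono n λ t t<n → h (suc t) (s≤s t<n)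

  Σ<-* : ∀ n c f → Σ< n (λ t → c * f t) ≡ c * Σ< n f
  Σ<-* zero c f = sym (*-zeroʳ c)
  Σ<-* (suc n) c f rewrite Σ<-* n c (λ t → f (suc t)) = sym (*-distribˡ-+ c (f 0) _)

  Σ<-+ : ∀ n f g → Σ< n (λ t → f t + g t) ≡ Σ< n f + Σ< n g
  Σ<-+ zero f g = refl
  Σ<-+ (suc n) f g rewrite Σ<-+ n (λ t → f (suc t)) (λ t → g (suc t)) = lem (f 0) (g 0) _ _
    where
    lem : ∀ a b c d → a + b + (c + d) ≡ a + c + (b + d)
    lem = solve-∀

  Σ<-affine : ∀ n a b → + 2 * Σ< n (λ t → a + b * + t) ≡ + n * (+ 2 * a + b * (+ n - 1ℤ))
  Σ<-affine zero a b = sym (*-zeroˡ (+ 2 * a + b * (0ℤ - 1ℤ)))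
  Σ<-affine (suc n) a b = begin
    + 2 * (a + b * 0ℤ + Σ< n (λ t → a + b * + suc t)) ≡⟨ cong (λ s → + 2 * (a + b * 0ℤ + s)) (Σ<-cong n λ t _ → shift a b (+ t)) ⟩
    + 2 * (a + b * 0ℤ + Σ< n (λ t → (a + b) + b * + t)) ≡⟨ *-distribˡ-+ (+ 2) (a + b * 0ℤ) _ ⟩
    + 2 * (a + b * 0ℤ) + + 2 * Σ< n (λ t → (a + b) + b * + t) ≡⟨ cong (λ s → + 2 * (a + b * 0ℤ) + s) (Σ<-affine n (a + b) b) ⟩
    + 2 * (a + b * 0ℤ) + + n * (+ 2 * (a + b) + b * (+ n - 1ℤ)) ≡⟨ lem a b (+ n) ⟩
    + suc n * (+ 2 * a + b * (+ suc n - 1ℤ)) ∎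
    where
    open ≡-Reasoning
    shift : ∀ a b t → a + b * (1ℤ + t) ≡ (a + b) + b * t
    shift = solve-∀
    lem : ∀ a b n → + 2 * (a + b * 0ℤ) + n * (+ 2 * (a + b) + b * (n - 1ℤ)) ≡ (1ℤ + n) * (+ 2 * a + b * ((1ℤ + n) - 1ℤ))
    lem = solve-∀

  extremal : ∀ {A : Set} {P : A → Set} (P? : ∀ a → Dec (P a)) {R : A → A → Set} →
    (∀ a b → P a → P b → R a b ⊎ R b a) → (∀ a b c → P a → P b → P c → R a b → R b c → R a c) →
    ∀ {n} (xs : Vec A n) → (∀ u → u ∈ xs → ¬ P u) ⊎ Σ A λ w → w ∈ xs × P w × (∀ u → u ∈ xs → P u → R u w)
  extremal P? total trans [] = inj₁ λ _ ()
  extremal {A} {P} P? {R} total trans (x ∷ xs) = extend (extremal P? total trans xs) (P? x)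
    where
    reflexive : ∀ a → P a → R a a
    reflexive a p with total a a p p
    ... | inj₁ r = r
    ... | inj₂ r = r
    extend : (∀ u → u ∈ xs → ¬ P u) ⊎ (Σ A λ w → w ∈ xs × P w × (∀ u → u ∈ xs → P u → R u w)) → Dec (P x) → _
    extend (inj₁ none) (no ¬p) = inj₁ λ { _ (here refl) → ¬p ; u (there u∈) → none u u∈ }
    extend (inj₁ none) (yes p) = inj₂ (x , here refl , p ,
      λ { _ (here refl) q → reflexive x p ; u (there u∈) q → ⊥-elim (none u u∈ q) })
    extend (inj₂ (w , w∈ , pw , max)) (no ¬p) = inj₂ (w , there w∈ , pw ,
      λ { _ (here refl) q → ⊥-elim (¬p q) ; u (there u∈) q → max u u∈ q })
    extend (inj₂ (w , w∈ , pw , max)) (yes p) with total x w p pw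
    ... | inj₁ x≤w = inj₂ (w , there w∈ , pw , λ { _ (here refl) q → x≤w ; u (there u∈) q → max u u∈ q })
    ... | inj₂ w≤x = inj₂ (x , here refl , p ,
      λ { _ (here refl) q → reflexive x p ; u (there u∈) q → trans u w x q pw p (max u u∈ q) w≤x })

  -- (n , d): the boundary moves n + 1 rows up and d to the right.
  Edge : Set
  Edge = ℕ × ℤ

  rows : List Edge → ℕ
  rows [] = 0
  rows ((n , d) ∷ es) = suc n ℕ.+ rows es

  end : ℤ → List Edge → ℤ
  end x [] = x
  end x ((n , d) ∷ es) = end (x + d) es

  -- Twice the area between the boundary and the y-axis.
  area₂ : ℤ → List Edge → ℤ
  area₂ x [] = 0ℤ
  area₂ x ((n , d) ∷ es) = + suc n * (+ 2 * x + d) + area₂ (x + d) es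

  Supports : ∀ {m} → Vec LatticePoint m → ℤ → ℤ → Edge → Set
  Supports T x y (n , d) = ∀ u → u ∈ T → (proj₁ u - x) * + suc n ≤ d * (proj₂ u - y)

  -- Right boundary of conv T, from (x , y) up to the row top.
  data Chain {m} (T : Vec LatticePoint m) (top : ℤ) : ℤ → ℤ → List Edge → Set where
    stop : ∀ {x} → Chain T top x top []
    step : ∀ {x y n d es} → (x + d , y + + suc n) ∈ T → Supports T x y (n , d) →
      Chain T top (x + d) (y + + suc n) es → Chain T top x y ((n , d) ∷ es)

  module _ {m} {T : Vec LatticePoint m} {top : ℤ} where

    chain-rows : ∀ {x y es} → Chain T top x y es → y + + rows es ≡ top
    chain-rows stop = +-identityʳ top
    chain-rows {y = y} {es = (n , d) ∷ es} (step _ _ c) = trans (sym (+-assoc y (+ suc n) (+ rows es))) (chain-rows c)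

    chain-end : ∀ {x y es} → (x , y) ∈ T → Chain T top x y es → (end x es , top) ∈ T
    chain-end v∈ stop = v∈
    chain-end v∈ (step w∈ _ c) = chain-end w∈ c

    edge-hull : ∀ {x y X Y K} n d → Supports T x y (n , d) → 0ℤ ≤ K → Hull T X Y K →
      + suc n * X ≤ + suc n * (K * x) + d * (Y - K * y)
    edge-hull {x} {y} {X} {Y} {K} n d supp 0≤K h = ≤-by (hull-≤ (+ suc n) (- d) (+ suc n * x - d * y) facet 0≤K h) (lem (+ suc n) d X Y K x y)
      where
      facet : ∀ {u} → u ∈ T → + suc n * proj₁ u + - d * proj₂ u ≤ + suc n * x - d * y
      facet {u₁ , u₂} u∈ = ≤-by (supp (u₁ , u₂) u∈) (lem₁ (+ suc n) d u₁ u₂ x y)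
        where
        lem₁ : ∀ N d a b x y → N * x - d * y + (a - x) * N ≡ N * a + - d * b + d * (b - y)
        lem₁ = solve-∀
      lem : ∀ N d X Y K x y → N * (K * x) + d * (Y - K * y) + (N * X + - d * Y) ≡ N * X + (N * x - d * y) * K
      lem = solve-∀

    -- The boundary vertex (x , y) lies right of every segment of T crossing its row.
    Rightmost : ℤ → ℤ → Set
    Rightmost x y = ∀ u w → u ∈ T → w ∈ T → proj₂ u ≤ y → 1ℤ + y ≤ proj₂ w →
      (proj₁ w - x) * (y - proj₂ u) ≤ (x - proj₁ u) * (proj₂ w - y)

    wrap : ∀ fuel {x y} → (x , y) ∈ T → Rightmost x y → (∀ u → u ∈ T → proj₂ u ≤ top) →
      (Σ ℤ λ t → (t , top) ∈ T) → top ≤ y + + fuel → Σ (List Edge) (Chain T top x y)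
    wrap fuel {x} {y} v∈ right high (t , t∈) fuel≥ with extremal above? slope-total slope-trans T
      where
      Above : LatticePoint → Set
      Above u = 1ℤ + y ≤ proj₂ u
      above? : ∀ u → Dec (Above u)
      above? u = _ ≤? _
      Slope≤ : LatticePoint → LatticePoint → Set
      Slope≤ u w = (proj₁ u - x) * (proj₂ w - y) ≤ (proj₁ w - x) * (proj₂ u - y)
      slope-total : ∀ a b → Above a → Above b → Slope≤ a b ⊎ Slope≤ b a
      slope-total _ _ _ _ = ≤-total _ _
      rise : ∀ {b} → 1ℤ + y ≤ b → 1ℤ ≤ b - y
      rise {b} p = ≤-by p (lem b y)
        where
        lem : ∀ b y → b - y + (1ℤ + y) ≡ 1ℤ + b
        lem = solve-∀
      slope-trans : ∀ a b c → Above a → Above b → Above c → Slope≤ a b → Slope≤ b c → Slope≤ a c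
      slope-trans (a₁ , a₂) (b₁ , b₂) (c₁ , c₂) pa pb pc ab bc = cancel-≤ (rise pb)
        (≤-by (weaken (rise pc) ⊗ ab ⊕ weaken (rise pa) ⊗ bc) (lem (a₁ - x) (a₂ - y) (b₁ - x) (b₂ - y) (c₁ - x) (c₂ - y)))
        where
        lem : ∀ a n b m c k → m * (c * n) + (k * (a * m) + n * (b * k)) ≡ m * (a * k) + (k * (b * n) + n * (c * m))
        lem = solve-∀
    ... | inj₁ none = [] , subst (λ s → Chain T top x s []) (≤-antisym (≤-pred′ (none _ t∈)) (high _ v∈)) stop
      where
      ≤-pred′ : ¬ (1ℤ + y ≤ top) → top ≤ y
      ≤-pred′ q with split-≤ top y
      ... | inj₁ p = p
      ... | inj₂ p = ⊥-elim (q p)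
    ... | inj₂ ((w₁ , w₂) , w∈ , above , max) = go fuel fuel≥ (w₂ - y) refl
      where
      go : ∀ fuel → top ≤ y + + fuel → ∀ s → w₂ - y ≡ s → Σ (List Edge) (Chain T top x y)
      go zero le s eq = absurd-≤ (≤-trans (≤-trans above (high _ w∈)) le) (lem y)
        where
        lem : ∀ y → 1ℤ + y ≡ 1ℤ + (y + 0ℤ)
        lem = solve-∀
      go (suc fuel) le -[1+ s ] eq = ⊥-elim (case (≤-trans (difference above) (≤-reflexive (trans (lem w₂ y) (cong (_- 1ℤ) eq)))))
        where
        lem : ∀ b y → b - (1ℤ + y) ≡ b - y - 1ℤ
        lem = solve-∀
        case : ¬ 0ℤ ≤ -[1+ s ] - 1ℤ
        case ()
      go (suc fuel) le (+ zero) eq = absurd-≤ above (sym (trans (lem w₂ y) (trans (cong (λ s → 1ℤ + s + y) eq) (lem₂ y))))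
        where
        lem : ∀ b y → 1ℤ + b ≡ 1ℤ + (b - y) + y
        lem = solve-∀
        lem₂ : ∀ y → 1ℤ + 0ℤ + y ≡ 1ℤ + y
        lem₂ = solve-∀
      go (suc fuel) le (+ suc n) eq = (n , w₁ - x) ∷ proj₁ rest , step w∈′ supp (proj₂ rest)
        where
        w₂≡ : w₂ ≡ y + + suc n
        w₂≡ = trans (lem w₂ y) (cong (λ s → y + s) eq)
          where
          lem : ∀ b y → b ≡ y + (b - y)
          lem = solve-∀
        w₁≡ : w₁ ≡ x + (w₁ - x)
        w₁≡ = lem w₁ x
          where
          lem : ∀ b y → b ≡ y + (b - y)
          lem = solve-∀
        w∈′ : (x + (w₁ - x) , y + + suc n) ∈ T
        w∈′ = subst₂ (λ a b → (a , b) ∈ T) w₁≡ w₂≡ w∈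
        supp : Supports T x y (n , w₁ - x)
        supp (u₁ , u₂) u∈ with split-≤ u₂ y
        ... | inj₂ p = subst (λ s → (u₁ - x) * s ≤ (w₁ - x) * (u₂ - y)) eq (max _ u∈ p)
        ... | inj₁ p = subst (λ s → (u₁ - x) * s ≤ (w₁ - x) * (u₂ - y)) eq
          (≤-by (right _ _ u∈ w∈ p above) (lem u₁ u₂ w₁ w₂ x y))
          where
          lem : ∀ u₁ u₂ w₁ w₂ x y → (w₁ - x) * (u₂ - y) + (w₁ - x) * (y - u₂) ≡ (u₁ - x) * (w₂ - y) + (x - u₁) * (w₂ - y)
          lem = solve-∀
        right′ : Rightmost (x + (w₁ - x)) (y + + suc n)
        right′ (u₁ , u₂) (z₁ , z₂) u∈ z∈ u≤ z> = cancel-≤ (1≤+suc n)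
          (≤-by (difference u≤ ⊗ supp (z₁ , z₂) z∈ ⊕ weaken z>′ ⊗ supp (u₁ , u₂) u∈) (lem x y (w₁ - x) (+ suc n) u₁ u₂ z₁ z₂))
          where
          z>′ : 1ℤ ≤ z₂ - (y + + suc n)
          z>′ = ≤-by z> (lem′ z₂ (y + + suc n))
            where
            lem′ : ∀ b y → b - y + (1ℤ + y) ≡ 1ℤ + b
            lem′ = solve-∀
          lem : ∀ x y d N u₁ u₂ z₁ z₂ →
            N * ((x + d - u₁) * (z₂ - (y + N))) + ((y + N - u₂) * ((z₁ - x) * N) + (z₂ - (y + N)) * ((u₁ - x) * N)) ≡
            N * ((z₁ - (x + d)) * (y + N - u₂)) + ((y + N - u₂) * (d * (z₂ - y)) + (z₂ - (y + N)) * (d * (u₂ - y)))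
          lem = solve-∀
        rest = wrap fuel w∈′ right′ high (t , t∈) (≤-by (le ⊕ 1≤+suc n) (lem y (+ fuel) (+ suc n) top))
          where
          lem : ∀ y f N t → y + N + f + (t + 1ℤ) ≡ t + (y + (1ℤ + f) + N)
          lem = solve-∀

  record Boundary {m} (T : Vec LatticePoint m) (y₀ : ℤ) (p : ℕ) : Set where
    constructor boundary
    field
      x₀    : ℤ
      edges : List Edge
      start : (x₀ , y₀) ∈ T
      chain : Chain T (y₀ + + p) x₀ y₀ edges
      height : rows edges ≡ p

module ScaledRows where

  open Inequalities
  open Hulls
  open Chains
  open import Defs
  open import Data.Nat as ℕ using (ℕ; suc)
  import Data.Nat.Properties as ℕ
  open import Data.Integer hiding (suc)
  open import Data.Integer.Properties
  open import Data.Integer.DivMod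
  open import Data.Integer.Tactic.RingSolver using (solve-∀)
  open import Data.Bool using (Bool; true; false; if_then_else_; T)
  open import Data.Product using (_×_; _,_; Σ; proj₁; proj₂)
  open import Data.Sum using (_⊎_; inj₁; inj₂)
  open import Data.Empty using (⊥-elim)
  open import Data.Unit using (tt)
  open import Data.List using (List; []; _∷_)
  open import Data.Vec using (Vec; []; _∷_; map)
  open import Data.Vec.Membership.Propositional using (_∈_)
  open import Function.Bundles using (_⇔_; mk⇔)
  open import Relation.Binary.PropositionalEquality

  mirror : Unimodular
  mirror = record { mat = matrix -1ℤ 0ℤ 0ℤ 1ℤ ; inv = matrix -1ℤ 0ℤ 0ℤ 1ℤ ; inv-mat = twice ; mat-inv = twice }
    where
    twice : ∀ z → act (matrix -1ℤ 0ℤ 0ℤ 1ℤ) (act (matrix -1ℤ 0ℤ 0ℤ 1ℤ) z) ≡ z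
    twice (x , y) = cong₂ _,_ (lem x y) (lem′ x y)
      where
      lem : ∀ x y → -1ℤ * (-1ℤ * x + 0ℤ * y) + 0ℤ * (0ℤ * x + 1ℤ * y) ≡ x
      lem = solve-∀
      lem′ : ∀ x y → 0ℤ * (-1ℤ * x + 0ℤ * y) + 1ℤ * (0ℤ * x + 1ℤ * y) ≡ y
      lem′ = solve-∀

  flip : LatticePoint → LatticePoint
  flip = act (Unimodular.mat mirror)

  flip≡ : ∀ x y → flip (x , y) ≡ (- x , y)
  flip≡ x y = cong₂ _,_ (lem x y) (lem′ x y)
    where
    lem : ∀ x y → -1ℤ * x + 0ℤ * y ≡ - x
    lem = solve-∀
    lem′ : ∀ x y → 0ℤ * x + 1ℤ * y ≡ y
    lem′ = solve-∀

  hull-flip : ∀ {n} {T : Vec LatticePoint n} {X Y K} → Hull T X Y K → Hull (map flip T) (- X) Y K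
  hull-flip {X = X} {Y} h = hull-cast (cong proj₁ (flip≡ X Y)) (cong proj₂ (flip≡ X Y)) refl (hull-act (Unimodular.mat mirror) h)

  hull-unflip : ∀ {n} {T : Vec LatticePoint n} {X Y K} → Hull (map flip T) X Y K → Hull T (- X) Y K
  hull-unflip {X = X} {Y} {K} h = subst (λ T → Hull T (- X) Y K) (map-inv mirror) (hull-flip h)

  boundary-exists : ∀ {n} {T : Vec LatticePoint n} {y₀ p} →
    (∀ u → u ∈ T → y₀ ≤ proj₂ u) → (∀ u → u ∈ T → proj₂ u ≤ y₀ + + p) →
    (Σ ℤ λ x → (x , y₀) ∈ T) → (Σ ℤ λ x → (x , y₀ + + p) ∈ T) → Boundary T y₀ p
  boundary-exists {T = T} {y₀} {p} low high (b , b∈) top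
    with extremal {P = λ u → proj₂ u ≡ y₀} (λ u → proj₂ u ≟ y₀) {R = λ a b → proj₁ a ≤ proj₁ b} (λ _ _ _ _ → ≤-total _ _) (λ _ _ _ _ _ _ → ≤-trans) T
  ... | inj₁ none = ⊥-elim (none _ b∈ refl)
  ... | inj₂ ((x₀ , _) , v∈ , refl , max) with wrap p v∈ right high top ≤-refl
    where
    right : Rightmost {T = T} {top = y₀ + + p} x₀ y₀
    right (u₁ , u₂) (w₁ , w₂) u∈ w∈ u≤ above rewrite ≤-antisym u≤ (low (u₁ , u₂) u∈) =
      ≤-by (difference (max (u₁ , y₀) u∈′ refl) ⊗ difference (≤-trans (i≤j⇒i≤1+j ≤-refl) above)) (lem u₁ w₁ w₂ x₀ y₀)
      where
      u∈′ : (u₁ , y₀) ∈ T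
      u∈′ = subst (λ s → (u₁ , s) ∈ T) (≤-antisym u≤ (low (u₁ , u₂) u∈)) u∈
      lem : ∀ u₁ w₁ w₂ x₀ y₀ → (x₀ - u₁) * (w₂ - y₀) + (x₀ - u₁) * 0ℤ ≡ (w₁ - x₀) * (y₀ - y₀) + (x₀ - u₁) * (w₂ - y₀)
      lem = solve-∀
  ... | es , c = boundary x₀ es v∈ c (+-injective (cancel y₀ (chain-rows c)))
    where
    cancel : ∀ y {a b} → y + a ≡ y + b → a ≡ b
    cancel y {a} {b} eq = trans (lem y a) (trans (cong (_- y) eq) (sym (lem y b)))
      where
      lem : ∀ y a → a ≡ y + a - y
      lem = solve-∀

  floor : (k D : ℕ) → ℤ → List Edge → ℕ → ℤ
  floor k D x [] t = (+ k * x) /ℕ suc D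
  floor k D x ((n , d) ∷ es) t =
    if t ℕ.<ᵇ k ℕ.* suc n then (+ k * x * + suc n + d * + t) /ℕ (suc D ℕ.* suc n) else floor k D (x + d) es (t ℕ.∸ k ℕ.* suc n)

  -- The boundary crosses row Y of the K-fold dilate at R / m, and f is the floor of R / (m D).
  record RowEnd {n} (T : Vec LatticePoint n) (K Y D f : ℤ) : Set where
    field
      m R     : ℤ
      1≤m     : 1ℤ ≤ m
      attained : Hull T R (m * Y) (m * K)
      bound   : ∀ {c X} → 1ℤ ≤ c → Hull T X (c * Y) (c * K) → m * X ≤ c * R
      lower   : m * (D * f) ≤ R
      upper   : 1ℤ + R ≤ m * (D * (f + 1ℤ))

  VertexBound : ∀ {n} → Vec LatticePoint n → ℤ → ℤ → ℤ → Set
  VertexBound T k x y = ∀ {c X} → 1ℤ ≤ c → Hull T X (c * (k * y)) (c * k) → X ≤ c * (k * x)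

  floor-lower : ∀ a m D → + suc m * (+ suc D * (a /ℕ (suc D ℕ.* suc m))) ≤ a
  floor-lower a m D = ≤-trans (≤-reflexive (trans (lem (+ suc m) (+ suc D) _) (cong (λ s → a /ℕ (suc D ℕ.* suc m) * s) (sym (pos-* (suc D) (suc m))))))
    ([n/ℕd]*d≤n a (suc D ℕ.* suc m))
    where
    lem : ∀ m D q → m * (D * q) ≡ q * (D * m)
    lem = solve-∀

  floor-upper : ∀ a m D → 1ℤ + a ≤ + suc m * (+ suc D * (a /ℕ (suc D ℕ.* suc m) + 1ℤ))
  floor-upper a m D = ≤-trans (i<j⇒suc[i]≤j (n<s[n/ℕd]*d a (suc D ℕ.* suc m)))
    (≤-reflexive (trans (cong (λ s → (1ℤ + a /ℕ (suc D ℕ.* suc m)) * s) (pos-* (suc D) (suc m))) (lem (+ suc m) (+ suc D) (a /ℕ (suc D ℕ.* suc m)))))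
    where
    lem : ∀ m D q → (1ℤ + q) * (D * m) ≡ m * (D * (q + 1ℤ))
    lem = solve-∀

  module _ {n} {T : Vec LatticePoint n} {top : ℤ} where

    edge-row : ∀ {x y X K Y c} m d → Supports T x y (m , d) → 1ℤ ≤ K → 1ℤ ≤ c → Hull T X (c * Y) (c * K) →
      + suc m * X ≤ c * (+ suc m * (K * x) + d * (Y - K * y))
    edge-row {x} {y} {X} {K} {Y} {c} m d supp 1≤K 1≤c h =
      ≤-trans (edge-hull {top = top} m d supp (weaken (1≤-* 1≤c 1≤K)) h) (≤-reflexive (lem (+ suc m) d c K Y x y))
      where
      lem : ∀ N d c K Y x y → N * (c * K * x) + d * (c * Y - c * K * y) ≡ c * (N * (K * x) + d * (Y - K * y))
      lem = solve-∀

    top-bound : ∀ {x y k} m d → Supports T x y (m , d) → 1ℤ ≤ k → VertexBound T k (x + d) (y + + suc m)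
    top-bound {x} {y} {k} m d supp 1≤k {c} {X} 1≤c h = cancel-≤ (1≤+suc m) (≤-by (edge-row m d supp 1≤k 1≤c h) (lem (+ suc m) d c k x y X))
      where
      lem : ∀ N d c k x y X → N * (c * (k * (x + d))) + N * X ≡ N * X + c * (N * (k * x) + d * (k * (y + N) - k * y))
      lem = solve-∀

    bottom-bound : ∀ {x y k} m d → Supports T x y (m , d) → 1ℤ ≤ k → VertexBound T k x y
    bottom-bound {x} {y} {k} m d supp 1≤k {c} {X} 1≤c h = cancel-≤ (1≤+suc m) (≤-by (edge-row m d supp 1≤k 1≤c h) (lem (+ suc m) d c k x y X))
      where
      lem : ∀ N d c k x y X → N * (c * (k * x)) + N * X ≡ N * X + c * (N * (k * x) + d * (k * y - k * y))
      lem = solve-∀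

    row-end : ∀ k D t {x y es} → Chain T top x y es → (x , y) ∈ T → VertexBound T (+ suc k) x y → t ℕ.≤ suc k ℕ.* rows es →
      RowEnd T (+ suc k) (+ suc k * y + + t) (+ suc D) (floor (suc k) D x es t)
    row-end k D t {x} {y} stop v∈ vb t≤ with ℕ.n≤0⇒n≡0 (ℕ.≤-trans t≤ (ℕ.≤-reflexive (ℕ.*-zeroʳ (suc k))))
    ... | refl = record
      { m = 1ℤ ; R = K * x ; 1≤m = ≤-refl
      ; attained = hull-cast refl (lem₁ K y) (lem₂ K) (hull-scale K (hull-vertex v∈))
      ; bound = λ {c} {X} 1≤c h → ≤-trans (≤-reflexive (*-identityˡ X)) (vb 1≤c (hull-cast refl (lem₃ c K y) refl h))
      ; lower = subst (λ E → 1ℤ * (+ suc D * (K * x /ℕ suc E)) ≤ K * x) D*1 (floor-lower (K * x) 0 D)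
      ; upper = subst (λ E → 1ℤ + K * x ≤ 1ℤ * (+ suc D * (K * x /ℕ suc E + 1ℤ))) D*1 (floor-upper (K * x) 0 D) }
      where
      K = + suc k
      D*1 : D ℕ.* 1 ≡ D
      D*1 = ℕ.*-identityʳ D
      lem₁ : ∀ K y → K * y ≡ 1ℤ * (K * y + 0ℤ)
      lem₁ = solve-∀
      lem₂ : ∀ K → K * 1ℤ ≡ 1ℤ * K
      lem₂ = solve-∀
      lem₃ : ∀ c K y → c * (K * y + 0ℤ) ≡ c * (K * y)
      lem₃ = solve-∀
    row-end k D t {x} {y} {(m , d) ∷ es} (step w∈ supp chain) v∈ vb t≤ with t ℕ.<ᵇ suc k ℕ.* suc m in lt
    ... | true = record
      { m = N ; R = R ; 1≤m = 1≤+suc m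
      ; attained = hull-cast (lem₁ K N (+ t) x d) (lem₂ K N (+ t) y) (lem₃ K N (+ t))
          (hull-mix (K * N - + t) (+ t) (difference t≤KN) (+m-nonneg t) (subst (1ℤ ≤_) (sym (lem₄ (K * N) (+ t))) (1≤-* (1≤+suc k) (1≤+suc m)))
            (hull-vertex v∈) (hull-vertex w∈))
      ; bound = λ {c} {X} 1≤c h → ≤-trans (edge-row m d supp (1≤+suc k) 1≤c h) (≤-reflexive (cong (c *_) (lem₅ K N x y d (+ t))))
      ; lower = floor-lower R m D
      ; upper = floor-upper R m D }
      where
      K = + suc k
      N = + suc m
      R = K * x * N + d * + t
      t≤KN : + t ≤ K * N
      t≤KN = subst (+ t ≤_) (pos-* (suc k) (suc m)) (+≤+ (ℕ.<⇒≤ (ℕ.<ᵇ⇒< t (suc k ℕ.* suc m) (subst T′ (sym lt) tt))))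
        where T′ = Data.Bool.T
      lem₁ : ∀ K N t x d → (K * N - t) * x + t * (x + d) ≡ K * x * N + d * t
      lem₁ = solve-∀
      lem₂ : ∀ K N t y → (K * N - t) * y + t * (y + N) ≡ N * (K * y + t)
      lem₂ = solve-∀
      lem₃ : ∀ K N t → (K * N - t + t) * 1ℤ ≡ N * K
      lem₃ = solve-∀
      lem₄ : ∀ a b → a - b + b ≡ a
      lem₄ = solve-∀
      lem₅ : ∀ K N x y d t → N * (K * x) + d * (K * y + t - K * y) ≡ K * x * N + d * t
      lem₅ = solve-∀
    ... | false = subst (λ Y → RowEnd T (+ suc k) Y (+ suc D) _) place (row-end k D (t ℕ.∸ kN) chain w∈ (top-bound m d supp (1≤+suc k)) t′≤)
      where
      K = + suc k
      N = + suc m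
      kN = suc k ℕ.* suc m
      kN≤t : kN ℕ.≤ t
      kN≤t = ℕ.≮⇒≥ (λ t<kN → subst T′ lt (ℕ.<⇒<ᵇ t<kN))
        where T′ = Data.Bool.T
      t′≤ : t ℕ.∸ kN ℕ.≤ suc k ℕ.* rows es
      t′≤ = ℕ.≤-trans (ℕ.∸-monoˡ-≤ kN t≤) (ℕ.≤-reflexive (trans (cong (ℕ._∸ kN) (ℕ.*-distribˡ-+ (suc k) (suc m) (rows es))) (ℕ.m+n∸m≡n kN _)))
      place : K * (y + N) + + (t ℕ.∸ kN) ≡ K * y + + t
      place = trans (lem K y N (+ (t ℕ.∸ kN))) (cong (λ s → K * y + s) (trans (cong (_+ + (t ℕ.∸ kN)) (sym (pos-* (suc k) (suc m)))) (cong +_ (ℕ.m+[n∸m]≡n kN≤t))))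
        where
        lem : ∀ K y N s → K * (y + N) + s ≡ K * y + (K * N + s)
        lem = solve-∀

  boundary-row : ∀ {n} {T : Vec LatticePoint n} {y₀ p} (b : Boundary T y₀ (suc p)) k D t → t ℕ.≤ suc k ℕ.* suc p →
    RowEnd T (+ suc k) (+ suc k * y₀ + + t) (+ suc D) (floor (suc k) D (Boundary.x₀ b) (Boundary.edges b) t)
  boundary-row {T = T} {y₀} {p} (boundary x₀ [] start chain ()) k D t t≤
  boundary-row {T = T} {y₀} {p} (boundary x₀ ((m , d) ∷ es) start c@(step _ supp _) height) k D t t≤ =
    row-end k D t c start (bottom-bound {top = y₀ + + suc p} m d supp (1≤+suc k)) (subst (λ r → t ℕ.≤ suc k ℕ.* r) (sym height) t≤)

  row-range : ∀ {n} {T : Vec LatticePoint n} {K Y D f g} → 1ℤ ≤ D → RowEnd T K Y D f → RowEnd (map flip T) K Y D g →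
    (∀ x → Hull T (D * x) Y K ⇔ (- g ≤ x × x ≤ f)) × 0ℤ ≤ f + g + 1ℤ
  row-range {T = T} {K} {Y} {D} {f} {g} 1≤D r l = (λ x → mk⇔ (to x) (from x)) , total
    where
    module r = RowEnd r
    module l = RowEnd l
    fits : ∀ {T : Vec LatticePoint _} {f x} → RowEnd T K Y D f → Hull T (D * x) Y K → x ≤ f
    fits {f = f} {x} e h with split-≤ x f
    ... | inj₁ p = p
    ... | inj₂ p = absurd-≤ (≤-trans e.upper (≤-trans (weaken e.1≤m ⊗ weaken 1≤D ⊗ subst (_≤ x) (+-comm 1ℤ f) p)
                     (e.bound {1ℤ} ≤-refl (hull-cast refl (sym (*-identityˡ Y)) (sym (*-identityˡ K)) h)))) (cong (λ s → 1ℤ + s) (sym (*-identityˡ e.R)))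
      where module e = RowEnd e
    to : ∀ x → Hull T (D * x) Y K → - g ≤ x × x ≤ f
    to x h = ≤-by (fits l (hull-cast (neg-distribʳ-* D x) refl refl (hull-flip h))) (lem x g) , fits r h
      where
      lem : ∀ x g → x + - x ≡ - g + g
      lem x g = trans (+-inverseʳ x) (sym (+-inverseˡ g))
    from : ∀ x → - g ≤ x × x ≤ f → Hull T (D * x) Y K
    from x (-g≤x , x≤f) = result (split-≤ (a + b) 0ℤ)
      where
      t = l.m * (r.m * (D * x))
      a = l.m * r.R - t
      b = t + r.m * l.R
      0≤a : 0ℤ ≤ a
      0≤a = difference (weaken l.1≤m ⊗ ≤-trans (weaken r.1≤m ⊗ weaken 1≤D ⊗ x≤f) r.lower)
      0≤b : 0ℤ ≤ b
      0≤b = ≤-by (weaken r.1≤m ⊗ ≤-trans (weaken l.1≤m ⊗ weaken 1≤D ⊗ ≤-by -g≤x (lem₁ x g)) l.lower) (lem₂ r.m l.m D x l.R)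
        where
        lem₁ : ∀ x g → g + - g ≡ - x + x
        lem₁ x g = trans (+-inverseʳ g) (sym (+-inverseˡ x))
        lem₂ : ∀ m m′ D x R → m′ * (m * (D * x)) + m * R + m * (m′ * (D * - x)) ≡ 0ℤ + m * R
        lem₂ = solve-∀
      R-end : Hull T (l.m * r.R) (l.m * (r.m * Y)) (l.m * (r.m * K))
      R-end = hull-scale l.m r.attained
      L-end : Hull T (r.m * - l.R) (l.m * (r.m * Y)) (l.m * (r.m * K))
      L-end = hull-cast refl (swap Y) (swap K) (hull-scale r.m (hull-unflip l.attained))
        where
        swap : ∀ Y → r.m * (l.m * Y) ≡ l.m * (r.m * Y)
        swap = lem r.m l.m
          where
          lem : ∀ a b c → a * (b * c) ≡ b * (a * c)
          lem = solve-∀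
      unscale : Hull T t (l.m * (r.m * Y)) (l.m * (r.m * K)) → Hull T (D * x) Y K
      unscale h = hull-unscale r.m r.1≤m (hull-unscale l.m l.1≤m h)
      result : (a + b ≤ 0ℤ) ⊎ (1ℤ + 0ℤ ≤ a + b) → Hull T (D * x) Y K
      result (inj₁ degenerate) = unscale (hull-cast (≤-antisym (≤-by (degenerate ⊕ 0≤b) (lem₁ (l.m * r.R) t b)) (≤-by 0≤a (lem₂ (l.m * r.R) t))) refl refl R-end)
        where
        lem₁ : ∀ A t b → t + (A - t + b + 0ℤ) ≡ A + (0ℤ + b)
        lem₁ = solve-∀
        lem₂ : ∀ A t → A + 0ℤ ≡ t + (A - t)
        lem₂ = solve-∀
      result (inj₂ wide) = unscale (hull-unscale (a + b) wide (hull-cast (lem₁ (l.m * r.R) (r.m * l.R) t)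
          (lem₂ a b (l.m * (r.m * Y))) refl
          (hull-mix a b 0≤a 0≤b wide (hull-cast (lem₃ r.m l.R) refl refl L-end) R-end)))
        where
        lem₁ : ∀ A B t → (A - t) * - B + (t + B) * A ≡ (A - t + (t + B)) * t
        lem₁ = solve-∀
        lem₂ : ∀ a b Y → a * Y + b * Y ≡ (a + b) * Y
        lem₂ = solve-∀
        lem₃ : ∀ m R → m * - R ≡ - (m * R)
        lem₃ m R = sym (neg-distribʳ-* m R)
    total : 0ℤ ≤ f + g + 1ℤ
    total with split-≤ 0ℤ (f + g + 1ℤ)
    ... | inj₁ p = p
    ... | inj₂ p = absurd-≤ contradiction refl
      where
      mm : 1ℤ ≤ r.m * l.m * D
      mm = 1≤-* (1≤-* r.1≤m l.1≤m) 1≤D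
      meet : l.m * - r.R ≤ r.m * l.R
      meet = l.bound r.1≤m (hull-flip r.attained)
      contradiction : 1ℤ + r.m * l.m ≤ r.m * l.m
      contradiction = ≤-by (meet ⊕ weaken l.1≤m ⊗ r.upper ⊕ weaken r.1≤m ⊗ l.upper ⊕ weaken mm ⊗ p ⊕ r.1≤m ⊕ weaken l.1≤m)
        (lem r.m l.m r.R l.R D f g)
        where
        lem : ∀ m m′ R R′ D f g → m * m′ + (m′ * - R + m′ * (1ℤ + R) + m * (1ℤ + R′) + m * m′ * D * (1ℤ + (f + g + 1ℤ)) + 1ℤ + 0ℤ) ≡
          1ℤ + m * m′ + (m * R′ + m′ * (m * (D * (f + 1ℤ))) + m * (m′ * (D * (g + 1ℤ))) + m * m′ * D * 0ℤ + m + m′)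
        lem = solve-∀

  -- m X ≤ R for a point (R / m , D-row) of the hull: a rational lower bound for where the boundary sits.
  record Reach {n} (T : Vec LatticePoint n) (D Y X : ℤ) : Set where
    constructor reach
    field
      {m R} : ℤ
      1≤m : 1ℤ ≤ m
      inside : Hull T R (m * Y) (m * D)
      below : m * X ≤ R

  trapezoid : ℕ → (ℕ → ℤ) → ℤ
  trapezoid p X = Σ< p λ t → X t + X (suc t)

  area-≥ : ∀ {n} {T : Vec LatticePoint n} {top} {D} → 1ℤ ≤ D → ∀ {x y es} → Chain T top x y es → ∀ X →
    (∀ t → t ℕ.≤ rows es → Reach T D (D * (y + + t)) (X t)) → trapezoid (rows es) X ≤ D * area₂ x es
  area-≥ {D = D} 1≤D stop X h = ≤-reflexive (sym (*-zeroʳ D))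
  area-≥ {T = T} {top} {D} 1≤D {x} {y} {(m , d) ∷ es} (step w∈ supp chain) X h = begin
    trapezoid (suc m ℕ.+ rows es) X ≡⟨ Σ<-split (suc m) (rows es) (λ t → X t + X (suc t)) ⟩
    trapezoid (suc m) X + Σ< (rows es) (λ t → X (suc m ℕ.+ t) + X (suc (suc m ℕ.+ t))) ≡⟨ cong (λ s → trapezoid (suc m) X + s) (Σ<-cong (rows es) λ t _ → cong (λ s → X (suc m ℕ.+ t) + X s) (sym (ℕ.+-suc (suc m) t))) ⟩
    trapezoid (suc m) X + trapezoid (rows es) (λ t → X (suc m ℕ.+ t)) ≤⟨ first ⊕ area-≥ 1≤D chain _ rest ⟩
    D * (N * (+ 2 * x + d)) + D * area₂ (x + d) es ≡⟨ sym (*-distribˡ-+ D (N * (+ 2 * x + d)) (area₂ (x + d) es)) ⟩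
    D * (N * (+ 2 * x + d) + area₂ (x + d) es) ∎
    where
    open ≤-Reasoning
    N = + suc m
    rest : ∀ t → t ℕ.≤ rows es → Reach T D (D * (y + N + + t)) (X (suc m ℕ.+ t))
    rest t t≤ = subst (λ Y → Reach T D (D * Y) (X (suc m ℕ.+ t))) (sym (+-assoc y N (+ t))) (h (suc m ℕ.+ t) (ℕ.+-monoʳ-≤ (suc m) t≤))
    under : ∀ t → t ℕ.≤ suc m → N * X t ≤ D * (N * x + d * + t)
    under t t≤ with h t (ℕ.≤-trans t≤ (ℕ.m≤m+n (suc m) (rows es)))
    ... | reach {k} {R} 1≤k inside below = cancel-≤ 1≤k (≤-by (weaken (1≤+suc m) ⊗ below ⊕ edge-row {top = top} m d supp 1≤D 1≤k inside) (lem k N (X t) R D x d y (+ t)))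
      where
      lem : ∀ k N X R D x d y t → k * (D * (N * x + d * t)) + (N * (k * X) + N * R) ≡ k * (N * X) + (N * R + k * (N * (D * x) + d * (D * (y + t) - D * y)))
      lem = solve-∀
    first : trapezoid (suc m) X ≤ D * (N * (+ 2 * x + d))
    first = cancel-≤ (1≤+suc m) (cancel-≤ {+ 2} (1≤+suc 1) (begin
      + 2 * (N * trapezoid (suc m) X) ≡⟨ cong (+ 2 *_) (sym (Σ<-* (suc m) N (λ t → X t + X (suc t)))) ⟩
      + 2 * Σ< (suc m) (λ t → N * (X t + X (suc t))) ≤⟨ _⊗_ {+ 2} (+m-nonneg 2) (Σ<-mono (suc m) pointwise) ⟩
      + 2 * Σ< (suc m) (λ t → D * (+ 2 * N * x + d) + + 2 * D * d * + t) ≡⟨ Σ<-affine (suc m) (D * (+ 2 * N * x + d)) (+ 2 * D * d) ⟩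
      N * (+ 2 * (D * (+ 2 * N * x + d)) + + 2 * D * d * (N - 1ℤ)) ≡⟨ lem D N x d ⟩
      + 2 * (N * (D * (N * (+ 2 * x + d)))) ∎))
      where
      pointwise : ∀ t → t ℕ.< suc m → N * (X t + X (suc t)) ≤ D * (+ 2 * N * x + d) + + 2 * D * d * + t
      pointwise t t< = ≤-by (under t (ℕ.<⇒≤ t<) ⊕ under (suc t) t<) (lem′ D N x d (X t) (X (suc t)) (+ t))
        where
        lem′ : ∀ D N x d X X′ t → D * (+ 2 * N * x + d) + + 2 * D * d * t + (N * X + N * X′) ≡ N * (X + X′) + (D * (N * x + d * t) + D * (N * x + d * (1ℤ + t)))
        lem′ = solve-∀
      lem : ∀ D N x d → N * (+ 2 * (D * (+ 2 * N * x + d)) + + 2 * D * d * (N - 1ℤ)) ≡ + 2 * (N * (D * (N * (+ 2 * x + d))))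
      lem = solve-∀

module Counting where

  open Inequalities
  open Hulls
  open Chains
  open ScaledRows
  open import Defs
  open import Data.Nat as ℕ using (ℕ; zero; suc; z≤n; s≤s)
  import Data.Nat.Properties as ℕ
  open import Data.Integer hiding (suc)
  open import Data.Integer.Properties
  open import Data.Integer.Tactic.RingSolver using (solve-∀)
  open import Data.Product.Properties using (,-injectiveˡ; ,-injectiveʳ)
  open import Data.Product using (_×_; _,_; Σ; proj₁; proj₂)
  open import Data.Sum using (inj₁; inj₂)
  open import Data.Empty using (⊥; ⊥-elim)
  open import Data.List using (List; []; _∷_; length; applyUpTo; _++_)
  open import Data.List.Properties using (length-++; length-applyUpTo)
  open import Data.List.Membership.Propositional renaming (_∈_ to _∈ˡ_)
  open import Data.List.Membership.Propositional.Properties using (∈-∃++; ∈-++⁺ˡ; ∈-++⁺ʳ; ∈-++⁻; ∈-applyUpTo⁺; ∈-applyUpTo⁻)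
  open import Data.List.Relation.Unary.Any using () renaming (here to hereˡ; there to thereˡ)
  open import Data.List.Relation.Unary.All using () renaming (lookup to lookupˡ)
  open import Data.List.Relation.Unary.AllPairs using ([]; _∷_)
  open import Data.List.Relation.Unary.Unique.Propositional using (Unique)
  import Data.List.Relation.Unary.Unique.Propositional.Properties as Unique
  open import Data.Vec using (Vec; map)
  open import Function.Bundles using (_⇔_; mk⇔; Equivalence)
  open import Relation.Binary.PropositionalEquality

  Counts : (LatticePoint → Set) → ℕ → Set
  Counts P c = Σ (List LatticePoint) λ L → Unique L × (∀ z → (z ∈ˡ L) ⇔ P z) × length L ≡ c

  unique-⊆ : ∀ {A : Set} {xs ys : List A} → Unique xs → (∀ {z} → z ∈ˡ xs → z ∈ˡ ys) → length xs ℕ.≤ length ys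
  unique-⊆ {xs = []} _ _ = z≤n
  unique-⊆ {xs = x ∷ xs} (x∉ ∷ u) sub with ∈-∃++ (sub (hereˡ refl))
  ... | as , bs , refl = ℕ.≤-trans (s≤s (unique-⊆ u sub′)) (ℕ.≤-reflexive (sym (trans (length-++ as) (trans (ℕ.+-suc _ _) (cong suc (sym (length-++ as)))))))
    where
    sub′ : ∀ {z} → z ∈ˡ xs → z ∈ˡ as ++ bs
    sub′ {z} z∈ with ∈-++⁻ as (sub (thereˡ z∈))
    ... | inj₁ p = ∈-++⁺ˡ p
    ... | inj₂ (hereˡ refl) = ⊥-elim (lookupˡ x∉ z∈ refl)
    ... | inj₂ (thereˡ p) = ∈-++⁺ʳ as p

  counts-unique : ∀ {P c c′} → Counts P c → Counts P c′ → c ≡ c′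
  counts-unique (L , u , mem , refl) (L′ , u′ , mem′ , refl) = ℕ.≤-antisym
    (unique-⊆ u λ z∈ → Equivalence.from (mem′ _) (Equivalence.to (mem _) z∈))
    (unique-⊆ u′ λ z∈ → Equivalence.from (mem _) (Equivalence.to (mem′ _) z∈))

  counts-value : ∀ {P c v} → Counts P c → (Σ ℕ λ c′ → Counts P c′ × + c′ ≡ v) → + c ≡ v
  counts-value counts (c′ , counts′ , eq) = trans (cong +_ (counts-unique counts counts′)) eq

  counts-cong : ∀ {P Q c} → (∀ z → P z ⇔ Q z) → Counts P c → Counts Q c
  counts-cong eq (L , u , mem , len) = L , u ,
    (λ z → mk⇔ (λ z∈ → Equivalence.to (eq z) (Equivalence.to (mem z) z∈)) (λ q → Equivalence.from (mem z) (Equivalence.from (eq z) q))) , len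

  row : ℤ → ℤ → ℕ → List LatticePoint
  row y lo = applyUpTo λ j → lo + + j , y

  strip : (y f g : ℕ → ℤ) → ℕ → List LatticePoint
  strip y f g zero = []
  strip y f g (suc N) = row (y 0) (- g 0) ∣ f 0 + g 0 + 1ℤ ∣ ++ strip (λ j → y (suc j)) (λ j → f (suc j)) (λ j → g (suc j)) N

  +-cancelˡ : ∀ a {b c} → a + b ≡ a + c → b ≡ c
  +-cancelˡ a {b} {c} eq = trans (lem a b) (trans (cong (_- a) eq) (sym (lem a c)))
    where
    lem : ∀ a b → b ≡ a + b - a
    lem = solve-∀

  row-unique : ∀ y lo n → Unique (row y lo n)
  row-unique y lo n = Unique.applyUpTo⁺₁ _ n λ {i} {j} i<j _ eq → ℕ.<⇒≢ i<j (+-injective (+-cancelˡ lo (,-injectiveˡ eq)))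

  module _ where
    ∈-strip⁻ : ∀ {y f g} N {z} → (∀ j → j ℕ.< N → 0ℤ ≤ f j + g j + 1ℤ) → z ∈ˡ strip y f g N → Σ ℕ λ j → j ℕ.< N × proj₂ z ≡ y j × - g j ≤ proj₁ z × proj₁ z ≤ f j
    ∈-strip⁻ {y} {f} {g} (suc N) nn z∈ with ∈-++⁻ (row (y 0) (- g 0) ∣ f 0 + g 0 + 1ℤ ∣) z∈
    ... | inj₂ p with ∈-strip⁻ N (λ j j<N → nn (suc j) (s≤s j<N)) p
    ...   | j , j<N , eq = suc j , s≤s j<N , eq
    ∈-strip⁻ {y} {f} {g} (suc N) nn z∈ | inj₁ p with ∈-applyUpTo⁻ _ p
    ... | i , i< , refl = 0 , s≤s z≤n , refl , i≤i+j (- g 0) (+ i) , ≤-by i≤ (lem (f 0) (g 0) (+ i))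
      where
      i≤ : 1ℤ + + i ≤ f 0 + g 0 + 1ℤ
      i≤ = subst (1ℤ + + i ≤_) (0≤i⇒+∣i∣≡i (nn 0 (s≤s z≤n))) (+≤+ i<)
      lem : ∀ f g i → f + (1ℤ + i) ≡ - g + i + (f + g + 1ℤ)
      lem = solve-∀

    ∈-strip⁺ : ∀ {y f g} N {x} j → j ℕ.< N → - g j ≤ x → x ≤ f j → (x , y j) ∈ˡ strip y f g N
    ∈-strip⁺ {y} {f} {g} (suc N) (suc j) (s≤s j<N) lo hi = ∈-++⁺ʳ (row (y 0) (- g 0) _) (∈-strip⁺ N j j<N lo hi)
    ∈-strip⁺ {y} {f} {g} (suc N) {x} zero j<N lo hi = ∈-++⁺ˡ (subst (λ x → (x , y 0) ∈ˡ row (y 0) (- g 0) ∣ f 0 + g 0 + 1ℤ ∣) place (∈-applyUpTo⁺ _ i<))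
      where
      i = ∣ x + g 0 ∣
      i≡ : + i ≡ x + g 0
      i≡ = 0≤i⇒+∣i∣≡i (≤-by lo (lem x (g 0)))
        where
        lem : ∀ x g → x + g + - g ≡ 0ℤ + x
        lem = solve-∀
      place : - g 0 + + i ≡ x
      place rewrite i≡ = lem x (g 0)
        where
        lem : ∀ x g → - g + (x + g) ≡ x
        lem = solve-∀
      i≤ : 1ℤ + + i ≤ f 0 + g 0 + 1ℤ
      i≤ = subst (λ s → 1ℤ + s ≤ f 0 + g 0 + 1ℤ) (sym i≡) (≤-by hi (lem x (f 0) (g 0)))
        where
        lem : ∀ x f g → f + g + 1ℤ + x ≡ 1ℤ + (x + g) + f
        lem = solve-∀
      i< : i ℕ.< ∣ f 0 + g 0 + 1ℤ ∣
      i< = drop‿+≤+ (≤-trans i≤ (≤-reflexive (sym (0≤i⇒+∣i∣≡i (≤-trans (+≤+ z≤n) i≤)))))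

    strip-unique : ∀ {y f g} N → (∀ j → j ℕ.< N → 0ℤ ≤ f j + g j + 1ℤ) → (∀ {i j} → y i ≡ y j → i ≡ j) → Unique (strip y f g N)
    strip-unique zero nn inj = []
    strip-unique {y} {f} {g} (suc N) nn inj = Unique.++⁺ (row-unique (y 0) (- g 0) ∣ f 0 + g 0 + 1ℤ ∣)
      (strip-unique N (λ j j<N → nn (suc j) (s≤s j<N)) (λ eq → ℕ.suc-injective (inj eq))) disjoint
      where
      disjoint : ∀ {z} → z ∈ˡ row (y 0) (- g 0) ∣ f 0 + g 0 + 1ℤ ∣ × z ∈ˡ strip (λ j → y (suc j)) (λ j → f (suc j)) (λ j → g (suc j)) N → ⊥
      disjoint (p , q) with ∈-applyUpTo⁻ (λ j → - g 0 + + j , y 0) p | ∈-strip⁻ N (λ j j<N → nn (suc j) (s≤s j<N)) q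
      ... | i , _ , eq | j , _ , eq′ , _ with inj (trans (sym (cong proj₂ eq)) eq′)
      ... | ()

    strip-length : ∀ {y f g} N → (∀ j → j ℕ.< N → 0ℤ ≤ f j + g j + 1ℤ) → + length (strip y f g N) ≡ Σ< N (λ j → f j + g j + 1ℤ)
    strip-length zero nn = refl
    strip-length {y} {f} {g} (suc N) nn = trans (cong +_ (length-++ (row (y 0) (- g 0) ∣ f 0 + g 0 + 1ℤ ∣)))
      (cong₂ _+_ (trans (cong +_ (length-applyUpTo _ ∣ f 0 + g 0 + 1ℤ ∣)) (0≤i⇒+∣i∣≡i (nn 0 (s≤s z≤n)))) (strip-length N (λ j j<N → nn (suc j) (s≤s j<N))))

  counts-strip : ∀ {P : LatticePoint → Set} (y f g : ℕ → ℤ) N → (∀ {i j} → y i ≡ y j → i ≡ j) →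
    (∀ z → P z → Σ ℕ λ j → j ℕ.< N × proj₂ z ≡ y j) →
    (∀ j → j ℕ.< N → (∀ x → P (x , y j) ⇔ (- g j ≤ x × x ≤ f j)) × 0ℤ ≤ f j + g j + 1ℤ) →
    Σ ℕ λ c → Counts P c × + c ≡ Σ< N (λ j → f j + g j + 1ℤ)
  counts-strip {P} y f g N inj cover ranges = _ , (strip y f g N , strip-unique N nn inj , (λ z → mk⇔ (to z) (from z)) , refl) , strip-length N nn
    where
    nn : ∀ j → j ℕ.< N → 0ℤ ≤ f j + g j + 1ℤ
    nn j j<N = proj₂ (ranges j j<N)
    to : ∀ z → z ∈ˡ strip y f g N → P z
    to (x , _) z∈ with ∈-strip⁻ N nn z∈
    ... | j , j<N , refl , lo , hi = Equivalence.from (proj₁ (ranges j j<N) x) (lo , hi)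
    from : ∀ z → P z → z ∈ˡ strip y f g N
    from (x , s) pz with cover (x , s) pz
    ... | j , j<N , refl with Equivalence.to (proj₁ (ranges j j<N) x) pz
    ... | lo , hi = ∈-strip⁺ N j j<N lo hi

  record Sides {n} (T : Vec LatticePoint n) (y₀ : ℤ) (p : ℕ) : Set where
    field
      right : Boundary T y₀ p
      left  : Boundary (map flip T) y₀ p
      low   : ∀ {X Y K} → 0ℤ ≤ K → Hull T X Y K → K * y₀ ≤ Y
      high  : ∀ {X Y K} → 0ℤ ≤ K → Hull T X Y K → Y ≤ K * (y₀ + + p)
    module R = Boundary right
    module L = Boundary left

  -- Row j consists of the points (x , η + j); in the k-fold dilate of conv T it is the row ε + D j above the bottom.
  counts-rows : ∀ {n} {T : Vec LatticePoint n} {y₀ p} (s : Sides T y₀ (suc p)) k D N ε η → let open Sides s in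
    ε ℕ.≤ D → + suc k * y₀ + + ε ≡ + suc D * η →
    suc k ℕ.* suc p ℕ.< ε ℕ.+ suc D ℕ.* N → ε ℕ.+ suc D ℕ.* N ℕ.≤ suc k ℕ.* suc p ℕ.+ suc D →
    Σ ℕ λ c → Counts (λ z → Hull T (+ suc D * proj₁ z) (+ suc D * proj₂ z) (+ suc k)) c ×
      + c ≡ Σ< N (λ j → floor (suc k) D R.x₀ R.edges (ε ℕ.+ suc D ℕ.* j) + floor (suc k) D L.x₀ L.edges (ε ℕ.+ suc D ℕ.* j) + 1ℤ)
  counts-rows {T = T} {y₀} {p} s k D N ε η ε≤D start beyond within = counts-strip (λ j → η + + j) _ _ N
    (λ {i} {j} eq → +-injective (+-cancelˡ η eq)) cover ranges
    where
    open Sides s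
    K = + suc k
    E = + suc D
    height : ∀ j → K * y₀ + + (ε ℕ.+ suc D ℕ.* j) ≡ E * (η + + j)
    height j = trans (cong (λ s → K * y₀ + (+ ε + s)) (pos-* (suc D) j)) (trans (lem₀ (K * y₀) (+ ε) (E * + j)) (trans (cong (_+ E * + j) start) (lem E η (+ j))))
      where
      lem₀ : ∀ a b c → a + (b + c) ≡ a + b + c
      lem₀ = solve-∀
      lem : ∀ E η j → E * η + E * j ≡ E * (η + j)
      lem = solve-∀
    t≤ : ∀ j → j ℕ.< N → ε ℕ.+ suc D ℕ.* j ℕ.≤ suc k ℕ.* suc p
    t≤ j j<N = ℕ.+-cancelʳ-≤ (suc D) _ _ (ℕ.≤-trans (ℕ.≤-reflexive (trans (ℕ.+-assoc ε (suc D ℕ.* j) (suc D)) (cong (ε ℕ.+_) (trans (ℕ.+-comm (suc D ℕ.* j) (suc D)) (sym (ℕ.*-suc (suc D) j))))))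
      (ℕ.≤-trans (ℕ.+-monoʳ-≤ ε (ℕ.*-monoʳ-≤ (suc D) j<N)) within))
    ranges : ∀ j → j ℕ.< N → _
    ranges j j<N = subst (λ Y → (∀ x → Hull T (E * x) Y K ⇔ _) × _) (height j)
      (row-range (1≤+suc D) (boundary-row right k D _ (t≤ j j<N)) (boundary-row left k D _ (t≤ j j<N)))
    cover : ∀ z → Hull T (E * proj₁ z) (E * proj₂ z) K → Σ ℕ λ j → j ℕ.< N × proj₂ z ≡ η + + j
    cover (x , y) h = j , j<N , trans (lem y η) (cong (λ s → η + s) (sym j≡))
      where
      lem : ∀ y η → y ≡ η + (y - η)
      lem = solve-∀
      η≤y : η ≤ y
      η≤y with split-≤ η y
      ... | inj₁ q = q
      ... | inj₂ q = absurd-≤ {1ℤ} {0ℤ} (≤-by (weaken (1≤+suc D) ⊗ q ⊕ low (weaken (1≤+suc k)) h ⊕ +≤+ ε≤D ⊕ ≤-reflexive (sym start)) (lem′ K y₀ (+ ε) (+ D) y η)) refl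
        where
        lem′ : ∀ K y₀ ε D y η → 0ℤ + ((1ℤ + D) * (1ℤ + y) + K * y₀ + ε + (1ℤ + D) * η) ≡ 1ℤ + ((1ℤ + D) * η + (1ℤ + D) * y + D + (K * y₀ + ε))
        lem′ = solve-∀
      j = ∣ y - η ∣
      j≡ : + j ≡ y - η
      j≡ = 0≤i⇒+∣i∣≡i (difference η≤y)
      j<N : j ℕ.< N
      j<N = drop‿+≤+ (subst (λ s → 1ℤ + s ≤ + N) (sym j≡) small)
        where
        small : 1ℤ + (y - η) ≤ + N
        small with split-≤ (1ℤ + (y - η)) (+ N)
        ... | inj₁ q = q
        ... | inj₂ q = absurd-≤ {1ℤ} {0ℤ} (≤-by (weaken (1≤+suc D) ⊗ q ⊕ high (weaken (1≤+suc k)) h ⊕ beyond′ ⊕ ≤-reflexive start) (lem′ K y₀ (+ ε) (+ D) y η (+ N) (+ suc p))) refl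
          where
          beyond′ : 1ℤ + K * + suc p ≤ + ε + E * + N
          beyond′ = subst₂ (λ a b → 1ℤ + a ≤ + ε + b) (pos-* (suc k) (suc p)) (pos-* (suc D) N) (+≤+ beyond)
          lem′ : ∀ K y₀ ε D y η N p → 0ℤ + ((1ℤ + D) * (1ℤ + N) + (1ℤ + D) * y + (1ℤ + K * p) + (K * y₀ + ε)) ≡
            1ℤ + ((1ℤ + D) * (1ℤ + (y - η)) + K * (y₀ + p) + (ε + (1ℤ + D) * N) + (1ℤ + D) * η)
          lem′ = solve-∀

module EvenDilates where

  open Inequalities
  open Hulls
  open Chains
  open ScaledRows
  open Counting
  open import Defs
  open import Data.Nat as ℕ using (ℕ; zero; suc; z≤n; s≤s)
  import Data.Nat.Properties as ℕ
  open import Data.Integer hiding (suc)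
  open import Data.Integer.Properties
  open import Data.Integer.DivMod
  open import Data.Integer.Tactic.RingSolver using (solve-∀)
  open import Data.Bool using (true; false; T)
  open import Data.Product using (_×_; _,_; Σ; proj₁; proj₂)
  open import Data.Sum using (inj₁; inj₂)
  open import Data.Empty using (⊥-elim)
  open import Data.Unit using (tt)
  open import Data.List using (List; []; _∷_)
  open import Data.Vec using (Vec)
  open import Function.Bundles using (_⇔_; mk⇔)
  open import Relation.Binary.PropositionalEquality

  /-unique : ∀ {a q} n → q * + suc n ≤ a → 1ℤ + a ≤ (1ℤ + q) * + suc n → a /ℕ suc n ≡ q
  /-unique {a} {q} n lo hi = ≤-antisym (below ([n/ℕd]*d≤n a (suc n)) hi) (below lo (i<j⇒suc[i]≤j (n<s[n/ℕd]*d a (suc n))))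
    where
    below : ∀ {q r} → q * + suc n ≤ a → 1ℤ + a ≤ (1ℤ + r) * + suc n → q ≤ r
    below {q} {r} p s with split-≤ q r
    ... | inj₁ le = le
    ... | inj₂ gt = absurd-≤ (≤-trans s (≤-trans (*-monoʳ-≤-nonNeg (+ suc n) gt) p)) refl

  /-shift : ∀ a q n → (a + q * + suc n) /ℕ suc n ≡ a /ℕ suc n + q
  /-shift a q n = /-unique {a + q * + suc n} {a /ℕ suc n + q} n
    (≤-by ([n/ℕd]*d≤n a (suc n)) (lem (a /ℕ suc n) q (+ suc n) a))
    (≤-by (i<j⇒suc[i]≤j (n<s[n/ℕd]*d a (suc n))) (lem′ (a /ℕ suc n) q (+ suc n) a))
    where
    lem : ∀ r q N a → a + q * N + r * N ≡ (r + q) * N + a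
    lem = solve-∀
    lem′ : ∀ r q N a → (1ℤ + (r + q)) * N + (1ℤ + a) ≡ 1ℤ + (a + q * N) + (1ℤ + r) * N
    lem′ = solve-∀

  <ᵇ-true : ∀ {m n} → m ℕ.< n → (m ℕ.<ᵇ n) ≡ true
  <ᵇ-true {m} {n} lt with m ℕ.<ᵇ n | ℕ.<⇒<ᵇ lt
  ... | true | _ = refl

  <ᵇ-false : ∀ m n → (m ℕ.+ n ℕ.<ᵇ m) ≡ false
  <ᵇ-false m n with m ℕ.+ n ℕ.<ᵇ m in eq
  ... | false = refl
  ... | true = ⊥-elim (ℕ.<⇒≱ (ℕ.<ᵇ⇒< (m ℕ.+ n) m (subst T (sym eq) tt)) (ℕ.m≤m+n m n))

  floor-edge : ∀ k D x n d es {t} → t ℕ.< k ℕ.* suc n → floor k D x ((n , d) ∷ es) t ≡ (+ k * x * + suc n + d * + t) /ℕ (suc D ℕ.* suc n)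
  floor-edge k D x n d es lt rewrite <ᵇ-true lt = refl

  floor-rest : ∀ k D x n d es t → floor k D x ((n , d) ∷ es) (k ℕ.* suc n ℕ.+ t) ≡ floor k D (x + d) es t
  floor-rest k D x n d es t rewrite <ᵇ-false (k ℕ.* suc n) t | ℕ.m+n∸m≡n (k ℕ.* suc n) t = refl

  floor-top : ∀ k D x es → floor k D x es (k ℕ.* rows es) ≡ (+ k * end x es) /ℕ suc D
  floor-top k D x [] = refl
  floor-top k D x ((n , d) ∷ es) rewrite ℕ.*-distribˡ-+ k (suc n) (rows es) = trans (floor-rest k D x n d es (k ℕ.* rows es)) (floor-top k D (x + d) es)

  Σ<-last : ∀ n f → Σ< (suc n) f ≡ Σ< n f + f n
  Σ<-last n f = trans (cong (λ s → Σ< s f) (ℕ.+-comm 1 n)) (trans (Σ<-split n 1 f)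
    (cong (λ s → Σ< n f + s) (trans (+-identityʳ _) (cong f (ℕ.+-identityʳ n)))))

  Σ<-reverse : ∀ n f → Σ< n (λ t → f (n ℕ.∸ suc t)) ≡ Σ< n f
  Σ<-reverse zero f = refl
  Σ<-reverse (suc n) f = trans (cong (λ s → f n + s) (Σ<-reverse n f)) (trans (+-comm (f n) _) (sym (Σ<-last n f)))

  Σ<-const : ∀ n c → Σ< n (λ _ → c) ≡ + n * c
  Σ<-const zero c = sym (*-zeroˡ c)
  Σ<-const (suc n) c = trans (cong (λ s → c + s) (Σ<-const n c)) (lem (+ n) c)
    where
    lem : ∀ n c → c + n * c ≡ (1ℤ + n) * c
    lem = solve-∀

  Σ<-periodic : ∀ q n d (h : ℕ → ℤ) → (∀ t → h (n ℕ.+ t) ≡ h t + d) → + 2 * Σ< (q ℕ.* n) h ≡ + 2 * + q * Σ< n h + + n * d * (+ q * (+ q - 1ℤ))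
  Σ<-periodic zero n d h shift = lem (Σ< n h) (+ n * d)
    where
    lem : ∀ s a → + 2 * 0ℤ ≡ + 2 * 0ℤ * s + a * (0ℤ * (0ℤ - 1ℤ))
    lem = solve-∀
  Σ<-periodic (suc q) n d h shift = begin
    + 2 * Σ< (n ℕ.+ q ℕ.* n) h ≡⟨ cong (λ s → + 2 * s) (Σ<-split n (q ℕ.* n) h) ⟩
    + 2 * (Σ< n h + Σ< (q ℕ.* n) (λ t → h (n ℕ.+ t))) ≡⟨ cong (λ s → + 2 * (Σ< n h + s)) (trans (Σ<-cong (q ℕ.* n) λ t _ → shift t)
        (trans (Σ<-+ (q ℕ.* n) h (λ _ → d)) (cong (λ s → Σ< (q ℕ.* n) h + s) (trans (Σ<-const (q ℕ.* n) d) (cong (_* d) (pos-* q n)))))) ⟩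
    + 2 * (Σ< n h + (Σ< (q ℕ.* n) h + + q * + n * d)) ≡⟨ lem₁ (Σ< n h) (Σ< (q ℕ.* n) h) (+ q * + n * d) ⟩
    + 2 * Σ< n h + + 2 * (+ q * + n * d) + + 2 * Σ< (q ℕ.* n) h ≡⟨ cong (λ s → + 2 * Σ< n h + + 2 * (+ q * + n * d) + s) (Σ<-periodic q n d h shift) ⟩
    + 2 * Σ< n h + + 2 * (+ q * + n * d) + (+ 2 * + q * Σ< n h + + n * d * (+ q * (+ q - 1ℤ))) ≡⟨ lem₂ (Σ< n h) (+ q) (+ n) d ⟩
    + 2 * + suc q * Σ< n h + + n * d * (+ suc q * (+ suc q - 1ℤ)) ∎
    where
    open ≡-Reasoning
    lem₁ : ∀ a b c → + 2 * (a + (b + c)) ≡ + 2 * a + + 2 * c + + 2 * b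
    lem₁ = solve-∀
    lem₂ : ∀ s q n d → + 2 * s + + 2 * (q * n * d) + (+ 2 * q * s + n * d * (q * (q - 1ℤ))) ≡ + 2 * (1ℤ + q) * s + n * d * ((1ℤ + q) * ((1ℤ + q) - 1ℤ))
    lem₂ = solve-∀

  slope-floor : Edge → ℕ → ℤ
  slope-floor (n , d) s = (d * + s) /ℕ suc n

  -- The number of rows strictly inside the edge at which it passes through no lattice point.
  irregular : Edge → ℤ
  irregular (n , d) = + suc n * d - d - + 2 * Σ< (suc n) (slope-floor (n , d))

  irregulars : List Edge → ℤ
  irregulars [] = 0ℤ
  irregulars (e ∷ es) = irregular e + irregulars es

  irregular-nonneg : ∀ e → 0ℤ ≤ irregular e
  irregular-nonneg (n , d) = cancel-≤ (1≤+suc n) (≤-by (_⊗_ {+ 2} (+m-nonneg 2) scaled ⊕ ≤-reflexive (Σ<-affine (suc n) 0ℤ d)) (lem (+ suc n) d S (Σ< (suc n) (λ t → 0ℤ + d * + t))))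
    where
    S = Σ< (suc n) (slope-floor (n , d))
    scaled : + suc n * S ≤ Σ< (suc n) (λ t → 0ℤ + d * + t)
    scaled = ≤-trans (≤-reflexive (sym (Σ<-* (suc n) (+ suc n) (slope-floor (n , d))))) (Σ<-mono (suc n) λ t _ →
      ≤-trans (≤-reflexive (*-comm (+ suc n) (slope-floor (n , d) t))) (≤-trans ([n/ℕd]*d≤n (d * + t) (suc n)) (≤-reflexive (sym (+-identityˡ _)))))
    lem : ∀ N d S A → N * (N * d - d - + 2 * S) + (+ 2 * (N * S) + + 2 * A) ≡ N * 0ℤ + (+ 2 * A + N * (+ 2 * 0ℤ + d * (N - 1ℤ)))
    lem = solve-∀

  irregular-≤ : ∀ n d → irregular (n , d) ≤ + n
  irregular-≤ n d = ≤-by doubled (trans (lem (+ n) d S′) (cong (λ s → + suc n * d - d - + 2 * s + + 2 * S′) (sym S≡)))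
    where
    h = slope-floor (n , d)
    S′ = Σ< n (λ t → h (suc t))
    S≡ : Σ< (suc n) h ≡ S′
    S≡ = trans (cong (_+ S′) (/-unique {d * 0ℤ} {0ℤ} n (≤-reflexive (trans (*-zeroˡ (+ suc n)) (sym (*-zeroʳ d)))) (≤-trans (≤-reflexive (cong (λ s → 1ℤ + s) (*-zeroʳ d))) (≤-trans (1≤+suc n) (≤-reflexive (sym (*-identityˡ (+ suc n)))))))) (+-identityˡ S′)
    pair : ∀ t → t ℕ.< n → d - 1ℤ ≤ h (suc t) + h (suc (n ℕ.∸ suc t))
    pair t t<n with split-≤ (d - 1ℤ) (h (suc t) + h (suc (n ℕ.∸ suc t)))
    ... | inj₁ p = p
    ... | inj₂ p = absurd-≤ {+ 2} {1ℤ} (≤-by (weaken (1≤+suc n) ⊗ p ⊕ i<j⇒suc[i]≤j (n<s[n/ℕd]*d (d * + suc t) (suc n)) ⊕ i<j⇒suc[i]≤j (n<s[n/ℕd]*d (d * + suc (n ℕ.∸ suc t)) (suc n)) ⊕ ≤-reflexive (cong (d *_) (sym total)) ⊕ +m-nonneg 1)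
        (lem′ (+ n) d (+ t) (+ (n ℕ.∸ suc t)) (h (suc t)) (h (suc (n ℕ.∸ suc t))))) refl
      where
      total : + suc t + + (n ℕ.∸ suc t) ≡ + n
      total = cong +_ (ℕ.m+[n∸m]≡n t<n)
      lem′ : ∀ n d t r a b → 1ℤ + ((1ℤ + n) * (1ℤ + (a + b)) + (1ℤ + d * (1ℤ + t)) + (1ℤ + d * (1ℤ + r)) + d * n + 0ℤ) ≡
        + 2 + ((1ℤ + n) * (d - 1ℤ) + (1ℤ + a) * (1ℤ + n) + (1ℤ + b) * (1ℤ + n) + d * ((1ℤ + t) + r) + 1ℤ)
      lem′ = solve-∀
    doubled : + n * (d - 1ℤ) ≤ + 2 * S′
    doubled = ≤-trans (≤-reflexive (sym (Σ<-const n (d - 1ℤ)))) (≤-trans (Σ<-mono n pair) (≤-reflexive (trans (Σ<-+ n (λ t → h (suc t)) (λ t → h (suc (n ℕ.∸ suc t))))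
      (trans (cong (λ s → S′ + s) (Σ<-reverse n (λ t → h (suc t)))) (lem′ S′)))))
      where
      lem′ : ∀ s → s + s ≡ + 2 * s
      lem′ = solve-∀
    lem : ∀ n d S → n + n * (d - 1ℤ) ≡ (1ℤ + n) * d - d - + 2 * S + + 2 * S
    lem = solve-∀

  boundary-sum : ∀ m x es → + 2 * Σ< (m ℕ.* rows es) (floor m 0 x es) ≡ + m * + m * area₂ x es - + m * (end x es - x) - + m * irregulars es
  boundary-sum m x [] = trans (cong (λ s → + 2 * Σ< s (floor m 0 x [])) (ℕ.*-zeroʳ m)) (lem (+ m) x)
    where
    lem : ∀ m x → + 2 * 0ℤ ≡ m * m * 0ℤ - m * (x - x) - m * 0ℤ
    lem = solve-∀
  boundary-sum m x ((n , d) ∷ es) = begin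
    + 2 * Σ< (m ℕ.* (suc n ℕ.+ rows es)) F ≡⟨ cong (λ s → + 2 * Σ< s F) (ℕ.*-distribˡ-+ m (suc n) (rows es)) ⟩
    + 2 * Σ< (m ℕ.* suc n ℕ.+ m ℕ.* rows es) F ≡⟨ cong (λ s → + 2 * s) (Σ<-split (m ℕ.* suc n) (m ℕ.* rows es) F) ⟩
    + 2 * (Σ< (m ℕ.* suc n) F + Σ< (m ℕ.* rows es) (λ t → F (m ℕ.* suc n ℕ.+ t))) ≡⟨ cong₂ (λ a b → + 2 * (a + b)) first (Σ<-cong (m ℕ.* rows es) λ t _ → floor-rest m 0 x n d es t) ⟩
    + 2 * (+ m * N * (M * x) + Σ< (m ℕ.* suc n) h + Σ< (m ℕ.* rows es) (floor m 0 (x + d) es)) ≡⟨ lem₁ (+ m * N * (M * x)) (Σ< (m ℕ.* suc n) h) _ ⟩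
    + 2 * (+ m * N * (M * x)) + + 2 * Σ< (m ℕ.* suc n) h + + 2 * Σ< (m ℕ.* rows es) (floor m 0 (x + d) es) ≡⟨ cong₂ (λ a b → + 2 * (+ m * N * (M * x)) + a + b) (Σ<-periodic m (suc n) d h h-shift) (boundary-sum m (x + d) es) ⟩
    + 2 * (+ m * N * (M * x)) + (+ 2 * M * S + N * d * (M * (M - 1ℤ))) + (M * M * A - M * (E - (x + d)) - M * I) ≡⟨ lem₂ M N x d S A E I ⟩
    M * M * (N * (+ 2 * x + d) + A) - M * (E - x) - M * (N * d - d - + 2 * S + I) ∎
    where
    open ≡-Reasoning
    F = floor m 0 x ((n , d) ∷ es)
    M = + m
    N = + suc n
    h = slope-floor (n , d)
    S = Σ< (suc n) h
    A = area₂ (x + d) es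
    E = end (x + d) es
    I = irregulars es
    h-shift : ∀ t → h (suc n ℕ.+ t) ≡ h t + d
    h-shift t = trans (cong (_/ℕ suc n) (lem d N (+ t))) (/-shift (d * + t) d n)
      where
      lem : ∀ d N t → d * (N + t) ≡ d * t + d * N
      lem = solve-∀
    F≡ : ∀ t → t ℕ.< m ℕ.* suc n → F t ≡ M * x + h t
    F≡ t lt = trans (floor-edge m 0 x n d es lt) (trans (subst (λ s → (M * x * N + d * + t) /ℕ suc s ≡ (M * x * N + d * + t) /ℕ suc n) (sym (ℕ.+-identityʳ n)) refl)
      (trans (cong (_/ℕ suc n) (+-comm (M * x * N) (d * + t))) (trans (/-shift (d * + t) (M * x) n) (+-comm (h t) (M * x)))))
    first : Σ< (m ℕ.* suc n) F ≡ + m * N * (M * x) + Σ< (m ℕ.* suc n) h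
    first = trans (Σ<-cong (m ℕ.* suc n) F≡) (trans (Σ<-+ (m ℕ.* suc n) (λ _ → M * x) h)
      (cong (_+ Σ< (m ℕ.* suc n) h) (trans (Σ<-const (m ℕ.* suc n) (M * x)) (cong (_* (M * x)) (pos-* m (suc n))))))
    lem₁ : ∀ a b c → + 2 * (a + b + c) ≡ + 2 * a + + 2 * b + + 2 * c
    lem₁ = solve-∀
    lem₂ : ∀ M N x d S A E I → + 2 * (M * N * (M * x)) + (+ 2 * M * S + N * d * (M * (M - 1ℤ))) + (M * M * A - M * (E - (x + d)) - M * I) ≡
      M * M * (N * (+ 2 * x + d) + A) - M * (E - x) - M * (N * d - d - + 2 * S + I)
    lem₂ = solve-∀

  module _ {n} {T : Vec LatticePoint n} {y₀ p} (s : Sides T y₀ p) where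
    open Sides s

    bottom-width top-width twice-area boundary-count : ℤ
    bottom-width = R.x₀ + L.x₀
    top-width = end R.x₀ R.edges + end L.x₀ L.edges
    twice-area = area₂ R.x₀ R.edges + area₂ L.x₀ L.edges
    boundary-count = bottom-width + top-width + + 2 * + p - irregulars R.edges - irregulars L.edges

  side-total : ∀ m x es p → rows es ≡ p → + 2 * Σ< (suc (m ℕ.* p)) (floor m 0 x es) ≡
    + m * + m * area₂ x es + + m * (x + end x es) - + m * irregulars es
  side-total m x es .(rows es) refl = begin
    + 2 * Σ< (suc (m ℕ.* rows es)) F ≡⟨ cong (λ s → + 2 * s) (Σ<-last (m ℕ.* rows es) F) ⟩
    + 2 * (Σ< (m ℕ.* rows es) F + F (m ℕ.* rows es)) ≡⟨ *-distribˡ-+ (+ 2) (Σ< (m ℕ.* rows es) F) _ ⟩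
    + 2 * Σ< (m ℕ.* rows es) F + + 2 * F (m ℕ.* rows es) ≡⟨ cong₂ (λ a b → a + + 2 * b) (boundary-sum m x es) (trans (floor-top m 0 x es) div-1) ⟩
    M * M * A - M * (E - x) - M * I + + 2 * (M * E) ≡⟨ lem M x A E I ⟩
    M * M * A + M * (x + E) - M * I ∎
    where
    open ≡-Reasoning
    F = floor m 0 x es
    M = + m
    A = area₂ x es
    E = end x es
    I = irregulars es
    div-1 : (M * E) /ℕ 1 ≡ M * E
    div-1 = /-unique {M * E} {M * E} 0 (≤-reflexive (*-identityʳ (M * E))) (≤-reflexive (sym (*-identityʳ (1ℤ + M * E))))
    lem : ∀ M x A E I → M * M * A - M * (E - x) - M * I + + 2 * (M * E) ≡ M * M * A + M * (x + E) - M * I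
    lem = solve-∀

  Σ<-rows : ∀ q f g → + 2 * Σ< (suc q) (λ t → f t + g t + 1ℤ) ≡ + 2 * Σ< (suc q) f + + 2 * Σ< (suc q) g + + 2 * (1ℤ + + q)
  Σ<-rows q f g = trans (cong (λ s → + 2 * s) (trans (Σ<-+ (suc q) (λ t → f t + g t) (λ _ → 1ℤ)) (cong₂ _+_ (Σ<-+ (suc q) f g) (Σ<-const (suc q) 1ℤ))))
    (lem (Σ< (suc q) f) (Σ< (suc q) g) (+ q))
    where
    lem : ∀ a b q → + 2 * (a + b + (1ℤ + q) * 1ℤ) ≡ + 2 * a + + 2 * b + + 2 * (1ℤ + q)
    lem = solve-∀

  hull-double : ∀ {n} {T : Vec LatticePoint n} {k} (z : LatticePoint) →
    Hull T (1ℤ * proj₁ z) (1ℤ * proj₂ z) k ⇔ Hull T (+ 2 * proj₁ z) (+ 2 * proj₂ z) (+ 2 * k)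
  hull-double (x , y) = mk⇔ (λ h → hull-scale (+ 2) (hull-cast (*-identityˡ x) (*-identityˡ y) refl h))
    (λ h → hull-cast (sym (*-identityˡ x)) (sym (*-identityˡ y)) refl (hull-unscale (+ 2) (1≤+suc 1) h))

  even-total : ∀ {n} {T : Vec LatticePoint n} {y₀ p} (s : Sides T y₀ p) m → let open Sides s in
    + 2 * Σ< (suc (m ℕ.* p)) (λ t → floor m 0 R.x₀ R.edges t + floor m 0 L.x₀ L.edges t + 1ℤ) ≡
    + m * + m * twice-area s + + m * boundary-count s + + 2
  even-total {p = p} s m = trans (Σ<-rows (m ℕ.* p) f g) (trans
    (cong₂ _+_ (cong₂ _+_ (side-total m R.x₀ R.edges p R.height) (side-total m L.x₀ L.edges p L.height)) (cong (λ s → + 2 * (1ℤ + s)) (pos-* m p)))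
    (lem (+ m) (+ p) R.x₀ (end R.x₀ R.edges) (area₂ R.x₀ R.edges) (irregulars R.edges) L.x₀ (end L.x₀ L.edges) (area₂ L.x₀ L.edges) (irregulars L.edges)))
    where
    open Sides s
    f = floor m 0 R.x₀ R.edges
    g = floor m 0 L.x₀ L.edges
    lem : ∀ M P x E A I x′ E′ A′ I′ → M * M * A + M * (x + E) - M * I + (M * M * A′ + M * (x′ + E′) - M * I′) + + 2 * (1ℤ + M * P) ≡
      M * M * (A + A′) + M * (x + x′ + (E + E′) + + 2 * P - I - I′) + + 2
    lem = solve-∀

  even-count : ∀ {n} {T : Vec LatticePoint n} {y₀ p} (s : Sides T y₀ (suc p)) m →
    Σ ℕ λ c → Counts (λ z → Hull T (+ 2 * proj₁ z) (+ 2 * proj₂ z) (+ 2 * + suc m)) c ×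
      + 2 * + c ≡ + suc m * + suc m * twice-area s + + suc m * boundary-count s + + 2
  even-count {T = T} {y₀} {p} s m = finish (counts-rows s m 0 (suc q) 0 (+ suc m * y₀) z≤n
    (trans (+-identityʳ (+ suc m * y₀)) (sym (*-identityˡ (+ suc m * y₀)))) (s≤s (ℕ.≤-reflexive (sym (ℕ.+-identityʳ q))))
    (ℕ.≤-reflexive (trans (cong suc (ℕ.+-identityʳ q)) (ℕ.+-comm 1 q))))
    where
    open Sides s
    q = suc m ℕ.* suc p
    f = floor (suc m) 0 R.x₀ R.edges
    g = floor (suc m) 0 L.x₀ L.edges
    finish : (Σ ℕ λ c → Counts (λ z → Hull T (1ℤ * proj₁ z) (1ℤ * proj₂ z) (+ suc m)) c × + c ≡ Σ< (suc q) (λ j → f (1 ℕ.* j) + g (1 ℕ.* j) + 1ℤ)) → _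
    finish (c , counts , c≡) = c , counts-cong (hull-double {T = T} {+ suc m}) counts ,
      trans (cong (λ s → + 2 * s) (trans c≡ (Σ<-cong (suc q) λ t _ → cong (λ j → f j + g j + 1ℤ) (ℕ.+-identityʳ t)))) (even-total s (suc m))

module Problems where

  open Inequalities
  open Hulls
  open Chains
  open ScaledRows
  open Counting
  open EvenDilates
  open import Defs
  open import Data.Nat using (ℕ; zero; suc)
  open import Data.Integer hiding (suc)
  open import Data.Integer.Properties
  open import Data.Integer.Tactic.RingSolver using (solve-∀)
  open import Data.Product using (_×_; _,_; Σ; proj₁; proj₂)
  open import Data.Sum using (inj₁; inj₂)
  open import Data.Empty using (⊥-elim)
  open import Data.Unit using (⊤; tt)
  open import Data.List as List using (List)
  open import Data.List.Properties using (length-map)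
  open import Data.List.Membership.Propositional.Properties using () renaming (∈-map⁺ to ∈ˡ-map⁺; ∈-map⁻ to ∈ˡ-map⁻)
  import Data.List.Relation.Unary.Unique.Propositional.Properties as Unique
  open import Data.List.Membership.Propositional renaming (_∈_ to _∈ˡ_)
  open import Data.Vec using (Vec; map)
  open import Data.Vec.Properties using (map-∘; map-cong)
  open import Data.Vec.Membership.Propositional using (_∈_)
  open import Data.Vec.Membership.Propositional.Properties using (∈-map⁺)
  open import Function.Bundles using (mk⇔; Equivalence)
  open import Relation.Nullary using (¬_; yes)
  open import Relation.Binary.PropositionalEquality

  double : LatticePoint → LatticePoint
  double (x , y) = + 2 * x , + 2 * y

  -- With conv T = 2P, the lattice points of k P.
  Dilate : ∀ {n} → Vec LatticePoint n → ℤ → LatticePoint → Set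
  Dilate T k z = Hull T (+ 2 * proj₁ z) (+ 2 * proj₂ z) k

  -- conv T is the hull of points with even coordinates, i.e. P is a lattice polygon.
  Even : ∀ {n} → Vec LatticePoint n → Set
  Even T = Σ ℕ λ m → Σ (Vec LatticePoint m) λ U → (∀ u → u ∈ U → Dilate T 1ℤ u) × (∀ u → u ∈ T → Hull (map double U) (proj₁ u) (proj₂ u) 1ℤ)

  Nondegenerate : ∀ {n} → Vec LatticePoint n → Set
  Nondegenerate T = ∀ α β γ → (∀ u → u ∈ T → α * proj₁ u + β * proj₂ u ≡ γ) → α ≡ 0ℤ × β ≡ 0ℤ

  -- A is twice the area of conv T and B its number of boundary lattice points.
  record Problem {n} (T : Vec LatticePoint n) (A B : ℤ) (c₁ c₃ : ℕ) : Set where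
    field
      nondegenerate : Nondegenerate T
      count₁ : Counts (Dilate T 1ℤ) c₁
      count₃ : Counts (Dilate T (+ 3)) c₃
      count₂ : Σ ℕ λ c → Counts (Dilate T (+ 2)) c × + 2 * + c ≡ A + B + + 2
      count₄ : Σ ℕ λ c → Counts (Dilate T (+ 4)) c × + 2 * + c ≡ + 4 * A + + 2 * B + + 2
      poly₁  : + 8 * + c₁ ≡ A + + 2 * B + + 8
      poly₃  : + 8 * + c₃ ≡ + 9 * A + + 6 * B + + 8
      uneven : ¬ Even T

  act-double : ∀ M z → act M (double z) ≡ double (act M z)
  act-double (matrix a b c d) (x , y) = cong₂ _,_ (lem a b x y) (lem c d x y)
    where
    lem : ∀ a b x y → a * (+ 2 * x) + b * (+ 2 * y) ≡ + 2 * (a * x + b * y)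
    lem = solve-∀

  module _ (G : Unimodular) where
    open Unimodular G

    dilate-act : ∀ {n} {T : Vec LatticePoint n} {k} M z → Dilate T k z → Dilate (map (act M) T) k (act M z)
    dilate-act M z h = hull-cast (cong proj₁ (act-double M z)) (cong proj₂ (act-double M z)) refl (hull-act M h)

    dilate-unact : ∀ {n} {T : Vec LatticePoint n} {k} z → Dilate (map (act mat) T) k z → Dilate T k (act inv z)
    dilate-unact {T = T} {k} z h = subst (λ T → Dilate T k (act inv z)) (map-inv G) (dilate-act inv z h)

    counts-act : ∀ {n} {T : Vec LatticePoint n} {k c} → Counts (Dilate T k) c → Counts (Dilate (map (act mat) T) k) c
    counts-act {T = T} {k} (L , u , mem , len) = List.map (act mat) L , Unique.map⁺ injective u ,
      (λ z → mk⇔ (to z) (from z)) , trans (length-map (act mat) L) len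
      where
      injective : ∀ {x y} → act mat x ≡ act mat y → x ≡ y
      injective {x} {y} eq = trans (sym (inv-mat x)) (trans (cong (act inv) eq) (inv-mat y))
      to : ∀ z → z ∈ˡ List.map (act mat) L → Dilate (map (act mat) T) k z
      to z z∈ with ∈ˡ-map⁻ (act mat) z∈
      ... | x , x∈ , refl = dilate-act mat x (Equivalence.to (mem x) x∈)
      from : ∀ z → Dilate (map (act mat) T) k z → z ∈ˡ List.map (act mat) L
      from z h = subst (_∈ˡ List.map (act mat) L) (mat-inv z) (∈ˡ-map⁺ (act mat) (Equivalence.from (mem (act inv z)) (dilate-unact z h)))

    even-unact : ∀ {n} {T : Vec LatticePoint n} → Even (map (act mat) T) → Even T
    even-unact {T = T} (m , U , U⊆ , T⊆) = m , map (act inv) U ,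
      (λ u u∈ → inner u (∈-map⁻ u∈)) , λ u u∈ → subst (λ V → Hull V (proj₁ u) (proj₂ u) 1ℤ) commute
        (hull-cast (cong proj₁ (inv-mat u)) (cong proj₂ (inv-mat u)) refl (hull-act inv (T⊆ (act mat u) (∈-map⁺ (act mat) u∈))))
      where
      inner : ∀ u → (Σ _ λ v → v ∈ U × act inv v ≡ u) → Dilate T 1ℤ u
      inner u (v , v∈ , refl) = dilate-unact v (U⊆ v v∈)
      commute : map (act inv) (map double U) ≡ map double (map (act inv) U)
      commute = trans (sym (map-∘ _ _ U)) (trans (map-cong (act-double inv) U) (map-∘ _ _ U))

    problem-act : ∀ {n} {T : Vec LatticePoint n} {A B c₁ c₃} → Problem T A B c₁ c₃ → Problem (map (act mat) T) A B c₁ c₃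
    problem-act {T = T} P = record
      { nondegenerate = nondeg
      ; count₁ = counts-act count₁
      ; count₃ = counts-act count₃
      ; count₂ = proj₁ count₂ , counts-act (proj₁ (proj₂ count₂)) , proj₂ (proj₂ count₂)
      ; count₄ = proj₁ count₄ , counts-act (proj₁ (proj₂ count₄)) , proj₂ (proj₂ count₄)
      ; poly₁ = poly₁ ; poly₃ = poly₃ ; uneven = λ e → uneven (even-unact e) }
      where
      open Problem P
      open Matrix mat
      nondeg : Nondegenerate (map (act mat) T)
      nondeg α β γ flat with nondegenerate (α * a + β * c) (α * b + β * d) γ
        (λ u u∈ → trans (regroup α β a b c d (proj₁ u) (proj₂ u)) (flat (act mat u) (∈-map⁺ (act mat) u∈)))
        where
        regroup : ∀ α β a b c d x y → (α * a + β * c) * x + (α * b + β * d) * y ≡ α * (a * x + b * y) + β * (c * x + d * y)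
        regroup = solve-∀
      ... | zero₁ , zero₂ = trans (lem₁ α β) (coeff (1ℤ , 0ℤ)) , trans (lem₂ α β) (coeff (0ℤ , 1ℤ))
        where
        lem₁ : ∀ α β → α ≡ α * 1ℤ + β * 0ℤ
        lem₁ = solve-∀
        lem₂ : ∀ α β → β ≡ α * 0ℤ + β * 1ℤ
        lem₂ = solve-∀
        regroup : ∀ α β a b c d x y → α * (a * x + b * y) + β * (c * x + d * y) ≡ (α * a + β * c) * x + (α * b + β * d) * y
        regroup = solve-∀
        coeff : ∀ z → α * proj₁ z + β * proj₂ z ≡ 0ℤ
        coeff z = trans (cong (λ v → α * proj₁ v + β * proj₂ v) (sym (mat-inv z))) (trans (regroup α β a b c d (proj₁ (act inv z)) (proj₂ (act inv z)))
          (cong₂ (λ s t → s * proj₁ (act inv z) + t * proj₂ (act inv z)) zero₁ zero₂))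

  record Extent {n} (T : Vec LatticePoint n) (y₀ : ℤ) (p : ℕ) : Set where
    field
      low    : ∀ u → u ∈ T → y₀ ≤ proj₂ u
      high   : ∀ u → u ∈ T → proj₂ u ≤ y₀ + + p
      bottom : Σ ℤ λ x → (x , y₀) ∈ T
      top    : Σ ℤ λ x → (x , y₀ + + p) ∈ T

  abstract
    extent : ∀ {n} {T : Vec LatticePoint n} → Nondegenerate T → Σ ℤ λ y₀ → Σ ℕ λ p → Extent T y₀ (suc p)
    extent {T = T} P
      with extremal {P = λ _ → ⊤} (λ _ → yes tt) {R = λ a b → proj₂ b ≤ proj₂ a} (λ _ _ _ _ → ≤-total _ _) (λ _ _ _ _ _ _ p q → ≤-trans q p) T
         | extremal {P = λ _ → ⊤} (λ _ → yes tt) {R = λ a b → proj₂ a ≤ proj₂ b} (λ _ _ _ _ → ≤-total _ _) (λ _ _ _ _ _ _ → ≤-trans) T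
    ... | inj₁ none | _ = ⊥-elim (1≢0 (proj₁ (P 1ℤ 0ℤ 0ℤ λ u u∈ → ⊥-elim (none u u∈ tt))))
      where
      1≢0 : ¬ 1ℤ ≡ 0ℤ
      1≢0 ()
    ... | inj₂ _ | inj₁ none = ⊥-elim (1≢0 (proj₁ (P 1ℤ 0ℤ 0ℤ λ u u∈ → ⊥-elim (none u u∈ tt))))
      where
      1≢0 : ¬ 1ℤ ≡ 0ℤ
      1≢0 ()
    ... | inj₂ ((b , y₀) , b∈ , _ , low) | inj₂ ((t , y₁) , t∈ , _ , high) = go ∣ y₁ - y₀ ∣ (0≤i⇒+∣i∣≡i (difference (high (b , y₀) b∈ tt)))
      where
      1≢0 : ¬ 1ℤ ≡ 0ℤ
      1≢0 ()
      shift : ∀ y₀ y₁ → y₁ ≡ y₀ + (y₁ - y₀)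
      shift = solve-∀
      go : ∀ p → + p ≡ y₁ - y₀ → Σ ℤ λ y₀ → Σ ℕ λ p → Extent T y₀ (suc p)
      go zero eq = ⊥-elim (1≢0 (proj₂ (P 0ℤ 1ℤ y₀ λ u u∈ → trans (lem (proj₁ u) (proj₂ u))
        (≤-antisym (≤-trans (high u u∈ tt) (≤-reflexive (trans (shift y₀ y₁) (trans (cong (λ s → y₀ + s) (sym eq)) (+-identityʳ y₀))))) (low u u∈ tt)))))
        where
        lem : ∀ x y → 0ℤ * x + 1ℤ * y ≡ y
        lem = solve-∀
      go (suc p) eq = y₀ , p , record
        { low = λ u u∈ → low u u∈ tt
        ; high = λ u u∈ → ≤-trans (high u u∈ tt) (≤-reflexive y₁≡)
        ; bottom = b , b∈
        ; top = t , subst (λ s → (t , s) ∈ T) y₁≡ t∈ }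
        where
        y₁≡ : y₁ ≡ y₀ + + suc p
        y₁≡ = trans (shift y₀ y₁) (cong (λ s → y₀ + s) (sym eq))

  sides-from : ∀ {n} {T : Vec LatticePoint n} {y₀ p} → Extent T y₀ p → Boundary T y₀ p → Boundary (map flip T) y₀ p → Sides T y₀ p
  sides-from {T = T} {y₀} {p} E R L = record
    { right = R
    ; left = L
    ; low = λ {X} {Y} {K} 0≤K h → ≤-by (hull-≤ {X = X} {Y} 0ℤ -1ℤ (- y₀) (λ {u} u∈ → ≤-by (low u u∈) (lem₁ y₀ (proj₁ u) (proj₂ u))) 0≤K h) (lem₂ X Y K y₀)
    ; high = λ {X} {Y} {K} 0≤K h → ≤-by (hull-≤ {X = X} {Y} 0ℤ 1ℤ (y₀ + + p) (λ {u} u∈ → ≤-by (high u u∈) (lem₃ (y₀ + + p) (proj₁ u) (proj₂ u))) 0≤K h) (lem₄ X Y K (y₀ + + p)) }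
    where
    open Extent E
    lem₁ : ∀ y₀ x y → - y₀ + y₀ ≡ 0ℤ * x + -1ℤ * y + y
    lem₁ = solve-∀
    lem₂ : ∀ X Y K y₀ → Y + (0ℤ * X + -1ℤ * Y) ≡ K * y₀ + - y₀ * K
    lem₂ = solve-∀
    lem₃ : ∀ t x y → t + y ≡ 0ℤ * x + 1ℤ * y + t
    lem₃ = solve-∀
    lem₄ : ∀ X Y K t → K * t + (0ℤ * X + 1ℤ * Y) ≡ Y + t * K
    lem₄ = solve-∀

  abstract
    sides : ∀ {n} {T : Vec LatticePoint n} {y₀ p} → Extent T y₀ p → Sides T y₀ p
    sides {T = T} {y₀} {p} E = sides-from E (boundary-exists low high bottom top)
      (boundary-exists (λ u u∈ → flipped {λ v → y₀ ≤ proj₂ v} low u∈) (λ u u∈ → flipped {λ v → proj₂ v ≤ y₀ + + p} high u∈)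
        (- proj₁ bottom , subst (_∈ map flip T) (flip≡ _ _) (∈-map⁺ flip (proj₂ bottom)))
        (- proj₁ top , subst (_∈ map flip T) (flip≡ _ _) (∈-map⁺ flip (proj₂ top))))
      where
      open Extent E
      flipped : ∀ {Q : LatticePoint → Set} → (∀ u → u ∈ T → Q (0ℤ , proj₂ u)) → ∀ {u} → u ∈ map flip T → Q (0ℤ , proj₂ u)
      flipped {Q} q u∈ with ∈-map⁻ u∈
      ... | (x , y) , v∈ , refl = subst (λ s → Q (0ℤ , s)) (sym (cong proj₂ (flip≡ x y))) (q (x , y) v∈)

  module _ {n} {T : Vec LatticePoint n} {A B c₁ c₃} (P : Problem T A B c₁ c₃) {y₀ p} (s : Sides T y₀ (suc p)) where
    open Problem P

    private
      agree : ∀ {Q a b} → (Σ ℕ λ c → Counts Q c × + 2 * + c ≡ a) → (Σ ℕ λ c → Counts Q c × + 2 * + c ≡ b) → a ≡ b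
      agree (c , counts , eq) (c′ , counts′ , eq′) = trans (sym eq) (trans (cong (λ c → + 2 * + c) (counts-unique counts counts′)) eq′)
      A′ = twice-area s
      B′ = boundary-count s
      first : A + B + + 2 ≡ 1ℤ * 1ℤ * A′ + 1ℤ * B′ + + 2
      first = agree count₂ (even-count s 0)
      second : + 4 * A + + 2 * B + + 2 ≡ + 2 * + 2 * A′ + + 2 * B′ + + 2
      second = agree count₄ (even-count s 1)

    area≡ : A ≡ twice-area s
    area≡ = cancel-≡ {+ 2} (1≤+suc 1) (trans (lem A B) (trans (cong₂ (λ a b → a - + 2 * b + + 2) second first) (lem′ A′ B′)))
      where
      lem : ∀ A B → + 2 * A ≡ + 4 * A + + 2 * B + + 2 - + 2 * (A + B + + 2) + + 2
      lem = solve-∀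
      lem′ : ∀ A B → + 2 * + 2 * A + + 2 * B + + 2 - + 2 * (1ℤ * 1ℤ * A + 1ℤ * B + + 2) + + 2 ≡ + 2 * A
      lem′ = solve-∀

    count≡ : B ≡ boundary-count s
    count≡ = +-cancelˡ A (trans (lem A B) (trans (cong (_- + 2) first) (trans (lem′ A′ B′) (cong (_+ B′) (sym area≡)))))
      where
      lem : ∀ A B → A + B ≡ A + B + + 2 - + 2
      lem = solve-∀
      lem′ : ∀ A B → 1ℤ * 1ℤ * A + 1ℤ * B + + 2 - + 2 ≡ A + B
      lem′ = solve-∀

module AreaBounds where

  open Inequalities
  open Hulls
  open Chains
  open ScaledRows
  open Counting
  open EvenDilates
  open Problems
  open import Defs
  open import Data.Nat as ℕ using (ℕ; zero; suc)
  import Data.Nat.Properties as ℕ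
  open import Data.Integer hiding (suc)
  open import Data.Integer.Properties
  open import Data.Integer.Tactic.RingSolver using (solve-∀)
  open import Data.Product using (_,_; proj₁; proj₂)
  open import Data.Sum using (inj₁; inj₂)
  open import Data.Vec using (Vec; map)
  open import Data.Vec.Membership.Propositional using (_∈_)
  open import Data.Vec.Membership.Propositional.Properties using (∈-map⁺)
  open import Relation.Binary.PropositionalEquality hiding (J)

  trapezoid-affine : ∀ n a b X → (∀ t → t ℕ.≤ n → X t ≡ a + b * + t) → trapezoid n X ≡ + n * (+ 2 * a + b * + n)
  trapezoid-affine n a b X affine = cancel-≡ {+ 2} (1≤+suc 1) (trans (cong (λ s → + 2 * s) (Σ<-cong n λ t t<n →
      trans (cong₂ _+_ (affine t (ℕ.<⇒≤ t<n)) (affine (suc t) t<n)) (lem₁ a b (+ t)))) (trans (Σ<-affine n (+ 2 * a + b) (+ 2 * b)) (lem₂ (+ n) a b)))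
    where
    lem₁ : ∀ a b t → a + b * t + (a + b * (1ℤ + t)) ≡ + 2 * a + b + + 2 * b * t
    lem₁ = solve-∀
    lem₂ : ∀ n a b → n * (+ 2 * (+ 2 * a + b) + + 2 * b * (n - 1ℤ)) ≡ + 2 * (n * (+ 2 * a + b * n))
    lem₂ = solve-∀

  trapezoid-split : ∀ m n X → trapezoid (m ℕ.+ n) X ≡ trapezoid m X + trapezoid n (λ t → X (m ℕ.+ t))
  trapezoid-split m n X = trans (Σ<-split m n (λ t → X t + X (suc t)))
    (cong (λ s → trapezoid m X + s) (Σ<-cong n λ t _ → cong (λ s → X (m ℕ.+ t) + X s) (sym (ℕ.+-suc m t))))

  +-∸ : ∀ {m n} → m ℕ.≤ n → + (n ℕ.∸ m) ≡ + n - + m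
  +-∸ {m} {n} m≤n = trans (lem (+ (n ℕ.∸ m)) (+ m)) (cong (_- + m) (cong +_ (ℕ.m∸n+n≡m m≤n)))
    where
    lem : ∀ a b → a ≡ a + b - b
    lem = solve-∀

  reach-hull : ∀ {n} {T : Vec LatticePoint n} {X Y D} → Hull T X Y D → Reach T D Y X
  reach-hull {X = X} {Y} {D} h = reach ≤-refl (hull-cast refl (sym (*-identityˡ Y)) (sym (*-identityˡ D)) h) (≤-reflexive (*-identityˡ X))

  segment : ∀ {n} {T : Vec LatticePoint n} {x y x′} u v l → u ℕ.+ v ≡ suc l → Hull T x y 1ℤ → Hull T x′ (y + + suc l) 1ℤ →
    Hull T (+ u * x + + v * x′) (+ suc l * (y + + v)) (+ suc l)
  segment {x = x} {y} {x′} u v l u+v h h′ = hull-cast refl (trans (cong (λ s → + u * y + + v * (y + s)) (sym uv)) (trans (lem₁ (+ u) (+ v) y) (cong (λ s → s * (y + + v)) uv)))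
    (trans (*-identityʳ (+ u + + v)) uv)
    (hull-mix (+ u) (+ v) (+m-nonneg u) (+m-nonneg v) (≤-trans (1≤+suc l) (≤-reflexive (sym uv))) h h′)
    where
    uv : + u + + v ≡ + suc l
    uv = cong +_ u+v
    lem₁ : ∀ u v y → u * y + v * (y + (u + v)) ≡ (u + v) * (y + v)
    lem₁ = solve-∀

  boundary-area : ∀ {n} {T : Vec LatticePoint n} {y₀ p} → Boundary T y₀ p → ℤ
  boundary-area b = area₂ (Boundary.x₀ b) (Boundary.edges b)

  module _ {n} {T : Vec LatticePoint n} {y₀ p} (b : Boundary T y₀ p) where

    area-bound : ∀ {D} → 1ℤ ≤ D → ∀ X → (∀ t → t ℕ.≤ p → Reach T D (D * (y₀ + + t)) (X t)) → trapezoid p X ≤ D * boundary-area b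
    area-bound {D} 1≤D X h = subst (λ p → (∀ t → t ℕ.≤ p → Reach T D (D * (y₀ + + t)) (X t)) → trapezoid p X ≤ D * boundary-area b) (Boundary.height b)
      (area-≥ 1≤D (Boundary.chain b) X) h

  area-linear : ∀ {n} {T : Vec LatticePoint n} {y₀ p} (b : Boundary T y₀ (suc p)) {xb xt} → Hull T xb y₀ 1ℤ → Hull T xt (y₀ + + suc p) 1ℤ →
    + suc p * (xb + xt) ≤ boundary-area b
  area-linear {T = T} {y₀} {p} b {xb} {xt} hb ht = cancel-≤ (1≤+suc p) (≤-trans (≤-reflexive (sym total)) (area-bound b (1≤+suc p) X reached))
    where
    X : ℕ → ℤ
    X t = + (suc p ℕ.∸ t) * xb + + t * xt
    reached : ∀ t → t ℕ.≤ suc p → Reach T (+ suc p) (+ suc p * (y₀ + + t)) (X t)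
    reached t t≤ = reach-hull (segment (suc p ℕ.∸ t) t p (ℕ.m∸n+n≡m t≤) hb ht)
    total : trapezoid (suc p) X ≡ + suc p * (+ suc p * (xb + xt))
    total = trans (trapezoid-affine (suc p) (+ suc p * xb) (xt - xb) X λ t t≤ → trans (cong (λ s → s * xb + + t * xt) (+-∸ t≤)) (lem₁ (+ suc p) xb xt (+ t))) (lem₂ (+ suc p) xb xt)
      where
      lem₁ : ∀ p b t k → (p - k) * b + k * t ≡ p * b + (t - b) * k
      lem₁ = solve-∀
      lem₂ : ∀ p b t → p * (+ 2 * (p * b) + (t - b) * p) ≡ p * (p * (b + t))
      lem₂ = solve-∀

  -- The boundary lies right of the two segments joining an inner point to the bottom and top rows.
  area-tent : ∀ {n} {T : Vec LatticePoint n} {y₀ p} (b : Boundary T y₀ (suc p)) {xb xt x} j l → j ℕ.+ l ≡ suc p →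
    Hull T xb y₀ 1ℤ → Hull T xt (y₀ + + suc p) 1ℤ → Hull T x (y₀ + + j) 1ℤ →
    + suc p * x + + j * xb + + l * xt ≤ boundary-area b
  area-tent {y₀ = y₀} {p} b {xb} {xt} {x} zero .(suc p) refl hb ht h = ≤-by (area-linear b (hull-cast refl (+-identityʳ y₀) refl h) ht) (lem (boundary-area b) (+ suc p) x xb xt)
    where
    lem : ∀ A P x xb xt → A + P * (x + xt) ≡ P * x + 0ℤ * xb + P * xt + A
    lem = solve-∀
  area-tent {y₀ = y₀} {p} b {xb} {xt} {x} (suc j) zero eq hb ht h = ≤-by (area-linear b hb (hull-cast refl (cong (λ s → y₀ + + s) (trans (sym (ℕ.+-identityʳ (suc j))) eq)) refl h))
    (trans (lem (boundary-area b) (+ suc p) x xb xt) (cong (λ s → + suc p * x + + s * xb + 0ℤ * xt + boundary-area b) (sym (trans (sym (ℕ.+-identityʳ (suc j))) eq))))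
    where
    lem : ∀ A P x xb xt → A + P * (xb + x) ≡ P * x + P * xb + 0ℤ * xt + A
    lem = solve-∀
  area-tent {T = T} {y₀} {p} b {xb} {xt} {x} (suc j) (suc l) eq hb ht h = cancel-≤ 1≤D (≤-trans (≤-reflexive (sym total)) (area-bound b 1≤D X reached))
    where
    J = + suc j
    L = + suc l
    D = J * L
    1≤D : 1ℤ ≤ D
    1≤D = 1≤-* (1≤+suc j) (1≤+suc l)
    X : ℕ → ℤ
    X t = L * + (suc j ℕ.∸ t) * (xb - x) + J * + (t ℕ.∸ suc j) * (xt - x) + D * x
    ht′ : Hull T xt (y₀ + J + L) 1ℤ
    ht′ = hull-cast refl (trans (cong (λ s → y₀ + + s) (sym eq)) (sym (+-assoc y₀ J L))) refl ht
    X-low : ∀ t → t ℕ.≤ suc j → X t ≡ L * (+ (suc j ℕ.∸ t) * xb + + t * x)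
    X-low t t≤ = trans (cong₂ (λ a c → L * a * (xb - x) + J * c * (xt - x) + D * x) (+-∸ t≤) (cong +_ (ℕ.m≤n⇒m∸n≡0 t≤)))
      (trans (lem L J (+ t) xb x (xt - x)) (cong (λ s → L * (s * xb + + t * x)) (sym (+-∸ t≤))))
      where
      lem : ∀ L J t xb x d → L * (J - t) * (xb - x) + J * 0ℤ * d + J * L * x ≡ L * ((J - t) * xb + t * x)
      lem = solve-∀
    X-high : ∀ v → v ℕ.≤ suc l → X (suc j ℕ.+ v) ≡ J * (+ (suc l ℕ.∸ v) * x + + v * xt)
    X-high v v≤ = trans (cong₂ (λ a c → L * a * (xb - x) + J * c * (xt - x) + D * x)
        (cong +_ (ℕ.m≤n⇒m∸n≡0 (ℕ.m≤m+n (suc j) v))) (cong +_ (ℕ.m+n∸m≡n (suc j) v)))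
      (trans (lem L J (+ v) xt x (xb - x)) (cong (λ s → J * (s * x + + v * xt)) (sym (+-∸ v≤))))
      where
      lem : ∀ L J v xt x d → L * 0ℤ * d + J * v * (xt - x) + J * L * x ≡ J * ((L - v) * x + v * xt)
      lem = solve-∀
    reached : ∀ t → t ℕ.≤ suc p → Reach T D (D * (y₀ + + t)) (X t)
    reached t t≤ with ℕ.≤-total t (suc j)
    ... | inj₁ t≤j = reach-hull (hull-cast (sym (X-low t t≤j)) (lem₁ L J (y₀ + + t)) (*-comm L J)
            (hull-scale L (segment (suc j ℕ.∸ t) t j (ℕ.m∸n+n≡m t≤j) hb h)))
      where
      lem₁ : ∀ L J y → L * (J * y) ≡ J * L * y
      lem₁ = solve-∀
    ... | inj₂ j≤t = subst (λ t → Reach T D (D * (y₀ + + t)) (X t)) (ℕ.m+[n∸m]≡n j≤t)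
            (reach-hull (hull-cast (sym (X-high v v≤)) (lem₁ J L y₀ (+ v)) refl (hull-scale J (segment (suc l ℕ.∸ v) v l (ℕ.m∸n+n≡m v≤) h ht′))))
      where
      v = t ℕ.∸ suc j
      v≤ : v ℕ.≤ suc l
      v≤ = ℕ.≤-trans (ℕ.∸-monoˡ-≤ (suc j) (ℕ.≤-trans t≤ (ℕ.≤-reflexive (sym eq)))) (ℕ.≤-reflexive (ℕ.m+n∸m≡n (suc j) (suc l)))
      lem₁ : ∀ J L y v → J * (L * (y + J + v)) ≡ J * L * (y + (J + v))
      lem₁ = solve-∀
    total : trapezoid (suc p) X ≡ D * (+ suc p * x + J * xb + L * xt)
    total = begin
      trapezoid (suc p) X ≡⟨ cong (λ p → trapezoid p X) (sym eq) ⟩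
      trapezoid (suc j ℕ.+ suc l) X ≡⟨ trapezoid-split (suc j) (suc l) X ⟩
      trapezoid (suc j) X + trapezoid (suc l) (λ t → X (suc j ℕ.+ t)) ≡⟨ cong₂ _+_
          (trapezoid-affine (suc j) (D * xb) (L * (x - xb)) X λ t t≤ → trans (X-low t t≤) (trans (cong (λ s → L * (s * xb + + t * x)) (+-∸ t≤)) (lem₁ L J (+ t) xb x)))
          (trapezoid-affine (suc l) (D * x) (J * (xt - x)) _ λ t t≤ → trans (X-high t t≤) (trans (cong (λ s → J * (s * x + + t * xt)) (+-∸ t≤)) (lem₂ L J (+ t) xt x))) ⟩
      J * (+ 2 * (D * xb) + L * (x - xb) * J) + L * (+ 2 * (D * x) + J * (xt - x) * L) ≡⟨ lem₃ J L x xb xt ⟩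
      D * ((J + L) * x + J * xb + L * xt) ≡⟨ cong (λ s → D * (+ s * x + J * xb + L * xt)) eq ⟩
      D * (+ suc p * x + J * xb + L * xt) ∎
      where
      open ≡-Reasoning
      lem₁ : ∀ L J t xb x → L * ((J - t) * xb + t * x) ≡ J * L * xb + L * (x - xb) * t
      lem₁ = solve-∀
      lem₂ : ∀ L J t xt x → J * ((L - t) * x + t * xt) ≡ J * L * x + J * (xt - x) * t
      lem₂ = solve-∀
      lem₃ : ∀ J L x xb xt → J * (+ 2 * (J * L * xb) + L * (x - xb) * J) + L * (+ 2 * (J * L * x) + J * (xt - x) * L) ≡ J * L * ((J + L) * x + J * xb + L * xt)
      lem₃ = solve-∀

  module _ {n} {T : Vec LatticePoint n} {y₀ p} (b : Boundary T y₀ p) where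
    open Boundary b
    bottom-hull : Hull T x₀ y₀ 1ℤ
    bottom-hull = hull-vertex start
    top-hull : Hull T (end x₀ edges) (y₀ + + p) 1ℤ
    top-hull = hull-vertex (chain-end start chain)

  width : ∀ {n} {T : Vec LatticePoint n} {y₀ p} → Sides T y₀ p → ℤ
  width s = bottom-width s + top-width s

  parallelogram-area : ∀ {n} {T : Vec LatticePoint n} {y₀ p} (s : Sides T y₀ (suc p)) → + suc p * width s ≤ twice-area s
  parallelogram-area {p = p} s = ≤-by (area-linear right (bottom-hull right) (top-hull right) ⊕ area-linear left (bottom-hull left) (top-hull left))
    (lem (+ suc p) (boundary-area right) (boundary-area left) R.x₀ (end R.x₀ R.edges) L.x₀ (end L.x₀ L.edges))
    where
    open Sides s
    lem : ∀ P A A′ x e x′ e′ → A + A′ + (P * (x + e) + P * (x′ + e′)) ≡ P * (x + x′ + (e + e′)) + (A + A′)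
    lem = solve-∀

  cross-area : ∀ {n} {T : Vec LatticePoint n} {y₀ p} (s : Sides T y₀ (suc p)) {xb xt xr xl} jr jl → jr ℕ.≤ suc p → jl ℕ.≤ suc p →
    Hull T xb y₀ 1ℤ → Hull T xt (y₀ + + suc p) 1ℤ → Hull T xr (y₀ + + jr) 1ℤ → Hull T xl (y₀ + + jl) 1ℤ →
    + suc p * (xr - xl) - (+ jr - + jl) * (xt - xb) ≤ twice-area s
  cross-area {p = p} s {xb} {xt} {xr} {xl} jr jl jr≤ jl≤ hb ht hr hl = ≤-by
    (area-tent right jr (suc p ℕ.∸ jr) (ℕ.m+[n∸m]≡n jr≤) hb ht hr ⊕ area-tent left jl (suc p ℕ.∸ jl) (ℕ.m+[n∸m]≡n jl≤) (hull-flip hb) (hull-flip ht) (hull-flip hl))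
    (trans (cong₂ (λ a b → boundary-area right + boundary-area left + (+ suc p * xr + + jr * xb + a * xt + (+ suc p * - xl + + jl * - xb + b * - xt))) (+-∸ jr≤) (+-∸ jl≤))
      (lem (+ suc p) (boundary-area right) (boundary-area left) (+ jr) (+ jl) xr xl xb xt))
    where
    open Sides s
    lem : ∀ P A A′ jr jl xr xl xb xt → A + A′ + (P * xr + jr * xb + (P - jr) * xt + (P * - xl + jl * - xb + (P - jl) * - xt)) ≡
      P * (xr - xl) - (jr - jl) * (xt - xb) + (A + A′)
    lem = solve-∀

  shear : ℤ → Unimodular
  shear σ = record { mat = matrix 1ℤ σ 0ℤ 1ℤ ; inv = matrix 1ℤ (- σ) 0ℤ 1ℤ
    ; inv-mat = λ (x , y) → cong₂ _,_ (lem₁ σ x y) (lem₂ σ x y) ; mat-inv = λ (x , y) → cong₂ _,_ (lem₃ σ x y) (lem₄ σ x y) }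
    where
    lem₁ : ∀ σ x y → 1ℤ * (1ℤ * x + σ * y) + - σ * (0ℤ * x + 1ℤ * y) ≡ x
    lem₁ = solve-∀
    lem₂ : ∀ σ x y → 0ℤ * (1ℤ * x + σ * y) + 1ℤ * (0ℤ * x + 1ℤ * y) ≡ y
    lem₂ = solve-∀
    lem₃ : ∀ σ x y → 1ℤ * (1ℤ * x + - σ * y) + σ * (0ℤ * x + 1ℤ * y) ≡ x
    lem₃ = solve-∀
    lem₄ : ∀ σ x y → 0ℤ * (1ℤ * x + - σ * y) + 1ℤ * (0ℤ * x + 1ℤ * y) ≡ y
    lem₄ = solve-∀

  shear≡ : ∀ σ x y → act (Unimodular.mat (shear σ)) (x , y) ≡ (x + σ * y , y)
  shear≡ σ x y = cong₂ _,_ (lem₁ σ x y) (lem₂ x y)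
    where
    lem₁ : ∀ σ x y → 1ℤ * x + σ * y ≡ x + σ * y
    lem₁ = solve-∀
    lem₂ : ∀ x y → 0ℤ * x + 1ℤ * y ≡ y
    lem₂ = solve-∀

  swap : Unimodular
  swap = record { mat = matrix 0ℤ 1ℤ 1ℤ 0ℤ ; inv = matrix 0ℤ 1ℤ 1ℤ 0ℤ ; inv-mat = twice ; mat-inv = twice }
    where
    lem₁ : ∀ x y → 0ℤ * (0ℤ * x + 1ℤ * y) + 1ℤ * (1ℤ * x + 0ℤ * y) ≡ x
    lem₁ = solve-∀
    lem₂ : ∀ x y → 1ℤ * (0ℤ * x + 1ℤ * y) + 0ℤ * (1ℤ * x + 0ℤ * y) ≡ y
    lem₂ = solve-∀
    twice : ∀ z → act (matrix 0ℤ 1ℤ 1ℤ 0ℤ) (act (matrix 0ℤ 1ℤ 1ℤ 0ℤ) z) ≡ z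
    twice (x , y) = cong₂ _,_ (lem₁ x y) (lem₂ x y)

  ∈-unswap : ∀ {n} {T : Vec LatticePoint n} {x y} → (x , y) ∈ map (act (Unimodular.mat swap)) T → (y , x) ∈ T
  ∈-unswap {T = T} m with ∈-map⁻ m
  ... | (a , b) , v∈ , refl = subst₂ (λ s t → (s , t) ∈ T) (lem₁ a b) (lem₂ a b) v∈
    where
    lem₁ : ∀ a b → a ≡ 1ℤ * a + 0ℤ * b
    lem₁ = solve-∀
    lem₂ : ∀ a b → b ≡ 0ℤ * a + 1ℤ * b
    lem₂ = solve-∀

  extent-shear : ∀ {n} {T : Vec LatticePoint n} {y₀ p} σ → Extent T y₀ p → Extent (map (act (Unimodular.mat (shear σ))) T) y₀ p
  extent-shear {T = T} {y₀} {p} σ E = record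
    { low = λ u u∈ → level {λ s → y₀ ≤ s} low u u∈
    ; high = λ u u∈ → level {λ s → s ≤ y₀ + + p} high u u∈
    ; bottom = proj₁ bottom + σ * y₀ , subst (_∈ T′) (shear≡ σ (proj₁ bottom) y₀) (∈-map⁺ (act (Unimodular.mat (shear σ))) (proj₂ bottom))
    ; top = proj₁ top + σ * (y₀ + + p) , subst (_∈ T′) (shear≡ σ (proj₁ top) (y₀ + + p)) (∈-map⁺ (act (Unimodular.mat (shear σ))) (proj₂ top)) }
    where
    open Extent E
    T′ = map (act (Unimodular.mat (shear σ))) T
    level : ∀ {Q : ℤ → Set} → (∀ u → u ∈ T → Q (proj₂ u)) → ∀ u → u ∈ T′ → Q (proj₂ u)
    level {Q} q u u∈ with ∈-map⁻ u∈
    ... | (x , y) , v∈ , refl = subst Q (sym (cong proj₂ (shear≡ σ x y))) (q (x , y) v∈)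

  hull-shear : ∀ {n} {T : Vec LatticePoint n} {X Y K} σ → Hull T X Y K → Hull (map (act (Unimodular.mat (shear σ))) T) (X + σ * Y) Y K
  hull-shear {X = X} {Y} σ h = hull-cast (cong proj₁ (shear≡ σ X Y)) (cong proj₂ (shear≡ σ X Y)) refl (hull-act (Unimodular.mat (shear σ)) h)

module Reduction where

  open Inequalities
  open Hulls
  open Chains
  open ScaledRows
  open Counting
  open EvenDilates
  open Problems
  open AreaBounds
  open import Defs
  open import Data.Nat as ℕ using (ℕ; zero; suc; s≤s)
  import Data.Nat.Properties as ℕ
  open import Data.Integer hiding (suc)
  open import Data.Integer.Properties
  open import Data.Integer.DivMod
  open import Data.Integer.Tactic.RingSolver using (solve-∀)
  open import Data.Product using (_×_; _,_; Σ; proj₁; proj₂)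
  open import Data.Sum using (_⊎_; inj₁; inj₂)
  open import Data.Vec using (Vec; map)
  open import Data.Vec.Membership.Propositional using (_∈_)
  open import Relation.Binary.PropositionalEquality hiding (J)

  Avail : ℤ → ℤ → ℤ → ℤ → ℤ → Set
  Avail A P w J D = P * w - J * D ≤ A

  module Balance (A P W w J : ℤ) (1≤P : 1ℤ ≤ P) (P≤w : P ≤ w) (J≤P : J ≤ P) (-P≤J : - P ≤ J) where

    balanced : ∀ {D} → Avail A P w J D → + 2 * (J * D) ≤ P * (P - W) → P * P + P * W ≤ + 2 * A
    balanced {D} avail small = ≤-by (_⊗_ {+ 2} (+m-nonneg 2) avail ⊕ small ⊕ weaken 1≤P ⊗ P≤w ⊕ weaken 1≤P ⊗ P≤w) (lem A P W w (J * D))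
      where
      lem : ∀ A P W w JD → + 2 * A + (+ 2 * (P * w - JD) + + 2 * JD + P * P + P * P) ≡ P * P + P * W + (+ 2 * A + P * (P - W) + P * w + P * w)
      lem = solve-∀

    pos-D : ∀ {D} → 0ℤ ≤ D → + 2 * D ≤ P - W → Avail A P w J D → P * P + P * W ≤ + 2 * A
    pos-D {D} 0≤D 2D≤ avail = balanced avail (≤-by (weaken 1≤P ⊗ 2D≤ ⊕ 0≤D ⊗ J≤P ⊕ 0≤D ⊗ J≤P) (lem P W J D))
      where
      lem : ∀ P W J D → P * (P - W) + (P * (+ 2 * D) + D * J + D * J) ≡ + 2 * (J * D) + (P * (P - W) + D * P + D * P)
      lem = solve-∀

    neg-D : ∀ {D} → 0ℤ ≤ - D → + 2 * - D ≤ P - W → Avail A P w J D → P * P + P * W ≤ + 2 * A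
    neg-D {D} 0≤-D 2D≤ avail = balanced avail (≤-by (weaken 1≤P ⊗ 2D≤ ⊕ 0≤-D ⊗ -P≤J ⊕ 0≤-D ⊗ -P≤J) (lem P W J D))
      where
      lem : ∀ P W J D → P * (P - W) + (P * (+ 2 * - D) + - D * - P + - D * - P) ≡ + 2 * (J * D) + (P * (P - W) + - D * J + - D * J)
      lem = solve-∀

    opposite : ∀ {D₁ D₂} → 0ℤ ≤ - D₁ → 0ℤ ≤ D₂ → 0ℤ ≤ P - W → Avail A P w J D₁ → Avail A P w J D₂ → P * P + P * W ≤ + 2 * A
    opposite {D₁} {D₂} D₁≤0 0≤D₂ W≤P a₁ a₂ with split-≤ 0ℤ J
    ... | inj₁ 0≤J = balanced a₁ (≤-by (0≤J ⊗ D₁≤0 ⊕ 0≤J ⊗ D₁≤0 ⊕ weaken 1≤P ⊗ W≤P) (lem P W J D₁))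
      where
      lem : ∀ P W J D → P * (P - W) + (J * 0ℤ + J * 0ℤ + P * 0ℤ) ≡ + 2 * (J * D) + (J * - D + J * - D + P * (P - W))
      lem = solve-∀
    ... | inj₂ J<0 = balanced a₂ (≤-by (0≤D₂ ⊗ J<0 ⊕ 0≤D₂ ⊗ J<0 ⊕ weaken 1≤P ⊗ W≤P ⊕ 0≤D₂ ⊕ 0≤D₂) (lem P W J D₂))
      where
      lem : ∀ P W J D → P * (P - W) + (D * (1ℤ + J) + D * (1ℤ + J) + P * 0ℤ + 0ℤ + 0ℤ) ≡ + 2 * (J * D) + (D * 0ℤ + D * 0ℤ + P * (P - W) + D + D)
      lem = solve-∀

  Wide : ℤ → ℕ → ℤ → Set
  Wide A p W = (+ p * W ≤ A) × (+ p * + p + + p * W ≤ + 2 * A)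

  record Reduced (A B : ℤ) (c₁ c₃ : ℕ) : Set where
    constructor reduced
    field
      {n}     : ℕ
      {T}     : Vec LatticePoint n
      {y₀}    : ℤ
      {p}     : ℕ
      problem : Problem T A B c₁ c₃
      ext     : Extent T y₀ (suc p)
      shape   : (suc p ℕ.≤ 3) ⊎ (4 ℕ.≤ suc p × Wide A (suc p) (width (sides ext)))

  module _ {A B : ℤ} {c₁ c₃ : ℕ} where

    reduce : ∀ fuel {n} {T : Vec LatticePoint n} {y₀ p} → Problem T A B c₁ c₃ → Extent T y₀ (suc p) → suc p ℕ.≤ fuel → Reduced A B c₁ c₃
    reduce zero P E ()
    reduce (suc fuel) {n} {T} {y₀} {p} P E (s≤s p≤) with ℕ.≤-total (suc p) 3
    ... | inj₁ small = reduced P E (inj₁ small)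
    ... | inj₂ 3≤p with ℕ.m≤n⇒m<n∨m≡n 3≤p
    ...   | inj₂ eq = reduced P E (inj₁ (ℕ.≤-reflexive (sym eq)))
    ...   | inj₁ 4≤p = answer (split-≤ H W)
      where
      s = sides E
      open Sides s
      H = + suc p
      W = width s
      area : twice-area s ≡ A
      area = sym (area≡ P s)
      flat : H * W ≤ A
      flat = ≤-trans (parallelogram-area s) (≤-reflexive area)
      u = - end L.x₀ L.edges - R.x₀
      q = u /ℕ suc p
      r = + (u %ℕ suc p)
      u≡ : u ≡ r + q * H
      u≡ = a≡a%ℕn+[a/ℕn]*n u (suc p)
      r≤ : 1ℤ + r ≤ H
      r≤ = +≤+ (n%ℕd<d u (suc p))

      -- D₁ and D₂ are the extreme displacements between the bottom and top edges after the shear.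
      sheared : ∀ σ → let D₁ = r + (q + σ) * H in
        (∀ w J → H ≤ w → J ≤ H → - H ≤ J → Avail A H w J D₁ → Avail A H w J (D₁ + W) → H * H + H * W ≤ + 2 * A) → Reduced A B c₁ c₃
      sheared σ conclude = compare (extent (Problem.nondegenerate (problem-act swap P′)))
        where
        P′ = problem-act (shear σ) P
        E′ = extent-shear σ E
        T′ = map (act (Unimodular.mat (shear σ))) T
        s′ = sides E′
        wide : ∀ {xl w} → Extent (map (act (Unimodular.mat swap)) T′) xl (suc w) → suc p ℕ.≤ suc w → Reduced A B c₁ c₃
        wide {xl} {w} E″ p≤w = reduced P E (inj₂ (4≤p , flat ,
          conclude (+ suc w) (+ jr - + jl) (+≤+ p≤w) (≤-by (+≤+ (j≤ r∈) ⊕ +m-nonneg jl) (lem₁ (+ jr) (+ jl) H)) (≤-by (+≤+ (j≤ l∈) ⊕ +m-nonneg jr) (lem₂ (+ jr) (+ jl) H))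
            (avail (hull-shear σ (bottom-hull right)) (hull-shear σ (hull-unflip (top-hull left))) (trans (lem₃ R.x₀ (end L.x₀ L.edges) σ y₀ H) (trans (cong (_+ σ * H) u≡) (lem₅ r q σ H))))
            (avail (hull-shear σ (hull-unflip (bottom-hull left))) (hull-shear σ (top-hull right)) (trans (lem₄ R.x₀ (end R.x₀ R.edges) L.x₀ (end L.x₀ L.edges) σ y₀ H) (trans (cong (λ u → u + σ * H + W) u≡) (cong (_+ W) (lem₅ r q σ H)))))))
          where
          l∈ = ∈-unswap (proj₂ (Extent.bottom E″))
          r∈ = ∈-unswap (proj₂ (Extent.top E″))
          jl = ∣ proj₁ (Extent.bottom E″) - y₀ ∣
          jr = ∣ proj₁ (Extent.top E″) - y₀ ∣
          j≡ : ∀ {x y} → (x , y) ∈ T′ → + ∣ y - y₀ ∣ ≡ y - y₀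
          j≡ v∈ = 0≤i⇒+∣i∣≡i (difference (Extent.low E′ _ v∈))
          j≤ : ∀ {x y} → (x , y) ∈ T′ → ∣ y - y₀ ∣ ℕ.≤ suc p
          j≤ {x} {y} v∈ = drop‿+≤+ (≤-trans (≤-reflexive (j≡ v∈)) (≤-by (Extent.high E′ _ v∈) (lem y y₀ H)))
            where
            lem : ∀ y y₀ H → H + y ≡ y - y₀ + (y₀ + H)
            lem = solve-∀
          at-row : ∀ {x y} → (x , y) ∈ T′ → Hull T′ x (y₀ + + ∣ y - y₀ ∣) 1ℤ
          at-row {x} {y} v∈ = hull-cast refl (trans (lem y y₀) (cong (λ s → y₀ + s) (sym (j≡ v∈)))) refl (hull-vertex v∈)
            where
            lem : ∀ y y₀ → y ≡ y₀ + (y - y₀)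
            lem = solve-∀
          avail : ∀ {xb xt D} → Hull T′ xb y₀ 1ℤ → Hull T′ xt (y₀ + H) 1ℤ → xt - xb ≡ D → Avail A H (+ suc w) (+ jr - + jl) D
          avail {xb} {xt} hb ht refl = ≤-trans (≤-reflexive (lem H xl (+ suc w) ((+ jr - + jl) * (xt - xb))))
            (≤-trans (cross-area s′ jr jl (j≤ r∈) (j≤ l∈) hb ht (at-row r∈) (at-row l∈)) (≤-reflexive (sym (area≡ P′ s′))))
            where
            lem : ∀ H xl w X → H * w - X ≡ H * (xl + w - xl) - X
            lem = solve-∀
          lem₁ : ∀ a b H → H + (a + 0ℤ) ≡ a - b + (H + b)
          lem₁ = solve-∀
          lem₂ : ∀ a b H → a - b + (b + 0ℤ) ≡ - H + (H + a)
          lem₂ = solve-∀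
          lem₃ : ∀ x e′ σ y H → - e′ + σ * (y + H) - (x + σ * y) ≡ - e′ - x + σ * H
          lem₃ = solve-∀
          lem₄ : ∀ x e x′ e′ σ y H → e + σ * (y + H) - (- x′ + σ * y) ≡ - e′ - x + σ * H + (x + x′ + (e + e′))
          lem₄ = solve-∀
          lem₅ : ∀ r q σ H → r + q * H + σ * H ≡ r + (q + σ) * H
          lem₅ = solve-∀
        compare : (Σ ℤ λ x₀ → Σ ℕ λ w → Extent (map (act (Unimodular.mat swap)) T′) x₀ (suc w)) → Reduced A B c₁ c₃
        compare (xl , w , E″) with ℕ.≤-total (suc p) (suc w)
        ... | inj₁ p≤w = wide E″ p≤w
        ... | inj₂ w≤p with ℕ.m≤n⇒m<n∨m≡n w≤p
        ...   | inj₁ (s≤s w<p) = reduce fuel (problem-act swap P′) E″ (ℕ.≤-trans w<p p≤)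
        ...   | inj₂ eq = wide E″ (ℕ.≤-reflexive (sym eq))

      0≤1 : 0ℤ ≤ 1ℤ
      0≤1 = +m-nonneg 1
      1≤H : 1ℤ ≤ H
      1≤H = 1≤+suc p
      answer : (H ≤ W) ⊎ (1ℤ + W ≤ H) → Reduced A B c₁ c₃
      answer (inj₁ H≤W) = reduced P E (inj₂ (4≤p , flat , ≤-by (_⊗_ {+ 2} (+m-nonneg 2) flat ⊕ weaken 1≤H ⊗ H≤W) (lem A H W)))
        where
        lem : ∀ A H W → + 2 * A + (+ 2 * (H * W) + H * H) ≡ H * H + H * W + (+ 2 * A + H * W)
        lem = solve-∀
      answer (inj₂ W<H) with split-≤ (+ 2 * r) (H - W)
      ... | inj₁ left-near = sheared (- q) λ w J H≤w J≤H -H≤J a₁ _ →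
        Balance.pos-D A H W w J 1≤H H≤w J≤H -H≤J (+m-nonneg (u %ℕ suc p)) left-near (subst (Avail A H w J) (lem r q H) a₁)
        where
        lem : ∀ r q H → r + (q + - q) * H ≡ r
        lem = solve-∀
      ... | inj₂ right-near = sheared (- q - 1ℤ) λ w J H≤w J≤H -H≤J a₁ a₂ →
        finish w J H≤w J≤H -H≤J (subst (Avail A H w J) (lem r q H) a₁) (subst (Avail A H w J) (cong (_+ W) (lem r q H)) a₂)
        where
        lem : ∀ r q H → r + (q + (- q - 1ℤ)) * H ≡ r - H
        lem = solve-∀
        finish : ∀ w J → H ≤ w → J ≤ H → - H ≤ J → Avail A H w J (r - H) → Avail A H w J (r - H + W) → H * H + H * W ≤ + 2 * A
        finish w J H≤w J≤H -H≤J a₁ a₂ with split-≤ 0ℤ (r - H + W)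
        ... | inj₁ 0≤D₂ = Balance.opposite A H W w J 1≤H H≤w J≤H -H≤J (≤-by (r≤ ⊕ 0≤1) (lem₁ r H)) 0≤D₂ (≤-by (W<H ⊕ 0≤1) (lem₂ H W)) a₁ a₂
          where
          lem₁ : ∀ r H → - (r - H) + (1ℤ + r + 0ℤ) ≡ 0ℤ + (H + 1ℤ)
          lem₁ = solve-∀
          lem₂ : ∀ H W → H - W + (1ℤ + W + 0ℤ) ≡ 0ℤ + (H + 1ℤ)
          lem₂ = solve-∀
        ... | inj₂ D₂<0 = Balance.neg-D A H W w J 1≤H H≤w J≤H -H≤J (≤-by (D₂<0 ⊕ 0≤1) (lem₁ (r - H + W))) (≤-by (right-near ⊕ 0≤1) (lem₂ r H W)) a₂
          where
          lem₁ : ∀ D → - D + (1ℤ + D + 0ℤ) ≡ 0ℤ + (0ℤ + 1ℤ)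
          lem₁ = solve-∀
          lem₂ : ∀ r H W → H - W + (1ℤ + (H - W) + 0ℤ) ≡ + 2 * - (r - H + W) + (+ 2 * r + 1ℤ)
          lem₂ = solve-∀

module HeightThree where

  open Inequalities
  open Chains
  open ScaledRows
  open EvenDilates
  open import Data.Nat as ℕ using (ℕ; suc)
  import Data.Nat.Properties as ℕ
  open import Data.Fin using (Fin; toℕ; fromℕ<)
  open import Data.Fin.Properties using (all?; toℕ-fromℕ<)
  open import Data.Integer hiding (suc)
  open import Data.Integer.Properties
  open import Data.Integer.DivMod
  open import Data.Integer.Tactic.RingSolver using (solve-∀)
  open import Data.Bool using (true; false; if_then_else_)
  open import Data.Product using (_×_; _,_)
  open import Data.List using (List; []; _∷_)
  open import Data.Unit using (tt)
  open import Relation.Nullary using (Dec)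
  open import Relation.Nullary.Decidable using (toWitness; _×-dec_)
  open import Relation.Binary.PropositionalEquality

  shift : List Edge → List ℤ → List Edge
  shift ((n , d) ∷ es) (e ∷ us) = (n , d + + 2 * + suc n * e) ∷ shift es us
  shift es _ = es

  lift : (k : ℕ) → ℤ → List Edge → List ℤ → ℕ → ℤ
  lift k a ((n , d) ∷ es) (e ∷ us) t = if t ℕ.<ᵇ k ℕ.* suc n then + k * a + e * + t else lift k (a + + suc n * e) es us (t ℕ.∸ k ℕ.* suc n)
  lift k a ((n , d) ∷ es) [] t = if t ℕ.<ᵇ k ℕ.* suc n then + k * a else lift k a es [] (t ℕ.∸ k ℕ.* suc n)
  lift k a [] _ t = + k * a

  -- Halving commutes with adding the even profile (2a, us).
  floor-shift : ∀ k x a es us t → floor k 1 (x + + 2 * a) (shift es us) t ≡ floor k 1 x es t + lift k a es us t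
  floor-shift k x a [] us t = trans (cong (_/ℕ 2) (lem (+ k) x a)) (/-shift (+ k * x) (+ k * a) 1)
    where
    lem : ∀ k x a → k * (x + + 2 * a) ≡ k * x + k * a * + 2
    lem = solve-∀
  floor-shift k x a ((n , d) ∷ es) [] t with t ℕ.<ᵇ k ℕ.* suc n
  ... | true = trans (cong (_/ℕ (2 ℕ.* suc n)) (trans (lem (+ k) x a (+ suc n) (d * + t)) (cong (λ s → + k * x * + suc n + d * + t + + k * a * s) (sym (pos-* 2 (suc n))))))
      (/-shift (+ k * x * + suc n + d * + t) (+ k * a) (n ℕ.+ 1 ℕ.* suc n))
    where
    lem : ∀ k x a N s → k * (x + + 2 * a) * N + s ≡ k * x * N + s + k * a * (+ 2 * N)
    lem = solve-∀
  ... | false = trans (cong (λ y → floor k 1 y es (t ℕ.∸ k ℕ.* suc n)) (lem x a d)) (trans (cong (λ fs → floor k 1 (x + d + + 2 * a) fs (t ℕ.∸ k ℕ.* suc n)) (sym (none es))) (floor-shift k (x + d) a es [] (t ℕ.∸ k ℕ.* suc n)))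
    where
    lem : ∀ x a d → x + + 2 * a + d ≡ x + d + + 2 * a
    lem = solve-∀
    none : ∀ es → shift es [] ≡ es
    none [] = refl
    none (e ∷ es) = refl
  floor-shift k x a ((n , d) ∷ es) (e ∷ us) t with t ℕ.<ᵇ k ℕ.* suc n
  ... | true = trans (cong (_/ℕ (2 ℕ.* suc n)) (trans (lem (+ k) x a (+ suc n) d e (+ t)) (cong (λ s → + k * x * + suc n + d * + t + (+ k * a + e * + t) * s) (sym (pos-* 2 (suc n))))))
      (/-shift (+ k * x * + suc n + d * + t) (+ k * a + e * + t) (n ℕ.+ 1 ℕ.* suc n))
    where
    lem : ∀ k x a N d e t → k * (x + + 2 * a) * N + (d + + 2 * N * e) * t ≡ k * x * N + d * t + (k * a + e * t) * (+ 2 * N)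
    lem = solve-∀
  ... | false = trans (cong (λ y → floor k 1 y (shift es us) (t ℕ.∸ k ℕ.* suc n)) (lem x a d (+ suc n) e)) (floor-shift k (x + d) (a + + suc n * e) es us (t ℕ.∸ k ℕ.* suc n))
    where
    lem : ∀ x a d N e → x + + 2 * a + (d + + 2 * N * e) ≡ x + d + + 2 * (a + N * e)
    lem = solve-∀

  irregular-shift : ∀ n d e → irregular (n , d + + 2 * + suc n * e) ≡ irregular (n , d)
  irregular-shift n d e = trans (cong (λ s → N * (d + + 2 * N * e) - (d + + 2 * N * e) - + 2 * s) (trans (Σ<-cong (suc n) pointwise) (Σ<-+ (suc n) (slope-floor (n , d)) (λ t → 0ℤ + + 2 * e * + t))))
    (trans (lem N d e S (Σ< (suc n) (λ t → 0ℤ + + 2 * e * + t))) (trans (cong (λ s → N * (d + + 2 * N * e) - (d + + 2 * N * e) - + 2 * S - s) (Σ<-affine (suc n) 0ℤ (+ 2 * e))) (lem′ N d e S)))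
    where
    N = + suc n
    S = Σ< (suc n) (slope-floor (n , d))
    pointwise : ∀ t → t ℕ.< suc n → slope-floor (n , d + + 2 * N * e) t ≡ slope-floor (n , d) t + (0ℤ + + 2 * e * + t)
    pointwise t _ = trans (cong (_/ℕ suc n) (lem₁ d N e (+ t))) (/-shift (d * + t) (0ℤ + + 2 * e * + t) n)
      where
      lem₁ : ∀ d N e t → (d + + 2 * N * e) * t ≡ d * t + (0ℤ + + 2 * e * t) * N
      lem₁ = solve-∀
    lem : ∀ N d e S A → N * (d + + 2 * N * e) - (d + + 2 * N * e) - + 2 * (S + A) ≡ N * (d + + 2 * N * e) - (d + + 2 * N * e) - + 2 * S - + 2 * A
    lem = solve-∀
    lem′ : ∀ N d e S → N * (d + + 2 * N * e) - (d + + 2 * N * e) - + 2 * S - N * (+ 2 * 0ℤ + + 2 * e * (N - 1ℤ)) ≡ N * d - d - + 2 * S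
    lem′ = solve-∀

  irregulars-shift : ∀ es us → irregulars (shift es us) ≡ irregulars es
  irregulars-shift [] us = refl
  irregulars-shift (e ∷ es) [] = refl
  irregulars-shift ((n , d) ∷ es) (e ∷ us) = cong₂ _+_ (irregular-shift n d e) (irregulars-shift es us)

  -- Lattice points of P and of 3P counted on one side of a polygon of height 3 starting on an even row.
  half₁ half₃ : ℤ → List Edge → ℤ
  half₁ x es = floor 1 1 x es 0 + floor 1 1 x es 2
  half₃ x es = floor 3 1 x es 0 + floor 3 1 x es 2 + floor 3 1 x es 4 + floor 3 1 x es 6 + floor 3 1 x es 8

  lift₁ lift₃ : ℤ → List Edge → List ℤ → ℤ
  lift₁ a es us = lift 1 a es us 0 + lift 1 a es us 2
  lift₃ a es us = lift 3 a es us 0 + lift 3 a es us 2 + lift 3 a es us 4 + lift 3 a es us 6 + lift 3 a es us 8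

  half₁-shift : ∀ x a es us → half₁ (x + + 2 * a) (shift es us) ≡ half₁ x es + lift₁ a es us
  half₁-shift x a es us = trans (cong₂ _+_ (floor-shift 1 x a es us 0) (floor-shift 1 x a es us 2))
    (lem (floor 1 1 x es 0) (lift 1 a es us 0) (floor 1 1 x es 2) (lift 1 a es us 2))
    where
    lem : ∀ a b c d → a + b + (c + d) ≡ a + c + (b + d)
    lem = solve-∀

  half₃-shift : ∀ x a es us → half₃ (x + + 2 * a) (shift es us) ≡ half₃ x es + lift₃ a es us
  half₃-shift x a es us = trans (cong₂ _+_ (cong₂ _+_ (cong₂ _+_ (cong₂ _+_ (floor-shift 3 x a es us 0) (floor-shift 3 x a es us 2)) (floor-shift 3 x a es us 4)) (floor-shift 3 x a es us 6)) (floor-shift 3 x a es us 8))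
    (lem (floor 3 1 x es 0) (floor 3 1 x es 2) (floor 3 1 x es 4) (floor 3 1 x es 6) (floor 3 1 x es 8)
      (lift 3 a es us 0) (lift 3 a es us 2) (lift 3 a es us 4) (lift 3 a es us 6) (lift 3 a es us 8))
    where
    lem : ∀ a b c d e a′ b′ c′ d′ e′ → a + a′ + (b + b′) + (c + c′) + (d + d′) + (e + e′) ≡ a + b + c + d + e + (a′ + b′ + c′ + d′ + e′)
    lem = solve-∀

  linearI linearZ : ℤ → ℤ → ℤ → ℤ → ℤ → ℤ
  linearI A L₁ L₃ x e = + 4 * L₃ - + 10 * L₁ - + 3 * A - (x + e)
  linearZ A L₁ L₃ x e = + 11 * A + x - e + + 24 * L₁ - + 12 * L₃

  I-slack Z-slack : ℤ → List Edge → ℤ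
  I-slack x es = linearI (area₂ x es) (half₁ x es) (half₃ x es) x (end x es) + irregulars es
  Z-slack x es = linearZ (area₂ x es) (half₁ x es) (half₃ x es) x (end x es) - irregulars es

  Slack : ℤ → List Edge → Set
  Slack x es = 0ℤ ≤ I-slack x es × 0ℤ ≤ Z-slack x es

  slack-shift : ∀ x a es us {i z} → 0ℤ ≤ i → 0ℤ ≤ z →
    linearI (area₂ (x + + 2 * a) (shift es us) - area₂ x es) (lift₁ a es us) (lift₃ a es us) (+ 2 * a) (end (x + + 2 * a) (shift es us) - end x es) ≡ i →
    linearZ (area₂ (x + + 2 * a) (shift es us) - area₂ x es) (lift₁ a es us) (lift₃ a es us) (+ 2 * a) (end (x + + 2 * a) (shift es us) - end x es) ≡ z →
    Slack x es → Slack (x + + 2 * a) (shift es us)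
  slack-shift x a es us {i} {z} 0≤i 0≤z i≡ z≡ (I , Z) = ≤-trans (I ⊕ 0≤i) (≤-reflexive (sym I′)) , ≤-trans (Z ⊕ 0≤z) (≤-reflexive (sym Z′))
    where
    A = area₂ x es
    A′ = area₂ (x + + 2 * a) (shift es us)
    L₁ = half₁ x es
    L₃ = half₃ x es
    l₁ = lift₁ a es us
    l₃ = lift₃ a es us
    e = end x es
    e′ = end (x + + 2 * a) (shift es us)
    I′ : I-slack (x + + 2 * a) (shift es us) ≡ I-slack x es + i
    I′ = trans (cong₂ _+_ (cong₂ (λ h₁ h₃ → linearI A′ h₁ h₃ (x + + 2 * a) e′) (half₁-shift x a es us) (half₃-shift x a es us)) (irregulars-shift es us))
      (trans (lem A A′ L₁ l₁ L₃ l₃ x a e e′ (irregulars es)) (cong (λ s → I-slack x es + s) i≡))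
      where
      lem : ∀ A A′ L₁ l₁ L₃ l₃ x a e e′ I → + 4 * (L₃ + l₃) - + 10 * (L₁ + l₁) - + 3 * A′ - (x + + 2 * a + e′) + I ≡
        + 4 * L₃ - + 10 * L₁ - + 3 * A - (x + e) + I + (+ 4 * l₃ - + 10 * l₁ - + 3 * (A′ - A) - (+ 2 * a + (e′ - e)))
      lem = solve-∀
    Z′ : Z-slack (x + + 2 * a) (shift es us) ≡ Z-slack x es + z
    Z′ = trans (cong₂ _-_ (cong₂ (λ h₁ h₃ → linearZ A′ h₁ h₃ (x + + 2 * a) e′) (half₁-shift x a es us) (half₃-shift x a es us)) (irregulars-shift es us))
      (trans (lem A A′ L₁ l₁ L₃ l₃ x a e e′ (irregulars es)) (cong (λ s → Z-slack x es + s) z≡))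
      where
      lem : ∀ A A′ L₁ l₁ L₃ l₃ x a e e′ I → + 11 * A′ + (x + + 2 * a) - e′ + + 24 * (L₁ + l₁) - + 12 * (L₃ + l₃) - I ≡
        + 11 * A + x - e + + 24 * L₁ - + 12 * L₃ - I + (+ 11 * (A′ - A) + + 2 * a - (e′ - e) + + 24 * l₁ - + 12 * l₃)
      lem = solve-∀

  slack? : ∀ x es → Dec (Slack x es)
  slack? x es = (_ ≤? _) ×-dec (_ ≤? _)

  remainder : ∀ z n .{{_ : ℕ.NonZero n}} → Fin n
  remainder z n = fromℕ< (n%ℕd<d z n)

  divide : ∀ z n .{{_ : ℕ.NonZero n}} → z ≡ + toℕ (remainder z n) + + n * (z /ℕ n)
  divide z n = trans (a≡a%ℕn+[a/ℕn]*n z n) (cong₂ _+_ (cong +_ (sym (toℕ-fromℕ< (n%ℕd<d z n)))) (*-comm (z /ℕ n) (+ n)))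

  0≤/ : ∀ {z} n .{{_ : ℕ.NonZero n}} → 0ℤ ≤ z → 0ℤ ≤ z /ℕ n
  0≤/ {z} n = 0≤n⇒0≤n/ℕd z n

  -- The four shapes of a side of height 3; by slack-shift each reduces to finitely many residues.
  slack-3 : ∀ x d → Slack x ((2 , d) ∷ [])
  slack-3 x d = subst₂ (λ x d → Slack x ((2 , d) ∷ [])) (sym (divide x 2)) (sym (divide d 6))
    (slack-shift (+ toℕ (remainder x 2)) (x /ℕ 2) ((2 , + toℕ (remainder d 6)) ∷ []) (d /ℕ 6 ∷ []) ≤-refl ≤-refl
      (lemI (+ toℕ (remainder x 2)) (x /ℕ 2) (+ toℕ (remainder d 6)) (d /ℕ 6)) (lemZ (+ toℕ (remainder x 2)) (x /ℕ 2) (+ toℕ (remainder d 6)) (d /ℕ 6))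
      (base (remainder x 2) (remainder d 6)))
    where
    base : ∀ (i : Fin 2) (j : Fin 6) → Slack (+ toℕ i) ((2 , + toℕ j) ∷ [])
    base = toWitness {a? = all? λ i → all? λ j → slack? (+ toℕ i) ((2 , + toℕ j) ∷ [])} tt
    lemI : ∀ x a d e → + 4 * ((+ 3 * a + e * + 0) + (+ 3 * a + e * + 2) + (+ 3 * a + e * + 4) + (+ 3 * a + e * + 6) + (+ 3 * a + e * + 8)) - + 10 * ((+ 1 * a + e * + 0) + (+ 1 * a + e * + 2)) - + 3 * ((+ 3 * (+ 2 * (x + + 2 * a) + (d + + 2 * + 3 * e)) + 0ℤ) - (+ 3 * (+ 2 * x + d) + 0ℤ)) - (+ 2 * a + (((x + + 2 * a) + (d + + 2 * + 3 * e)) - (x + d))) ≡ 0ℤ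
    lemI = solve-∀
    lemZ : ∀ x a d e → + 11 * ((+ 3 * (+ 2 * (x + + 2 * a) + (d + + 2 * + 3 * e)) + 0ℤ) - (+ 3 * (+ 2 * x + d) + 0ℤ)) + + 2 * a - (((x + + 2 * a) + (d + + 2 * + 3 * e)) - (x + d)) + + 24 * ((+ 1 * a + e * + 0) + (+ 1 * a + e * + 2)) - + 12 * ((+ 3 * a + e * + 0) + (+ 3 * a + e * + 2) + (+ 3 * a + e * + 4) + (+ 3 * a + e * + 6) + (+ 3 * a + e * + 8)) ≡ 0ℤ
    lemZ = solve-∀

  slack-12 : ∀ x d₁ d₂ → d₂ ≤ + 2 * d₁ → Slack x ((0 , d₁) ∷ (1 , d₂) ∷ [])
  slack-12 x d₁ d₂ concave = subst₂ (λ x es → Slack x es) (sym (divide x 2)) (cong₂ (λ d₁ d₂ → (0 , d₁) ∷ (1 , d₂) ∷ []) (sym (divide d₁ 2)) d₂≡)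
    (slack-shift (+ toℕ i) (x /ℕ 2) ((0 , r) ∷ (1 , + 2 * r - c) ∷ []) (q ∷ (q - g) ∷ []) (_⊗_ {+ 2} (+m-nonneg 2) (0≤/ 4 (difference concave))) ≤-refl
      (lemI (+ toℕ i) (x /ℕ 2) r c q g) (lemZ (+ toℕ i) (x /ℕ 2) r c q g) (base i j k))
    where
    i = remainder x 2
    j = remainder d₁ 2
    k = remainder (+ 2 * d₁ - d₂) 4
    r = + toℕ j
    c = + toℕ k
    q = d₁ /ℕ 2
    g = (+ 2 * d₁ - d₂) /ℕ 4
    d₂≡ : + 2 * r - c + + 2 * + 2 * (q - g) ≡ d₂
    d₂≡ = trans (lem r c q g) (trans (cong₂ (λ a b → + 2 * a - b) (sym (divide d₁ 2)) (sym (divide (+ 2 * d₁ - d₂) 4))) (lem′ d₁ d₂))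
      where
      lem : ∀ r c q g → + 2 * r - c + + 2 * + 2 * (q - g) ≡ + 2 * (r + + 2 * q) - (c + + 4 * g)
      lem = solve-∀
      lem′ : ∀ d₁ d₂ → + 2 * d₁ - (+ 2 * d₁ - d₂) ≡ d₂
      lem′ = solve-∀
    base : ∀ (i : Fin 2) (j : Fin 2) (k : Fin 4) → Slack (+ toℕ i) ((0 , + toℕ j) ∷ (1 , + 2 * + toℕ j - + toℕ k) ∷ [])
    base = toWitness {a? = all? λ i → all? λ j → all? λ k → slack? (+ toℕ i) ((0 , + toℕ j) ∷ (1 , + 2 * + toℕ j - + toℕ k) ∷ [])} tt
    lemI : ∀ x a r c q g → + 4 * ((+ 3 * a + q * + 0) + (+ 3 * a + q * + 2) + (+ 3 * (a + + 1 * q) + (q - g) * + 1) + (+ 3 * (a + + 1 * q) + (q - g) * + 3) + (+ 3 * (a + + 1 * q) + (q - g) * + 5)) - + 10 * ((+ 1 * a + q * + 0) + (+ 1 * (a + + 1 * q) + (q - g) * + 1)) - + 3 * ((+ 1 * (+ 2 * (x + + 2 * a) + (r + + 2 * + 1 * q)) + (+ 2 * (+ 2 * ((x + + 2 * a) + (r + + 2 * + 1 * q)) + ((+ 2 * r - c) + + 2 * + 2 * (q - g))) + 0ℤ)) - (+ 1 * (+ 2 * x + r) + (+ 2 * (+ 2 * (x + r) + (+ 2 * r - c)) + 0ℤ))) - (+ 2 * a + ((((x + + 2 * a) + (r + + 2 * + 1 * q)) + ((+ 2 * r - c) + + 2 * + 2 * (q - g))) - ((x + r) + (+ 2 * r -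 c)))) ≡ + 2 * g
    lemI = solve-∀
    lemZ : ∀ x a r c q g → + 11 * ((+ 1 * (+ 2 * (x + + 2 * a) + (r + + 2 * + 1 * q)) + (+ 2 * (+ 2 * ((x + + 2 * a) + (r + + 2 * + 1 * q)) + ((+ 2 * r - c) + + 2 * + 2 * (q - g))) + 0ℤ)) - (+ 1 * (+ 2 * x + r) + (+ 2 * (+ 2 * (x + r) + (+ 2 * r - c)) + 0ℤ))) + + 2 * a - ((((x + + 2 * a) + (r + + 2 * + 1 * q)) + ((+ 2 * r - c) + + 2 * + 2 * (q - g))) - ((x + r) + (+ 2 * r - c))) + + 24 * ((+ 1 * a + q * + 0) + (+ 1 * (a + + 1 * q) + (q - g) * + 1)) - + 12 * ((+ 3 * a + q * + 0) + (+ 3 * a + q * + 2) + (+ 3 * (a + + 1 * q) + (q - g) * + 1) + (+ 3 * (a + + 1 * q) + (q - g) * + 3) + (+ 3 * (a + + 1 * q) + (q - g) * + 5)) ≡ 0ℤ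
    lemZ = solve-∀

  slack-21 : ∀ x d₁ d₂ → + 2 * d₂ ≤ d₁ → Slack x ((1 , d₁) ∷ (0 , d₂) ∷ [])
  slack-21 x d₁ d₂ concave = subst₂ (λ x es → Slack x es) (sym (divide x 2)) (cong₂ (λ d₁ d₂ → (1 , d₁) ∷ (0 , d₂) ∷ []) d₁≡ (sym (divide d₂ 2)))
    (slack-shift (+ toℕ i) (x /ℕ 2) ((1 , c + + 2 * r) ∷ (0 , r) ∷ []) ((g + q) ∷ q ∷ []) ≤-refl (_⊗_ {+ 4} (+m-nonneg 4) (0≤/ 4 (difference concave)))
      (lemI (+ toℕ i) (x /ℕ 2) r c q g) (lemZ (+ toℕ i) (x /ℕ 2) r c q g) (base i j k))
    where
    i = remainder x 2
    j = remainder d₂ 2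
    k = remainder (d₁ - + 2 * d₂) 4
    r = + toℕ j
    c = + toℕ k
    q = d₂ /ℕ 2
    g = (d₁ - + 2 * d₂) /ℕ 4
    d₁≡ : c + + 2 * r + + 2 * + 2 * (g + q) ≡ d₁
    d₁≡ = trans (lem r c q g) (trans (cong₂ (λ a b → b + + 2 * a) (sym (divide d₂ 2)) (sym (divide (d₁ - + 2 * d₂) 4))) (lem′ d₁ d₂))
      where
      lem : ∀ r c q g → c + + 2 * r + + 2 * + 2 * (g + q) ≡ c + + 4 * g + + 2 * (r + + 2 * q)
      lem = solve-∀
      lem′ : ∀ d₁ d₂ → d₁ - + 2 * d₂ + + 2 * d₂ ≡ d₁
      lem′ = solve-∀
    base : ∀ (i : Fin 2) (j : Fin 2) (k : Fin 4) → Slack (+ toℕ i) ((1 , + toℕ k + + 2 * + toℕ j) ∷ (0 , + toℕ j) ∷ [])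
    base = toWitness {a? = all? λ i → all? λ j → all? λ k → slack? (+ toℕ i) ((1 , + toℕ k + + 2 * + toℕ j) ∷ (0 , + toℕ j) ∷ [])} tt
    lemI : ∀ x a r c q g → + 4 * ((+ 3 * a + (g + q) * + 0) + (+ 3 * a + (g + q) * + 2) + (+ 3 * a + (g + q) * + 4) + (+ 3 * (a + + 2 * (g + q)) + q * + 0) + (+ 3 * (a + + 2 * (g + q)) + q * + 2)) - + 10 * ((+ 1 * a + (g + q) * + 0) + (+ 1 * (a + + 2 * (g + q)) + q * + 0)) - + 3 * ((+ 2 * (+ 2 * (x + + 2 * a) + ((c + + 2 * r) + + 2 * + 2 * (g + q))) + (+ 1 * (+ 2 * ((x + + 2 * a) + ((c + + 2 * r) + + 2 * + 2 * (g + q))) + (r + + 2 * + 1 * q)) + 0ℤ)) - (+ 2 * (+ 2 * x + (c + + 2 * r)) + (+ 1 * (+ 2 * (x + (c + + 2 * r)) + r) + 0ℤ))) - (+ 2 * a + ((((x + + 2 * a) + ((c + + 2 * r) + + 2 * + 2 * (g + q))) + (r + + 2 * + 1 * q)) - ((x + (c + + 2 * r)) + r))) ≡ 0ℤ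
    lemI = solve-∀
    lemZ : ∀ x a r c q g → + 11 * ((+ 2 * (+ 2 * (x + + 2 * a) + ((c + + 2 * r) + + 2 * + 2 * (g + q))) + (+ 1 * (+ 2 * ((x + + 2 * a) + ((c + + 2 * r) + + 2 * + 2 * (g + q))) + (r + + 2 * + 1 * q)) + 0ℤ)) - (+ 2 * (+ 2 * x + (c + + 2 * r)) + (+ 1 * (+ 2 * (x + (c + + 2 * r)) + r) + 0ℤ))) + + 2 * a - ((((x + + 2 * a) + ((c + + 2 * r) + + 2 * + 2 * (g + q))) + (r + + 2 * + 1 * q)) - ((x + (c + + 2 * r)) + r)) + + 24 * ((+ 1 * a + (g + q) * + 0) + (+ 1 * (a + + 2 * (g + q)) + q * + 0)) - + 12 * ((+ 3 * a + (g + q) * + 0) + (+ 3 * a + (g + q) * + 2) + (+ 3 * a + (g + q) * + 4) + (+ 3 * (a + + 2 * (g + q)) + q * + 0) + (+ 3 * (a + + 2 * (g + q)) + q * + 2)) ≡ + 4 * g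
    lemZ = solve-∀

  slack-111 : ∀ x d₁ d₂ d₃ → d₂ ≤ d₁ → d₃ ≤ d₂ → Slack x ((0 , d₁) ∷ (0 , d₂) ∷ (0 , d₃) ∷ [])
  slack-111 x d₁ d₂ d₃ concave₁ concave₂ = subst₂ (λ x es → Slack x es) (sym (divide x 2)) (cong₂ (λ d₁ ds → (0 , d₁) ∷ ds) d₁≡ (cong₂ (λ d₂ d₃ → (0 , d₂) ∷ (0 , d₃) ∷ []) d₂≡ (sym (divide d₃ 2))))
    (slack-shift (+ toℕ i) (x /ℕ 2) ((0 , r + c + b) ∷ (0 , r + c) ∷ (0 , r) ∷ []) ((q + g + f) ∷ (q + g) ∷ q ∷ [])
      (_⊗_ {+ 2} (+m-nonneg 2) (0≤/ 2 (difference concave₁))) (_⊗_ {+ 4} (+m-nonneg 4) (0≤/ 2 (difference concave₂)))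
      (lemI (+ toℕ i) (x /ℕ 2) r c b q g f) (lemZ (+ toℕ i) (x /ℕ 2) r c b q g f) (base i j k l))
    where
    i = remainder x 2
    j = remainder d₃ 2
    k = remainder (d₂ - d₃) 2
    l = remainder (d₁ - d₂) 2
    r = + toℕ j
    c = + toℕ k
    b = + toℕ l
    q = d₃ /ℕ 2
    g = (d₂ - d₃) /ℕ 2
    f = (d₁ - d₂) /ℕ 2
    telescope : ∀ a b → b + (a - b) ≡ a
    telescope = solve-∀
    d₂≡ : r + c + + 2 * + 1 * (q + g) ≡ d₂
    d₂≡ = trans (lem r c q g) (trans (cong₂ _+_ (sym (divide d₃ 2)) (sym (divide (d₂ - d₃) 2))) (telescope d₂ d₃))
      where
      lem : ∀ r c q g → r + c + + 2 * + 1 * (q + g) ≡ r + + 2 * q + (c + + 2 * g)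
      lem = solve-∀
    d₁≡ : r + c + b + + 2 * + 1 * (q + g + f) ≡ d₁
    d₁≡ = trans (lem r c b q g f) (trans (cong₂ _+_ d₂≡ (sym (divide (d₁ - d₂) 2))) (telescope d₁ d₂))
      where
      lem : ∀ r c b q g f → r + c + b + + 2 * + 1 * (q + g + f) ≡ r + c + + 2 * + 1 * (q + g) + (b + + 2 * f)
      lem = solve-∀
    base : ∀ (i j k l : Fin 2) → Slack (+ toℕ i) ((0 , + toℕ j + + toℕ k + + toℕ l) ∷ (0 , + toℕ j + + toℕ k) ∷ (0 , + toℕ j) ∷ [])
    base = toWitness {a? = all? λ i → all? λ j → all? λ k → all? λ l →
      slack? (+ toℕ i) ((0 , + toℕ j + + toℕ k + + toℕ l) ∷ (0 , + toℕ j + + toℕ k) ∷ (0 , + toℕ j) ∷ [])} tt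
    lemI : ∀ x a r c b q g f → + 4 * ((+ 3 * a + (q + g + f) * + 0) + (+ 3 * a + (q + g + f) * + 2) + (+ 3 * (a + + 1 * (q + g + f)) + (q + g) * + 1) + (+ 3 * ((a + + 1 * (q + g + f)) + + 1 * (q + g)) + q * + 0) + (+ 3 * ((a + + 1 * (q + g + f)) + + 1 * (q + g)) + q * + 2)) - + 10 * ((+ 1 * a + (q + g + f) * + 0) + (+ 1 * ((a + + 1 * (q + g + f)) + + 1 * (q + g)) + q * + 0)) - + 3 * ((+ 1 * (+ 2 * (x + + 2 * a) + ((r + c + b) + + 2 * + 1 * (q + g + f))) + (+ 1 * (+ 2 * ((x + + 2 * a) + ((r + c + b) + + 2 * + 1 * (q + g + f))) + ((r + c) + + 2 * + 1 * (q + g))) + (+ 1 * (+ 2 * (((x + + 2 * a) + ((r + c + b) + + 2 * + 1 * (q + g + f))) + ((r + c) + + 2 * + 1 * (q + g))) + (r + + 2 * + 1 * q)) + 0ℤ))) - (+ 1 * (+ 2 * x + (r + c + b)) + (+ 1 * (+ 2 * (x + (r + c + b)) + (r + c)) + (+ 1 * (+ 2 * ((x + (r + c + b)) + (r + c)) + r) + 0ℤ)))) - (+ 2 * a + (((((x + + 2 * a) + ((r + c + b) + + 2 * + 1 * (q + g + f))) + ((r + c) + + 2 * + 1 * (q + g))) + (r + + 2 * + 1 * q)) - (((x + (r + c + b)) + (r + c)) + r))) ≡ + 2 * f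
    lemI = solve-∀
    lemZ : ∀ x a r c b q g f → + 11 * ((+ 1 * (+ 2 * (x + + 2 * a) + ((r + c + b) + + 2 * + 1 * (q + g + f))) + (+ 1 * (+ 2 * ((x + + 2 * a) + ((r + c + b) + + 2 * + 1 * (q + g + f))) + ((r + c) + + 2 * + 1 * (q + g))) + (+ 1 * (+ 2 * (((x + + 2 * a) + ((r + c + b) + + 2 * + 1 * (q + g + f))) + ((r + c) + + 2 * + 1 * (q + g))) + (r + + 2 * + 1 * q)) + 0ℤ))) - (+ 1 * (+ 2 * x + (r + c + b)) + (+ 1 * (+ 2 * (x + (r + c + b)) + (r + c)) + (+ 1 * (+ 2 * ((x + (r + c + b)) + (r + c)) + r) + 0ℤ)))) + + 2 * a - (((((x + + 2 * a) + ((r + c + b) + + 2 * + 1 * (q + g + f))) + ((r + c) + + 2 * + 1 * (q + g))) + (r + + 2 * + 1 * q)) - (((x + (r + c + b)) + (r + c)) + r)) + + 24 * ((+ 1 * a + (q + g + f) * + 0) + (+ 1 * ((a + + 1 * (q + g + f)) + + 1 * (q + g)) + q * + 0)) - + 12 * ((+ 3 * a + (q + g + f) * + 0) + (+ 3 * a + (q + g + f) * + 2) + (+ 3 * (a + + 1 * (q + g + f)) + (q + g) * + 1) + (+ 3 * ((a + + 1 * (q + g + f)) + + 1 * (q + g)) + q * + 0) + (+ 3 * ((a + + 1 * (q + g + f)) + + 1 * (q + g)) + q * + 2)) ≡ + 4 * g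
    lemZ = solve-∀

module Situations where

  open Inequalities
  open Hulls
  open Chains
  open ScaledRows
  open Counting
  open EvenDilates
  open Problems
  open AreaBounds
  open Reduction
  open HeightThree
  open import Defs
  open import Data.Nat as ℕ using (ℕ; suc; z≤n; s≤s)
  import Data.Nat.Properties as ℕ
  open import Data.Integer hiding (suc)
  open import Data.Integer.Properties
  open import Data.Integer.Tactic.RingSolver using (solve-∀)
  open import Data.Product using (_×_; _,_; Σ; proj₁; proj₂)
  open import Data.Sum using (_⊎_; inj₁; inj₂)
  open import Data.Empty using (⊥; ⊥-elim)
  open import Data.List using ([]; _∷_; length)
  open import Data.Vec using (Vec; map)
  open import Data.Vec.Membership.Propositional using (_∈_)
  open import Data.Vec.Membership.Propositional.Properties using (∈-map⁺)
  open import Relation.Nullary using (¬_)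
  open import Relation.Binary.PropositionalEquality hiding (J)

  irregulars-length : ∀ es → irregulars es + + length es ≤ + rows es
  irregulars-length [] = ≤-refl
  irregulars-length ((n , d) ∷ es) = ≤-by (irregular-≤ n d ⊕ irregulars-length es) (lem (+ n) (irregular (n , d)) (irregulars es) (+ length es) (+ rows es))
    where
    lem : ∀ n i I l r → 1ℤ + n + r + (i + (I + l)) ≡ i + I + (1ℤ + l) + (n + r)
    lem = solve-∀

  irregulars-nonneg : ∀ es → 0ℤ ≤ irregulars es
  irregulars-nonneg [] = ≤-refl
  irregulars-nonneg (e ∷ es) = irregular-nonneg e ⊕ irregulars-nonneg es

  module _ {n} {T : Vec LatticePoint n} where

    bottom-max : ∀ {y₀ p} (b : Boundary T y₀ (suc p)) → VertexBound T 1ℤ (Boundary.x₀ b) y₀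
    bottom-max (boundary x₀ [] start chain ())
    bottom-max {y₀} {p} (boundary x₀ ((m , d) ∷ es) start (step _ supp _) height) = bottom-bound {top = y₀ + + suc p} m d supp ≤-refl

    chain-top-max : ∀ {top x y es} → VertexBound T 1ℤ x y → Chain T top x y es → VertexBound T 1ℤ (end x es) top
    chain-top-max vb stop = vb
    chain-top-max {top} vb (step {n = m} {d} w∈ supp c) = chain-top-max (top-bound {top = top} m d supp ≤-refl) c

    top-max : ∀ {y₀ p} (b : Boundary T y₀ (suc p)) → VertexBound T 1ℤ (end (Boundary.x₀ b) (Boundary.edges b)) (y₀ + + suc p)
    top-max b = chain-top-max (bottom-max b) (Boundary.chain b)

    vertex-bound : ∀ {x y X} → VertexBound T 1ℤ x y → Hull T X y 1ℤ → X ≤ x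
    vertex-bound {x} {y} vb h = ≤-trans (vb {1ℤ} ≤-refl (hull-cast refl (lem y) refl h)) (≤-reflexive (sym (lem x)))
      where
      lem : ∀ y → y ≡ 1ℤ * (1ℤ * y)
      lem = solve-∀

    reach-bound : ∀ {x y X} → VertexBound T 1ℤ x y → Reach T 1ℤ y X → X ≤ x
    reach-bound {x} {y} vb (reach {m} {R} 1≤m inside below) = cancel-≤ 1≤m (≤-trans below (≤-trans (vb 1≤m (hull-cast refl (cong (m *_) (sym (*-identityˡ y))) refl inside)) (≤-reflexive (cong (m *_) (*-identityˡ x)))))

    reach-mid : ∀ {Y Y′ X X′} → Reach T 1ℤ Y X → Reach T 1ℤ Y′ X′ → Reach T (+ 2) (Y + Y′) (X + X′)
    reach-mid {Y} {Y′} {X} {X′} (reach {m} {R} 1≤m inside below) (reach {m′} {R′} 1≤m′ inside′ below′) = reach (1≤-* 1≤m 1≤m′)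
      (hull-cast refl (lem₁ m m′ Y Y′) (lem₂ m m′)
        (hull-mix 1ℤ 1ℤ (+m-nonneg 1) (+m-nonneg 1) (1≤+suc 1) (hull-cast refl refl (lem₃ m′ m) (hull-scale m′ inside)) (hull-scale m inside′)))
      (≤-by (weaken 1≤m′ ⊗ below ⊕ weaken 1≤m ⊗ below′) (lem m m′ X X′ R R′))
      where
      lem : ∀ m m′ X X′ R R′ → 1ℤ * (m′ * R) + 1ℤ * (m * R′) + (m′ * (m * X) + m * (m′ * X′)) ≡ m * m′ * (X + X′) + (m′ * R + m * R′)
      lem = solve-∀
      lem₁ : ∀ m m′ Y Y′ → 1ℤ * (m′ * (m * Y)) + 1ℤ * (m * (m′ * Y′)) ≡ m * m′ * (Y + Y′)
      lem₁ = solve-∀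
      lem₂ : ∀ m m′ → (1ℤ + 1ℤ) * (m * (m′ * 1ℤ)) ≡ m * m′ * + 2
      lem₂ = solve-∀
      lem₃ : ∀ m m′ → m * (m′ * 1ℤ) ≡ m′ * (m * 1ℤ)
      lem₃ = solve-∀

    reach-cast : ∀ {D Y Y′ X} → Y ≡ Y′ → Reach T D Y X → Reach T D Y′ X
    reach-cast refl r = r

    half : ∀ {y₀ p} → Boundary T y₀ p → ℕ → ℤ
    half b = floor 1 1 (Boundary.x₀ b) (Boundary.edges b)

    reach-half : ∀ {y₀ p} (b : Boundary T y₀ (suc p)) t → t ℕ.≤ suc p → Reach T 1ℤ (y₀ + + t) (+ 2 * half b t)
    reach-half {y₀} {p} b t t≤ = reach 1≤m (hull-cast refl (cong (λ y → m * (y + + t)) (*-identityˡ y₀)) refl attained) lower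
      where open RowEnd (boundary-row b 0 1 t (ℕ.≤-trans t≤ (ℕ.≤-reflexive (sym (ℕ.*-identityˡ (suc p))))))

    reach-bottom : ∀ {y₀ p} (b : Boundary T y₀ p) → Reach T 1ℤ y₀ (Boundary.x₀ b)
    reach-bottom b = reach-hull (bottom-hull b)

    half-bottom : ∀ {y₀ p} (b : Boundary T y₀ (suc p)) → + 2 * half b 0 ≤ Boundary.x₀ b
    half-bottom {y₀} b = reach-bound (bottom-max b) (reach-cast (+-identityʳ y₀) (reach-half b 0 z≤n))

    half-top : ∀ {y₀ p} (b : Boundary T y₀ (suc p)) → + 2 * half b (suc p) ≤ end (Boundary.x₀ b) (Boundary.edges b)
    half-top b = reach-bound (top-max b) (reach-half b _ ℕ.≤-refl)

    -- D times the area of a polygon through five (three) points with abscissae X t / D on consecutive rows.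
    area-5 : ∀ {y₀ D} (b : Boundary T y₀ 4) → 1ℤ ≤ D → ∀ {X₀ X₁ X₂ X₃ X₄} →
      Reach T D (D * (y₀ + 0ℤ)) X₀ → Reach T D (D * (y₀ + + 1)) X₁ → Reach T D (D * (y₀ + + 2)) X₂ → Reach T D (D * (y₀ + + 3)) X₃ → Reach T D (D * (y₀ + + 4)) X₄ →
      X₀ + + 2 * X₁ + + 2 * X₂ + + 2 * X₃ + X₄ ≤ D * boundary-area b
    area-5 {y₀} {D} b 1≤D {X₀} {X₁} {X₂} {X₃} {X₄} r₀ r₁ r₂ r₃ r₄ = ≤-trans (≤-reflexive (lem X₀ X₁ X₂ X₃ X₄)) (area-bound b 1≤D X reached)
      where
      X : ℕ → ℤ
      X 0 = X₀
      X 1 = X₁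
      X 2 = X₂
      X 3 = X₃
      X _ = X₄
      reached : ∀ t → t ℕ.≤ 4 → Reach T D (D * (y₀ + + t)) (X t)
      reached 0 _ = r₀
      reached 1 _ = r₁
      reached 2 _ = r₂
      reached 3 _ = r₃
      reached 4 _ = r₄
      reached (suc (suc (suc (suc (suc t))))) (s≤s (s≤s (s≤s (s≤s ()))))
      lem : ∀ a b c d e → a + + 2 * b + + 2 * c + + 2 * d + e ≡ a + b + (b + c + (c + d + (d + e + 0ℤ)))
      lem = solve-∀

    area-3 : ∀ {y₀ D} (b : Boundary T y₀ 2) → 1ℤ ≤ D → ∀ {X₀ X₁ X₂} →
      Reach T D (D * (y₀ + 0ℤ)) X₀ → Reach T D (D * (y₀ + + 1)) X₁ → Reach T D (D * (y₀ + + 2)) X₂ →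
      X₀ + + 2 * X₁ + X₂ ≤ D * boundary-area b
    area-3 {y₀} {D} b 1≤D {X₀} {X₁} {X₂} r₀ r₁ r₂ = ≤-trans (≤-reflexive (lem X₀ X₁ X₂)) (area-bound b 1≤D X reached)
      where
      X : ℕ → ℤ
      X 0 = X₀
      X 1 = X₁
      X _ = X₂
      reached : ∀ t → t ℕ.≤ 2 → Reach T D (D * (y₀ + + t)) (X t)
      reached 0 _ = r₀
      reached 1 _ = r₁
      reached 2 _ = r₂
      reached (suc (suc (suc t))) (s≤s (s≤s ()))
      lem : ∀ a b c → a + + 2 * b + c ≡ a + b + (b + c + 0ℤ)
      lem = solve-∀

    reach-double : ∀ {Y X} → Reach T 1ℤ Y X → Reach T (+ 2) (+ 2 * Y) (+ 2 * X)
    reach-double {Y} {X} r = subst₂ (Reach T (+ 2)) (lem Y) (lem X) (reach-mid r r)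
      where
      lem : ∀ Y → Y + Y ≡ + 2 * Y
      lem = solve-∀

    reach-1 : ∀ {Y X} → Reach T 1ℤ Y X → Reach T 1ℤ (1ℤ * Y) X
    reach-1 {Y} = reach-cast (sym (*-identityˡ Y))

    reach-top : ∀ {y₀ p} (b : Boundary T y₀ p) → Reach T 1ℤ (y₀ + + p) (end (Boundary.x₀ b) (Boundary.edges b))
    reach-top b = reach-hull (top-hull b)

    reach-between : ∀ y a b c {X X′} → a ℕ.+ c ≡ 2 ℕ.* b → Reach T 1ℤ (y + + a) X → Reach T 1ℤ (y + + c) X′ → Reach T (+ 2) (+ 2 * (y + + b)) (X + X′)
    reach-between y a b c eq r r′ = reach-cast (trans (lem y (+ a) (+ c)) (trans (cong (λ s → + 2 * y + s) (trans (cong +_ eq) (pos-* 2 b))) (sym (*-distribˡ-+ (+ 2) y (+ b))))) (reach-mid r r′)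
      where
      lem : ∀ y a c → y + a + (y + c) ≡ + 2 * y + (a + c)
      lem = solve-∀

  -- A = 8i + 2B − 8 and B = 2b: either i ≥ 1 and b ≤ 2i + 7, or i = 0 and b = 3.
  Verdict : ℤ → ℤ → Set
  Verdict A B = (+ 2 * B + 1ℤ ≤ A + + 8 × + 4 * B ≤ A + + 36) ⊎ (A + + 8 ≡ + 2 * B × B ≡ + 6)

  module Situation {n} {T : Vec LatticePoint n} {A B c₁ c₃} (P : Problem T A B c₁ c₃) {y₀ p} (E : Extent T y₀ (suc p)) where
    open Problem P public
    s : Sides T y₀ (suc p)
    s = sides E
    open Sides s public
    W I : ℤ
    W = width s
    I = irregulars R.edges + irregulars L.edges
    rx re lx le : ℤ
    rx = R.x₀
    re = end R.x₀ R.edges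
    lx = L.x₀
    le = end L.x₀ L.edges
    area : A ≡ boundary-area right + boundary-area left
    area = area≡ P s
    count : B ≡ W + + 2 * + suc p - I
    count = trans (count≡ P s) (lem W (+ suc p) (irregulars R.edges) (irregulars L.edges))
      where
      lem : ∀ W p i j → W + + 2 * p - i - j ≡ W + + 2 * p - (i + j)
      lem = solve-∀
    bottom≥0 : 0ℤ ≤ bottom-width s
    bottom≥0 = ≤-by (vertex-bound (bottom-max right) (hull-unflip (bottom-hull left))) (lem rx lx)
      where
      lem : ∀ x l → x + l + - l ≡ 0ℤ + x
      lem = solve-∀
    top≥0 : 0ℤ ≤ top-width s
    top≥0 = ≤-by (vertex-bound (top-max right) (hull-unflip (top-hull left))) (lem re le)
      where
      lem : ∀ x l → x + l + - l ≡ 0ℤ + x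
      lem = solve-∀
    W≥0 : 0ℤ ≤ W
    W≥0 = bottom≥0 ⊕ top≥0
    I≥0 : 0ℤ ≤ I
    I≥0 = irregulars-nonneg R.edges ⊕ irregulars-nonneg L.edges
    B≤ : B ≤ W + + 2 * + suc p
    B≤ = ≤-by I≥0 (trans (cong (λ s → W + + 2 * + suc p + s) refl) (trans (lem W (+ suc p) I) (cong (_+ I) (sym count))))
      where
      lem : ∀ W P I → W + + 2 * P + 0ℤ ≡ W + + 2 * P - I + I
      lem = solve-∀

    rows-count : ∀ k N ε η → ε ℕ.≤ 1 → + suc k * y₀ + + ε ≡ + 2 * η → suc k ℕ.* suc p ℕ.< ε ℕ.+ 2 ℕ.* N → ε ℕ.+ 2 ℕ.* N ℕ.≤ suc k ℕ.* suc p ℕ.+ 2 →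
      ∀ {c} → Counts (Dilate T (+ suc k)) c → + c ≡ Σ< N (λ j → floor (suc k) 1 rx R.edges (ε ℕ.+ 2 ℕ.* j) + floor (suc k) 1 lx L.edges (ε ℕ.+ 2 ℕ.* j) + 1ℤ)
    rows-count k N ε η ε≤ start beyond within counts = counts-value {Dilate T (+ suc k)} counts (counts-rows s k 1 N ε η ε≤ start beyond within)

    -- Without two distinct boundary chains all of T would be collinear.
    3≤B : + 3 ≤ B
    3≤B with split-≤ 1ℤ W | edge-count R.edges R.height | edge-count L.edges L.height
      where
      edge-count : ∀ es → rows es ≡ suc p → (1ℤ ≤ + length es) × ((+ 2 ≤ + length es) ⊎ (Σ ℤ λ d → es ≡ (p , d) ∷ []))
      edge-count [] ()
      edge-count ((m , d) ∷ []) eq = ≤-refl , inj₂ (d , cong (λ m → (m , d) ∷ []) (ℕ.suc-injective (trans (sym (ℕ.+-identityʳ (suc m))) eq)))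
      edge-count (_ ∷ _ ∷ es) eq = 1≤+suc _ , inj₁ (+≤+ (s≤s (s≤s z≤n)))
    ... | positive | (1≤r , r) | (1≤l , l) = decide positive r l
      where
      total : ∀ {w a b} → w ≤ W → a ≤ + length R.edges → b ≤ + length L.edges → w + a + b ≤ B
      total {w} {a} {b} w≤ a≤ b≤ = ≤-trans (≤-by (w≤ ⊕ a≤ ⊕ b≤ ⊕ fewer R.edges R.height ⊕ fewer L.edges L.height)
          (lem W (+ suc p) (irregulars R.edges) (irregulars L.edges) (+ length R.edges) (+ length L.edges) w a b)) (≤-reflexive (sym count))
        where
        fewer : ∀ es → rows es ≡ suc p → irregulars es + + length es ≤ + suc p
        fewer es eq = ≤-trans (irregulars-length es) (≤-reflexive (cong +_ eq))
        lem : ∀ W P i j r l w a b → W + + 2 * P - (i + j) + (w + a + b + (i + r) + (j + l)) ≡ w + a + b + (W + r + l + P + P)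
        lem = solve-∀
      collinear : ∀ d d′ → R.edges ≡ (p , d) ∷ [] → L.edges ≡ (p , d′) ∷ [] → W ≤ 0ℤ → ⊥
      collinear d d′ r≡ l≡ W≤0 = impossible (proj₁ (nondegenerate (+ suc p) (- d) (+ suc p * rx - d * y₀) flat))
        where
        impossible : ¬ (+ suc p ≡ 0ℤ)
        impossible ()
        rsupp : Supports T rx y₀ (p , d)
        rsupp = support R.chain r≡
          where
          support : ∀ {top x y es} → Chain T top x y es → es ≡ (p , d) ∷ [] → Supports T x y (p , d)
          support (step _ supp _) refl = supp
        lsupp : Supports (map flip T) lx y₀ (p , d′)
        lsupp = support L.chain l≡
          where
          support : ∀ {top x y es} → Chain (map flip T) top x y es → es ≡ (p , d′) ∷ [] → Supports (map flip T) x y (p , d′)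
          support (step _ supp _) refl = supp
        zeroB : rx + lx ≤ 0ℤ
        zeroB = ≤-by (W≤0 ⊕ top≥0) (lem (bottom-width s) (top-width s))
          where
          lem : ∀ b t → 0ℤ + (b + t + 0ℤ) ≡ b + (0ℤ + t)
          lem = solve-∀
        zeroT : rx + d + (lx + d′) ≤ 0ℤ
        zeroT = subst₂ (λ e f → e + f ≤ 0ℤ) (cong (end rx) r≡) (cong (end lx) l≡) (≤-by (W≤0 ⊕ bottom≥0) (lem (bottom-width s) (top-width s)))
          where
          lem : ∀ b t → 0ℤ + (b + t + 0ℤ) ≡ t + (0ℤ + b)
          lem = solve-∀
        flat : ∀ u → u ∈ T → + suc p * proj₁ u + - d * proj₂ u ≡ + suc p * rx - d * y₀
        flat (a , b) u∈ = ≤-antisym (≤-by (rsupp (a , b) u∈) (lem₁ (+ suc p) d a b rx y₀))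
          (≤-by (mirrored ⊕ difference (Extent.low E _ u∈) ⊗ zeroT ⊕ difference (Extent.high E _ u∈) ⊗ zeroB) (lem₂ (+ suc p) d d′ a b rx lx y₀))
          where
          mirrored : (- a - lx) * + suc p ≤ d′ * (b - y₀)
          mirrored = subst (λ v → (proj₁ v - lx) * + suc p ≤ d′ * (proj₂ v - y₀)) (flip≡ a b) (lsupp _ (∈-map⁺ flip u∈))
          lem₁ : ∀ P d a b x y → P * x - d * y + (a - x) * P ≡ P * a + - d * b + d * (b - y)
          lem₁ = solve-∀
          lem₂ : ∀ P d d′ a b x l y → P * a + - d * b + ((- a - l) * P + (b - y) * (x + d + (l + d′)) + (y + P - b) * (x + l)) ≡
            P * x - d * y + (d′ * (b - y) + (b - y) * 0ℤ + (y + P - b) * 0ℤ)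
          lem₂ = solve-∀
      decide : (1ℤ ≤ W) ⊎ (1ℤ + W ≤ 1ℤ) → (+ 2 ≤ + length R.edges) ⊎ (Σ ℤ λ d → R.edges ≡ (p , d) ∷ []) → (+ 2 ≤ + length L.edges) ⊎ (Σ ℤ λ d → L.edges ≡ (p , d) ∷ []) → + 3 ≤ B
      decide (inj₁ 1≤W) _ _ = total 1≤W 1≤r 1≤l
      decide (inj₂ _) (inj₁ 2≤r) _ = total W≥0 2≤r 1≤l
      decide (inj₂ _) (inj₂ _) (inj₁ 2≤l) = total W≥0 1≤r 2≤l
      decide (inj₂ W<1) (inj₂ (d , r≡)) (inj₂ (d′ , l≡)) = ⊥-elim (collinear d d′ r≡ l≡ (≤-by W<1 (lem W)))
        where
        lem : ∀ W → 0ℤ + (1ℤ + W) ≡ W + 1ℤ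
        lem = solve-∀

module Heights where

  open Inequalities
  open Hulls
  open Chains
  open ScaledRows
  open Counting
  open EvenDilates
  open Problems
  open AreaBounds
  open Reduction
  open Situations
  open HeightThree
  open import Defs
  open import Data.Nat as ℕ using (ℕ; zero; suc; z≤n; s≤s)
  import Data.Nat.Properties as ℕ
  open import Data.Integer hiding (suc)
  open import Data.Integer.Properties
  open import Data.Integer.DivMod
  open import Data.Integer.Tactic.RingSolver using (solve-∀)
  open import Data.Product using (_×_; _,_; Σ; proj₁; proj₂)
  open import Data.Sum using (_⊎_; inj₁; inj₂)
  open import Data.Empty using (⊥)
  open import Data.List using ([]; _∷_)
  open import Data.Vec using (Vec; map)
  open import Data.Vec.Membership.Propositional using (_∈_)
  open import Data.Vec.Membership.Propositional.Properties using (∈-map⁺)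
  open import Relation.Binary.PropositionalEquality hiding (J)

  square≥0 : ∀ x → 0ℤ ≤ x * x
  square≥0 (+ n) = ≤-trans (+m-nonneg (n ℕ.* n)) (≤-reflexive (pos-* n n))
  square≥0 -[1+ n ] = +m-nonneg _

  eq-≤ : ∀ {a b : ℤ} → a ≡ b → a ≤ b
  eq-≤ = ≤-reflexive

  wide-count : ∀ {A B W H} → 0ℤ ≤ W → + 4 ≤ H → H * W ≤ A → H * H + H * W ≤ + 2 * A → B ≤ W + + 2 * H → + 4 * B ≤ A + + 36
  wide-count {A} {B} {W} {H} W≥0 4≤H flat area B≤ with split-≤ H W
  ... | inj₁ H≤W = ≤-by (flat ⊕ _⊗_ {+ 4} (+m-nonneg 4) B≤ ⊕ cross-≤ 4≤H H≤W ⊕ square≥0 (H - + 6)) (lem A B W H)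
    where
    lem : ∀ A B W H → A + + 36 + (H * W + + 4 * B + (+ 4 * W + H * H) + 0ℤ) ≡ + 4 * B + (A + + 4 * (W + + 2 * H) + (H * W + + 4 * H) + (H - + 6) * (H - + 6))
    lem = solve-∀
  ... | inj₂ W<H with split-≤ H (+ 8)
  ...   | inj₁ H≤8 = cancel-≤ {+ 2} (1≤+suc 1) (≤-by (area ⊕ _⊗_ {+ 8} (+m-nonneg 8) B≤ ⊕ cross-≤ H≤8 (≤-trans (i≤j⇒i≤1+j ≤-refl) W<H) ⊕ _⊗_ {+ 2} (+m-nonneg 2) (square≥0 (H - + 6))) (lem A B W H))
    where
    lem : ∀ A B W H → + 2 * (A + + 36) + (H * H + H * W + + 8 * B + (H * H + + 8 * W) + + 2 * 0ℤ) ≡ + 2 * (+ 4 * B) + (+ 2 * A + + 8 * (W + + 2 * H) + (+ 8 * H + H * W) + + 2 * ((H - + 6) * (H - + 6)))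
    lem = solve-∀
  ...   | inj₂ 9≤H = cancel-≤ {+ 2} (1≤+suc 1) (≤-by (area ⊕ _⊗_ {+ 8} (+m-nonneg 8) B≤ ⊕ W≥0 ⊗ 9≤H ⊕ W≥0 ⊕ square≥0 (H - + 8) ⊕ +m-nonneg 8) (lem A B W H))
    where
    lem : ∀ A B W H → + 2 * (A + + 36) + (H * H + H * W + + 8 * B + W * (1ℤ + + 8) + 0ℤ + 0ℤ + 0ℤ) ≡ + 2 * (+ 4 * B) + (+ 2 * A + + 8 * (W + + 2 * H) + W * H + W + (H - + 8) * (H - + 8) + + 8)
    lem = solve-∀

  wide-interior : ∀ {A B W H} → 0ℤ ≤ W → + 5 ≤ H → H * H + H * W ≤ + 2 * A → B ≤ W + + 2 * H → + 2 * B + 1ℤ ≤ A + + 8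
  wide-interior {A} {B} {W} {H} W≥0 5≤H area B≤ with split-≤ (+ 2 * B + 1ℤ) (A + + 8)
  ... | inj₁ p = p
  ... | inj₂ q = absurd-≤ {1ℤ} {0ℤ} (≤-by (_⊗_ {+ 2} (+m-nonneg 2) q ⊕ area ⊕ _⊗_ {+ 4} (+m-nonneg 4) B≤ ⊕ cross-≤ 5≤H 5≤H ⊕ W≥0 ⊗ 5≤H ⊕ W≥0 ⊕ _⊗_ {+ 2} (+m-nonneg 2) 5≤H) (lem A B W H)) refl
    where
    lem : ∀ A B W H → 0ℤ + (+ 2 * (1ℤ + (A + + 8)) + (H * H + H * W) + + 4 * B + (+ 5 * H + H * + 5) + W * + 5 + 0ℤ + + 2 * + 5) ≡
      1ℤ + (+ 2 * (+ 2 * B + 1ℤ) + + 2 * A + + 4 * (W + + 2 * H) + (H * H + + 5 * + 5) + W * H + W + + 2 * H)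
    lem = solve-∀

  EvenRow OddRow : ℤ → Set
  EvenRow y = Σ ℤ λ η → y ≡ + 2 * η
  OddRow y = Σ ℤ λ η → y + 1ℤ ≡ + 2 * η

  parity : ∀ y → EvenRow y ⊎ OddRow y
  parity y with y %ℕ 2 | n%ℕd<d y 2 | a≡a%ℕn+[a/ℕn]*n y 2
  ... | 0 | _ | eq = inj₁ (y /ℕ 2 , trans eq (lem (y /ℕ 2)))
    where
    lem : ∀ q → 0ℤ + q * + 2 ≡ + 2 * q
    lem = solve-∀
  ... | 1 | _ | eq = inj₂ (y /ℕ 2 + 1ℤ , trans (cong (_+ 1ℤ) eq) (lem (y /ℕ 2)))
    where
    lem : ∀ q → 1ℤ + q * + 2 + 1ℤ ≡ + 2 * (q + 1ℤ)
    lem = solve-∀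
  ... | suc (suc _) | s≤s (s≤s ()) | _

  even-start : ∀ k {y η} → y ≡ + 2 * η → + k * y + 0ℤ ≡ + 2 * (+ k * η)
  even-start k {η = η} refl = lem (+ k) η
    where
    lem : ∀ k η → k * (+ 2 * η) + 0ℤ ≡ + 2 * (k * η)
    lem = solve-∀

  upside-down : Unimodular
  upside-down = record { mat = matrix 1ℤ 0ℤ 0ℤ -1ℤ ; inv = matrix 1ℤ 0ℤ 0ℤ -1ℤ ; inv-mat = twice ; mat-inv = twice }
    where
    lem₁ : ∀ x y → 1ℤ * (1ℤ * x + 0ℤ * y) + 0ℤ * (0ℤ * x + -1ℤ * y) ≡ x
    lem₁ = solve-∀
    lem₂ : ∀ x y → 0ℤ * (1ℤ * x + 0ℤ * y) + -1ℤ * (0ℤ * x + -1ℤ * y) ≡ y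
    lem₂ = solve-∀
    twice : ∀ z → act (matrix 1ℤ 0ℤ 0ℤ -1ℤ) (act (matrix 1ℤ 0ℤ 0ℤ -1ℤ) z) ≡ z
    twice (x , y) = cong₂ _,_ (lem₁ x y) (lem₂ x y)

  extent-flip : ∀ {n} {T : Vec LatticePoint n} {y₀ p} → Extent T y₀ p → Extent (map (act (Unimodular.mat upside-down)) T) (- (y₀ + + p)) p
  extent-flip {T = T} {y₀} {p} E = record
    { low = λ u u∈ → level {λ s → - (y₀ + + p) ≤ s} (λ u u∈ → neg-mono-≤ (high u u∈)) u u∈
    ; high = λ u u∈ → level {λ s → s ≤ - (y₀ + + p) + + p} (λ u u∈ → ≤-trans (neg-mono-≤ (low u u∈)) (≤-reflexive (lem y₀ (+ p)))) u u∈
    ; bottom = proj₁ top , subst (_∈ T′) (flip≡′ (proj₁ top) (y₀ + + p)) (∈-map⁺ f (proj₂ top))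
    ; top = proj₁ bottom , subst (_∈ T′) (trans (flip≡′ (proj₁ bottom) y₀) (cong (proj₁ bottom ,_) (lem y₀ (+ p)))) (∈-map⁺ f (proj₂ bottom)) }
    where
    open Extent E
    f = act (Unimodular.mat upside-down)
    T′ = map f T
    lem : ∀ y p → - y ≡ - (y + p) + p
    lem = solve-∀
    flip≡′ : ∀ x y → f (x , y) ≡ (x , - y)
    flip≡′ x y = cong₂ _,_ (lem₁ x y) (lem₂ x y)
      where
      lem₁ : ∀ x y → 1ℤ * x + 0ℤ * y ≡ x
      lem₁ = solve-∀
      lem₂ : ∀ x y → 0ℤ * x + -1ℤ * y ≡ - y
      lem₂ = solve-∀
    level : ∀ {Q : ℤ → Set} → (∀ u → u ∈ T → Q (- proj₂ u)) → ∀ u → u ∈ T′ → Q (proj₂ u)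
    level {Q} q u u∈ with ∈-map⁻ u∈
    ... | (x , y) , v∈ , refl = subst Q (sym (cong proj₂ (flip≡′ x y))) (q (x , y) v∈)

  module _ {A B : ℤ} {c₁ c₃ : ℕ} where

    height-1 : ∀ {n} {T : Vec LatticePoint n} {y₀} → Problem T A B c₁ c₃ → Extent T y₀ 1 → EvenRow y₀ → Verdict A B
    height-1 {T = T} {y₀} P E (η , even) = inj₂ (A+8≡ , B≡6)
      where
      open Situation P E
      L₁ : ∀ {T : Vec LatticePoint _} → Boundary T y₀ 1 → ℤ
      L₁ b = floor 1 1 (Boundary.x₀ b) (Boundary.edges b) 0
      L₃ : ∀ {T : Vec LatticePoint _} → Boundary T y₀ 1 → ℤ
      L₃ b = floor 3 1 (Boundary.x₀ b) (Boundary.edges b) 0 + floor 3 1 (Boundary.x₀ b) (Boundary.edges b) 2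
      per-side : ∀ {T : Vec LatticePoint _} (b : Boundary T y₀ 1) → let open Boundary b in
        L₃ b ≡ boundary-area b + + 2 * L₁ b × boundary-area b ≡ x₀ + end x₀ edges × irregulars edges ≡ 0ℤ
      per-side (boundary x [] _ _ ())
      per-side (boundary x ((suc m , d) ∷ es) _ _ ())
      per-side (boundary x ((zero , d) ∷ (m , d′) ∷ es) _ _ ())
      per-side (boundary x ((zero , d) ∷ []) _ _ _) = trans (cong₂ _+_ (f₃ 0 0ℤ (lem₁ x d)) (f₃ 2 d (lem₂ x d))) (trans (lem₃ x d (x /ℕ 2)) (cong (λ s → 1ℤ * (+ 2 * x + d) + 0ℤ + + 2 * s) (sym f₁))) , lem₄ x d ,
        trans (+-identityʳ _) (≤-antisym (irregular-≤ 0 d) (irregular-nonneg (0 , d)))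
        where
        f₁ : (1ℤ * x * 1ℤ + d * 0ℤ) /ℕ 2 ≡ x /ℕ 2
        f₁ = cong (_/ℕ 2) (lem x d)
          where
          lem : ∀ x d → 1ℤ * x * 1ℤ + d * 0ℤ ≡ x
          lem = solve-∀
        f₃ : ∀ t e → + 3 * x * 1ℤ + d * + t ≡ x + (x + e) * + 2 → (+ 3 * x * 1ℤ + d * + t) /ℕ 2 ≡ x /ℕ 2 + (x + e)
        f₃ t e eq = trans (cong (_/ℕ 2) eq) (/-shift x (x + e) 1)
        lem₁ : ∀ x d → + 3 * x * 1ℤ + d * 0ℤ ≡ x + (x + 0ℤ) * + 2
        lem₁ = solve-∀
        lem₂ : ∀ x d → + 3 * x * 1ℤ + d * + 2 ≡ x + (x + d) * + 2
        lem₂ = solve-∀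
        lem₃ : ∀ x d h → h + (x + 0ℤ) + (h + (x + d)) ≡ 1ℤ * (+ 2 * x + d) + 0ℤ + + 2 * h
        lem₃ = solve-∀
        lem₄ : ∀ x d → 1ℤ * (+ 2 * x + d) + 0ℤ ≡ x + (x + d)
        lem₄ = solve-∀
      c₁≡ : + c₁ ≡ L₁ right + L₁ left + 1ℤ + 0ℤ
      c₁≡ = rows-count 0 1 0 (1ℤ * η) z≤n (even-start 1 even) (s≤s (s≤s z≤n)) (s≤s (s≤s z≤n)) count₁
      c₃≡ : + c₃ ≡ floor 3 1 rx R.edges 0 + floor 3 1 lx L.edges 0 + 1ℤ + (floor 3 1 rx R.edges 2 + floor 3 1 lx L.edges 2 + 1ℤ + 0ℤ)
      c₃≡ = rows-count 2 2 0 (+ 3 * η) z≤n (even-start 3 even) (s≤s (s≤s (s≤s (s≤s z≤n)))) (s≤s (s≤s (s≤s (s≤s z≤n)))) count₃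
      c₃-c₁ : + c₃ ≡ A + + 2 * + c₁
      c₃-c₁ = trans c₃≡ (trans (lem (floor 3 1 rx R.edges 0) (floor 3 1 lx L.edges 0) (floor 3 1 rx R.edges 2) (floor 3 1 lx L.edges 2))
        (trans (cong₂ (λ a b → a + b + + 2) (proj₁ (per-side right)) (proj₁ (per-side left))) (trans (lem′ (boundary-area right) (boundary-area left) (L₁ right) (L₁ left)) (cong₂ (λ a c → a + + 2 * c) (sym area) (sym c₁≡)))))
        where
        lem : ∀ a b c d → a + b + 1ℤ + (c + d + 1ℤ + 0ℤ) ≡ a + c + (b + d) + + 2
        lem = solve-∀
        lem′ : ∀ A A′ a b → A + + 2 * a + (A′ + + 2 * b) + + 2 ≡ A + A′ + + 2 * (a + b + 1ℤ + 0ℤ)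
        lem′ = solve-∀
      A+8≡ : A + + 8 ≡ + 2 * B
      A+8≡ = +-cancelˡ (+ 9 * A + + 4 * B + + 8) (sym (trans (lem₁ A B) (trans (sym poly₃) (trans (cong (λ c → + 8 * c) c₃-c₁) (trans (lem₂ A (+ c₁)) (trans (cong (λ c → + 8 * A + + 2 * c) poly₁) (lem₃ A B)))))))
        where
        lem₁ : ∀ A B → + 9 * A + + 4 * B + + 8 + + 2 * B ≡ + 9 * A + + 6 * B + + 8
        lem₁ = solve-∀
        lem₂ : ∀ A c → + 8 * (A + + 2 * c) ≡ + 8 * A + + 2 * (+ 8 * c)
        lem₂ = solve-∀
        lem₃ : ∀ A B → + 8 * A + + 2 * (A + + 2 * B + + 8) ≡ + 9 * A + + 4 * B + + 8 + (A + + 8)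
        lem₃ = solve-∀
      A≡W : A ≡ W
      A≡W = trans area (trans (cong₂ _+_ (proj₁ (proj₂ (per-side right))) (proj₁ (proj₂ (per-side left)))) (lem rx re lx le))
        where
        lem : ∀ a b c d → a + b + (c + d) ≡ a + c + (b + d)
        lem = solve-∀
      B≡6 : B ≡ + 6
      B≡6 = +-cancelˡ B (trans (lem₁ B) (trans (sym A+8≡) (trans (cong (λ a → a + + 8) A≡W) (trans (lem₂ W) (cong (_+ + 6) (trans (cong₂ (λ i j → W + + 2 - (i + j)) (sym (proj₂ (proj₂ (per-side right)))) (sym (proj₂ (proj₂ (per-side left))))) (sym count)))))))
        where
        lem₁ : ∀ B → B + B ≡ + 2 * B
        lem₁ = solve-∀
        lem₂ : ∀ W → W + + 8 ≡ W + + 2 - (0ℤ + 0ℤ) + + 6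
        lem₂ = solve-∀

    height-3 : ∀ {n} {T : Vec LatticePoint n} {y₀} → Problem T A B c₁ c₃ → Extent T y₀ 3 → EvenRow y₀ → Verdict A B
    height-3 {T = T} {y₀} P E (η , even) = inj₁ (interior , bounded)
      where
      open Situation P E
      slack : ∀ {T : Vec LatticePoint _} (b : Boundary T y₀ 3) → Slack (Boundary.x₀ b) (Boundary.edges b)
      slack (boundary x ((2 , d) ∷ []) _ _ _) = slack-3 x d
      slack (boundary x ((1 , d₁) ∷ (0 , d₂) ∷ []) _ (step _ supp (step w∈ _ _)) _) = slack-21 x d₁ d₂ (≤-by (supp _ w∈) (lem x d₁ d₂ y₀))
        where
        lem : ∀ x d₁ d₂ y → d₁ + (x + d₁ + d₂ - x) * + 2 ≡ + 2 * d₂ + d₁ * (y + + 2 + + 1 - y)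
        lem = solve-∀
      slack (boundary x ((0 , d₁) ∷ (1 , d₂) ∷ []) _ (step _ supp (step w∈ _ _)) _) = slack-12 x d₁ d₂ (≤-by (supp _ w∈) (lem x d₁ d₂ y₀))
        where
        lem : ∀ x d₁ d₂ y → + 2 * d₁ + (x + d₁ + d₂ - x) * + 1 ≡ d₂ + d₁ * (y + + 1 + + 2 - y)
        lem = solve-∀
      slack (boundary x ((0 , d₁) ∷ (0 , d₂) ∷ (0 , d₃) ∷ []) _ (step _ supp₁ (step w∈ supp₂ (step z∈ _ _))) _) =
        slack-111 x d₁ d₂ d₃ (≤-by (supp₁ _ w∈) (lem x d₁ d₂ y₀)) (≤-by (supp₂ _ z∈) (lem (x + d₁) d₂ d₃ (y₀ + + 1)))
        where
        lem : ∀ x d₁ d₂ y → d₁ + (x + d₁ + d₂ - x) * + 1 ≡ d₂ + d₁ * (y + + 1 + + 1 - y)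
        lem = solve-∀
      slack (boundary x [] _ _ ())
      slack (boundary x ((suc (suc (suc n)) , d) ∷ es) _ _ ())
      slack (boundary x ((2 , d) ∷ (n , d′) ∷ es) _ _ ())
      slack (boundary x ((1 , d) ∷ []) _ _ ())
      slack (boundary x ((1 , d) ∷ (suc n , d′) ∷ es) _ _ ())
      slack (boundary x ((1 , d) ∷ (0 , d′) ∷ (n , d″) ∷ es) _ _ ())
      slack (boundary x ((0 , d) ∷ []) _ _ ())
      slack (boundary x ((0 , d) ∷ (suc (suc n) , d′) ∷ es) _ _ ())
      slack (boundary x ((0 , d) ∷ (1 , d′) ∷ (n , d″) ∷ es) _ _ ())
      slack (boundary x ((0 , d) ∷ (0 , d′) ∷ []) _ _ ())
      slack (boundary x ((0 , d) ∷ (0 , d′) ∷ (suc n , d″) ∷ es) _ _ ())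
      slack (boundary x ((0 , d) ∷ (0 , d′) ∷ (0 , d″) ∷ (n , d‴) ∷ es) _ _ ())
      h₁ h₃ h₁′ h₃′ : ℤ
      h₁ = half₁ rx R.edges
      h₃ = half₃ rx R.edges
      h₁′ = half₁ lx L.edges
      h₃′ = half₃ lx L.edges
      c₁≡ : + c₁ ≡ h₁ + h₁′ + + 2
      c₁≡ = trans (rows-count 0 2 0 (1ℤ * η) z≤n (even-start 1 even) (s≤s (s≤s (s≤s (s≤s z≤n)))) (s≤s (s≤s (s≤s (s≤s z≤n)))) count₁)
        (lem (floor 1 1 rx R.edges 0) (floor 1 1 lx L.edges 0) (floor 1 1 rx R.edges 2) (floor 1 1 lx L.edges 2))
        where
        lem : ∀ a b c d → a + b + 1ℤ + (c + d + 1ℤ + 0ℤ) ≡ a + c + (b + d) + + 2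
        lem = solve-∀
      c₃≡ : + c₃ ≡ h₃ + h₃′ + + 5
      c₃≡ = trans (rows-count 2 5 0 (+ 3 * η) z≤n (even-start 3 even) (ℕ.≤-refl) (ℕ.n≤1+n 10) count₃)
        (lem (floor 3 1 rx R.edges 0) (floor 3 1 lx L.edges 0) (floor 3 1 rx R.edges 2) (floor 3 1 lx L.edges 2) (floor 3 1 rx R.edges 4) (floor 3 1 lx L.edges 4)
          (floor 3 1 rx R.edges 6) (floor 3 1 lx L.edges 6) (floor 3 1 rx R.edges 8) (floor 3 1 lx L.edges 8))
        where
        lem : ∀ a b c d e f g h i j → a + b + 1ℤ + (c + d + 1ℤ + (e + f + 1ℤ + (g + h + 1ℤ + (i + j + 1ℤ + 0ℤ)))) ≡ a + c + e + g + i + (b + d + f + h + j) + + 5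
        lem = solve-∀
      a a′ i i′ : ℤ
      a = boundary-area right
      a′ = boundary-area left
      i = irregulars R.edges
      i′ = irregulars L.edges
      eq₁ : + 8 * (h₁ + h₁′ + + 2) ≡ a + a′ + + 2 * (rx + lx + (re + le) + + 2 * + 3 - (i + i′)) + + 8
      eq₁ = trans (cong (λ c → + 8 * c) (sym c₁≡)) (trans poly₁ (cong₂ (λ A B → A + + 2 * B + + 8) area count))
      eq₃ : + 8 * (h₃ + h₃′ + + 5) ≡ + 9 * (a + a′) + + 6 * (rx + lx + (re + le) + + 2 * + 3 - (i + i′)) + + 8
      eq₃ = trans (cong (λ c → + 8 * c) (sym c₃≡)) (trans poly₃ (cong₂ (λ A B → + 9 * A + + 6 * B + + 8) area count))
      interior : + 2 * B + 1ℤ ≤ A + + 8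
      interior = subst₂ (λ A B → + 2 * B + 1ℤ ≤ A + + 8) (sym area) (sym count)
        (≤-by (_⊗_ {+ 4} (+m-nonneg 4) (proj₁ (slack right) ⊕ proj₁ (slack left)) ⊕ _⊗_ {+ 5} (+m-nonneg 5) (eq-≤ (sym eq₁)) ⊕ _⊗_ {+ 2} (+m-nonneg 2) (eq-≤ eq₃) ⊕ +m-nonneg 7)
          (lem rx lx re le a a′ i i′ h₁ h₁′ h₃ h₃′))
        where
        lem : ∀ x x′ e e′ a a′ i i′ h₁ h₁′ h₃ h₃′ →
          a + a′ + + 8 + (+ 4 * (0ℤ + 0ℤ) + + 5 * (a + a′ + + 2 * (x + x′ + (e + e′) + + 2 * + 3 - (i + i′)) + + 8) + + 2 * (+ 8 * (h₃ + h₃′ + + 5)) + 0ℤ) ≡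
          + 2 * (x + x′ + (e + e′) + + 2 * + 3 - (i + i′)) + 1ℤ + (+ 4 * (+ 4 * h₃ - + 10 * h₁ - + 3 * a - (x + e) + i + (+ 4 * h₃′ - + 10 * h₁′ - + 3 * a′ - (x′ + e′) + i′)) +
            + 5 * (+ 8 * (h₁ + h₁′ + + 2)) + + 2 * (+ 9 * (a + a′) + + 6 * (x + x′ + (e + e′) + + 2 * + 3 - (i + i′)) + + 8) + + 7)
        lem = solve-∀
      bounded : + 4 * B ≤ A + + 36
      bounded = subst₂ (λ A B → + 4 * B ≤ A + + 36) (sym area) (sym count)
        (≤-by (_⊗_ {+ 2} (+m-nonneg 2) (proj₂ (slack right) ⊕ proj₂ (slack left)) ⊕ _⊗_ {+ 6} (+m-nonneg 6) (eq-≤ eq₁) ⊕ _⊗_ {+ 3} (+m-nonneg 3) (eq-≤ (sym eq₃)) ⊕ _⊗_ {+ 4} (+m-nonneg 4) top≥0)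
          (lem rx lx re le a a′ i i′ h₁ h₁′ h₃ h₃′))
        where
        lem : ∀ x x′ e e′ a a′ i i′ h₁ h₁′ h₃ h₃′ →
          a + a′ + + 36 + (+ 2 * (0ℤ + 0ℤ) + + 6 * (+ 8 * (h₁ + h₁′ + + 2)) + + 3 * (+ 9 * (a + a′) + + 6 * (x + x′ + (e + e′) + + 2 * + 3 - (i + i′)) + + 8) + + 4 * 0ℤ) ≡
          + 4 * (x + x′ + (e + e′) + + 2 * + 3 - (i + i′)) + (+ 2 * (+ 11 * a + x - e + + 24 * h₁ - + 12 * h₃ - i + (+ 11 * a′ + x′ - e′ + + 24 * h₁′ - + 12 * h₃′ - i′)) +
            + 6 * (a + a′ + + 2 * (x + x′ + (e + e′) + + 2 * + 3 - (i + i′)) + + 8) + + 3 * (+ 8 * (h₃ + h₃′ + + 5)) + + 4 * (e + e′))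
        lem = solve-∀

    height-2-odd : ∀ {n} {T : Vec LatticePoint n} {y₀} → Problem T A B c₁ c₃ → Extent T y₀ 2 → OddRow y₀ → Verdict A B
    height-2-odd {T = T} {y₀} P E (η , odd) = inj₁ (interior , bounded)
      where
      open Situation P E
      per-side : ∀ {T : Vec LatticePoint _} (b : Boundary T y₀ 2) → let open Boundary b in x₀ + + 2 * (+ 2 * half b 1) + end x₀ edges ≤ 1ℤ * boundary-area b
      per-side b = area-3 b ≤-refl (reach-1 (reach-cast (sym (+-identityʳ y₀)) (reach-bottom b))) (reach-1 (reach-half b 1 (s≤s z≤n))) (reach-1 (reach-top b))
      c₁≡ : + c₁ ≡ half right 1 + half left 1 + 1ℤ + 0ℤ
      c₁≡ = rows-count 0 1 1 η ℕ.≤-refl (trans (cong (_+ 1ℤ) (*-identityˡ y₀)) odd) (s≤s (s≤s (s≤s z≤n))) (s≤s (s≤s (s≤s z≤n))) count₁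
      total : W + + 4 * (+ c₁ - 1ℤ) ≤ A
      total = subst₂ (λ A c → W + + 4 * (c - 1ℤ) ≤ A) (sym area) (sym c₁≡) (≤-by (per-side right ⊕ per-side left)
        (lem rx lx re le (half right 1) (half left 1) (boundary-area right) (boundary-area left)))
        where
        lem : ∀ x x′ e e′ h h′ a a′ → a + a′ + (x + + 2 * (+ 2 * h) + e + (x′ + + 2 * (+ 2 * h′) + e′)) ≡ x + x′ + (e + e′) + + 4 * (h + h′ + 1ℤ + 0ℤ - 1ℤ) + (1ℤ * a + 1ℤ * a′)
        lem = solve-∀
      interior : + 2 * B + 1ℤ ≤ A + + 8
      interior = ≤-by (_⊗_ {+ 2} (+m-nonneg 2) total ⊕ eq-≤ (sym poly₁) ⊕ _⊗_ {+ 2} (+m-nonneg 2) W≥0 ⊕ +m-nonneg 7) (lem A B W (+ c₁))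
        where
        lem : ∀ A B W c → A + + 8 + (+ 2 * (W + + 4 * (c - 1ℤ)) + (A + + 2 * B + + 8) + + 2 * 0ℤ + 0ℤ) ≡ + 2 * B + 1ℤ + (+ 2 * A + + 8 * c + + 2 * W + + 7)
        lem = solve-∀
      bounded : + 4 * B ≤ A + + 36
      bounded = ≤-by (_⊗_ {+ 2} (+m-nonneg 2) total ⊕ eq-≤ (sym poly₁) ⊕ _⊗_ {+ 2} (+m-nonneg 2) B≤ ⊕ +m-nonneg 28) (lem A B W (+ c₁))
        where
        lem : ∀ A B W c → A + + 36 + (+ 2 * (W + + 4 * (c - 1ℤ)) + (A + + 2 * B + + 8) + + 2 * B + 0ℤ) ≡ + 4 * B + (+ 2 * A + + 8 * c + + 2 * (W + + 2 * + 2) + + 28)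
        lem = solve-∀

    height-4-odd : ∀ {n} {T : Vec LatticePoint n} {y₀} (P : Problem T A B c₁ c₃) (E : Extent T y₀ 4) → OddRow y₀ →
      Wide A 4 (width (sides E)) → A + + 8 ≤ + 2 * B → ⊥
    height-4-odd {T = T} {y₀} P E (η , odd) (_ , wide) i≤0 = absurd-≤ {1ℤ} {0ℤ} contradiction refl
      where
      open Situation P E
      per-side : ∀ {T : Vec LatticePoint _} (b : Boundary T y₀ 4) → let open Boundary b in
        + 2 * x₀ + + 2 * (+ 2 * (+ 2 * half b 1)) + + 2 * (+ 2 * half b 1 + + 2 * half b 3) + + 2 * (+ 2 * (+ 2 * half b 3)) + + 2 * end x₀ edges ≤ + 2 * boundary-area b
      per-side b = area-5 b (1≤+suc 1) (reach-double (reach-cast (sym (+-identityʳ y₀)) (reach-bottom b))) (reach-double r₁) (reach-between y₀ 1 2 3 refl r₁ r₃) (reach-double r₃) (reach-double (reach-top b))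
        where
        r₁ = reach-half b 1 (s≤s z≤n)
        r₃ = reach-half b 3 (s≤s (s≤s (s≤s z≤n)))
      c₁≡ : + c₁ ≡ half right 1 + half left 1 + 1ℤ + (half right 3 + half left 3 + 1ℤ + 0ℤ)
      c₁≡ = rows-count 0 2 1 η ℕ.≤-refl (trans (cong (_+ 1ℤ) (*-identityˡ y₀)) odd) (s≤s (s≤s (s≤s (s≤s (s≤s z≤n))))) (s≤s (s≤s (s≤s (s≤s (s≤s z≤n))))) count₁
      total : W + + 6 * (+ c₁ - + 2) ≤ A
      total = subst₂ (λ A c → W + + 6 * (c - + 2) ≤ A) (sym area) (sym c₁≡) (cancel-≤ {+ 2} (1≤+suc 1) (≤-by (per-side right ⊕ per-side left)
        (lem rx lx re le (half right 1) (half left 1) (half right 3) (half left 3) (boundary-area right) (boundary-area left))))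
        where
        lem : ∀ x x′ e e′ h h′ k k′ a a′ → + 2 * (a + a′) + (+ 2 * x + + 2 * (+ 2 * (+ 2 * h)) + + 2 * (+ 2 * h + + 2 * k) + + 2 * (+ 2 * (+ 2 * k)) + + 2 * e +
          (+ 2 * x′ + + 2 * (+ 2 * (+ 2 * h′)) + + 2 * (+ 2 * h′ + + 2 * k′) + + 2 * (+ 2 * (+ 2 * k′)) + + 2 * e′)) ≡
          + 2 * (x + x′ + (e + e′) + + 6 * (h + h′ + 1ℤ + (k + k′ + 1ℤ + 0ℤ) - + 2)) + (+ 2 * a + + 2 * a′)
        lem = solve-∀
      contradiction : 1ℤ ≤ 0ℤ
      contradiction = cancel-≤ {+ 16} (1≤+suc 15) (≤-by (_⊗_ {+ 4} (+m-nonneg 4) total ⊕ _⊗_ {+ 3} (+m-nonneg 3) (eq-≤ (sym poly₁)) ⊕ _⊗_ {+ 3} (+m-nonneg 3) i≤0 ⊕ wide ⊕ _⊗_ {+ 8} (+m-nonneg 8) W≥0) (lem A B W (+ c₁)))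
        where
        lem : ∀ A B W c → + 16 * 0ℤ + (+ 4 * (W + + 6 * (c - + 2)) + + 3 * (A + + 2 * B + + 8) + + 3 * (A + + 8) + (+ 4 * + 4 + + 4 * W) + + 8 * 0ℤ) ≡
          + 16 * 1ℤ + (+ 4 * A + + 3 * (+ 8 * c) + + 3 * (+ 2 * B) + + 2 * A + + 8 * W)
        lem = solve-∀

module EvenHeights where

  open Inequalities
  open Hulls
  open Chains
  open ScaledRows
  open Counting
  open EvenDilates
  open Problems
  open AreaBounds
  open Reduction
  open Situations
  open Heights
  open import Defs
  open import Data.Nat as ℕ using (ℕ; suc; z≤n; s≤s)
  import Data.Nat.Properties as ℕ
  open import Data.Integer hiding (suc)
  open import Data.Integer.Properties
  open import Data.Integer.Tactic.RingSolver using (solve-∀)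
  open import Data.Product using (_×_; _,_; Σ; proj₁; proj₂)
  open import Data.Sum using (_⊎_; inj₁; inj₂)
  open import Data.Empty using (⊥)
  open import Data.List using ([]; _∷_)
  open import Data.Vec using (Vec; map; []; _∷_)
  open import Data.Vec.Relation.Unary.All as All using ([]; _∷_)
  open import Data.Vec.Membership.Propositional using (_∈_)
  open import Data.Vec.Membership.Propositional.Properties using (∈-map⁺)
  open import Data.Vec.Relation.Unary.Any using (here; there)
  open import Function.Bundles using (Equivalence)
  open import Relation.Binary.PropositionalEquality hiding (J)

  module _ {n} {T : Vec LatticePoint n} where

    hull-between : ∀ {a b x y K} → b ≤ x → x ≤ a → Hull T b y K → Hull T a y K → Hull T x y K
    hull-between {a} {b} {x} {y} {K} b≤x x≤a hb ha with split-≤ (a - x + (x - b)) 0ℤ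
    ... | inj₁ degenerate = hull-cast (≤-antisym (≤-by (degenerate ⊕ b≤x) (lem a b x)) x≤a) refl refl ha
      where
      lem : ∀ a b x → x + (a - x + (x - b) + b) ≡ a + (0ℤ + x)
      lem = solve-∀
    ... | inj₂ wide = hull-unscale (a - x + (x - b)) wide (hull-cast (lem₁ a b x) (lem₂ a b x y) refl (hull-mix (a - x) (x - b) (difference x≤a) (difference b≤x) wide hb ha))
      where
      lem₁ : ∀ a b x → (a - x) * b + (x - b) * a ≡ (a - x + (x - b)) * x
      lem₁ = solve-∀
      lem₂ : ∀ a b x y → (a - x) * y + (x - b) * y ≡ (a - x + (x - b)) * y
      lem₂ = solve-∀

    -- A lattice point in the row halfway between two rows of the hull.
    hull-halfway : ∀ {a b a′ b′ x y} → b + b′ ≤ + 2 * x → + 2 * x ≤ a + a′ →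
      Hull T b y 1ℤ → Hull T a y 1ℤ → Hull T b′ (y + + 2) 1ℤ → Hull T a′ (y + + 2) 1ℤ → Hull T x (y + + 1) 1ℤ
    hull-halfway {a} {b} {a′} {b′} {x} {y} lo hi hb ha hb′ ha′ = hull-unscale (+ 2) (1≤+suc 1) (hull-between lo hi (mid b b′ hb hb′) (mid a a′ ha ha′))
      where
      mid : ∀ u v → Hull T u y 1ℤ → Hull T v (y + + 2) 1ℤ → Hull T (u + v) (+ 2 * (y + + 1)) (+ 2 * 1ℤ)
      mid u v h h′ = hull-cast (lem₁ u v) (lem₂ y) refl (hull-mix 1ℤ 1ℤ (+m-nonneg 1) (+m-nonneg 1) (1≤+suc 1) h h′)
        where
        lem₁ : ∀ u v → 1ℤ * u + 1ℤ * v ≡ u + v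
        lem₁ = solve-∀
        lem₂ : ∀ y → 1ℤ * y + 1ℤ * (y + + 2) ≡ + 2 * (y + + 1)
        lem₂ = solve-∀

  exact : ∀ {a b} → b - a ≡ 0ℤ → b ≡ a
  exact {a} {b} eq = +-cancelˡ (- a) (trans (+-comm (- a) b) (trans eq (sym (+-inverseˡ a))))

  tight₂ : ∀ {a b a′ b′} → a ≤ a′ → b ≤ b′ → a′ + b′ ≤ a + b → a′ ≡ a × b′ ≡ b
  tight₂ {a} {b} {a′} {b′} p q r = ≤-antisym (≤-by (r ⊕ q) (lem a b a′ b′)) p , ≤-antisym (≤-by (r ⊕ p) (lem′ a b a′ b′)) q
    where
    lem : ∀ a b a′ b′ → a + (a′ + b′ + b) ≡ a′ + (a + b + b′)
    lem = solve-∀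
    lem′ : ∀ a b a′ b′ → b + (a′ + b′ + a) ≡ b′ + (a + b + a′)
    lem′ = solve-∀

  tight₄ : ∀ {a b c d a′ b′ c′ d′} → a ≤ a′ → b ≤ b′ → c ≤ c′ → d ≤ d′ → a′ + b′ + (c′ + d′) ≤ a + b + (c + d) → (a′ ≡ a × b′ ≡ b) × (c′ ≡ c × d′ ≡ d)
  tight₄ p q r s le with tight₂ (p ⊕ q) (r ⊕ s) le
  ... | u , v = tight₂ p q (≤-reflexive u) , tight₂ r s (≤-reflexive v)

  corner : ∀ {m} {U : Vec LatticePoint m} {x y X Y} → (x , y) ∈ U → X ≡ + 2 * x → Y ≡ + 2 * y → Hull (map double U) X Y 1ℤ
  corner u∈ refl refl = hull-vertex (∈-map⁺ double u∈)

  negate : ∀ {x y} → x ≡ + 2 * y → - x ≡ + 2 * - y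
  negate {y = y} refl = neg-distribʳ-* (+ 2) y

  neg-flip : ∀ {a b} → - a ≤ b → - b ≤ a
  neg-flip {a} {b} le = ≤-by le (trans (+-inverseʳ a) (sym (+-inverseˡ b)))

  neg-flip₂ : ∀ {a} b c → + 2 * - a ≤ b + c → - b + - c ≤ + 2 * a
  neg-flip₂ {a} b c le = ≤-by le (lem a b c)
    where
    lem : ∀ a b c → + 2 * a + + 2 * - a ≡ - b + - c + (b + c)
    lem = solve-∀

  row-of : ∀ {n} {T : Vec LatticePoint n} {y₀ p a b} → Extent T y₀ p → (a , b) ∈ T → Σ ℕ λ j → j ℕ.≤ p × b ≡ y₀ + + j
  row-of {y₀ = y₀} {p} {a} {b} E u∈ = ∣ b - y₀ ∣ , drop‿+≤+ (≤-trans (≤-reflexive j≡) (≤-by (Extent.high E _ u∈) (lem b y₀ (+ p)))) , trans (lem′ b y₀) (cong (λ s → y₀ + s) (sym j≡))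
    where
    j≡ : + ∣ b - y₀ ∣ ≡ b - y₀
    j≡ = 0≤i⇒+∣i∣≡i (difference (Extent.low E _ u∈))
    lem : ∀ b y p → p + b ≡ b - y + (y + p)
    lem = solve-∀
    lem′ : ∀ b y → b ≡ y + (b - y)
    lem′ = solve-∀

  by-rows-2 : ∀ {n} {T : Vec LatticePoint n} {y₀} → Extent T y₀ 2 → (Q : ℤ → ℤ → Set) →
    (∀ a → (a , y₀ + + 0) ∈ T → Q a (y₀ + + 0)) → (∀ a → (a , y₀ + + 1) ∈ T → Q a (y₀ + + 1)) → (∀ a → (a , y₀ + + 2) ∈ T → Q a (y₀ + + 2)) →
    ∀ u → u ∈ T → Q (proj₁ u) (proj₂ u)
  by-rows-2 E Q q₀ q₁ q₂ (a , _) u∈ with row-of E u∈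
  ... | 0 , _ , refl = q₀ a u∈
  ... | 1 , _ , refl = q₁ a u∈
  ... | 2 , _ , refl = q₂ a u∈
  ... | suc (suc (suc _)) , s≤s (s≤s ()) , _

  by-rows-4 : ∀ {n} {T : Vec LatticePoint n} {y₀} → Extent T y₀ 4 → (Q : ℤ → ℤ → Set) →
    (∀ a → (a , y₀ + + 0) ∈ T → Q a (y₀ + + 0)) → (∀ a → (a , y₀ + + 1) ∈ T → Q a (y₀ + + 1)) → (∀ a → (a , y₀ + + 2) ∈ T → Q a (y₀ + + 2)) →
    (∀ a → (a , y₀ + + 3) ∈ T → Q a (y₀ + + 3)) → (∀ a → (a , y₀ + + 4) ∈ T → Q a (y₀ + + 4)) → ∀ u → u ∈ T → Q (proj₁ u) (proj₂ u)
  by-rows-4 E Q q₀ q₁ q₂ q₃ q₄ (a , _) u∈ with row-of E u∈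
  ... | 0 , _ , refl = q₀ a u∈
  ... | 1 , _ , refl = q₁ a u∈
  ... | 2 , _ , refl = q₂ a u∈
  ... | 3 , _ , refl = q₃ a u∈
  ... | 4 , _ , refl = q₄ a u∈
  ... | suc (suc (suc (suc (suc _)))) , s≤s (s≤s (s≤s (s≤s ()))) , _

  half-count : ∀ {n} {T : Vec LatticePoint n} {A B c₁ c₃} → Problem T A B c₁ c₃ → Σ ℤ λ b → B ≡ + 2 * b × A + + 8 ≡ + 8 * (+ c₁ - b) + + 2 * B
  half-count {A = A} {B} {c₁} {c₃} P = b , even , trans (lem₂ A B) (trans (cong (λ s → s - + 2 * B) (sym poly₁)) (trans (lem₃ (+ c₁) b B) (trans (cong (λ s → + 8 * (+ c₁ - b) + (+ 8 * b - + 2 * s)) even) (trans (lem₄ (+ c₁) b) (cong (λ s → + 8 * (+ c₁ - b) + + 2 * s) (sym even))))))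
    where
    open Problem P
    b = + 9 * + c₁ - + c₃ - + 8 - B
    even : B ≡ + 2 * b
    even = cancel-≡ {+ 4} (1≤+suc 3) (trans (lem A B) (trans (cong₂ (λ x y → + 9 * x - y - + 64 - + 8 * B) (sym poly₁) (sym poly₃)) (lem′ B (+ c₁) (+ c₃))))
      where
      lem : ∀ A B → + 4 * B ≡ + 9 * (A + + 2 * B + + 8) - (+ 9 * A + + 6 * B + + 8) - + 64 - + 8 * B
      lem = solve-∀
      lem′ : ∀ B c d → + 9 * (+ 8 * c) - + 8 * d - + 64 - + 8 * B ≡ + 4 * (+ 2 * (+ 9 * c - d - + 8 - B))
      lem′ = solve-∀
    lem₂ : ∀ A B → A + + 8 ≡ A + + 2 * B + + 8 - + 2 * B
    lem₂ = solve-∀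
    lem₃ : ∀ c b B → + 8 * c - + 2 * B ≡ + 8 * (c - b) + (+ 8 * b - + 2 * B)
    lem₃ = solve-∀
    lem₄ : ∀ c b → + 8 * (c - b) + (+ 8 * b - + 2 * (+ 2 * b)) ≡ + 8 * (c - b) + + 2 * (+ 2 * b)
    lem₄ = solve-∀

  dichotomy : ∀ {A B i} → A + + 8 ≡ + 8 * i + + 2 * B → (+ 2 * B ≤ A) ⊎ (A + + 8 ≤ + 2 * B)
  dichotomy {A} {B} {i} eq = decide (split-≤ i 0ℤ)
    where
    decide : (i ≤ 0ℤ) ⊎ (1ℤ ≤ i) → (+ 2 * B ≤ A) ⊎ (A + + 8 ≤ + 2 * B)
    decide (inj₁ i≤0) = inj₂ (≤-trans (≤-reflexive eq) (≤-trans (+-monoˡ-≤ (+ 2 * B) (_⊗_ {+ 8} {i} {0ℤ} (+m-nonneg 8) i≤0)) (≤-reflexive (+-identityˡ (+ 2 * B)))))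
    decide (inj₂ 1≤i) = inj₁ (≤-by {+ 2 * B} {A} {+ 8} {+ 8 * i} (_⊗_ {+ 8} {1ℤ} {i} (+m-nonneg 8) 1≤i) (trans eq (+-comm (+ 8 * i) (+ 2 * B))))

  interior-dichotomy : ∀ {n} {T : Vec LatticePoint n} {A B c₁ c₃} → Problem T A B c₁ c₃ → (+ 2 * B ≤ A) ⊎ (A + + 8 ≤ + 2 * B)
  interior-dichotomy {A = A} {B} {c₁} P = dichotomy {A} {B} {+ c₁ - proj₁ (half-count P)} (proj₂ (proj₂ (half-count P)))

  module _ {A B c x x′ e e′ : ℤ} where

    few-points : ∀ {h h′ k k′} → + 2 * h ≤ x → + 2 * h′ ≤ x′ → + 2 * k ≤ e → + 2 * k′ ≤ e′ → c ≡ h + h′ + 1ℤ + (k + k′ + 1ℤ + 0ℤ) →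
      + 8 * c ≡ A + + 2 * B + + 8 → A + + 2 * B ≤ + 4 * (x + x′ + (e + e′)) + + 8
    few-points {h} {h′} {k} {k′} p q r s refl poly = ≤-by (_⊗_ {+ 4} (+m-nonneg 4) (p ⊕ q ⊕ r ⊕ s) ⊕ eq-≤ (sym poly)) (lem A B x x′ e e′ h h′ k k′)
      where
      lem : ∀ A B x x′ e e′ h h′ k k′ → + 4 * (x + x′ + (e + e′)) + + 8 + (+ 4 * (+ 2 * h + + 2 * h′ + + 2 * k + + 2 * k′) + (A + + 2 * B + + 8)) ≡
        A + + 2 * B + (+ 4 * (x + x′ + e + e′) + + 8 * (h + h′ + 1ℤ + (k + k′ + 1ℤ + 0ℤ)))
      lem = solve-∀

    collapse-2 : ∀ {h h′ k k′} → + 2 * h ≤ x → + 2 * h′ ≤ x′ → + 2 * k ≤ e → + 2 * k′ ≤ e′ → c ≡ h + h′ + 1ℤ + (k + k′ + 1ℤ + 0ℤ) →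
      + 8 * c ≡ A + + 2 * B + + 8 → A + + 8 ≤ + 2 * B → + 2 * (x + x′ + (e + e′)) ≤ A → (x ≡ + 2 * h × x′ ≡ + 2 * h′) × (e ≡ + 2 * k × e′ ≡ + 2 * k′)
    collapse-2 {h} {h′} {k} {k′} p q r s refl poly le flat =
      tight₄ p q r s (cancel-≤ {+ 4} (1≤+suc 3) (≤-by (le ⊕ _⊗_ {+ 2} (+m-nonneg 2) flat ⊕ eq-≤ (sym poly)) (lem A B x x′ e e′ h h′ k k′)))
      where
      lem : ∀ A B x x′ e e′ h h′ k k′ → + 4 * (+ 2 * h + + 2 * h′ + (+ 2 * k + + 2 * k′)) + (A + + 8 + + 2 * (+ 2 * (x + x′ + (e + e′))) + (A + + 2 * B + + 8)) ≡
        + 4 * (x + x′ + (e + e′)) + (+ 2 * B + + 2 * A + + 8 * (h + h′ + 1ℤ + (k + k′ + 1ℤ + 0ℤ)))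
      lem = solve-∀

    areas-2 : ∀ {a a′} → + 2 * (x + e) ≤ a → + 2 * (x′ + e′) ≤ a′ → A ≡ a + a′ → A + + 8 ≤ + 2 * B → B ≤ x + x′ + (e + e′) + + 2 * + 2 → a ≡ + 2 * (x + e) × a′ ≡ + 2 * (x′ + e′)
    areas-2 {a} {a′} p q refl le B≤ = tight₂ p q (≤-by (le ⊕ _⊗_ {+ 2} (+m-nonneg 2) B≤) (lem B a a′ x x′ e e′))
      where
      lem : ∀ B a a′ x x′ e e′ → + 2 * (x + e) + + 2 * (x′ + e′) + (a + a′ + + 8 + + 2 * B) ≡ a + a′ + (+ 2 * B + + 2 * (x + x′ + (e + e′) + + 2 * + 2))
      lem = solve-∀

    two-irregular : ∀ {i i′} → A + + 2 * B ≤ + 4 * (x + x′ + (e + e′)) + + 8 → + 2 * B ≤ A → B ≡ x + x′ + (e + e′) + + 2 * + 2 - (i + i′) → + 2 ≤ i + i′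
    two-irregular {i} {i′} A≤ 2B≤A refl = cancel-≤ {+ 4} (1≤+suc 3) (≤-by (A≤ ⊕ 2B≤A) (lem A (x + x′ + (e + e′)) (i + i′)))
      where
      lem : ∀ A W i → + 4 * i + (A + + 2 * (W + + 2 * + 2 - i) + + 2 * (W + + 2 * + 2 - i)) ≡ + 4 * + 2 + (+ 4 * W + + 8 + A)
      lem = solve-∀

    too-flat : ∀ {a a′ i i′} → A ≡ a + a′ → a ≡ + 2 * (x + e) → a′ ≡ + 2 * (x′ + e′) → + 2 * B ≤ A → B ≡ x + x′ + (e + e′) + + 2 * + 2 - (i + i′) → i ≤ 1ℤ → i′ ≤ 1ℤ → ⊥
    too-flat {i = i} {i′} refl refl refl 2B≤A refl i≤ i′≤ = absurd-≤ {1ℤ} {0ℤ} (≤-by (2B≤A ⊕ _⊗_ {+ 2} (+m-nonneg 2) (i≤ ⊕ i′≤) ⊕ +m-nonneg 3) (lem x x′ e e′ i i′)) refl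
      where
      lem : ∀ x x′ e e′ i i′ → 0ℤ + (+ 2 * (x + x′ + (e + e′) + + 2 * + 2 - (i + i′)) + + 2 * (i + i′) + 0ℤ) ≡ 1ℤ + (+ 2 * (x + e) + + 2 * (x′ + e′) + + 2 * (1ℤ + 1ℤ) + + 3)
      lem = solve-∀

  module _ {y₀ : ℤ} where

    shapes-2 : ∀ {n} {T : Vec LatticePoint n} (b : Boundary T y₀ 2) → let open Boundary b in
      (irregulars edges ≡ 0ℤ) ⊎ (boundary-area b ≡ + 2 * (x₀ + end x₀ edges) × irregulars edges ≤ 1ℤ)
    shapes-2 (boundary x [] _ _ ())
    shapes-2 (boundary x ((0 , d) ∷ []) _ _ ())
    shapes-2 (boundary x ((0 , d) ∷ (0 , d′) ∷ []) _ _ _) = inj₁ (cong₂ (λ a b → a + (b + 0ℤ)) (none d) (none d′))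
      where
      none : ∀ d → irregular (0 , d) ≡ 0ℤ
      none d = ≤-antisym (irregular-≤ 0 d) (irregular-nonneg (0 , d))
    shapes-2 (boundary x ((0 , d) ∷ (0 , d′) ∷ (_ , _) ∷ _) _ _ ())
    shapes-2 (boundary x ((0 , d) ∷ (suc n , d′) ∷ es) _ _ ())
    shapes-2 (boundary x ((1 , d) ∷ []) _ _ _) = inj₂ (lem x d , ≤-trans (≤-reflexive (+-identityʳ _)) (irregular-≤ 1 d))
      where
      lem : ∀ x d → + 2 * (+ 2 * x + d) + 0ℤ ≡ + 2 * (x + (x + d))
      lem = solve-∀
    shapes-2 (boundary x ((1 , d) ∷ (_ , _) ∷ _) _ _ ())
    shapes-2 (boundary x ((suc (suc n) , d) ∷ es) _ _ ())

    irregulars-2 : ∀ {n} {T : Vec LatticePoint n} (b : Boundary T y₀ 2) → irregulars (Boundary.edges b) ≤ 1ℤ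
    irregulars-2 b with shapes-2 b
    ... | inj₁ none = ≤-trans (≤-reflexive none) (+m-nonneg 1)
    ... | inj₂ (_ , le) = le

    row-1-of-2 : ∀ {n} {T : Vec LatticePoint n} (b : Boundary T y₀ 2) → let open Boundary b in boundary-area b ≡ + 2 * (x₀ + end x₀ edges) →
      ∀ {a} → Hull T a (y₀ + + 1) 1ℤ → + 2 * a ≤ x₀ + end x₀ edges
    row-1-of-2 b area≡ {a} h = cancel-≤ {+ 2} (1≤+suc 1) (≤-by (area-3 b (1≤+suc 1) (reach-double (reach-cast (sym (+-identityʳ y₀)) (reach-bottom b))) (reach-double (reach-hull h)) (reach-double (reach-top b)) ⊕ _⊗_ {+ 2} (+m-nonneg 2) (eq-≤ area≡))
      (lem a (Boundary.x₀ b) (end (Boundary.x₀ b) (Boundary.edges b)) (boundary-area b)))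
      where
      lem : ∀ a x e A → + 2 * (x + e) + (+ 2 * x + + 2 * (+ 2 * a) + + 2 * e + + 2 * A) ≡ + 2 * (+ 2 * a) + (+ 2 * A + + 2 * (+ 2 * (x + e)))
      lem = solve-∀

    middle-reach : ∀ {n} {T : Vec LatticePoint n} (b : Boundary T y₀ 4) → Reach T 1ℤ (y₀ + + 2) (+ 2 * half b 2)
    middle-reach b = reach-half b 2 (s≤s (s≤s z≤n))
    bottom-reach : ∀ {n} {T : Vec LatticePoint n} (b : Boundary T y₀ 4) → Reach T 1ℤ (y₀ + 0ℤ) (Boundary.x₀ b)
    bottom-reach b = reach-cast (sym (+-identityʳ y₀)) (reach-bottom b)
    Side : ∀ {n} {T : Vec LatticePoint n} → Boundary T y₀ 4 → ℤ
    Side b = + 2 * Boundary.x₀ b + + 2 * end (Boundary.x₀ b) (Boundary.edges b) + + 8 * half b 2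
    side-area : ∀ {n} {T : Vec LatticePoint n} (b : Boundary T y₀ 4) → Side b ≤ boundary-area b
    side-area b = cancel-≤ {+ 2} (1≤+suc 1) (≤-by (area-5 b (1≤+suc 1) (reach-double (bottom-reach b)) (reach-between y₀ 0 1 2 refl (bottom-reach b) (middle-reach b))
        (reach-double (middle-reach b)) (reach-between y₀ 2 3 4 refl (middle-reach b) (reach-top b)) (reach-double (reach-top b)))
      (lem (Boundary.x₀ b) (end (Boundary.x₀ b) (Boundary.edges b)) (half b 2) (boundary-area b)))
      where
      lem : ∀ x e h A → + 2 * A + (+ 2 * x + + 2 * (x + + 2 * h) + + 2 * (+ 2 * (+ 2 * h)) + + 2 * (+ 2 * h + e) + + 2 * e) ≡ + 2 * (+ 2 * x + + 2 * e + + 8 * h) + + 2 * A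
      lem = solve-∀

    module RowsOfFour {n} {T : Vec LatticePoint n} (b : Boundary T y₀ 4) (area≡ : boundary-area b ≡ Side b) where
      x e h : ℤ
      x = Boundary.x₀ b
      e = end x (Boundary.edges b)
      h = half b 2
      full : + 2 * boundary-area b ≤ + 2 * Side b
      full = _⊗_ {+ 2} (+m-nonneg 2) (eq-≤ area≡)
      row-1 : ∀ {a} → Hull T a (y₀ + + 1) 1ℤ → + 2 * a ≤ x + + 2 * h
      row-1 {a} p = cancel-≤ {+ 2} (1≤+suc 1) (≤-by (area-5 b (1≤+suc 1) (reach-double (bottom-reach b)) (reach-double (reach-hull p))
          (reach-double (middle-reach b)) (reach-between y₀ 2 3 4 refl (middle-reach b) (reach-top b)) (reach-double (reach-top b)) ⊕ full) (lem a x e h (boundary-area b)))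
        where
        lem : ∀ a x e h A → + 2 * (x + + 2 * h) + (+ 2 * x + + 2 * (+ 2 * a) + + 2 * (+ 2 * (+ 2 * h)) + + 2 * (+ 2 * h + e) + + 2 * e + + 2 * A) ≡ + 2 * (+ 2 * a) + (+ 2 * A + + 2 * (+ 2 * x + + 2 * e + + 8 * h))
        lem = solve-∀
      row-2 : ∀ {a} → Hull T a (y₀ + + 2) 1ℤ → a ≤ + 2 * h
      row-2 {a} p = cancel-≤ {+ 8} (1≤+suc 7) (≤-by (area-5 b (1≤+suc 1) (reach-double (bottom-reach b)) (reach-between y₀ 0 1 2 refl (bottom-reach b) (reach-hull p))
          (reach-double (reach-hull p)) (reach-between y₀ 2 3 4 refl (reach-hull p) (reach-top b)) (reach-double (reach-top b)) ⊕ full) (lem a x e h (boundary-area b)))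
        where
        lem : ∀ a x e h A → + 8 * (+ 2 * h) + (+ 2 * x + + 2 * (x + a) + + 2 * (+ 2 * a) + + 2 * (a + e) + + 2 * e + + 2 * A) ≡ + 8 * a + (+ 2 * A + + 2 * (+ 2 * x + + 2 * e + + 8 * h))
        lem = solve-∀
      row-3 : ∀ {a} → Hull T a (y₀ + + 3) 1ℤ → + 2 * a ≤ + 2 * h + e
      row-3 {a} p = cancel-≤ {+ 2} (1≤+suc 1) (≤-by (area-5 b (1≤+suc 1) (reach-double (bottom-reach b)) (reach-between y₀ 0 1 2 refl (bottom-reach b) (middle-reach b))
          (reach-double (middle-reach b)) (reach-double (reach-hull p)) (reach-double (reach-top b)) ⊕ full) (lem a x e h (boundary-area b)))
        where
        lem : ∀ a x e h A → + 2 * (+ 2 * h + e) + (+ 2 * x + + 2 * (x + + 2 * h) + + 2 * (+ 2 * (+ 2 * h)) + + 2 * (+ 2 * a) + + 2 * e + + 2 * A) ≡ + 2 * (+ 2 * a) + (+ 2 * A + + 2 * (+ 2 * x + + 2 * e + + 8 * h))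
        lem = solve-∀

  module _ {A B c x x′ e e′ m m′ : ℤ} where

    middle-4 : ∀ {a a′} → + 2 * x + + 2 * e + + 8 * m ≤ a → + 2 * x′ + + 2 * e′ + + 8 * m′ ≤ a′ → A ≡ a + a′ → A ≤ + 2 * (x + x′ + (e + e′)) + + 8 → m + m′ ≤ 1ℤ
    middle-4 {a} {a′} p q refl A≤ = cancel-≤ {+ 8} {m + m′} {1ℤ} (1≤+suc 7) (≤-by {+ 8 * (m + m′)} {+ 8} (p ⊕ q ⊕ A≤) (lem a a′ x x′ e e′ m m′))
      where
      lem : ∀ a a′ x x′ e e′ m m′ → + 8 + (+ 2 * x + + 2 * e + + 8 * m + (+ 2 * x′ + + 2 * e′ + + 8 * m′) + (a + a′)) ≡
        + 8 * (m + m′) + (a + a′ + (+ 2 * (x + x′ + (e + e′)) + + 8))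
      lem = solve-∀

    areas-4 : ∀ {a a′} → + 2 * x + + 2 * e + + 8 * m ≤ a → + 2 * x′ + + 2 * e′ + + 8 * m′ ≤ a′ → A ≡ a + a′ → A ≤ + 2 * (x + x′ + (e + e′)) + + 8 → m + m′ ≡ 1ℤ →
      a ≡ + 2 * x + + 2 * e + + 8 * m × a′ ≡ + 2 * x′ + + 2 * e′ + + 8 * m′
    areas-4 {a} {a′} p q refl A≤ m+m′≡1 = tight₂ p q (≤-trans A≤ (≤-reflexive (trans (cong (λ s → + 2 * (x + x′ + (e + e′)) + + 8 * s) (sym m+m′≡1)) (lem x x′ e e′ m m′))))
      where
      lem : ∀ x x′ e e′ m m′ → + 2 * (x + x′ + (e + e′)) + + 8 * (m + m′) ≡ + 2 * x + + 2 * e + + 8 * m + (+ 2 * x′ + + 2 * e′ + + 8 * m′)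
      lem = solve-∀

    collapse-4 : ∀ {h h′ k k′} → + 2 * h ≤ x → + 2 * h′ ≤ x′ → + 2 * k ≤ e → + 2 * k′ ≤ e′ → m + m′ ≤ 1ℤ →
      c ≡ h + h′ + 1ℤ + (m + m′ + 1ℤ + (k + k′ + 1ℤ + 0ℤ)) → + 8 * c ≡ A + + 2 * B + + 8 → + 2 * (x + x′ + (e + e′)) + + 8 ≤ A → B ≡ x + x′ + (e + e′) + + 8 →
      ((x ≡ + 2 * h × x′ ≡ + 2 * h′) × (e ≡ + 2 * k × e′ ≡ + 2 * k′)) × m + m′ ≡ 1ℤ
    collapse-4 {h} {h′} {k} {k′} p q r s middle refl poly A≥ refl = finish (tight₂ {b′ = + 2 * (1ℤ - (m + m′))} (p ⊕ q ⊕ (r ⊕ s)) (_⊗_ {+ 2} (+m-nonneg 2) (difference middle)) total)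
      where
      H S slack : ℤ
      H = + 2 * h + + 2 * h′ + (+ 2 * k + + 2 * k′)
      S = x + x′ + (e + e′)
      slack = + 2 * (1ℤ - (m + m′))
      total : S + slack ≤ H + 0ℤ
      total = cancel-≤ {+ 4} {S + slack} {H + 0ℤ} (1≤+suc 3) (≤-by (A≥ ⊕ eq-≤ (sym poly)) (lem A S h h′ k k′ m m′))
        where
        lem : ∀ A S h h′ k k′ m m′ → + 4 * (+ 2 * h + + 2 * h′ + (+ 2 * k + + 2 * k′) + 0ℤ) + (+ 2 * S + + 8 + (A + + 2 * (S + + 8) + + 8)) ≡
          + 4 * (S + + 2 * (1ℤ - (m + m′))) + (A + + 8 * (h + h′ + 1ℤ + (m + m′ + 1ℤ + (k + k′ + 1ℤ + 0ℤ))))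
        lem = solve-∀
      finish : S ≡ H × slack ≡ 0ℤ → ((x ≡ + 2 * h × x′ ≡ + 2 * h′) × (e ≡ + 2 * k × e′ ≡ + 2 * k′)) × m + m′ ≡ 1ℤ
      finish (u , v) = tight₄ p q r s (≤-reflexive u) , sym (exact (cancel-≡ {+ 2} {1ℤ - (m + m′)} {0ℤ} (1≤+suc 1) v))

  module _ {A B : ℤ} {c₁ c₃ : ℕ} where

    height-2-even : ∀ {n} {T : Vec LatticePoint n} {y₀} → Problem T A B c₁ c₃ → Extent T y₀ 2 → EvenRow y₀ → ⊥
    height-2-even {T = T} {y₀} P E (η , even) = decide (interior-dichotomy P)
      where
      open Situation P E renaming (le to le′)
      c₁≡ : + c₁ ≡ half right 0 + half left 0 + 1ℤ + (half right 2 + half left 2 + 1ℤ + 0ℤ)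
      c₁≡ = rows-count 0 2 0 (1ℤ * η) z≤n (even-start 1 even) (s≤s (s≤s (s≤s z≤n))) (s≤s (s≤s (s≤s (s≤s z≤n)))) count₁
      A≤ : A + + 2 * B ≤ + 4 * W + + 8
      A≤ = few-points {A = A} {B = B} {c = + c₁} {x = rx} {x′ = lx} {e = re} {e′ = le′} {h = half right 0} {h′ = half left 0} {k = half right 2} {k′ = half left 2} (half-bottom right) (half-bottom left) (half-top right) (half-top left) c₁≡ poly₁
      interior-point : + 2 * B ≤ A → ⊥
      interior-point 2B≤A = cases (shapes-2 right) (shapes-2 left)
        where
        i i′ : ℤ
        i = irregulars R.edges
        i′ = irregulars L.edges
        two : + 2 ≤ i + i′
        two = two-irregular {A = A} {B = B} {c = + c₁} {x = rx} {x′ = lx} {e = re} {e′ = le′} {i = i} {i′ = i′} A≤ 2B≤A count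
        cases : (i ≡ 0ℤ) ⊎ (boundary-area right ≡ + 2 * (rx + re) × i ≤ 1ℤ) → (i′ ≡ 0ℤ) ⊎ (boundary-area left ≡ + 2 * (lx + le′) × i′ ≤ 1ℤ) → ⊥
        cases (inj₁ none) _ = absurd-≤ {+ 2} {1ℤ} (≤-trans two (≤-trans (≤-reflexive (trans (cong (_+ i′) none) (+-identityˡ i′))) (irregulars-2 left))) refl
        cases (inj₂ _) (inj₁ none) = absurd-≤ {+ 2} {1ℤ} (≤-trans two (≤-trans (≤-reflexive (trans (cong (λ s → i + s) none) (+-identityʳ i))) (irregulars-2 right))) refl
        cases (inj₂ (aR≡ , i≤)) (inj₂ (aL≡ , i′≤)) = too-flat {A = A} {B = B} {c = + c₁} {x = rx} {x′ = lx} {e = re} {e′ = le′} {i = i} {i′ = i′} area aR≡ aL≡ 2B≤A count i≤ i′≤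
      no-interior-point : A + + 8 ≤ + 2 * B → ⊥
      no-interior-point le = uneven (4 , U , inner , outer)
        where
        corners : (rx ≡ + 2 * half right 0 × lx ≡ + 2 * half left 0) × (re ≡ + 2 * half right 2 × le′ ≡ + 2 * half left 2)
        corners = collapse-2 {A = A} {B = B} {c = + c₁} {x = rx} {x′ = lx} {e = re} {e′ = le′} {h = half right 0} {h′ = half left 0} {k = half right 2} {k′ = half left 2} (half-bottom right) (half-bottom left) (half-top right) (half-top left) c₁≡ poly₁ le (≤-trans (parallelogram-area s) (≤-reflexive (sym (area≡ P s))))
        rx≡ : rx ≡ + 2 * half right 0
        rx≡ = proj₁ (proj₁ corners)
        lx≡ : lx ≡ + 2 * half left 0
        lx≡ = proj₂ (proj₁ corners)
        re≡ : re ≡ + 2 * half right 2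
        re≡ = proj₁ (proj₂ corners)
        le≡ : le′ ≡ + 2 * half left 2
        le≡ = proj₂ (proj₂ corners)
        areas : boundary-area right ≡ + 2 * (rx + re) × boundary-area left ≡ + 2 * (lx + le′)
        areas = areas-2 {A = A} {B = B} {c = + c₁} {x = rx} {x′ = lx} {e = re} {e′ = le′} (area-linear right (bottom-hull right) (top-hull right)) (area-linear left (bottom-hull left) (top-hull left)) area le B≤
        U : Vec LatticePoint 4
        U = (half right 0 , η) ∷ (- half left 0 , η) ∷ (half right 2 , η + 1ℤ) ∷ (- half left 2 , η + 1ℤ) ∷ []
        top-row : y₀ + + 2 ≡ + 2 * (η + 1ℤ)
        top-row = trans (cong (_+ + 2) even) (lem η)
          where
          lem : ∀ η → + 2 * η + + 2 ≡ + 2 * (η + 1ℤ)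
          lem = solve-∀
        inner : ∀ u → u ∈ U → Dilate T 1ℤ u
        inner _ = All.lookup {P = Dilate T 1ℤ} (
          hull-cast rx≡ even refl (bottom-hull right) ∷
          hull-cast (negate lx≡) even refl (hull-unflip (bottom-hull left)) ∷
          hull-cast re≡ top-row refl (top-hull right) ∷
          hull-cast (negate le≡) top-row refl (hull-unflip (top-hull left)) ∷ [])
        cr : Hull (map double U) rx y₀ 1ℤ
        cr = corner {U = U} (here refl) rx≡ even
        cl : Hull (map double U) (- lx) y₀ 1ℤ
        cl = corner {U = U} (there (here refl)) (negate lx≡) even
        cr′ : Hull (map double U) re (y₀ + + 2) 1ℤ
        cr′ = corner {U = U} (there (there (here refl))) re≡ top-row
        cl′ : Hull (map double U) (- le′) (y₀ + + 2) 1ℤ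
        cl′ = corner {U = U} (there (there (there (here refl)))) (negate le≡) top-row
        Target : ℤ → ℤ → Set
        Target a b = Hull (map double U) a b 1ℤ
        on-0 : ∀ a → (a , y₀ + + 0) ∈ T → Target a (y₀ + + 0)
        on-0 a u∈ = hull-cast refl (sym (+-identityʳ y₀)) refl (hull-between (neg-flip (vertex-bound (bottom-max left) (hull-flip (hull-cast refl (+-identityʳ y₀) refl (hull-vertex u∈))))) (vertex-bound (bottom-max right) (hull-cast refl (+-identityʳ y₀) refl (hull-vertex u∈))) cl cr)
        on-1 : ∀ a → (a , y₀ + + 1) ∈ T → Target a (y₀ + + 1)
        on-1 a u∈ = hull-halfway (neg-flip₂ lx le′ (row-1-of-2 left (proj₂ areas) (hull-flip (hull-vertex u∈)))) (row-1-of-2 right (proj₁ areas) (hull-vertex u∈)) cl cr cl′ cr′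
        on-2 : ∀ a → (a , y₀ + + 2) ∈ T → Target a (y₀ + + 2)
        on-2 a u∈ = hull-between (neg-flip (vertex-bound (top-max left) (hull-flip (hull-vertex u∈)))) (vertex-bound (top-max right) (hull-vertex u∈)) cl′ cr′
        outer : ∀ u → u ∈ T → Target (proj₁ u) (proj₂ u)
        outer = by-rows-2 E Target on-0 on-1 on-2
      decide : (+ 2 * B ≤ A) ⊎ (A + + 8 ≤ + 2 * B) → ⊥
      decide (inj₁ le) = interior-point le
      decide (inj₂ le) = no-interior-point le

    height-4-even : ∀ {n} {T : Vec LatticePoint n} {y₀} (P : Problem T A B c₁ c₃) (E : Extent T y₀ 4) → EvenRow y₀ →
      Wide A 4 (width (sides E)) → A + + 8 ≤ + 2 * B → ⊥
    height-4-even {T = T} {y₀} P E (η , even) (_ , wide) no-interior = uneven (6 , U , inner , outer)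
      where
      open Situation P E renaming (le to le′)
      m m′ : ℤ
      m = half right 2
      m′ = half left 2
      c₁≡ : + c₁ ≡ half right 0 + half left 0 + 1ℤ + (half right 2 + half left 2 + 1ℤ + (half right 4 + half left 4 + 1ℤ + 0ℤ))
      c₁≡ = rows-count 0 3 0 (1ℤ * η) z≤n (even-start 1 even) (ℕ.n≤1+n 5) ℕ.≤-refl count₁
      B≡ : B ≡ W + + 8
      B≡ = ≤-antisym B≤ (cancel-≤ {+ 4} (1≤+suc 3) (≤-by (wide ⊕ _⊗_ {+ 2} (+m-nonneg 2) no-interior) (lem A B W)))
        where
        lem : ∀ A B W → + 4 * B + (+ 4 * + 4 + + 4 * W + + 2 * (A + + 8)) ≡ + 4 * (W + + 8) + (+ 2 * A + + 2 * (+ 2 * B))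
        lem = solve-∀
      A≤ : A ≤ + 2 * W + + 8
      A≤ = ≤-by (no-interior ⊕ _⊗_ {+ 2} (+m-nonneg 2) (eq-≤ B≡)) (lem A B W)
        where
        lem : ∀ A B W → + 2 * W + + 8 + (A + + 8 + + 2 * B) ≡ A + (+ 2 * B + + 2 * (W + + 8))
        lem = solve-∀
      A≥ : + 2 * W + + 8 ≤ A
      A≥ = cancel-≤ {+ 2} (1≤+suc 1) (≤-by wide (lem A W))
        where
        lem : ∀ A W → + 2 * A + (+ 4 * + 4 + + 4 * W) ≡ + 2 * (+ 2 * W + + 8) + + 2 * A
        lem = solve-∀
      corners : ((rx ≡ + 2 * half right 0 × lx ≡ + 2 * half left 0) × (re ≡ + 2 * half right 4 × le′ ≡ + 2 * half left 4)) × m + m′ ≡ 1ℤ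
      corners = collapse-4 {A = A} {B = B} {c = + c₁} {x = rx} {x′ = lx} {e = re} {e′ = le′} {m = m} {m′ = m′} {h = half right 0} {h′ = half left 0} {k = half right 4} {k′ = half left 4} (half-bottom right) (half-bottom left) (half-top right) (half-top left) (middle-4 {A = A} {B = B} {c = + c₁} {x = rx} {x′ = lx} {e = re} {e′ = le′} {m = m} {m′ = m′} (side-area right) (side-area left) area A≤) c₁≡ poly₁ A≥ B≡
      rx≡ : rx ≡ + 2 * half right 0
      rx≡ = proj₁ (proj₁ (proj₁ corners))
      lx≡ : lx ≡ + 2 * half left 0
      lx≡ = proj₂ (proj₁ (proj₁ corners))
      re≡ : re ≡ + 2 * half right 4
      re≡ = proj₁ (proj₂ (proj₁ corners))
      le≡ : le′ ≡ + 2 * half left 4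
      le≡ = proj₂ (proj₂ (proj₁ corners))
      areas : boundary-area right ≡ Side right × boundary-area left ≡ Side left
      areas = areas-4 {A = A} {B = B} {c = + c₁} {x = rx} {x′ = lx} {e = re} {e′ = le′} {m = m} {m′ = m′} (side-area right) (side-area left) area A≤ (proj₂ corners)
      module RR = RowsOfFour right (proj₁ areas)
      module LL = RowsOfFour left (proj₂ areas)
      U : Vec LatticePoint 6
      U = (half right 0 , η) ∷ (- half left 0 , η) ∷ (m , η + 1ℤ) ∷ (- m′ , η + 1ℤ) ∷ (half right 4 , η + + 2) ∷ (- half left 4 , η + + 2) ∷ []
      mid-row : y₀ + + 2 ≡ + 2 * (η + 1ℤ)
      mid-row = trans (cong (_+ + 2) even) (lem η)
        where
        lem : ∀ η → + 2 * η + + 2 ≡ + 2 * (η + 1ℤ)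
        lem = solve-∀
      top-row : y₀ + + 4 ≡ + 2 * (η + + 2)
      top-row = trans (cong (_+ + 4) even) (lem η)
        where
        lem : ∀ η → + 2 * η + + 4 ≡ + 2 * (η + + 2)
        lem = solve-∀
      range : ∀ {x} → - m′ ≤ x → x ≤ m → Hull T (+ 2 * x) (+ 2 * (η + 1ℤ)) 1ℤ
      range {x} lo hi = hull-cast refl (trans (cong (_+ + 2) (*-identityˡ y₀)) mid-row) refl
        (Equivalence.from (proj₁ (row-range (1≤+suc 1) (boundary-row right 0 1 2 (s≤s (s≤s z≤n))) (boundary-row left 0 1 2 (s≤s (s≤s z≤n)))) x) (lo , hi))
      -m′≤m : - m′ ≤ m
      -m′≤m = ≤-by (eq-≤ (sym (proj₂ corners)) ⊕ +m-nonneg 1) (lem m m′)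
        where
        lem : ∀ m m′ → m + (1ℤ + 0ℤ) ≡ - m′ + (m + m′ + 1ℤ)
        lem = solve-∀
      inner : ∀ u → u ∈ U → Dilate T 1ℤ u
      inner _ = All.lookup {P = Dilate T 1ℤ} (
        hull-cast rx≡ even refl (bottom-hull right) ∷
        hull-cast (negate lx≡) even refl (hull-unflip (bottom-hull left)) ∷
        range -m′≤m ≤-refl ∷
        range ≤-refl -m′≤m ∷
        hull-cast re≡ top-row refl (top-hull right) ∷
        hull-cast (negate le≡) top-row refl (hull-unflip (top-hull left)) ∷ [])
      cr : Hull (map double U) rx y₀ 1ℤ
      cr = corner {U = U} (here refl) rx≡ even
      cl : Hull (map double U) (- lx) y₀ 1ℤ
      cl = corner {U = U} (there (here refl)) (negate lx≡) even
      cr′ : Hull (map double U) (+ 2 * m) (y₀ + + 2) 1ℤ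
      cr′ = corner {U = U} (there (there (here refl))) refl mid-row
      cl′ : Hull (map double U) (- (+ 2 * m′)) (y₀ + + 2) 1ℤ
      cl′ = corner {U = U} (there (there (there (here refl)))) (negate refl) mid-row
      cr″ : Hull (map double U) re (y₀ + + 2 + + 2) 1ℤ
      cr″ = hull-cast refl (sym (+-assoc y₀ (+ 2) (+ 2))) refl (corner {U = U} (there (there (there (there (here refl))))) re≡ top-row)
      cl″ : Hull (map double U) (- le′) (y₀ + + 2 + + 2) 1ℤ
      cl″ = hull-cast refl (sym (+-assoc y₀ (+ 2) (+ 2))) refl (corner {U = U} (there (there (there (there (there (here refl)))))) (negate le≡) top-row)
      Target : ℤ → ℤ → Set
      Target a b = Hull (map double U) a b 1ℤ
      on-0 : ∀ a → (a , y₀ + + 0) ∈ T → Target a (y₀ + + 0)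
      on-0 a u∈ = hull-cast refl (sym (+-identityʳ y₀)) refl (hull-between (neg-flip (vertex-bound (bottom-max left) (hull-flip (hull-cast refl (+-identityʳ y₀) refl (hull-vertex u∈))))) (vertex-bound (bottom-max right) (hull-cast refl (+-identityʳ y₀) refl (hull-vertex u∈))) cl cr)
      on-1 : ∀ a → (a , y₀ + + 1) ∈ T → Target a (y₀ + + 1)
      on-1 a u∈ = hull-halfway (neg-flip₂ lx (+ 2 * m′) (LL.row-1 (hull-flip (hull-vertex u∈)))) (RR.row-1 (hull-vertex u∈)) cl cr cl′ cr′
      on-2 : ∀ a → (a , y₀ + + 2) ∈ T → Target a (y₀ + + 2)
      on-2 a u∈ = hull-between (neg-flip (LL.row-2 (hull-flip (hull-vertex u∈)))) (RR.row-2 (hull-vertex u∈)) cl′ cr′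
      on-3 : ∀ a → (a , y₀ + + 3) ∈ T → Target a (y₀ + + 3)
      on-3 a u∈ = hull-cast refl (+-assoc y₀ (+ 2) (+ 1)) refl (hull-halfway (neg-flip₂ (+ 2 * m′) le′ (LL.row-3 (hull-flip (hull-vertex u∈)))) (RR.row-3 (hull-vertex u∈)) cl′ cr′ cl″ cr″)
      on-4 : ∀ a → (a , y₀ + + 4) ∈ T → Target a (y₀ + + 4)
      on-4 a u∈ = hull-cast refl (+-assoc y₀ (+ 2) (+ 2)) refl (hull-between (neg-flip (vertex-bound (top-max left) (hull-flip (hull-vertex u∈)))) (vertex-bound (top-max right) (hull-vertex u∈)) cl″ cr″)
      outer : ∀ u → u ∈ T → Target (proj₁ u) (proj₂ u)
      outer = by-rows-4 E Target on-0 on-1 on-2 on-3 on-4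

module Verdicts where

  open Inequalities
  open Hulls
  open Chains
  open Counting
  open EvenDilates
  open Problems
  open AreaBounds
  open Reduction
  open Situations
  open Heights
  open EvenHeights
  open import Defs
  open import Data.Nat as ℕ using (ℕ; suc; s≤s)
  import Data.Nat.Properties as ℕ
  open import Data.Integer hiding (suc)
  open import Data.Integer.Properties
  open import Data.Integer.Tactic.RingSolver using (solve-∀)
  open import Data.Product using (_×_; _,_; Σ; proj₂)
  open import Data.Sum using (inj₁; inj₂)
  open import Data.Empty using (⊥-elim)
  open import Data.Vec using (Vec)
  open import Relation.Binary.PropositionalEquality

  module _ {A B : ℤ} {c₁ c₃ : ℕ} where

    odd-flip : ∀ y k η → y + 1ℤ ≡ + 2 * η → - (y + (1ℤ + + 2 * k)) ≡ + 2 * (- η - k)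
    odd-flip y k η eq = trans (lem y k) (trans (cong (λ s → - s - + 2 * k) eq) (lem′ η k))
      where
      lem : ∀ y k → - (y + (1ℤ + + 2 * k)) ≡ - (y + 1ℤ) - + 2 * k
      lem = solve-∀
      lem′ : ∀ η k → - (+ 2 * η) - + 2 * k ≡ + 2 * (- η - k)
      lem′ = solve-∀

    small-verdict : ∀ {n} {T : Vec LatticePoint n} {y₀} p → suc p ℕ.≤ 3 → Problem T A B c₁ c₃ → Extent T y₀ (suc p) → Verdict A B
    small-verdict {y₀ = y₀} 0 _ P E with parity y₀
    ... | inj₁ even = height-1 P E even
    ... | inj₂ (η , odd) = height-1 (problem-act upside-down P) (extent-flip E) (- η - 0ℤ , odd-flip y₀ 0ℤ η odd)
    small-verdict {y₀ = y₀} 1 _ P E with parity y₀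
    ... | inj₁ even = ⊥-elim (height-2-even P E even)
    ... | inj₂ odd = height-2-odd P E odd
    small-verdict {y₀ = y₀} 2 _ P E with parity y₀
    ... | inj₁ even = height-3 P E even
    ... | inj₂ (η , odd) = height-3 (problem-act upside-down P) (extent-flip E) (- η - 1ℤ , odd-flip y₀ 1ℤ η odd)
    small-verdict (suc (suc (suc p))) (s≤s (s≤s (s≤s ())))

    wide-verdict : ∀ {n} {T : Vec LatticePoint n} {y₀} p → 4 ℕ.≤ suc p → (P : Problem T A B c₁ c₃) (E : Extent T y₀ (suc p)) → Wide A (suc p) (width (sides E)) → Verdict A B
    wide-verdict {y₀ = y₀} p 4≤p P E wide@(flat , area) with ℕ.m≤n⇒m<n∨m≡n 4≤p
    ... | inj₁ 5≤p = inj₁ (wide-interior W≥0 (+≤+ 5≤p) area B≤ , wide-count W≥0 (+≤+ 4≤p) flat area B≤)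
      where open Situation P E using (W≥0; B≤)
    ... | inj₂ refl with split-≤ (+ 2 * B + 1ℤ) (A + + 8)
    ...   | inj₁ interior = inj₁ (interior , wide-count W≥0 ≤-refl flat area B≤)
      where open Situation P E using (W≥0; B≤)
    ...   | inj₂ none with parity y₀
    ...     | inj₁ even = ⊥-elim (height-4-even P E even wide (≤-by none (lem A B)))
      where
      lem : ∀ A B → + 2 * B + (1ℤ + (A + + 8)) ≡ A + + 8 + (+ 2 * B + 1ℤ)
      lem = solve-∀
    ...     | inj₂ odd = ⊥-elim (height-4-odd P E odd wide (≤-by none (lem A B)))
      where
      lem : ∀ A B → + 2 * B + (1ℤ + (A + + 8)) ≡ A + + 8 + (+ 2 * B + 1ℤ)
      lem = solve-∀

    verdict : ∀ {n} {T : Vec LatticePoint n} → Problem T A B c₁ c₃ → Verdict A B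
    verdict P with extent (Problem.nondegenerate P)
    ... | y₀ , p , E with reduce (suc p) P E ℕ.≤-refl
    ... | reduced P′ E′ (inj₁ small) = small-verdict _ small P′ E′
    ... | reduced P′ E′ (inj₂ (4≤p , wide)) = wide-verdict _ 4≤p P′ E′ wide

    admissible : ∀ {n} {T : Vec LatticePoint n} → Problem T A B c₁ c₃ → Σ ℕ λ i → Σ ℕ λ b → Admissible i b × B ≡ + 2 * + b × A + + 8 ≡ + 8 * + i + + 2 * B
    admissible P = decide (half-count P) (verdict P)
      where
      3≤B : + 3 ≤ B
      3≤B = Situation.3≤B P (proj₂ (proj₂ (extent (Problem.nondegenerate P))))
      decide : (Σ ℤ λ b → B ≡ + 2 * b × A + + 8 ≡ + 8 * (+ c₁ - b) + + 2 * B) → Verdict A B → _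
      decide (b , B≡ , A≡) v = ∣ i ∣ , ∣ b ∣ , admit v , trans B≡ (cong (λ s → + 2 * s) (sym +b)) , trans A≡ (cong (λ s → + 8 * s + + 2 * B) (sym +i))
        where
        i = + c₁ - b
        2≤b : + 2 ≤ b
        2≤b with split-≤ (+ 2) b
        ... | inj₁ p = p
        ... | inj₂ q = absurd-≤ {1ℤ} {0ℤ} (≤-by (_⊗_ {+ 2} (+m-nonneg 2) q ⊕ 3≤B ⊕ eq-≤ B≡) (lem b B)) refl
          where
          lem : ∀ b B → 0ℤ + (+ 2 * (1ℤ + b) + + 3 + B) ≡ 1ℤ + (+ 2 * + 2 + B + + 2 * b)
          lem = solve-∀
        +b : + ∣ b ∣ ≡ b
        +b = 0≤i⇒+∣i∣≡i (≤-trans (+m-nonneg 2) 2≤b)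
        i≡ : ∀ {j} → A + + 8 ≡ + 8 * j + + 2 * B → i ≡ j
        i≡ {j} eq = cancel-≡ {+ 8} (1≤+suc 7) (+-cancelˡ (+ 2 * B) (trans (+-comm (+ 2 * B) (+ 8 * i)) (trans (trans (sym A≡) eq) (+-comm (+ 8 * j) (+ 2 * B)))))
        1≤i : + 2 * B + 1ℤ ≤ A + + 8 → 1ℤ ≤ i
        1≤i int with split-≤ 1ℤ i
        ... | inj₁ p = p
        ... | inj₂ q = absurd-≤ {1ℤ} {0ℤ} (≤-by (int ⊕ eq-≤ A≡ ⊕ _⊗_ {+ 8} (+m-nonneg 8) q) (lem A B i)) refl
          where
          lem : ∀ A B i → 0ℤ + (+ 2 * B + 1ℤ + (A + + 8) + + 8 * (1ℤ + i)) ≡ 1ℤ + (A + + 8 + (+ 8 * i + + 2 * B) + + 8 * 1ℤ)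
          lem = solve-∀
        0≤i : Verdict A B → 0ℤ ≤ i
        0≤i (inj₁ (int , _)) = weaken (1≤i int)
        0≤i (inj₂ (A≡′ , _)) = eq-≤ (sym (i≡ (trans A≡′ (lem B))))
          where
          lem : ∀ B → + 2 * B ≡ + 8 * 0ℤ + + 2 * B
          lem = solve-∀
        +i : + ∣ i ∣ ≡ i
        +i = 0≤i⇒+∣i∣≡i (0≤i v)
        admit : Verdict A B → Admissible ∣ i ∣ ∣ b ∣
        admit (inj₁ (int , bound)) = inj₂ (drop‿+≤+ (≤-trans (1≤i int) (eq-≤ (sym +i))) , drop‿+≤+ (≤-trans 2≤b (eq-≤ (sym +b))) ,
          drop‿+≤+ (≤-trans (eq-≤ +b) (≤-trans b≤ (eq-≤ (cong (_+ + 7) (trans (cong (λ s → + 2 * s) (sym +i)) (sym (pos-* 2 ∣ i ∣))))))))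
          where
          b≤ : b ≤ + 2 * i + + 7
          b≤ = cancel-≤ {+ 4} (1≤+suc 3) (≤-by (bound ⊕ eq-≤ A≡ ⊕ _⊗_ {+ 2} (+m-nonneg 2) (eq-≤ (sym B≡))) (lem A B b i))
            where
            lem : ∀ A B b i → + 4 * (+ 2 * i + + 7) + (+ 4 * B + (A + + 8) + + 2 * (+ 2 * b)) ≡ + 4 * b + (A + + 36 + (+ 8 * i + + 2 * B) + + 2 * B)
            lem = solve-∀
        admit (inj₂ (A≡′ , B≡6)) = inj₁ (cong ∣_∣ (i≡ {0ℤ} (trans A≡′ (lem B))) , cong ∣_∣ (cancel-≡ {+ 2} {b} {+ 3} (1≤+suc 1) (trans (sym B≡) B≡6)))
          where
          lem : ∀ B → + 2 * B ≡ + 8 * 0ℤ + + 2 * B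
          lem = solve-∀

module Necessity where

  open Inequalities using (1≤+suc; cancel-≡)
  open Convexity
  open Hulls
  open Counting
  open EvenDilates
  open Problems
  open Verdicts
  open import Defs
  open import Data.Nat using (ℕ; suc; z≤n; s≤s)
  open import Data.Integer as ℤ using (ℤ; +_; -[1+_]; 0ℤ; 1ℤ)
  import Data.Integer.Properties as ℤ
  open import Data.Integer.Tactic.RingSolver using (solve-∀)
  open import Data.Rational
  open import Data.Rational.Properties
  open import Data.Rational.Solver using (module +-*-Solver)
  open import Data.Product using (_×_; _,_; Σ; proj₁; proj₂)
  open import Data.Vec using (Vec; []; _∷_; map; zipWith; replicate)
  open import Data.Vec.Properties using (map-∘; map-cong)
  open import Data.Vec.Relation.Unary.All using (All; []; _∷_)
  open import Data.Vec.Relation.Unary.Any using (here; there)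
  open import Data.Vec.Membership.Propositional using (_∈_)
  open import Function.Bundles using (_⇔_; mk⇔; Equivalence)
  open import Relation.Binary.PropositionalEquality

  conv-trans : ∀ {m n} {S : Vec Point m} {V : Vec Point n} {q} → (∀ {s} → s ∈ S → InConv V s) → InConv S q → InConv V q
  conv-trans {n = n} {S = S} {V} sub (w , w≥0 , Σw , refl) with merge w S w≥0 sub
    where
    merge : ∀ {m} (w : Vec ℚ m) (S : Vec Point m) → All (0ℚ ≤_) w → (∀ {s} → s ∈ S → InConv V s) →
      Σ (Vec ℚ _) λ v → All (0ℚ ≤_) v × sumℚ v ≡ sumℚ w × combo v V ≡ combo w S
    merge [] [] [] sub = replicate n 0ℚ , zeros-nonneg n , sumℚ-zeros n , combo-0 V
    merge (a ∷ w) (s ∷ S) (a≥0 ∷ w≥0) sub with sub (here refl) | merge w S w≥0 (λ s∈ → sub (there s∈))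
    ... | u , u≥0 , Σu , eq | v , v≥0 , Σv , eq′ = zipWith _+_ (map (a *_) u) v , nonneg u≥0 v≥0 , total , place
      where
      nonneg : ∀ {n} {u v : Vec ℚ n} → All (0ℚ ≤_) u → All (0ℚ ≤_) v → All (0ℚ ≤_) (zipWith _+_ (map (a *_) u) v)
      nonneg [] [] = []
      nonneg (p ∷ ps) (q ∷ qs) = +-mono-≤ (0≤-* a≥0 p) q ∷ nonneg ps qs
      total : sumℚ (zipWith _+_ (map (a *_) u) v) ≡ a + sumℚ w
      total = trans (sumℚ-+ (map (a *_) u) v) (cong₂ _+_ (trans (sumℚ-* a u) (trans (cong (a *_) Σu) (*-identityʳ a))) Σv)
      place : combo (zipWith _+_ (map (a *_) u) v) V ≡ scale a s +ᵖ combo w S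
      place = trans (combo-+ (map (a *_) u) v V) (cong₂ _+ᵖ_ (trans (combo-* a u V) (cong (scale a) eq)) eq′)
  ... | v , v≥0 , Σv , eq = v , v≥0 , trans Σv Σw , eq

  module _ {m} {S : Vec Point m} where

    private
      2ℚ : ℚ
      2ℚ = ι (+ 2)

    scale-1 : ∀ p → scale 1ℚ p ≡ p
    scale-1 (x , y) = ≡-pair (*-identityˡ x) (*-identityˡ y)

    conv-double : ∀ {p} → InConv S p → InConv (scaledPts 2 S) (scale 2ℚ p)
    conv-double = conv-map (scaling 2ℚ)

    module _ {n} {T : Vec LatticePoint n} (twice : ∀ x → InConv (scaledPts 2 S) x ⇔ InConv (map embed T) x) where

      nondegenerate : HasNonemptyInterior S → Nondegenerate T
      nondegenerate ((c₁ , c₂) , ε , ε>0 , box) α β γ flat with <-dense ε>0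
      ... | δ , δ>0 , δ<ε = vanish (trans (cong₂ _-_ (level (c₁ + δ , c₂) (near c₁) (near-0 c₂)) (level (c₁ , c₂) (near-0 c₁) (near-0 c₂))) (+-inverseʳ (ι γ)))
            (solve 5 (λ a b x y d → a :* (con 2ℚ :* (x :+ d)) :+ b :* (con 2ℚ :* y) :- (a :* (con 2ℚ :* x) :+ b :* (con 2ℚ :* y)) := a :* (con 2ℚ :* d)) refl (ι α) (ι β) c₁ c₂ δ) ,
          vanish (trans (cong₂ _-_ (level (c₁ , c₂ + δ) (near-0 c₁) (near c₂)) (level (c₁ , c₂) (near-0 c₁) (near-0 c₂))) (+-inverseʳ (ι γ)))
            (solve 5 (λ a b x y d → a :* (con 2ℚ :* x) :+ b :* (con 2ℚ :* (y :+ d)) :- (a :* (con 2ℚ :* x) :+ b :* (con 2ℚ :* y)) := b :* (con 2ℚ :* d)) refl (ι α) (ι β) c₁ c₂ δ)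
        where
        open +-*-Solver
        neg-involutive : ∀ x → - - x ≡ x
        neg-involutive = solve 1 (λ x → :- (:- x) := x) refl
        near-0 : ∀ c → ∣ c - c ∣ < ε
        near-0 c = subst (_< ε) (sym (cong ∣_∣ (+-inverseʳ c))) ε>0
        near : ∀ c → ∣ c + δ - c ∣ < ε
        near c = subst (_< ε) (sym (trans (cong ∣_∣ (solve 2 (λ c d → c :+ d :- c := d) refl c δ)) (0≤p⇒∣p∣≡p (<⇒≤ δ>0)))) δ<ε
        functional : ∀ {q} → InConv (map embed T) q → ι α * proj₁ q + ι β * proj₂ q ≡ ι γ
        functional {x , y} q∈ = ≤-antisym (conv-≤ (ι α) (ι β) (ι γ) (λ s∈ → upper (∈-map⁻ s∈)) q∈)
          (subst₂ _≤_ (neg-involutive (ι γ)) (trans (cong -_ (solve 4 (λ a b x y → (:- a) :* x :+ (:- b) :* y := :- (a :* x :+ b :* y)) refl (ι α) (ι β) x y)) (neg-involutive _))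
            (neg-antimono-≤ (conv-≤ (- ι α) (- ι β) (- ι γ) (λ s∈ → lower (∈-map⁻ s∈)) q∈)))
          where
          value : ∀ u → u ∈ T → ι α * ι (proj₁ u) + ι β * ι (proj₂ u) ≡ ι γ
          value u u∈ = trans (sym (ι-form α β (proj₁ u) (proj₂ u))) (cong ι (flat u u∈))
          upper : ∀ {s} → Σ _ (λ u → u ∈ T × embed u ≡ s) → ι α * proj₁ s + ι β * proj₂ s ≤ ι γ
          upper (u , u∈ , refl) = ≤-reflexive (value u u∈)
          lower : ∀ {s} → Σ _ (λ u → u ∈ T × embed u ≡ s) → - ι α * proj₁ s + - ι β * proj₂ s ≤ - ι γ
          lower (u , u∈ , refl) = ≤-reflexive (trans (solve 4 (λ a b x y → (:- a) :* x :+ (:- b) :* y := :- (a :* x :+ b :* y)) refl (ι α) (ι β) (ι (proj₁ u)) (ι (proj₂ u))) (cong -_ (value u u∈)))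
        level : ∀ p → ∣ proj₁ p - c₁ ∣ < ε → ∣ proj₂ p - c₂ ∣ < ε → ι α * (2ℚ * proj₁ p) + ι β * (2ℚ * proj₂ p) ≡ ι γ
        level p n₁ n₂ = functional (Equivalence.to (twice _) (conv-double (box p n₁ n₂)))
        vanish : ∀ {a x} → x ≡ 0ℚ → x ≡ ι a * (2ℚ * δ) → a ≡ 0ℤ
        vanish {a} p q = ι-injective (≤-antisym (*-cancelʳ-≤-pos δ₂ (≤-reflexive same)) (*-cancelʳ-≤-pos δ₂ (≤-reflexive (sym same))))
          where
          δ₂ = 2ℚ * δ
          same : ι a * δ₂ ≡ 0ℚ * δ₂
          same = trans (trans (sym q) p) (sym (*-zeroˡ δ₂))
          instance
            δ-pos : Positive δ₂
            δ-pos = positive (subst (_< δ₂) (*-zeroʳ 2ℚ) (*-monoʳ-<-pos 2ℚ {{ι-pos (1≤+suc 1)}} δ>0))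

      lattice : Even T → IsLatticeAfterScaling 1 S
      lattice (k , U , U⊆ , T⊆) = k , U , λ x → mk⇔ to from
        where
        to : ∀ {x} → InConv (scaledPts 1 S) x → InConv (map embed U) x
        to {x} (w , w≥0 , Σw , eq) = halve (conv-trans sub (Equivalence.to (twice _) (conv-double (w , w≥0 , Σw , eq′))))
          where
          eq′ : combo w S ≡ x
          eq′ = trans (trans (sym (scale-1 _)) (sym (combo-map (scaling 1ℚ) w S))) eq
          sub : ∀ {s} → s ∈ map embed T → InConv (map embed (map double U)) s
          sub s∈ with ∈-map⁻ s∈
          ... | u , u∈ , refl with T⊆ u u∈
          ... | at q q∈ qx qy = subst (InConv _) (≡-pair (trans (sym (*-identityˡ _)) qx) (trans (sym (*-identityˡ _)) qy)) q∈
          halve : ∀ {x} → InConv (map embed (map double U)) (scale 2ℚ x) → InConv (map embed U) x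
          halve {x} (v , v≥0 , Σv , eq) = v , v≥0 , Σv , ≡-pair (cancel-ι (1≤+suc 1) (cong proj₁ doubled)) (cancel-ι (1≤+suc 1) (cong proj₂ doubled))
            where
            commute : map embed (map double U) ≡ map (scale 2ℚ) (map embed U)
            commute = trans (sym (map-∘ embed double U)) (trans (map-cong (λ u → ≡-pair (ι-* (+ 2) (proj₁ u)) (ι-* (+ 2) (proj₂ u))) U) (map-∘ (scale 2ℚ) embed U))
            doubled : scale 2ℚ (combo v (map embed U)) ≡ scale 2ℚ x
            doubled = trans (sym (combo-map (scaling 2ℚ) v (map embed U))) (trans (cong (combo v) (sym commute)) eq)
        from : ∀ {x} → InConv (map embed U) x → InConv (scaledPts 1 S) x
        from = conv-trans λ s∈ → inner (∈-map⁻ s∈)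
          where
          inner : ∀ {s} → Σ _ (λ u → u ∈ U × embed u ≡ s) → InConv (scaledPts 1 S) s
          inner (u , u∈ , refl) = Equivalence.from (dilate⇔hull twice 0 u) (U⊆ u u∈)

  agree : ∀ {Q c v} → Counts Q c → (Σ ℕ λ c′ → Counts Q c′ × + 2 ℤ.* + c′ ≡ v) → + 2 ℤ.* + c ≡ v
  agree counts (c′ , counts′ , eq) = trans (cong (λ c → + 2 ℤ.* + c) (counts-unique counts counts′)) eq

  -- The counts of 2P, 4P and 6P, known from Pick's theorem, determine the polynomial.
  module Interpolation (e₂ e₁ e₀ : ℚ) (c : ℕ → ℕ) (value : ∀ k → ι (+ c k) ≡ evalQuad e₂ e₁ e₀ (suc k)) (A B : ℤ)
    (two : + 2 ℤ.* + c 1 ≡ A ℤ.+ B ℤ.+ + 2) (four : + 2 ℤ.* + c 3 ≡ + 4 ℤ.* A ℤ.+ + 2 ℤ.* B ℤ.+ + 2)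
    (six : + 2 ℤ.* + c 5 ≡ + 9 ℤ.* A ℤ.+ + 3 ℤ.* B ℤ.+ + 2) where

    open +-*-Solver
    C₂ C₄ C₆ : ℤ
    C₂ = + c 1
    C₄ = + c 3
    C₆ = + c 5
    third-difference : 1ℤ ℤ.* C₆ ℤ.+ + 3 ℤ.* C₂ ≡ + 3 ℤ.* C₄ ℤ.+ 1ℤ ℤ.* 1ℤ
    third-difference = cancel-≡ {+ 2} (1≤+suc 1) (trans (lem₁ C₂ C₆) (trans (cong₂ (λ x y → x ℤ.+ + 3 ℤ.* y) six two) (trans (lem₂ A B) (trans (cong (λ x → + 3 ℤ.* x ℤ.+ + 2) (sym four)) (lem₃ C₄)))))
      where
      lem₁ : ∀ a b → + 2 ℤ.* (1ℤ ℤ.* b ℤ.+ + 3 ℤ.* a) ≡ + 2 ℤ.* b ℤ.+ + 3 ℤ.* (+ 2 ℤ.* a)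
      lem₁ = solve-∀
      lem₂ : ∀ A B → + 9 ℤ.* A ℤ.+ + 3 ℤ.* B ℤ.+ + 2 ℤ.+ + 3 ℤ.* (A ℤ.+ B ℤ.+ + 2) ≡ + 3 ℤ.* (+ 4 ℤ.* A ℤ.+ + 2 ℤ.* B ℤ.+ + 2) ℤ.+ + 2
      lem₂ = solve-∀
      lem₃ : ∀ a → + 3 ℤ.* (+ 2 ℤ.* a) ℤ.+ + 2 ≡ + 2 ℤ.* (+ 3 ℤ.* a ℤ.+ 1ℤ ℤ.* 1ℤ)
      lem₃ = solve-∀
    second-difference : + 2 ℤ.* C₄ ℤ.+ -[1+ 3 ] ℤ.* C₂ ≡ + 2 ℤ.* A ℤ.+ -[1+ 1 ] ℤ.* 1ℤ
    second-difference = trans (lem₁ C₂ C₄) (trans (cong₂ (λ x y → x ℤ.- + 2 ℤ.* y) four two) (lem₂ A B))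
      where
      lem₁ : ∀ a b → + 2 ℤ.* b ℤ.+ -[1+ 3 ] ℤ.* a ≡ + 2 ℤ.* b ℤ.- + 2 ℤ.* (+ 2 ℤ.* a)
      lem₁ = solve-∀
      lem₂ : ∀ A B → + 4 ℤ.* A ℤ.+ + 2 ℤ.* B ℤ.+ + 2 ℤ.- + 2 ℤ.* (A ℤ.+ B ℤ.+ + 2) ≡ + 2 ℤ.* A ℤ.+ -[1+ 1 ] ℤ.* 1ℤ
      lem₂ = solve-∀
    first-difference : + 8 ℤ.* C₂ ℤ.+ -[1+ 1 ] ℤ.* C₄ ≡ + 2 ℤ.* B ℤ.+ + 6 ℤ.* 1ℤ
    first-difference = trans (lem₁ C₂ C₄) (trans (cong₂ (λ x y → + 4 ℤ.* x ℤ.- y) two four) (lem₂ A B))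
      where
      lem₁ : ∀ a b → + 8 ℤ.* a ℤ.+ -[1+ 1 ] ℤ.* b ≡ + 4 ℤ.* (+ 2 ℤ.* a) ℤ.- + 2 ℤ.* b
      lem₁ = solve-∀
      lem₂ : ∀ A B → + 4 ℤ.* (A ℤ.+ B ℤ.+ + 2) ℤ.- (+ 4 ℤ.* A ℤ.+ + 2 ℤ.* B ℤ.+ + 2) ≡ + 2 ℤ.* B ℤ.+ + 6 ℤ.* 1ℤ
      lem₂ = solve-∀
    rational : ∀ α β γ δ x y z w → α ℤ.* x ℤ.+ β ℤ.* y ≡ γ ℤ.* z ℤ.+ δ ℤ.* w → ι α * ι x + ι β * ι y ≡ ι γ * ι z + ι δ * ι w
    rational α β γ δ x y z w eq = trans (sym (ι-form α β x y)) (trans (cong ι eq) (ι-form γ δ z w))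
    quad : ∀ {k} → Polynomial k → Polynomial k → Polynomial k → ℕ → Polynomial k
    quad a b c k = a :* (con (+ k / 1) :* con (+ k / 1)) :+ b :* con (+ k / 1) :+ c
    e₀≡1 : e₀ ≡ 1ℚ
    e₀≡1 = trans (solve 3 (λ a b c → c := (con (ι 1ℤ) :* quad a b c 6 :+ con (ι (+ 3)) :* quad a b c 2) :- con (ι (+ 3)) :* quad a b c 4) refl e₂ e₁ e₀)
      (trans (cong₂ (λ x y → x - ι (+ 3) * y) (trans (cong₂ (λ x y → ι 1ℤ * x + ι (+ 3) * y) (sym (value 5)) (sym (value 1))) (rational 1ℤ (+ 3) (+ 3) 1ℤ C₆ C₂ C₄ 1ℤ third-difference)) (sym (value 3)))
        (solve 1 (λ x → con (ι (+ 3)) :* x :+ con (ι 1ℤ) :* con (ι 1ℤ) :- con (ι (+ 3)) :* x := con 1ℚ) refl (ι C₄)))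
    ιA≡ : ι A ≡ ι (+ 8) * e₂
    ιA≡ = cancel-ι {+ 2} (1≤+suc 1) (trans (solve 1 (λ x → con (ι (+ 2)) :* x := con (ι (+ 2)) :* x :+ con (ι -[1+ 1 ]) :* con (ι 1ℤ) :+ con (ι (+ 2))) refl (ι A))
      (trans (cong (_+ ι (+ 2)) (trans (sym (rational (+ 2) -[1+ 3 ] (+ 2) -[1+ 1 ] C₄ C₂ A 1ℤ second-difference)) (cong₂ (λ x y → ι (+ 2) * x + ι -[1+ 3 ] * y) (value 3) (value 1))))
        (trans (cong (λ e₀ → ι (+ 2) * evalQuad e₂ e₁ e₀ 4 + ι -[1+ 3 ] * evalQuad e₂ e₁ e₀ 2 + ι (+ 2)) e₀≡1)
          (solve 2 (λ a b → con (ι (+ 2)) :* quad a b (con 1ℚ) 4 :+ con (ι -[1+ 3 ]) :* quad a b (con 1ℚ) 2 :+ con (ι (+ 2)) := con (ι (+ 2)) :* (con (ι (+ 8)) :* a)) refl e₂ e₁))))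
    ιB≡ : ι B ≡ ι (+ 4) * e₁
    ιB≡ = cancel-ι {+ 2} (1≤+suc 1) (trans (solve 1 (λ x → con (ι (+ 2)) :* x := con (ι (+ 2)) :* x :+ con (ι (+ 6)) :* con (ι 1ℤ) :- con (ι (+ 6))) refl (ι B))
      (trans (cong (_- ι (+ 6)) (trans (sym (rational (+ 8) -[1+ 1 ] (+ 2) (+ 6) C₂ C₄ B 1ℤ first-difference)) (cong₂ (λ x y → ι (+ 8) * x + ι -[1+ 1 ] * y) (value 1) (value 3))))
        (trans (cong (λ e₀ → ι (+ 8) * evalQuad e₂ e₁ e₀ 2 + ι -[1+ 1 ] * evalQuad e₂ e₁ e₀ 4 - ι (+ 6)) e₀≡1)
          (solve 2 (λ a b → con (ι (+ 8)) :* quad a b (con 1ℚ) 2 :+ con (ι -[1+ 1 ]) :* quad a b (con 1ℚ) 4 :- con (ι (+ 6)) := con (ι (+ 2)) :* (con (ι (+ 4)) :* b)) refl e₂ e₁))))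
    interpolate : ∀ k α β → (∀ a b → ι (+ 8) * evalQuad a b 1ℚ (suc k) ≡ (ι α * (ι (+ 8) * a) + ι β * (ι (+ 4) * b)) + ι (+ 8)) → + 8 ℤ.* + c k ≡ α ℤ.* A ℤ.+ β ℤ.* B ℤ.+ + 8
    interpolate k α β expand = ι-injective (begin
      ι (+ 8 ℤ.* + c k) ≡⟨ ι-* (+ 8) (+ c k) ⟩
      ι (+ 8) * ι (+ c k) ≡⟨ cong (ι (+ 8) *_) (trans (value k) (cong (λ e₀ → evalQuad e₂ e₁ e₀ (suc k)) e₀≡1)) ⟩
      ι (+ 8) * evalQuad e₂ e₁ 1ℚ (suc k) ≡⟨ expand e₂ e₁ ⟩
      (ι α * (ι (+ 8) * e₂) + ι β * (ι (+ 4) * e₁)) + ι (+ 8) ≡⟨ cong₂ (λ x y → (ι α * x + ι β * y) + ι (+ 8)) (sym ιA≡) (sym ιB≡) ⟩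
      (ι α * ι A + ι β * ι B) + ι (+ 8) ≡⟨ cong (_+ ι (+ 8)) (sym (ι-form α β A B)) ⟩
      ι (α ℤ.* A ℤ.+ β ℤ.* B) + ι (+ 8) ≡⟨ sym (ι-+ (α ℤ.* A ℤ.+ β ℤ.* B) (+ 8)) ⟩
      ι (α ℤ.* A ℤ.+ β ℤ.* B ℤ.+ + 8) ∎)
      where open ≡-Reasoning
    count-1 : + 8 ℤ.* + c 0 ≡ A ℤ.+ + 2 ℤ.* B ℤ.+ + 8
    count-1 = trans (interpolate 0 1ℤ (+ 2) (solve 2 (λ a b → con (ι (+ 8)) :* quad a b (con 1ℚ) 1 := con (ι 1ℤ) :* (con (ι (+ 8)) :* a) :+ con (ι (+ 2)) :* (con (ι (+ 4)) :* b) :+ con (ι (+ 8))) refl))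
      (cong (λ x → x ℤ.+ + 2 ℤ.* B ℤ.+ + 8) (ℤ.*-identityˡ A))
    count-3 : + 8 ℤ.* + c 2 ≡ + 9 ℤ.* A ℤ.+ + 6 ℤ.* B ℤ.+ + 8
    count-3 = interpolate 2 (+ 9) (+ 6) (solve 2 (λ a b → con (ι (+ 8)) :* quad a b (con 1ℚ) 3 := con (ι (+ 9)) :* (con (ι (+ 8)) :* a) :+ con (ι (+ 6)) :* (con (ι (+ 4)) :* b) :+ con (ι (+ 8))) refl)

    conclude : (Σ ℕ λ i → Σ ℕ λ b → Admissible i b × B ≡ + 2 ℤ.* + b × A ℤ.+ + 8 ≡ + 8 ℤ.* + i ℤ.+ + 2 ℤ.* B) →
      Σ ℕ λ i → Σ ℕ λ b → Admissible i b × e₂ ≡ (+ i / 1) + (+ b / 2) - 1ℚ × e₁ ≡ + b / 2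
    conclude (i , b , adm , B≡ , A≡) = i , b , adm , e₂≡ , e₁≡
      where
      h = + b / 2
      ιb : ι (+ b) ≡ ι (+ 2) * h
      ιb = sym (2*half (+ b))
      e₁≡ : e₁ ≡ h
      e₁≡ = cancel-ι {+ 4} (1≤+suc 3) (trans (sym ιB≡) (trans (trans (cong ι B≡) (ι-* (+ 2) (+ b))) (trans (cong (ι (+ 2) *_) ιb) (solve 1 (λ h → con (ι (+ 2)) :* (con (ι (+ 2)) :* h) := con (ι (+ 4)) :* h) refl h))))
      e₂≡ : e₂ ≡ ι (+ i) + h - 1ℚ
      e₂≡ = cancel-ι {+ 8} (1≤+suc 7) (begin
        ι (+ 8) * e₂ ≡⟨ sym ιA≡ ⟩
        ι A ≡⟨ solve 1 (λ x → x := (con (ι 1ℤ) :* x :+ con (ι (+ 8)) :* con (ι 1ℤ)) :- con (ι (+ 8))) refl (ι A) ⟩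
        (ι 1ℤ * ι A + ι (+ 8) * ι 1ℤ) - ι (+ 8) ≡⟨ cong (_- ι (+ 8)) (rational 1ℤ (+ 8) (+ 8) (+ 2) A 1ℤ (+ i) B (trans (lem A) A≡)) ⟩
        (ι (+ 8) * ι (+ i) + ι (+ 2) * ι B) - ι (+ 8) ≡⟨ cong (λ x → (ι (+ 8) * ι (+ i) + ι (+ 2) * x) - ι (+ 8)) (trans ιB≡ (cong (ι (+ 4) *_) e₁≡)) ⟩
        (ι (+ 8) * ι (+ i) + ι (+ 2) * (ι (+ 4) * h)) - ι (+ 8) ≡⟨ solve 2 (λ i h → (con (ι (+ 8)) :* i :+ con (ι (+ 2)) :* (con (ι (+ 4)) :* h)) :- con (ι (+ 8)) := con (ι (+ 8)) :* (i :+ h :- con 1ℚ)) refl (ι (+ i)) h ⟩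
        ι (+ 8) * (ι (+ i) + h - 1ℚ) ∎)
        where
        open ≡-Reasoning
        lem : ∀ A → 1ℤ ℤ.* A ℤ.+ + 8 ℤ.* 1ℤ ≡ A ℤ.+ + 8
        lem = solve-∀

  necessity : ∀ {e₂ e₁ e₀ m} (S : Vec Point m) → RationalPolygon S → HasDenom2 S → IsEhrhartPolynomial S e₂ e₁ e₀ →
    e₀ ≡ 1ℚ × Σ ℕ λ i → Σ ℕ λ b → Admissible i b × e₂ ≡ (+ i / 1) + (+ b / 2) - 1ℚ × e₁ ≡ + b / 2
  necessity {e₂} {e₁} {e₀} S interior ((_ , T , twice) , not-lattice) ehrhart = I.e₀≡1 , I.conclude (admissible P)
    where
    nondeg : Nondegenerate T
    nondeg = nondegenerate {S = S} {T = T} twice interior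
    s : Sides T (proj₁ (extent nondeg)) (suc (proj₁ (proj₂ (extent nondeg))))
    s = sides (proj₂ (proj₂ (extent nondeg)))
    A B : ℤ
    A = twice-area s
    B = boundary-count s
    c : ℕ → ℕ
    c k = proj₁ (ehrhart (suc k) (s≤s z≤n))
    counts : ∀ k → Counts (Dilate T (+ suc k)) (c k)
    counts k = counts-cong {λ z → InConv (scaledPts (suc k) S) (embed z)} (dilate⇔hull twice k) (proj₁ (proj₂ (ehrhart (suc k) (s≤s z≤n))))
    value : ∀ k → ι (+ c k) ≡ evalQuad e₂ e₁ e₀ (suc k)
    value k = proj₂ (proj₂ (ehrhart (suc k) (s≤s z≤n)))
    two : + 2 ℤ.* + c 1 ≡ A ℤ.+ B ℤ.+ + 2
    two = trans (agree {Dilate T (+ 2)} (counts 1) (even-count s 0)) (lem A B)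
      where
      lem : ∀ A B → 1ℤ ℤ.* 1ℤ ℤ.* A ℤ.+ 1ℤ ℤ.* B ℤ.+ + 2 ≡ A ℤ.+ B ℤ.+ + 2
      lem = solve-∀
    four : + 2 ℤ.* + c 3 ≡ + 4 ℤ.* A ℤ.+ + 2 ℤ.* B ℤ.+ + 2
    four = agree {Dilate T (+ 4)} (counts 3) (even-count s 1)
    module I = Interpolation e₂ e₁ e₀ c value A B two four (agree {Dilate T (+ 6)} (counts 5) (even-count s 2))
    P : Problem T A B (c 0) (c 2)
    P = record
      { nondegenerate = nondeg
      ; count₁ = counts 0 ; count₃ = counts 2
      ; count₂ = c 1 , counts 1 , two
      ; count₄ = c 3 , counts 3 , four
      ; poly₁ = I.count-1 ; poly₃ = I.count-3
      ; uneven = λ e → not-lattice (lattice {S = S} {T = T} twice e) }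

module HalvedPolygons where

  open Inequalities
  open Convexity
  open Hulls
  open Chains
  open ScaledRows
  open Counting
  open EvenDilates
  open Problems
  open Necessity
  open import Defs
  open import Data.Nat using (ℕ; suc)
  open import Data.Integer hiding (suc)
  open import Data.Integer.Properties
  open import Data.Integer.Tactic.RingSolver using (solve-∀)
  open import Data.Rational as ℚ using (ℚ; 0ℚ; 1ℚ)
  import Data.Rational.Properties as ℚ
  open import Data.Rational.Solver using (module +-*-Solver)
  open import Data.Product using (_×_; _,_; Σ; proj₁; proj₂)
  open import Data.Sum using (_⊎_; inj₁; inj₂)
  open import Data.Empty using (⊥)
  open import Data.List using ([]; _∷_)
  open import Data.Vec using (Vec; []; _∷_; map)
  open import Data.Vec.Properties using (map-∘; map-cong)
  open import Data.Vec.Membership.Propositional using (_∈_)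
  open import Data.Vec.Membership.Propositional.Properties using (∈-map⁺)
  open import Data.Vec.Relation.Unary.Any using (here; there)
  open import Data.Vec.Relation.Unary.All using ([]; _∷_)
  open import Function.Bundles using (_⇔_; mk⇔; Equivalence)
  open import Relation.Binary.PropositionalEquality

  halves : LatticePoint → Point
  halves (x , y) = x ℚ./ 2 , y ℚ./ 2

  module _ {n} (T : Vec LatticePoint n) where

    halved : Vec Point n
    halved = map halves T

    doubled≡ : scaledPts 2 halved ≡ map embed T
    doubled≡ = trans (sym (map-∘ _ _ T)) (map-cong (λ (x , y) → ≡-pair (2*half x) (2*half y)) T)

    twice : ∀ x → InConv (scaledPts 2 halved) x ⇔ InConv (map embed T) x
    twice x = mk⇔ (subst (λ S → InConv S x) doubled≡) (subst (λ S → InConv S x) (sym doubled≡))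

    halve-conv : ∀ {q} → InConv (map embed T) (scale (ι (+ 2)) q) → InConv halved q
    halve-conv q∈ with Equivalence.from (twice _) q∈
    ... | w , w≥0 , Σw , eq = w , w≥0 , Σw , ≡-pair (cancel-ι (1≤+suc 1) (cong proj₁ eq′)) (cancel-ι (1≤+suc 1) (cong proj₂ eq′))
      where
      eq′ = trans (sym (combo-map (scaling (ι (+ 2))) w halved)) eq

    -- P has a vertex on a line αx + βy = m + 1/2 that supports it.
    not-lattice : ∀ α β m → (∀ u → u ∈ T → α * proj₁ u + β * proj₂ u ≤ + 2 * m + 1ℤ) →
      Σ LatticePoint (λ v → v ∈ T × α * proj₁ v + β * proj₂ v ≡ + 2 * m + 1ℤ) → IsLatticeAfterScaling 1 halved → ⊥
    not-lattice α β m bound ((a , b) , v∈ , value) (_ , U , same) = absurd-≤ (subst (_≤ + 2 * m) value (ι-cancel (subst₂ ℚ._≤_ left (sym (ι-* (+ 2) m)) (ℚ.*-monoˡ-≤-nonNeg (ι (+ 2)) below)))) (+-comm (+ 2 * m) 1ℤ)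
      where
      open +-*-Solver
      v∈S : InConv (scaledPts 1 halved) (halves (a , b))
      v∈S = subst (InConv (scaledPts 1 halved)) (scale-1 {S = halved} (halves (a , b))) (conv-map (scaling 1ℚ) (conv-vertex (∈-map⁺ halves v∈)))
      integral : ∀ u → u ∈ U → α * proj₁ u + β * proj₂ u ≤ m
      integral (x , y) u∈ with split-≤ (α * x + β * y) m
      ... | inj₁ p = p
      ... | inj₂ q = absurd-≤ {1ℤ} {0ℤ} (≤-by (_⊗_ {+ 2} (+m-nonneg 2) q ⊕ hull-≤ α β (+ 2 * m + 1ℤ) (λ {u} → bound u) (+m-nonneg 1) (Equivalence.to (dilate⇔hull twice 0 (x , y)) (Equivalence.from (same _) (conv-vertex (∈-map⁺ embed u∈)))))
          (lem α β m x y)) refl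
        where
        lem : ∀ α β m x y → 0ℤ + (+ 2 * (1ℤ + m) + (α * (+ 2 * x) + β * (+ 2 * y))) ≡ 1ℤ + (+ 2 * (α * x + β * y) + (+ 2 * m + 1ℤ) * 1ℤ)
        lem = solve-∀
      below : ι α ℚ.* (a ℚ./ 2) ℚ.+ ι β ℚ.* (b ℚ./ 2) ℚ.≤ ι m
      below = conv-≤ (ι α) (ι β) (ι m) (λ s∈ → lower (∈-map⁻ s∈)) (Equivalence.to (same _) v∈S)
        where
        lower : ∀ {s} → Σ _ (λ u → u ∈ U × embed u ≡ s) → ι α ℚ.* proj₁ s ℚ.+ ι β ℚ.* proj₂ s ℚ.≤ ι m
        lower ((x , y) , u∈ , refl) = subst (ℚ._≤ ι m) (ι-form α β x y) (ι-mono (integral (x , y) u∈))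
      left : ι (+ 2) ℚ.* (ι α ℚ.* (a ℚ./ 2) ℚ.+ ι β ℚ.* (b ℚ./ 2)) ≡ ι (α * a + β * b)
      left = trans (solve 5 (λ t p q x y → t :* (p :* x :+ q :* y) := p :* (t :* x) :+ q :* (t :* y)) refl (ι (+ 2)) (ι α) (ι β) (a ℚ./ 2) (b ℚ./ 2))
        (trans (cong₂ (λ x y → ι α ℚ.* x ℚ.+ ι β ℚ.* y) (2*half a) (2*half b)) (sym (ι-form α β a b)))

    -- conv T contains a right triangle with unit legs, pointing in the directions σ and τ.
    interior : ∀ X Y σ τ → σ ≡ 1ℤ ⊎ σ ≡ -1ℤ → τ ≡ 1ℤ ⊎ τ ≡ -1ℤ → Hull T X Y 1ℤ → Hull T (X + σ) Y 1ℤ → Hull T X (Y + τ) 1ℤ → HasNonemptyInterior halved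
    interior X Y σ τ σ² τ² hO hE hF = (cx , cy) , ε , ε>0 , box
      where
      open +-*-Solver
      ε cx cy two quarter : ℚ
      two = ι (+ 2)
      quarter = + 1 ℚ./ 4
      ε = + 1 ℚ./ 8
      two-ε : two ℚ.* ε ≡ quarter
      two-ε = refl
      two-quarter : quarter ℚ.+ quarter ≡ ℚ.½
      two-quarter = refl
      ½+½ : ℚ.½ ℚ.+ ℚ.½ ≡ 1ℚ
      ½+½ = refl
      two-½ : two ℚ.* ℚ.½ ≡ 1ℚ
      two-½ = refl
      ε>0 : 0ℚ ℚ.< ε
      ε>0 = ℚ.positive⁻¹ ε
      centre : ℤ → ℤ → ℚ
      centre X σ = ℚ.½ ℚ.* (ι X ℚ.+ quarter ℚ.* ι σ)
      cx = centre X σ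
      cy = centre Y τ
      corner : ∀ {X Y} → Hull T X Y 1ℤ → InConv (map embed T) (embed (X , Y))
      corner (at q q∈ qx qy) = subst (InConv _) (≡-pair (trans (sym (ℚ.*-identityˡ _)) qx) (trans (sym (ℚ.*-identityˡ _)) qy)) q∈
      V : Vec Point 3
      V = embed (X , Y) ∷ embed (X + σ , Y) ∷ embed (X , Y + τ) ∷ []
      V⊆ : ∀ {s} → s ∈ V → InConv (map embed T) s
      V⊆ (here refl) = corner hO
      V⊆ (there (here refl)) = corner hE
      V⊆ (there (there (here refl))) = corner hF
      -- barycentric coordinate along a leg
      coord : ℤ → ℤ → ℚ → ℚ
      coord X σ x = ι σ ℚ.* (two ℚ.* x ℚ.- ι X)
      square : ∀ {σ} → σ ≡ 1ℤ ⊎ σ ≡ -1ℤ → ι σ ℚ.* ι σ ≡ 1ℚ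
      square (inj₁ refl) = refl
      square (inj₂ refl) = refl
      p≤∣p∣ : ∀ p → p ℚ.≤ ℚ.∣ p ∣
      p≤∣p∣ p with ℚ.≤-total 0ℚ p
      ... | inj₁ 0≤p = ℚ.≤-reflexive (sym (ℚ.0≤p⇒∣p∣≡p 0≤p))
      ... | inj₂ p≤0 = ℚ.≤-trans p≤0 (ℚ.0≤∣p∣ p)
      -p≤∣p∣ : ∀ p → ℚ.- p ℚ.≤ ℚ.∣ p ∣
      -p≤∣p∣ p = subst (ℚ.- p ℚ.≤_) (ℚ.∣-p∣≡∣p∣ p) (p≤∣p∣ (ℚ.- p))
      signed : ∀ {σ} d → σ ≡ 1ℤ ⊎ σ ≡ -1ℤ → ι σ ℚ.* d ℚ.≤ ℚ.∣ d ∣ × ℚ.- (ι σ ℚ.* d) ℚ.≤ ℚ.∣ d ∣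
      signed d (inj₁ refl) = subst (ℚ._≤ ℚ.∣ d ∣) (solve 1 (λ d → d := con (ι 1ℤ) :* d) refl d) (p≤∣p∣ d) ,
        subst (ℚ._≤ ℚ.∣ d ∣) (solve 1 (λ d → :- d := :- (con (ι 1ℤ) :* d)) refl d) (-p≤∣p∣ d)
      signed d (inj₂ refl) = subst (ℚ._≤ ℚ.∣ d ∣) (solve 1 (λ d → :- d := con (ι -1ℤ) :* d) refl d) (-p≤∣p∣ d) ,
        subst (ℚ._≤ ℚ.∣ d ∣) (solve 1 (λ d → d := :- (con (ι -1ℤ) :* d)) refl d) (p≤∣p∣ d)
      range : ∀ X σ x → σ ≡ 1ℤ ⊎ σ ≡ -1ℤ → ℚ.∣ x ℚ.- centre X σ ∣ ℚ.< ε → 0ℚ ℚ.≤ coord X σ x × coord X σ x ℚ.≤ ℚ.½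
      range X σ x sign near =
        subst₂ ℚ._≤_ (trans (cong (ℚ._+ two ℚ.* e) (sym (ℚ.neg-distribʳ-* two e))) (ℚ.+-inverseˡ (two ℚ.* e)))
          (trans (ℚ.+-comm (two ℚ.* ε) (two ℚ.* e)) (trans (cong (λ s → two ℚ.* e ℚ.+ s) two-ε) coord≡))
          (ℚ.+-monoˡ-≤ (two ℚ.* e) (ℚ.*-monoˡ-≤-nonNeg two (ℚ.≤-trans (proj₂ bounds) (ℚ.<⇒≤ near)))) ,
        subst₂ ℚ._≤_ coord≡ (trans (cong (ℚ._+ quarter) two-ε) two-quarter) (ℚ.+-monoˡ-≤ quarter (ℚ.*-monoˡ-≤-nonNeg two (ℚ.≤-trans (proj₁ bounds) (ℚ.<⇒≤ near))))
        where
        d e : ℚ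
        d = x ℚ.- centre X σ
        e = ι σ ℚ.* d
        bounds = signed d sign
        coord≡ : two ℚ.* e ℚ.+ quarter ≡ coord X σ x
        coord≡ = trans (cong (λ s → two ℚ.* e ℚ.+ s) (sym (trans (cong (quarter ℚ.*_) (square sign)) (ℚ.*-identityʳ quarter))))
          (trans (solve 6 (λ t h q s x X → t :* (s :* (x :- h :* (X :+ q :* s))) :+ q :* (s :* s) := s :* (t :* x) :- (t :* h) :* (s :* X :+ q :* (s :* s)) :+ q :* (s :* s)) refl two ℚ.½ quarter (ι σ) x (ι X))
          (trans (cong (λ u → ι σ ℚ.* (two ℚ.* x) ℚ.- u ℚ.* (ι σ ℚ.* ι X ℚ.+ quarter ℚ.* (ι σ ℚ.* ι σ)) ℚ.+ quarter ℚ.* (ι σ ℚ.* ι σ)) two-½)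
          (solve 5 (λ t q s x X → s :* (t :* x) :- con 1ℚ :* (s :* X :+ q :* (s :* s)) :+ q :* (s :* s) := s :* (t :* x :- X)) refl two quarter (ι σ) x (ι X))))
      along : ∀ X σ x → σ ≡ 1ℤ ⊎ σ ≡ -1ℤ → ι X ℚ.+ coord X σ x ℚ.* ι σ ≡ two ℚ.* x
      along X σ x sign = trans (solve 4 (λ t s x X → X :+ s :* (t :* x :- X) :* s := X :+ (s :* s) :* (t :* x :- X)) refl two (ι σ) x (ι X))
        (trans (cong (λ q → ι X ℚ.+ q ℚ.* (two ℚ.* x ℚ.- ι X)) (square sign)) (solve 3 (λ t x X → X :+ con 1ℚ :* (t :* x :- X) := t :* x) refl two x (ι X)))
      box : ∀ x → ℚ.∣ proj₁ x ℚ.- cx ∣ ℚ.< ε → ℚ.∣ proj₂ x ℚ.- cy ∣ ℚ.< ε → InConv halved x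
      box (x , y) nx ny = halve-conv (conv-trans V⊆ (((1ℚ ℚ.- (κ ℚ.+ μ)) ∷ κ ∷ μ ∷ []) , (rest ∷ proj₁ rx ∷ proj₁ ry ∷ []) , total , ≡-pair px py))
        where
        rx = range X σ x σ² nx
        ry = range Y τ y τ² ny
        κ μ : ℚ
        κ = coord X σ x
        μ = coord Y τ y
        rest : 0ℚ ℚ.≤ 1ℚ ℚ.- (κ ℚ.+ μ)
        rest = subst (ℚ._≤ 1ℚ ℚ.- (κ ℚ.+ μ)) (ℚ.+-inverseʳ (κ ℚ.+ μ)) (ℚ.+-monoˡ-≤ (ℚ.- (κ ℚ.+ μ)) (ℚ.≤-trans (ℚ.+-mono-≤ (proj₂ rx) (proj₂ ry)) (ℚ.≤-reflexive ½+½)))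
        total : (1ℚ ℚ.- (κ ℚ.+ μ)) ℚ.+ (κ ℚ.+ (μ ℚ.+ 0ℚ)) ≡ 1ℚ
        total = solve 2 (λ a b → (con 1ℚ :- (a :+ b)) :+ (a :+ (b :+ con 0ℚ)) := con 1ℚ) refl κ μ
        px : (1ℚ ℚ.- (κ ℚ.+ μ)) ℚ.* ι X ℚ.+ (κ ℚ.* ι (X + σ) ℚ.+ (μ ℚ.* ι X ℚ.+ 0ℚ)) ≡ two ℚ.* x
        px = trans (cong (λ s → (1ℚ ℚ.- (κ ℚ.+ μ)) ℚ.* ι X ℚ.+ (κ ℚ.* s ℚ.+ (μ ℚ.* ι X ℚ.+ 0ℚ))) (ι-+ X σ))
          (trans (solve 4 (λ k m X s → (con 1ℚ :- (k :+ m)) :* X :+ (k :* (X :+ s) :+ (m :* X :+ con 0ℚ)) := X :+ k :* s) refl κ μ (ι X) (ι σ)) (along X σ x σ²))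
        py : (1ℚ ℚ.- (κ ℚ.+ μ)) ℚ.* ι Y ℚ.+ (κ ℚ.* ι Y ℚ.+ (μ ℚ.* ι (Y + τ) ℚ.+ 0ℚ)) ≡ two ℚ.* y
        py = trans (cong (λ s → (1ℚ ℚ.- (κ ℚ.+ μ)) ℚ.* ι Y ℚ.+ (κ ℚ.* ι Y ℚ.+ (μ ℚ.* s ℚ.+ 0ℚ))) (ι-+ Y τ))
          (trans (solve 4 (λ k m Y s → (con 1ℚ :- (k :+ m)) :* Y :+ (k :* Y :+ (m :* (Y :+ s) :+ con 0ℚ)) := Y :+ m :* s) refl κ μ (ι Y) (ι τ)) (along Y τ y τ²))

    Enumerated : ℤ → ℤ → Set
    Enumerated i b = ∀ k → Σ ℕ λ c → Counts (Dilate T (+ suc k)) c × + 2 * + c ≡ (+ 2 * i + b - + 2) * (+ suc k * + suc k) + b * + suc k + + 2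

    ehrhart : ∀ i b → Enumerated (+ i) (+ b) → IsEhrhartPolynomial halved (ι (+ i) ℚ.+ (+ b ℚ./ 2) ℚ.- 1ℚ) (+ b ℚ./ 2) 1ℚ
    ehrhart i b counts (suc k) _ with counts k
    ... | c , counts-k , value = c , counts-cong (λ z → mk⇔ (Equivalence.from (dilate⇔hull twice k z)) (Equivalence.to (dilate⇔hull twice k z))) counts-k , cancel-ι {+ 2} (1≤+suc 1) (begin
        ι (+ 2) ℚ.* ι (+ c) ≡⟨ sym (ι-* (+ 2) (+ c)) ⟩
        ι (+ 2 * + c) ≡⟨ cong ι value ⟩
        ι (α * (K * K) + + b * K + + 2) ≡⟨ trans (ι-+ (α * (K * K) + + b * K) (+ 2)) (cong (ℚ._+ ι (+ 2)) (trans (ι-form α (+ b) (K * K) K) (cong (λ s → ι α ℚ.* s ℚ.+ ι (+ b) ℚ.* κ) (ι-* K K)))) ⟩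
        ι α ℚ.* (κ ℚ.* κ) ℚ.+ ι (+ b) ℚ.* κ ℚ.+ ι (+ 2) ≡⟨ cong₂ (λ x y → x ℚ.* (κ ℚ.* κ) ℚ.+ y ℚ.* κ ℚ.+ ι (+ 2)) α≡ (sym (2*half (+ b))) ⟩
        (ι (+ 2) ℚ.* ι (+ i) ℚ.+ ι (+ 2) ℚ.* h ℚ.- ι (+ 2)) ℚ.* (κ ℚ.* κ) ℚ.+ (ι (+ 2) ℚ.* h) ℚ.* κ ℚ.+ ι (+ 2) ≡⟨
          solve 3 (λ i h k → (con (ι (+ 2)) :* i :+ con (ι (+ 2)) :* h :- con (ι (+ 2))) :* (k :* k) :+ (con (ι (+ 2)) :* h) :* k :+ con (ι (+ 2)) :=
            con (ι (+ 2)) :* ((i :+ h :- con 1ℚ) :* (k :* k) :+ h :* k :+ con 1ℚ)) refl (ι (+ i)) h κ ⟩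
        ι (+ 2) ℚ.* evalQuad (ι (+ i) ℚ.+ h ℚ.- 1ℚ) h 1ℚ (suc k) ∎)
      where
      open ≡-Reasoning
      open +-*-Solver
      K = + suc k
      κ = ι K
      h = + b ℚ./ 2
      α = + 2 * + i + + b - + 2
      α≡ : ι α ≡ ι (+ 2) ℚ.* ι (+ i) ℚ.+ ι (+ 2) ℚ.* h ℚ.- ι (+ 2)
      α≡ = trans (ι-+ (+ 2 * + i + + b) (- (+ 2))) (cong₂ ℚ._+_ (trans (ι-+ (+ 2 * + i) (+ b)) (cong₂ ℚ._+_ (ι-* (+ 2) (+ i)) (sym (2*half (+ b))))) refl)

module Sufficiency where

  open Inequalities
  open Convexity
  open Hulls
  open Chains
  open ScaledRows
  open Counting
  open EvenDilates
  open Problems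
  open EvenHeights
  open HalvedPolygons
  open import Defs
  open import Data.Nat as ℕ using (ℕ; zero; suc; z≤n; s≤s)
  import Data.Nat.Properties as ℕ
  import Data.Nat.Tactic.RingSolver as ℕ-Solver
  open import Data.Integer hiding (suc)
  open import Data.Integer.Properties
  open import Data.Integer.Tactic.RingSolver using (solve-∀)
  open import Data.Rational as ℚ using (ℚ; 1ℚ)
  open import Data.Product using (_×_; _,_; Σ; proj₁; proj₂)
  open import Data.Sum using (_⊎_; inj₁; inj₂)
  open import Data.List using (List; []; _∷_)
  open import Data.Vec using (Vec; []; _∷_; map)
  open import Data.Vec.Membership.Propositional using (_∈_)
  open import Data.Vec.Relation.Unary.Any using (here; there)
  open import Relation.Nullary.Decidable using (toWitness; True)
  open import Relation.Binary.PropositionalEquality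

  /-exact : ∀ {a} q n → a ≡ q * + suc n → a /ℕ suc n ≡ q
  /-exact {a} q n refl = /-unique n ≤-refl (≤-by (1≤+suc n) (lem q (+ suc n)))
    where
    lem : ∀ q N → (1ℤ + q) * N + 1ℤ ≡ 1ℤ + q * N + N
    lem = solve-∀

  /-cancel : ∀ c a → (+ suc c * a) /ℕ (suc c ℕ.* 2) ≡ a /ℕ 2
  /-cancel c a = /-unique {+ suc c * a} {a /ℕ 2} (suc (c ℕ.* 2)) (≤-trans (≤-reflexive (trans (cong (a /ℕ 2 *_) (pos-* (suc c) 2)) (lem (+ suc c) (a /ℕ 2)))) (_⊗_ {+ suc c} (+m-nonneg (suc c)) lower))
    (≤-by (_⊗_ {+ suc c} (+m-nonneg (suc c)) upper ⊕ 1≤+suc c) (trans (cong (λ s → (1ℤ + a /ℕ 2) * s + (+ suc c * (1ℤ + a) + 1ℤ)) (pos-* (suc c) 2)) (lem′ (+ suc c) (a /ℕ 2) a)))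
    where
    open import Data.Integer.DivMod using ([n/ℕd]*d≤n; n<s[n/ℕd]*d)
    lower : a /ℕ 2 * + 2 ≤ a
    lower = [n/ℕd]*d≤n a 2
    upper : 1ℤ + a ≤ (1ℤ + a /ℕ 2) * + 2
    upper = i<j⇒suc[i]≤j (n<s[n/ℕd]*d a 2)
    lem : ∀ c q → q * (c * + 2) ≡ c * (q * + 2)
    lem = solve-∀
    lem′ : ∀ c q a → (1ℤ + q) * (c * + 2) + (c * (1ℤ + a) + 1ℤ) ≡ 1ℤ + c * a + (c * ((1ℤ + q) * + 2) + c)
    lem′ = solve-∀

  parity-of : ∀ k → Σ ℕ λ m → Σ ℕ λ ε → (ε ≡ 0 ⊎ ε ≡ 1) × ε ℕ.+ 2 ℕ.* m ≡ k
  parity-of zero = 0 , 0 , inj₁ refl , refl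
  parity-of (suc k) with parity-of k
  ... | m , .0 , inj₁ refl , eq = m , 1 , inj₂ refl , cong suc eq
  ... | m , .1 , inj₂ refl , eq = suc m , 0 , inj₁ refl , trans (lem m) (cong suc eq)
    where
    lem : ∀ m → 2 ℕ.* suc m ≡ suc (1 ℕ.+ 2 ℕ.* m)
    lem = ℕ-Solver.solve-∀

  Polygon : ℕ → ℕ → Set
  Polygon i b = Σ ℕ λ n → Σ (Vec Point n) λ S → RationalPolygon S × HasDenom2 S ×
    IsEhrhartPolynomial S (ι (+ i) ℚ.+ (+ b ℚ./ 2) ℚ.- 1ℚ) (+ b ℚ./ 2) 1ℚ

  by-decision : ∀ a b {_ : True (a ≤? b)} → a ≤ b
  by-decision a b {p} = toWitness p

  -- the triangle (0, 0), (2, 0), (1, −1/2)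
  module Triangle where
    T : Vec LatticePoint 3
    T = (+ 2 , -1ℤ) ∷ (+ 4 , 0ℤ) ∷ (0ℤ , 0ℤ) ∷ []

    E : Extent T -1ℤ 1
    E = record
      { low = λ { _ (here refl) → by-decision -1ℤ -1ℤ ; _ (there (here refl)) → by-decision -1ℤ 0ℤ ; _ (there (there (here refl))) → by-decision -1ℤ 0ℤ }
      ; high = λ { _ (here refl) → by-decision -1ℤ 0ℤ ; _ (there (here refl)) → ≤-refl ; _ (there (there (here refl))) → ≤-refl }
      ; bottom = + 2 , here refl ; top = 0ℤ , there (there (here refl)) }

    s : Sides T -1ℤ 1
    s = sides-from E
      (boundary (+ 2) ((0 , + 2) ∷ []) (here refl) (step (there (here refl))
        (λ { _ (here refl) → ≤-refl ; _ (there (here refl)) → ≤-refl ; _ (there (there (here refl))) → by-decision (- (+ 2)) (+ 2) }) stop) refl)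
      (boundary (- (+ 2)) ((0 , + 2) ∷ []) (here refl) (step (there (there (here refl)))
        (λ { _ (here refl) → ≤-refl ; _ (there (here refl)) → by-decision (- (+ 2)) (+ 2) ; _ (there (there (here refl))) → ≤-refl }) stop) refl)

    row-floor : ∀ k x t → t ℕ.≤ k → floor k 1 (+ 2 * x) ((0 , + 2) ∷ []) t ≡ + k * x + + t
    row-floor k x t t≤k with ℕ.m≤n⇒m<n∨m≡n t≤k
    ... | inj₁ t<k = trans (floor-edge k 1 (+ 2 * x) 0 (+ 2) [] (ℕ.≤-trans t<k (ℕ.≤-reflexive (sym (ℕ.*-identityʳ k))))) (/-exact (+ k * x + + t) 1 (lem (+ k) x (+ t)))
      where
      lem : ∀ k x t → k * (+ 2 * x) * 1ℤ + + 2 * t ≡ (k * x + t) * + 2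
      lem = solve-∀
    ... | inj₂ refl = trans (cong (floor t 1 (+ 2 * x) ((0 , + 2) ∷ [])) (sym (ℕ.*-identityʳ t))) (trans (floor-top t 1 (+ 2 * x) ((0 , + 2) ∷ [])) (/-exact (+ t * x + + t) 1 (lem (+ t) x)))
      where
      lem : ∀ k x → k * (+ 2 * x + + 2) ≡ (k * x + k) * + 2
      lem = solve-∀

    module _ (k m ε : ℕ) (eq : ε ℕ.+ 2 ℕ.* m ≡ suc k) where
      K≡ : + ε + + 2 * + m ≡ + suc k
      K≡ = trans (cong (λ s → + ε + s) (sym (pos-* 2 m))) (cong +_ eq)

      row-value : ℕ → ℤ
      row-value j = floor (suc k) 1 (+ 2) ((0 , + 2) ∷ []) (ε ℕ.+ 2 ℕ.* j) + floor (suc k) 1 (- (+ 2)) ((0 , + 2) ∷ []) (ε ℕ.+ 2 ℕ.* j) + 1ℤ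

      row≡ : ∀ j → j ℕ.< suc m → row-value j ≡ + 2 * + ε + 1ℤ + + 4 * + j
      row≡ j (s≤s j≤m) = trans (cong₂ (λ a b → a + b + 1ℤ) (row-floor (suc k) 1ℤ t t≤) (row-floor (suc k) -1ℤ t t≤)) (trans (cong (λ s → + suc k * 1ℤ + s + (+ suc k * -1ℤ + s) + 1ℤ) (cong (λ s → + ε + s) (pos-* 2 j))) (lem (+ suc k) (+ ε) (+ j)))
        where
        t = ε ℕ.+ 2 ℕ.* j
        t≤ : t ℕ.≤ suc k
        t≤ = ℕ.≤-trans (ℕ.+-monoʳ-≤ ε (ℕ.*-monoʳ-≤ 2 j≤m)) (ℕ.≤-reflexive eq)
        lem : ∀ K ε j → K * 1ℤ + (ε + + 2 * j) + (K * -1ℤ + (ε + + 2 * j)) + 1ℤ ≡ + 2 * ε + 1ℤ + + 4 * j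
        lem = solve-∀

      total : ε ≡ 0 ⊎ ε ≡ 1 → + 2 * Σ< (suc m) row-value ≡ (+ 2 * + 0 + + 3 - + 2) * (+ suc k * + suc k) + + 3 * + suc k + + 2
      total ε∈ = trans (cong (λ s → + 2 * s) (Σ<-cong (suc m) row≡)) (trans (Σ<-affine (suc m) (+ 2 * + ε + 1ℤ) (+ 4)) (trans (polynomial ε∈) (cong (λ K → (+ 2 * + 0 + + 3 - + 2) * (K * K) + + 3 * K + + 2) K≡)))
        where
        polynomial : ε ≡ 0 ⊎ ε ≡ 1 → + suc m * (+ 2 * (+ 2 * + ε + 1ℤ) + + 4 * (+ suc m - 1ℤ)) ≡ (+ 2 * + 0 + + 3 - + 2) * ((+ ε + + 2 * + m) * (+ ε + + 2 * + m)) + + 3 * (+ ε + + 2 * + m) + + 2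
        polynomial (inj₁ refl) = lem (+ m)
          where
          lem : ∀ m → (1ℤ + m) * (+ 2 * (+ 2 * 0ℤ + 1ℤ) + + 4 * (1ℤ + m - 1ℤ)) ≡ (+ 2 * + 0 + + 3 - + 2) * ((0ℤ + + 2 * m) * (0ℤ + + 2 * m)) + + 3 * (0ℤ + + 2 * m) + + 2
          lem = solve-∀
        polynomial (inj₂ refl) = lem (+ m)
          where
          lem : ∀ m → (1ℤ + m) * (+ 2 * (+ 2 * 1ℤ + 1ℤ) + + 4 * (1ℤ + m - 1ℤ)) ≡ (+ 2 * + 0 + + 3 - + 2) * ((1ℤ + + 2 * m) * (1ℤ + + 2 * m)) + + 3 * (1ℤ + + 2 * m) + + 2
          lem = solve-∀

      size : ε ℕ.+ 2 ℕ.* suc m ≡ suc k ℕ.* 1 ℕ.+ 2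
      size = trans (next ε m) (cong (ℕ._+ 2) (trans eq (sym (ℕ.*-identityʳ (suc k)))))
        where
        next : ∀ ε m → ε ℕ.+ 2 ℕ.* suc m ≡ ε ℕ.+ 2 ℕ.* m ℕ.+ 2
        next = ℕ-Solver.solve-∀

      counted : ε ≡ 0 ⊎ ε ≡ 1 → Σ ℕ λ c → Counts (Dilate T (+ suc k)) c × + 2 * + c ≡ (+ 2 * + 0 + + 3 - + 2) * (+ suc k * + suc k) + + 3 * + suc k + + 2
      counted ε∈ = finish (counts-rows s k 1 (suc m) ε (- (+ m)) (bound ε∈) start (ℕ.≤-trans (ℕ.n≤1+n _) (ℕ.≤-reflexive (trans (ℕ.+-comm 2 (suc k ℕ.* 1)) (sym size)))) (ℕ.≤-reflexive size))
        where
        bound : ε ≡ 0 ⊎ ε ≡ 1 → ε ℕ.≤ 1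
        bound (inj₁ refl) = z≤n
        bound (inj₂ refl) = s≤s z≤n
        start : + suc k * -1ℤ + + ε ≡ + 2 * - (+ m)
        start = trans (cong (λ K → K * -1ℤ + + ε) (sym K≡)) (lem (+ ε) (+ m))
          where
          lem : ∀ ε m → (ε + + 2 * m) * -1ℤ + ε ≡ + 2 * - m
          lem = solve-∀
        finish : (Σ ℕ λ c → Counts (Dilate T (+ suc k)) c × + c ≡ Σ< (suc m) row-value) → _
        finish (c , counts-c , c≡) = c , counts-c , trans (cong (λ s → + 2 * s) c≡) (total ε∈)

    counts : Enumerated T (+ 0) (+ 3)
    counts k with parity-of (suc k)
    ... | m , ε , ε∈ , eq = counted k m ε eq ε∈

    polygon : Polygon 0 3
    polygon = 3 , halved T ,
      interior T (+ 2) 0ℤ 1ℤ -1ℤ (inj₁ refl) (inj₂ refl) (row-0 (+ 2) (by-decision 0ℤ (+ 2)) (by-decision (+ 2) (+ 4))) (row-0 (+ 3) (by-decision 0ℤ (+ 3)) (by-decision (+ 3) (+ 4))) (hull-vertex (here refl)) ,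
      ((3 , T , twice T) , not-lattice T 0ℤ -1ℤ 0ℤ (λ { _ (here refl) → ≤-refl ; _ (there (here refl)) → by-decision 0ℤ 1ℤ ; _ (there (there (here refl))) → by-decision 0ℤ 1ℤ })
        ((+ 2 , -1ℤ) , here refl , refl)) ,
      ehrhart T 0 3 counts
      where
      row-0 : ∀ x → 0ℤ ≤ x → x ≤ + 4 → Hull T x 0ℤ 1ℤ
      row-0 x lo hi = hull-between lo hi (hull-vertex (there (there (here refl)))) (hull-vertex (there (here refl)))

  -- the triangle (0, 0), (1, 2), (i + 1/2, 1), i = n ≥ 1
  module Thin (i : ℕ) (1≤i : 1 ℕ.≤ i) where
    n : ℤ
    n = + i
    1≤n : 1ℤ ≤ n
    1≤n = +≤+ 1≤i
    0≤n : 0ℤ ≤ n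
    0≤n = +m-nonneg i

    T : Vec LatticePoint 3
    T = (0ℤ , 0ℤ) ∷ (+ 2 , + 4) ∷ (+ 2 * n + 1ℤ , + 2) ∷ []

    E : Extent T 0ℤ 4
    E = record
      { low = λ { _ (here refl) → ≤-refl ; _ (there (here refl)) → +m-nonneg 4 ; _ (there (there (here refl))) → +m-nonneg 2 }
      ; high = λ { _ (here refl) → +m-nonneg 4 ; _ (there (here refl)) → ≤-refl ; _ (there (there (here refl))) → by-decision (+ 2) (+ 4) }
      ; bottom = 0ℤ , here refl ; top = + 2 , there (here refl) }

    right-edges left-edges : List Edge
    right-edges = (1 , + 2 * n + 1ℤ) ∷ (1 , 1ℤ - + 2 * n) ∷ []
    left-edges = (3 , - (+ 2)) ∷ []

    s : Sides T 0ℤ 4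
    s = sides-from E
      (boundary 0ℤ right-edges (here refl) (step (subst (λ x → (x , + 2) ∈ T) (sym (+-identityˡ (+ 2 * n + 1ℤ))) (there (there (here refl)))) first
        (step (subst (λ x → (x , + 4) ∈ T) (end-x n) (there (here refl))) second stop)) refl)
      (boundary 0ℤ left-edges (here refl) (step (there (here refl)) left stop) refl)
      where
      end-x : ∀ n → + 2 ≡ 0ℤ + (+ 2 * n + 1ℤ) + (1ℤ - + 2 * n)
      end-x = solve-∀
      first : Supports T 0ℤ 0ℤ (1 , + 2 * n + 1ℤ)
      first _ (here refl) = ≤-reflexive (lem n)
        where
        lem : ∀ n → (0ℤ - 0ℤ) * + 2 ≡ (+ 2 * n + 1ℤ) * (0ℤ - 0ℤ)
        lem = solve-∀
      first _ (there (here refl)) = ≤-by (_⊗_ {+ 8} (+m-nonneg 8) 0≤n) (lem n)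
        where
        lem : ∀ n → (+ 2 * n + 1ℤ) * (+ 4 - 0ℤ) + + 8 * 0ℤ ≡ (+ 2 - 0ℤ) * + 2 + + 8 * n
        lem = solve-∀
      first _ (there (there (here refl))) = ≤-reflexive (lem n)
        where
        lem : ∀ n → (+ 2 * n + 1ℤ - 0ℤ) * + 2 ≡ (+ 2 * n + 1ℤ) * (+ 2 - 0ℤ)
        lem = solve-∀
      second : Supports T (0ℤ + (+ 2 * n + 1ℤ)) (0ℤ + + 2) (1 , 1ℤ - + 2 * n)
      second _ (here refl) = ≤-by (_⊗_ {+ 8} (+m-nonneg 8) 0≤n) (lem n)
        where
        lem : ∀ n → (1ℤ - + 2 * n) * (0ℤ - (0ℤ + + 2)) + + 8 * 0ℤ ≡ (0ℤ - (0ℤ + (+ 2 * n + 1ℤ))) * + 2 + + 8 * n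
        lem = solve-∀
      second _ (there (here refl)) = ≤-reflexive (lem n)
        where
        lem : ∀ n → (+ 2 - (0ℤ + (+ 2 * n + 1ℤ))) * + 2 ≡ (1ℤ - + 2 * n) * (+ 4 - (0ℤ + + 2))
        lem = solve-∀
      second _ (there (there (here refl))) = ≤-reflexive (lem n)
        where
        lem : ∀ n → (+ 2 * n + 1ℤ - (0ℤ + (+ 2 * n + 1ℤ))) * + 2 ≡ (1ℤ - + 2 * n) * (+ 2 - (0ℤ + + 2))
        lem = solve-∀
      left : Supports (map flip T) 0ℤ 0ℤ (3 , - (+ 2))
      left _ (here refl) = ≤-refl
      left _ (there (here refl)) = ≤-refl
      left _ (there (there (here refl))) = ≤-by (_⊗_ {+ 8} (+m-nonneg 8) 0≤n) (lem n)
        where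
        lem : ∀ n → - (+ 2) * (0ℤ * (+ 2 * n + 1ℤ) + 1ℤ * + 2 - 0ℤ) + + 8 * 0ℤ ≡ (-1ℤ * (+ 2 * n + 1ℤ) + 0ℤ * + 2 - 0ℤ) * + 4 + + 8 * n
        lem = solve-∀

    module _ (k : ℕ) where
      K = + suc k
      even-part : ℕ → ℤ
      even-part y = + y /ℕ 2 + - (+ y) /ℕ 2 + 1ℤ

      right-low : ∀ y → y ℕ.< suc k → floor (suc k) 1 0ℤ right-edges (2 ℕ.* y) ≡ + y /ℕ 2 + n * + y
      right-low y y<K = trans (floor-edge (suc k) 1 0ℤ 1 (+ 2 * n + 1ℤ) ((1 , 1ℤ - + 2 * n) ∷ []) (ℕ.≤-trans (ℕ.*-monoʳ-< 2 y<K) (ℕ.≤-reflexive (ℕ.*-comm 2 (suc k)))))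
        (trans (cong (_/ℕ 4) (trans (cong (λ s → K * 0ℤ * + 2 + (+ 2 * n + 1ℤ) * s) (pos-* 2 y)) (lem K n (+ y)))) (trans (/-cancel 1 (+ y + n * + y * + 2)) (/-shift (+ y) (n * + y) 1)))
        where
        lem : ∀ K n y → K * 0ℤ * + 2 + (+ 2 * n + 1ℤ) * (+ 2 * y) ≡ + 2 * (y + n * y * + 2)
        lem = solve-∀

      right-high : ∀ z → z ℕ.< suc k → floor (suc k) 1 0ℤ right-edges (2 ℕ.* (suc k ℕ.+ z)) ≡ + (suc k ℕ.+ z) /ℕ 2 + n * (K - + z)
      right-high z z<K = trans (cong (floor (suc k) 1 0ℤ right-edges) (index (suc k) z)) (trans (floor-rest (suc k) 1 0ℤ 1 (+ 2 * n + 1ℤ) ((1 , 1ℤ - + 2 * n) ∷ []) (2 ℕ.* z))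
        (trans (floor-edge (suc k) 1 (0ℤ + (+ 2 * n + 1ℤ)) 1 (1ℤ - + 2 * n) [] (ℕ.≤-trans (ℕ.*-monoʳ-< 2 z<K) (ℕ.≤-reflexive (ℕ.*-comm 2 (suc k)))))
        (trans (cong (_/ℕ 4) (trans (cong (λ s → K * (0ℤ + (+ 2 * n + 1ℤ)) * + 2 + (1ℤ - + 2 * n) * s) (pos-* 2 z)) (lem K n (+ z)))) (trans (/-cancel 1 (K + + z + n * (K - + z) * + 2)) (/-shift (K + + z) (n * (K - + z)) 1)))))
        where
        index : ∀ k z → 2 ℕ.* (k ℕ.+ z) ≡ k ℕ.* 2 ℕ.+ 2 ℕ.* z
        index = ℕ-Solver.solve-∀
        lem : ∀ K n z → K * (0ℤ + (+ 2 * n + 1ℤ)) * + 2 + (1ℤ - + 2 * n) * (+ 2 * z) ≡ + 2 * (K + z + n * (K - z) * + 2)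
        lem = solve-∀

      left-floor : ∀ y → y ℕ.< suc k ℕ.+ suc k → floor (suc k) 1 0ℤ left-edges (2 ℕ.* y) ≡ - (+ y) /ℕ 2
      left-floor y y< = trans (floor-edge (suc k) 1 0ℤ 3 (- (+ 2)) [] (ℕ.≤-trans (ℕ.*-monoʳ-< 2 y<) (ℕ.≤-reflexive (index (suc k)))))
        (trans (cong (_/ℕ 8) (trans (cong (λ s → K * 0ℤ * + 4 + - (+ 2) * s) (pos-* 2 y)) (lem K (+ y)))) (/-cancel 3 (- (+ y))))
        where
        index : ∀ k → 2 ℕ.* (k ℕ.+ k) ≡ k ℕ.* 4
        index = ℕ-Solver.solve-∀
        lem : ∀ K y → K * 0ℤ * + 4 + - (+ 2) * (+ 2 * y) ≡ + 4 * - y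
        lem = solve-∀

      rows-total : (h : ℕ → ℤ) → (∀ y → y ℕ.< suc k → h y ≡ even-part y + n * + y) → (∀ z → z ℕ.< suc k → h (suc k ℕ.+ z) ≡ even-part (suc k ℕ.+ z) + n * (K - + z)) →
        h (suc k ℕ.+ suc k) ≡ 1ℤ → + 2 * Σ< (suc (suc k ℕ.+ suc k)) h ≡ + 2 * n * (K * K) + + 2 * K + + 2
      rows-total h low high top = begin
        + 2 * Σ< (suc (suc k ℕ.+ suc k)) h ≡⟨ cong (λ s → + 2 * s) (trans (Σ<-last (suc k ℕ.+ suc k) h) (cong₂ _+_ (Σ<-split (suc k) (suc k) h) top)) ⟩
        + 2 * (Σ< (suc k) h + Σ< (suc k) (λ z → h (suc k ℕ.+ z)) + 1ℤ) ≡⟨ cong (λ s → + 2 * (s + 1ℤ)) (cong₂ _+_ (trans (Σ<-cong (suc k) low) (Σ<-+ (suc k) even-part (λ y → n * + y))) (trans (Σ<-cong (suc k) high) (Σ<-+ (suc k) (λ z → even-part (suc k ℕ.+ z)) (λ z → n * (K - + z))))) ⟩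
        + 2 * (e₁ + a + (e₂ + b) + 1ℤ) ≡⟨ lem₁ e₁ e₂ a b ⟩
        + 2 * (e₁ + e₂) + (+ 2 * a + + 2 * b) + + 2 ≡⟨ cong₂ (λ u v → u + v + + 2) evens (cong₂ _+_ (trans (cong (λ s → + 2 * s) (Σ<-cong (suc k) λ y _ → lem₂ n (+ y))) (Σ<-affine (suc k) 0ℤ n)) (trans (cong (λ s → + 2 * s) (Σ<-cong (suc k) λ z _ → lem₃ n K (+ z))) (Σ<-affine (suc k) (n * K) (- n)))) ⟩
        + 2 * K + (K * (+ 2 * 0ℤ + n * (K - 1ℤ)) + K * (+ 2 * (n * K) + - n * (K - 1ℤ))) + + 2 ≡⟨ lem₄ n K ⟩
        + 2 * n * (K * K) + + 2 * K + + 2 ∎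
        where
        open ≡-Reasoning
        e₁ e₂ a b : ℤ
        e₁ = Σ< (suc k) even-part
        e₂ = Σ< (suc k) (λ z → even-part (suc k ℕ.+ z))
        a = Σ< (suc k) (λ y → n * + y)
        b = Σ< (suc k) (λ z → n * (K - + z))
        evens : + 2 * (e₁ + e₂) ≡ + 2 * K
        evens = trans (cong (λ s → + 2 * s) (trans (sym (Σ<-split (suc k) (suc k) even-part)) (cong (λ N → Σ< N even-part) (index (suc k))))) (trans (Σ<-periodic (suc k) 2 0ℤ even-part periodic) (lem K))
          where
          index : ∀ k → k ℕ.+ k ≡ k ℕ.* 2
          index = ℕ-Solver.solve-∀
          lem : ∀ K → + 2 * K * 1ℤ + + 2 * 0ℤ * (K * (K - 1ℤ)) ≡ + 2 * K
          lem = solve-∀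
          periodic : ∀ t → even-part (2 ℕ.+ t) ≡ even-part t + 0ℤ
          periodic t = trans (cong₂ (λ a b → a + b + 1ℤ) (trans (cong (_/ℕ 2) (l₁ (+ t))) (/-shift (+ t) 1ℤ 1)) (trans (cong (_/ℕ 2) (l₂ (+ t))) (/-shift (- (+ t)) -1ℤ 1))) (l₃ (+ t /ℕ 2) (- (+ t) /ℕ 2))
            where
            l₁ : ∀ t → + 2 + t ≡ t + 1ℤ * + 2
            l₁ = solve-∀
            l₂ : ∀ t → - (+ 2 + t) ≡ - t + -1ℤ * + 2
            l₂ = solve-∀
            l₃ : ∀ a b → a + 1ℤ + (b + -1ℤ) + 1ℤ ≡ a + b + 1ℤ + 0ℤ
            l₃ = solve-∀
        lem₁ : ∀ e₁ e₂ a b → + 2 * (e₁ + a + (e₂ + b) + 1ℤ) ≡ + 2 * (e₁ + e₂) + (+ 2 * a + + 2 * b) + + 2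
        lem₁ = solve-∀
        lem₂ : ∀ n y → n * y ≡ 0ℤ + n * y
        lem₂ = solve-∀
        lem₃ : ∀ n K z → n * (K - z) ≡ n * K + - n * z
        lem₃ = solve-∀
        lem₄ : ∀ n K → + 2 * K + (K * (+ 2 * 0ℤ + n * (K - 1ℤ)) + K * (+ 2 * (n * K) + - n * (K - 1ℤ))) + + 2 ≡ + 2 * n * (K * K) + + 2 * K + + 2
        lem₄ = solve-∀

      row-value : ℕ → ℤ
      row-value j = floor (suc k) 1 0ℤ right-edges (2 ℕ.* j) + floor (suc k) 1 0ℤ left-edges (2 ℕ.* j) + 1ℤ

      row-top : row-value (suc k ℕ.+ suc k) ≡ 1ℤ
      row-top = trans (cong (λ t → floor (suc k) 1 0ℤ right-edges t + floor (suc k) 1 0ℤ left-edges t + 1ℤ) (index (suc k)))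
        (trans (cong₂ (λ a b → a + b + 1ℤ) (trans (floor-top (suc k) 1 0ℤ right-edges) (/-exact K 1 (lem₁ K n))) (trans (floor-top (suc k) 1 0ℤ left-edges) (/-exact (- K) 1 (lem₂ K)))) (lem₃ K))
        where
        index : ∀ k → 2 ℕ.* (k ℕ.+ k) ≡ k ℕ.* 4
        index = ℕ-Solver.solve-∀
        lem₁ : ∀ K n → K * (0ℤ + (+ 2 * n + 1ℤ) + (1ℤ - + 2 * n)) ≡ K * + 2
        lem₁ = solve-∀
        lem₂ : ∀ K → K * (0ℤ + - (+ 2)) ≡ - K * + 2
        lem₂ = solve-∀
        lem₃ : ∀ K → K + - K + 1ℤ ≡ 1ℤ
        lem₃ = solve-∀

      row-low : ∀ y → y ℕ.< suc k → row-value y ≡ even-part y + n * + y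
      row-low y y<K = trans (cong₂ (λ a b → a + b + 1ℤ) (right-low y y<K) (left-floor y (ℕ.≤-trans y<K (ℕ.m≤m+n (suc k) (suc k))))) (lem (+ y /ℕ 2) (- (+ y) /ℕ 2) (n * + y))
        where
        lem : ∀ a b c → a + c + b + 1ℤ ≡ a + b + 1ℤ + c
        lem = solve-∀

      row-high : ∀ z → z ℕ.< suc k → row-value (suc k ℕ.+ z) ≡ even-part (suc k ℕ.+ z) + n * (K - + z)
      row-high z z<K = trans (cong₂ (λ a b → a + b + 1ℤ) (right-high z z<K) (left-floor (suc k ℕ.+ z) (ℕ.+-monoʳ-< (suc k) z<K))) (lem (+ (suc k ℕ.+ z) /ℕ 2) (- (+ (suc k ℕ.+ z)) /ℕ 2) (n * (K - + z)))
        where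
        lem : ∀ a b c → a + c + b + 1ℤ ≡ a + b + 1ℤ + c
        lem = solve-∀

    counts : Enumerated T n (+ 2)
    counts k = finish (counts-rows s k 1 (suc (suc k ℕ.+ suc k)) 0 0ℤ z≤n (start (+ suc k)) (ℕ.≤-trans (ℕ.n≤1+n _) (ℕ.≤-reflexive (beyond (suc k)))) (ℕ.≤-reflexive (within (suc k))))
      where
      start : ∀ K → K * 0ℤ + 0ℤ ≡ + 2 * 0ℤ
      start = solve-∀
      beyond : ∀ k → suc (suc (k ℕ.* 4)) ≡ 2 ℕ.* suc (k ℕ.+ k)
      beyond = ℕ-Solver.solve-∀
      within : ∀ k → 2 ℕ.* suc (k ℕ.+ k) ≡ k ℕ.* 4 ℕ.+ 2
      within = ℕ-Solver.solve-∀
      finish : (Σ ℕ λ c → Counts (Dilate T (+ suc k)) c × + c ≡ Σ< (suc (suc k ℕ.+ suc k)) (row-value k)) → _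
      finish (c , counts-c , c≡) = c , counts-c , trans (cong (λ s → + 2 * s) c≡) (trans (rows-total k (row-value k) (row-low k) (row-high k) (row-top k)) (lem n (+ suc k)))
        where
        lem : ∀ n K → + 2 * n * (K * K) + + 2 * K + + 2 ≡ (+ 2 * n + + 2 - + 2) * (K * K) + + 2 * K + + 2
        lem = solve-∀

    polygon : Polygon i 2
    polygon = 3 , halved T , interior T (+ 2) (+ 2) -1ℤ 1ℤ (inj₂ refl) (inj₁ refl) inner left-mid above ,
      ((3 , T , twice T) , not-lattice T 1ℤ 0ℤ n support ((+ 2 * n + 1ℤ , + 2) , there (there (here refl)) , value n)) , ehrhart T i 2 counts
      where
      left-mid : Hull T 1ℤ (+ 2) 1ℤ
      left-mid = hull-unscale (+ 2) (1≤+suc 1) (hull-mix 1ℤ 1ℤ (+m-nonneg 1) (+m-nonneg 1) (1≤+suc 1) (hull-vertex (here refl)) (hull-vertex (there (here refl))))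
      inner : Hull T (+ 2) (+ 2) 1ℤ
      inner = hull-between (by-decision 1ℤ (+ 2)) (≤-by (_⊗_ {+ 2} (+m-nonneg 2) 1≤n ⊕ +m-nonneg 1) (lem n)) left-mid (hull-vertex (there (there (here refl))))
        where
        lem : ∀ n → + 2 * n + 1ℤ + (+ 2 * 1ℤ + 0ℤ) ≡ + 2 + (+ 2 * n + 1ℤ)
        lem = solve-∀
      above : Hull T (+ 2) (+ 3) 1ℤ
      above = hull-unscale (+ 2) (1≤+suc 1) (hull-mix 1ℤ 1ℤ (+m-nonneg 1) (+m-nonneg 1) (1≤+suc 1) inner (hull-vertex (there (here refl))))
      value : ∀ n → 1ℤ * (+ 2 * n + 1ℤ) + 0ℤ * + 2 ≡ + 2 * n + 1ℤ
      value = solve-∀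
      support : ∀ u → u ∈ T → 1ℤ * proj₁ u + 0ℤ * proj₂ u ≤ + 2 * n + 1ℤ
      support _ (here refl) = ≤-by (_⊗_ {+ 2} (+m-nonneg 2) 0≤n ⊕ +m-nonneg 1) (lem n)
        where
        lem : ∀ n → + 2 * n + 1ℤ + (+ 2 * 0ℤ + 0ℤ) ≡ 1ℤ * 0ℤ + 0ℤ * 0ℤ + (+ 2 * n + 1ℤ)
        lem = solve-∀
      support _ (there (here refl)) = ≤-by (_⊗_ {+ 2} (+m-nonneg 2) 1≤n ⊕ +m-nonneg 1) (lem n)
        where
        lem : ∀ n → + 2 * n + 1ℤ + (+ 2 * 1ℤ + 0ℤ) ≡ 1ℤ * + 2 + 0ℤ * + 4 + (+ 2 * n + 1ℤ)
        lem = solve-∀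
      support _ (there (there (here refl))) = ≤-reflexive (value n)

  -- the pentagon (0, −1/2), (i + 1, 0), (i + t/2, 1/2), (t, 1), (0, 1), with i = n and t = τ
  module Pentagon (i t : ℕ) (1≤i : 1 ℕ.≤ i) (t≤ : t ℕ.≤ 2 ℕ.* i ℕ.+ 4) where
    n τ : ℤ
    n = + i
    τ = + t
    1≤n : 1ℤ ≤ n
    1≤n = +≤+ 1≤i
    0≤n : 0ℤ ≤ n
    0≤n = +m-nonneg i
    0≤τ : 0ℤ ≤ τ
    0≤τ = +m-nonneg t
    τ≤ : τ ≤ + 2 * n + + 4
    τ≤ = ≤-trans (+≤+ t≤) (≤-reflexive (cong (_+ + 4) (pos-* 2 i)))

    T : Vec LatticePoint 5
    T = (0ℤ , -1ℤ) ∷ (+ 2 * n + + 2 , 0ℤ) ∷ (+ 2 * n + τ , + 1) ∷ (+ 2 * τ , + 2) ∷ (0ℤ , + 2) ∷ []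

    E : Extent T -1ℤ 3
    E = record
      { low = λ { _ (here refl) → ≤-refl ; _ (there (here refl)) → by-decision -1ℤ 0ℤ ; _ (there (there (here refl))) → by-decision -1ℤ 1ℤ
                ; _ (there (there (there (here refl)))) → by-decision -1ℤ (+ 2) ; _ (there (there (there (there (here refl))))) → by-decision -1ℤ (+ 2) }
      ; high = λ { _ (here refl) → by-decision -1ℤ (+ 2) ; _ (there (here refl)) → by-decision 0ℤ (+ 2) ; _ (there (there (here refl))) → by-decision 1ℤ (+ 2)
                 ; _ (there (there (there (here refl)))) → ≤-refl ; _ (there (there (there (there (here refl))))) → ≤-refl }
      ; bottom = 0ℤ , here refl ; top = 0ℤ , there (there (there (there (here refl)))) }

    right-edges left-edges : List Edge
    right-edges = (0 , + 2 * n + + 2) ∷ (0 , τ - + 2) ∷ (0 , τ - + 2 * n) ∷ []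
    left-edges = (2 , 0ℤ) ∷ []

    s : Sides T -1ℤ 3
    s = sides-from E
      (boundary 0ℤ right-edges (here refl)
        (step (subst (λ x → (x , 0ℤ) ∈ T) (x₁ n) (there (here refl))) first
        (step (subst (λ x → (x , 1ℤ) ∈ T) (x₂ n τ) (there (there (here refl)))) second
        (step (subst (λ x → (x , + 2) ∈ T) (x₃ n τ) (there (there (there (here refl))))) third stop))) refl)
      (boundary 0ℤ left-edges (here refl) (step (there (there (there (there (here refl))))) left stop) refl)
      where
      x₁ : ∀ n → + 2 * n + + 2 ≡ 0ℤ + (+ 2 * n + + 2)
      x₁ = solve-∀
      x₂ : ∀ n τ → + 2 * n + τ ≡ 0ℤ + (+ 2 * n + + 2) + (τ - + 2)
      x₂ = solve-∀
      x₃ : ∀ n τ → + 2 * τ ≡ 0ℤ + (+ 2 * n + + 2) + (τ - + 2) + (τ - + 2 * n)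
      x₃ = solve-∀
      first : Supports T 0ℤ -1ℤ (0 , + 2 * n + + 2)
      first _ (here refl) = ≤-reflexive (lem n)
        where
        lem : ∀ n → (0ℤ - 0ℤ) * + 1 ≡ (+ 2 * n + + 2) * (-1ℤ - -1ℤ)
        lem = solve-∀
      first _ (there (here refl)) = ≤-reflexive (lem n)
        where
        lem : ∀ n → (+ 2 * n + + 2 - 0ℤ) * + 1 ≡ (+ 2 * n + + 2) * (0ℤ - -1ℤ)
        lem = solve-∀
      first _ (there (there (here refl))) = ≤-by τ≤ (lem n τ)
        where
        lem : ∀ n τ → (+ 2 * n + + 2) * (+ 1 - -1ℤ) + τ ≡ (+ 2 * n + τ - 0ℤ) * + 1 + (+ 2 * n + + 4)
        lem = solve-∀
      first _ (there (there (there (here refl)))) = ≤-by (_⊗_ {+ 2} (+m-nonneg 2) τ≤ ⊕ _⊗_ {+ 2} (+m-nonneg 2) 1≤n) (lem n τ)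
        where
        lem : ∀ n τ → (+ 2 * n + + 2) * (+ 2 - -1ℤ) + (+ 2 * τ + + 2 * 1ℤ) ≡ (+ 2 * τ - 0ℤ) * + 1 + (+ 2 * (+ 2 * n + + 4) + + 2 * n)
        lem = solve-∀
      first _ (there (there (there (there (here refl))))) = ≤-by (_⊗_ {+ 6} (+m-nonneg 6) 0≤n ⊕ +m-nonneg 6) (lem n)
        where
        lem : ∀ n → (+ 2 * n + + 2) * (+ 2 - -1ℤ) + (+ 6 * 0ℤ + 0ℤ) ≡ (0ℤ - 0ℤ) * + 1 + (+ 6 * n + + 6)
        lem = solve-∀
      second : Supports T (0ℤ + (+ 2 * n + + 2)) 0ℤ (0 , τ - + 2)
      second _ (here refl) = ≤-by τ≤ (lem n τ)
        where
        lem : ∀ n τ → (τ - + 2) * (-1ℤ - 0ℤ) + τ ≡ (0ℤ - (0ℤ + (+ 2 * n + + 2))) * + 1 + (+ 2 * n + + 4)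
        lem = solve-∀
      second _ (there (here refl)) = ≤-reflexive (lem n τ)
        where
        lem : ∀ n τ → (+ 2 * n + + 2 - (0ℤ + (+ 2 * n + + 2))) * + 1 ≡ (τ - + 2) * (0ℤ - 0ℤ)
        lem = solve-∀
      second _ (there (there (here refl))) = ≤-reflexive (lem n τ)
        where
        lem : ∀ n τ → (+ 2 * n + τ - (0ℤ + (+ 2 * n + + 2))) * + 1 ≡ (τ - + 2) * (+ 1 - 0ℤ)
        lem = solve-∀
      second _ (there (there (there (here refl)))) = ≤-by (_⊗_ {+ 2} (+m-nonneg 2) 1≤n) (lem n τ)
        where
        lem : ∀ n τ → (τ - + 2) * (+ 2 - 0ℤ) + + 2 * 1ℤ ≡ (+ 2 * τ - (0ℤ + (+ 2 * n + + 2))) * + 1 + + 2 * n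
        lem = solve-∀
      second _ (there (there (there (there (here refl))))) = ≤-by (_⊗_ {+ 2} (+m-nonneg 2) 1≤n ⊕ _⊗_ {+ 2} (+m-nonneg 2) 0≤τ) (lem n τ)
        where
        lem : ∀ n τ → (τ - + 2) * (+ 2 - 0ℤ) + (+ 2 * 1ℤ + + 2 * 0ℤ) ≡ (0ℤ - (0ℤ + (+ 2 * n + + 2))) * + 1 + (+ 2 * n + + 2 * τ)
        lem = solve-∀
      third : Supports T (0ℤ + (+ 2 * n + + 2) + (τ - + 2)) 1ℤ (0 , τ - + 2 * n)
      third _ (here refl) = ≤-by (τ≤ ⊕ _⊗_ {+ 4} (+m-nonneg 4) 1≤n) (lem n τ)
        where
        lem : ∀ n τ → (τ - + 2 * n) * (-1ℤ - 1ℤ) + (τ + + 4 * 1ℤ) ≡ (0ℤ - (0ℤ + (+ 2 * n + + 2) + (τ - + 2))) * + 1 + (+ 2 * n + + 4 + + 4 * n)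
        lem = solve-∀
      third _ (there (here refl)) = ≤-by (_⊗_ {+ 2} (+m-nonneg 2) 1≤n) (lem n τ)
        where
        lem : ∀ n τ → (τ - + 2 * n) * (0ℤ - 1ℤ) + + 2 * 1ℤ ≡ (+ 2 * n + + 2 - (0ℤ + (+ 2 * n + + 2) + (τ - + 2))) * + 1 + + 2 * n
        lem = solve-∀
      third _ (there (there (here refl))) = ≤-reflexive (lem n τ)
        where
        lem : ∀ n τ → (+ 2 * n + τ - (0ℤ + (+ 2 * n + + 2) + (τ - + 2))) * + 1 ≡ (τ - + 2 * n) * (1ℤ - 1ℤ)
        lem = solve-∀
      third _ (there (there (there (here refl)))) = ≤-reflexive (lem n τ)
        where
        lem : ∀ n τ → (+ 2 * τ - (0ℤ + (+ 2 * n + + 2) + (τ - + 2))) * + 1 ≡ (τ - + 2 * n) * (+ 2 - 1ℤ)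
        lem = solve-∀
      third _ (there (there (there (there (here refl))))) = ≤-by (_⊗_ {+ 2} (+m-nonneg 2) 0≤τ) (lem n τ)
        where
        lem : ∀ n τ → (τ - + 2 * n) * (+ 2 - 1ℤ) + + 2 * 0ℤ ≡ (0ℤ - (0ℤ + (+ 2 * n + + 2) + (τ - + 2))) * + 1 + + 2 * τ
        lem = solve-∀
      left-≤ : ∀ {x} y → 0ℤ ≤ x → (-1ℤ * x + 0ℤ * y - 0ℤ) * + 3 ≤ 0ℤ
      left-≤ {x} y 0≤x = ≤-by (_⊗_ {+ 3} (+m-nonneg 3) 0≤x) (lem x y)
        where
        lem : ∀ x y → 0ℤ + + 3 * 0ℤ ≡ (-1ℤ * x + 0ℤ * y - 0ℤ) * + 3 + + 3 * x
        lem = solve-∀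
      left : Supports (map flip T) 0ℤ -1ℤ (2 , 0ℤ)
      left _ (here refl) = ≤-refl
      left _ (there (here refl)) = left-≤ {+ 2 * n + + 2} 0ℤ (≤-trans (+m-nonneg 2) (≤-by (_⊗_ {+ 2} (+m-nonneg 2) 0≤n) (lem n)))
        where
        lem : ∀ n → + 2 * n + + 2 + + 2 * 0ℤ ≡ + 2 + + 2 * n
        lem = solve-∀
      left _ (there (there (here refl))) = left-≤ {+ 2 * n + τ} (+ 1) (_⊗_ {+ 2} (+m-nonneg 2) 0≤n ⊕ 0≤τ)
      left _ (there (there (there (here refl)))) = left-≤ {+ 2 * τ} (+ 2) (_⊗_ {+ 2} (+m-nonneg 2) 0≤τ)
      left _ (there (there (there (there (here refl))))) = ≤-refl

    module _ (k m ε : ℕ) (eq : ε ℕ.+ 2 ℕ.* m ≡ suc k) where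
      K M ε′ : ℤ
      K = + suc k
      M = + m
      ε′ = + ε
      K≡ : ε′ + + 2 * M ≡ K
      K≡ = trans (cong (λ s → ε′ + s) (sym (pos-* 2 m))) (cong +_ eq)

      right-floor : ℕ → ℤ
      right-floor = floor (suc k) 1 0ℤ right-edges

      K*1 : suc k ℕ.* 1 ≡ suc k
      K*1 = ℕ.*-identityʳ (suc k)

      row₁ : ∀ j → j ℕ.< m → right-floor (ε ℕ.+ 2 ℕ.* j) ≡ (n + 1ℤ) * (ε′ + + 2 * + j)
      row₁ j j<m = trans (floor-edge (suc k) 1 0ℤ 0 (+ 2 * n + + 2) ((0 , τ - + 2) ∷ (0 , τ - + 2 * n) ∷ []) in-edge) (/-exact ((n + 1ℤ) * (ε′ + + 2 * + j)) 1 (trans (cong (λ s → K * 0ℤ * + 1 + (+ 2 * n + + 2) * (ε′ + s)) (pos-* 2 j)) (lem K n (ε′ + + 2 * + j))))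
        where
        in-edge : ε ℕ.+ 2 ℕ.* j ℕ.< suc k ℕ.* 1
        in-edge = ℕ.≤-trans (ℕ.+-monoʳ-< ε (ℕ.*-monoʳ-< 2 j<m)) (ℕ.≤-reflexive (trans eq (sym K*1)))
        lem : ∀ K n u → K * 0ℤ * + 1 + (+ 2 * n + + 2) * u ≡ (n + 1ℤ) * u * + 2
        lem = solve-∀

      row₂ : ∀ v → v ℕ.< m ℕ.+ ε → ε ℕ.≤ 1 → right-floor (ε ℕ.+ 2 ℕ.* (m ℕ.+ v)) ≡ K * (n + 1ℤ) + (τ - + 2) * + v
      row₂ v v< ε≤1 = trans (cong right-floor index) (trans (floor-rest (suc k) 1 0ℤ 0 (+ 2 * n + + 2) ((0 , τ - + 2) ∷ (0 , τ - + 2 * n) ∷ []) (2 ℕ.* v)) (trans (floor-edge (suc k) 1 (0ℤ + (+ 2 * n + + 2)) 0 (τ - + 2) ((0 , τ - + 2 * n) ∷ []) in-edge)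
        (/-exact (K * (n + 1ℤ) + (τ - + 2) * + v) 1 (trans (cong (λ s → K * (0ℤ + (+ 2 * n + + 2)) * + 1 + (τ - + 2) * s) (pos-* 2 v)) (lem K n τ (+ v))))))
        where
        index : ε ℕ.+ 2 ℕ.* (m ℕ.+ v) ≡ suc k ℕ.* 1 ℕ.+ 2 ℕ.* v
        index = trans (lem′ ε m v) (cong (ℕ._+ 2 ℕ.* v) (trans eq (sym K*1)))
          where
          lem′ : ∀ ε m v → ε ℕ.+ 2 ℕ.* (m ℕ.+ v) ≡ ε ℕ.+ 2 ℕ.* m ℕ.+ 2 ℕ.* v
          lem′ = ℕ-Solver.solve-∀
        in-edge : 2 ℕ.* v ℕ.< suc k ℕ.* 1
        in-edge = ℕ.+-cancelʳ-≤ 1 _ _ (ℕ.≤-trans (ℕ.≤-reflexive (lem₁ v)) (ℕ.≤-trans (ℕ.*-monoʳ-≤ 2 v<) (ℕ.≤-trans (ℕ.≤-reflexive (lem₂ ε m)) (ℕ.≤-trans (ℕ.+-monoʳ-≤ (ε ℕ.+ 2 ℕ.* m) ε≤1) (ℕ.≤-reflexive (cong (ℕ._+ 1) (trans eq (sym K*1))))))))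
          where
          lem₁ : ∀ v → suc (2 ℕ.* v) ℕ.+ 1 ≡ 2 ℕ.* suc v
          lem₁ = ℕ-Solver.solve-∀
          lem₂ : ∀ ε m → 2 ℕ.* (m ℕ.+ ε) ≡ ε ℕ.+ 2 ℕ.* m ℕ.+ ε
          lem₂ = ℕ-Solver.solve-∀
        lem : ∀ K n τ v → K * (0ℤ + (+ 2 * n + + 2)) * + 1 + (τ - + 2) * (+ 2 * v) ≡ (K * (n + 1ℤ) + (τ - + 2) * v) * + 2
        lem = solve-∀

      row₃ : ∀ j → j ℕ.< suc m → right-floor (ε ℕ.+ 2 ℕ.* (m ℕ.+ (m ℕ.+ ε ℕ.+ j))) ≡ + 2 * n * M + τ * (M + ε′) + (τ - + 2 * n) * + j
      row₃ j (s≤s j≤m) = trans (cong right-floor index) (trans (floor-rest (suc k) 1 0ℤ 0 (+ 2 * n + + 2) ((0 , τ - + 2) ∷ (0 , τ - + 2 * n) ∷ []) (suc k ℕ.* 1 ℕ.+ u)) (trans (floor-rest (suc k) 1 (0ℤ + (+ 2 * n + + 2)) 0 (τ - + 2) ((0 , τ - + 2 * n) ∷ []) u) (last (ℕ.m≤n⇒m<n∨m≡n j≤m))))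
        where
        u = ε ℕ.+ 2 ℕ.* j
        x = 0ℤ + (+ 2 * n + + 2) + (τ - + 2)
        index : ε ℕ.+ 2 ℕ.* (m ℕ.+ (m ℕ.+ ε ℕ.+ j)) ≡ suc k ℕ.* 1 ℕ.+ (suc k ℕ.* 1 ℕ.+ u)
        index = trans (lem ε m j) (cong (λ κ → κ ℕ.+ (κ ℕ.+ u)) (trans eq (sym K*1)))
          where
          lem : ∀ ε m j → ε ℕ.+ 2 ℕ.* (m ℕ.+ (m ℕ.+ ε ℕ.+ j)) ≡ ε ℕ.+ 2 ℕ.* m ℕ.+ (ε ℕ.+ 2 ℕ.* m ℕ.+ (ε ℕ.+ 2 ℕ.* j))
          lem = ℕ-Solver.solve-∀
        last : j ℕ.< m ⊎ j ≡ m → floor (suc k) 1 x ((0 , τ - + 2 * n) ∷ []) u ≡ + 2 * n * M + τ * (M + ε′) + (τ - + 2 * n) * + j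
        last (inj₁ j<m) = trans (floor-edge (suc k) 1 x 0 (τ - + 2 * n) [] in-edge)
          (/-exact (+ 2 * n * M + τ * (M + ε′) + (τ - + 2 * n) * + j) 1 (trans (cong₂ (λ K s → K * x * + 1 + (τ - + 2 * n) * (ε′ + s)) (sym K≡) (pos-* 2 j)) (lem n τ ε′ M (+ j))))
          where
          in-edge : u ℕ.< suc k ℕ.* 1
          in-edge = ℕ.≤-trans (ℕ.+-monoʳ-< ε (ℕ.*-monoʳ-< 2 j<m)) (ℕ.≤-reflexive (trans eq (sym K*1)))
          lem : ∀ n τ ε M j → (ε + + 2 * M) * (0ℤ + (+ 2 * n + + 2) + (τ - + 2)) * + 1 + (τ - + 2 * n) * (ε + + 2 * j) ≡ (+ 2 * n * M + τ * (M + ε) + (τ - + 2 * n) * j) * + 2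
          lem = solve-∀
        last (inj₂ refl) = trans (cong (floor (suc k) 1 x ((0 , τ - + 2 * n) ∷ [])) (trans eq (sym K*1))) (trans (floor-top (suc k) 1 x ((0 , τ - + 2 * n) ∷ []))
          (/-exact (+ 2 * n * M + τ * (M + ε′) + (τ - + 2 * n) * M) 1 (trans (cong (_* (x + (τ - + 2 * n))) (sym K≡)) (lem n τ ε′ M))))
          where
          lem : ∀ n τ ε M → (ε + + 2 * M) * (0ℤ + (+ 2 * n + + 2) + (τ - + 2) + (τ - + 2 * n)) ≡ (+ 2 * n * M + τ * (M + ε) + (τ - + 2 * n) * M) * + 2
          lem = solve-∀

      left-floor : ∀ t → t ℕ.≤ suc k ℕ.* 3 → floor (suc k) 1 0ℤ left-edges t ≡ 0ℤ
      left-floor t t≤ with ℕ.m≤n⇒m<n∨m≡n t≤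
      ... | inj₁ t< = trans (floor-edge (suc k) 1 0ℤ 2 0ℤ [] t<) (/-exact 0ℤ 5 (lem K (+ t)))
        where
        lem : ∀ K t → K * 0ℤ * + 3 + 0ℤ * t ≡ 0ℤ * + 6
        lem = solve-∀
      ... | inj₂ refl = trans (floor-top (suc k) 1 0ℤ left-edges) (/-exact 0ℤ 1 (*-zeroʳ K))

      total-rows : ℕ
      total-rows = m ℕ.+ (m ℕ.+ ε ℕ.+ suc m)

      size : ε ℕ.+ 2 ℕ.* total-rows ≡ suc k ℕ.* 3 ℕ.+ 2
      size = trans (lem ε m) (cong (λ κ → κ ℕ.* 3 ℕ.+ 2) eq)
        where
        lem : ∀ ε m → ε ℕ.+ 2 ℕ.* (m ℕ.+ (m ℕ.+ ε ℕ.+ suc m)) ≡ (ε ℕ.+ 2 ℕ.* m) ℕ.* 3 ℕ.+ 2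
        lem = ℕ-Solver.solve-∀

      row-count : ∀ j → j ℕ.< total-rows → right-floor (ε ℕ.+ 2 ℕ.* j) + floor (suc k) 1 0ℤ left-edges (ε ℕ.+ 2 ℕ.* j) + 1ℤ ≡ right-floor (ε ℕ.+ 2 ℕ.* j) + 1ℤ
      row-count j j< = cong (_+ 1ℤ) (trans (cong (λ s → right-floor (ε ℕ.+ 2 ℕ.* j) + s) (left-floor (ε ℕ.+ 2 ℕ.* j) (ℕ.+-cancelʳ-≤ 2 _ _ (ℕ.≤-trans (ℕ.≤-reflexive (lem ε j)) (ℕ.≤-trans (ℕ.+-monoʳ-≤ ε (ℕ.*-monoʳ-≤ 2 j<)) (ℕ.≤-reflexive size)))))) (+-identityʳ (right-floor (ε ℕ.+ 2 ℕ.* j))))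
        where
        lem : ∀ ε j → ε ℕ.+ 2 ℕ.* j ℕ.+ 2 ≡ ε ℕ.+ 2 ℕ.* suc j
        lem = ℕ-Solver.solve-∀

      total : ε ≡ 0 ⊎ ε ≡ 1 → + 2 * Σ< total-rows (λ j → right-floor (ε ℕ.+ 2 ℕ.* j) + 1ℤ) ≡ (+ 2 * n + (τ + + 3) - + 2) * (K * K) + (τ + + 3) * K + + 2
      total ε∈ = begin
        + 2 * Σ< total-rows h ≡⟨ cong (λ s → + 2 * s) (trans (Σ<-split m (m ℕ.+ ε ℕ.+ suc m) h) (cong (λ s → Σ< m h + s) (Σ<-split (m ℕ.+ ε) (suc m) (λ j → h (m ℕ.+ j))))) ⟩
        + 2 * (Σ< m h + (Σ< (m ℕ.+ ε) (λ j → h (m ℕ.+ j)) + Σ< (suc m) (λ j → h (m ℕ.+ (m ℕ.+ ε ℕ.+ j))))) ≡⟨ lem₀ (Σ< m h) (Σ< (m ℕ.+ ε) (λ j → h (m ℕ.+ j))) (Σ< (suc m) (λ j → h (m ℕ.+ (m ℕ.+ ε ℕ.+ j)))) ⟩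
        + 2 * Σ< m h + + 2 * Σ< (m ℕ.+ ε) (λ j → h (m ℕ.+ j)) + + 2 * Σ< (suc m) (λ j → h (m ℕ.+ (m ℕ.+ ε ℕ.+ j))) ≡⟨ cong₂ _+_ (cong₂ _+_
          (trans (cong (λ s → + 2 * s) (Σ<-cong m λ j j<m → trans (cong (_+ 1ℤ) (row₁ j j<m)) (lem₁ n ε′ (+ j)))) (Σ<-affine m ((n + 1ℤ) * ε′ + 1ℤ) (+ 2 * (n + 1ℤ))))
          (trans (cong (λ s → + 2 * s) (Σ<-cong (m ℕ.+ ε) λ v v< → trans (cong (_+ 1ℤ) (row₂ v v< ε≤1)) (lem₂ (K * (n + 1ℤ)) (τ - + 2) (+ v)))) (Σ<-affine (m ℕ.+ ε) (K * (n + 1ℤ) + 1ℤ) (τ - + 2))))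
          (trans (cong (λ s → + 2 * s) (Σ<-cong (suc m) λ j j< → trans (cong (_+ 1ℤ) (row₃ j j<)) (lem₂ (+ 2 * n * M + τ * (M + ε′)) (τ - + 2 * n) (+ j)))) (Σ<-affine (suc m) (+ 2 * n * M + τ * (M + ε′) + 1ℤ) (τ - + 2 * n))) ⟩
        M * (+ 2 * ((n + 1ℤ) * ε′ + 1ℤ) + + 2 * (n + 1ℤ) * (M - 1ℤ)) + (M + ε′) * (+ 2 * (K * (n + 1ℤ) + 1ℤ) + (τ - + 2) * (M + ε′ - 1ℤ)) +
          (1ℤ + M) * (+ 2 * (+ 2 * n * M + τ * (M + ε′) + 1ℤ) + (τ - + 2 * n) * (1ℤ + M - 1ℤ)) ≡⟨ cong (λ K → M * (+ 2 * ((n + 1ℤ) * ε′ + 1ℤ) + + 2 * (n + 1ℤ) * (M - 1ℤ)) + (M + ε′) * (+ 2 * (K * (n + 1ℤ) + 1ℤ) + (τ - + 2) * (M + ε′ - 1ℤ)) +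
          (1ℤ + M) * (+ 2 * (+ 2 * n * M + τ * (M + ε′) + 1ℤ) + (τ - + 2 * n) * (1ℤ + M - 1ℤ))) (sym K≡) ⟩
        _ ≡⟨ polynomial ε∈ ⟩
        (+ 2 * n + (τ + + 3) - + 2) * ((ε′ + + 2 * M) * (ε′ + + 2 * M)) + (τ + + 3) * (ε′ + + 2 * M) + + 2 ≡⟨ cong (λ K → (+ 2 * n + (τ + + 3) - + 2) * (K * K) + (τ + + 3) * K + + 2) K≡ ⟩
        (+ 2 * n + (τ + + 3) - + 2) * (K * K) + (τ + + 3) * K + + 2 ∎
        where
        open ≡-Reasoning
        h : ℕ → ℤ
        h j = right-floor (ε ℕ.+ 2 ℕ.* j) + 1ℤ
        ε≤1 : ε ℕ.≤ 1
        ε≤1 = bound ε∈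
          where
          bound : ε ≡ 0 ⊎ ε ≡ 1 → ε ℕ.≤ 1
          bound (inj₁ refl) = z≤n
          bound (inj₂ refl) = s≤s z≤n
        lem₀ : ∀ a b c → + 2 * (a + (b + c)) ≡ + 2 * a + + 2 * b + + 2 * c
        lem₀ = solve-∀
        lem₁ : ∀ n ε j → (n + 1ℤ) * (ε + + 2 * j) + 1ℤ ≡ (n + 1ℤ) * ε + 1ℤ + + 2 * (n + 1ℤ) * j
        lem₁ = solve-∀
        lem₂ : ∀ a b j → a + b * j + 1ℤ ≡ a + 1ℤ + b * j
        lem₂ = solve-∀
        polynomial : ε ≡ 0 ⊎ ε ≡ 1 → M * (+ 2 * ((n + 1ℤ) * ε′ + 1ℤ) + + 2 * (n + 1ℤ) * (M - 1ℤ)) + (M + ε′) * (+ 2 * ((ε′ + + 2 * M) * (n + 1ℤ) + 1ℤ) + (τ - + 2) * (M + ε′ - 1ℤ)) +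
          (1ℤ + M) * (+ 2 * (+ 2 * n * M + τ * (M + ε′) + 1ℤ) + (τ - + 2 * n) * (1ℤ + M - 1ℤ)) ≡
          (+ 2 * n + (τ + + 3) - + 2) * ((ε′ + + 2 * M) * (ε′ + + 2 * M)) + (τ + + 3) * (ε′ + + 2 * M) + + 2
        polynomial (inj₁ refl) = lem n τ M
          where
          lem : ∀ n τ M → M * (+ 2 * ((n + 1ℤ) * 0ℤ + 1ℤ) + + 2 * (n + 1ℤ) * (M - 1ℤ)) + (M + 0ℤ) * (+ 2 * ((0ℤ + + 2 * M) * (n + 1ℤ) + 1ℤ) + (τ - + 2) * (M + 0ℤ - 1ℤ)) +
            (1ℤ + M) * (+ 2 * (+ 2 * n * M + τ * (M + 0ℤ) + 1ℤ) + (τ - + 2 * n) * (1ℤ + M - 1ℤ)) ≡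
            (+ 2 * n + (τ + + 3) - + 2) * ((0ℤ + + 2 * M) * (0ℤ + + 2 * M)) + (τ + + 3) * (0ℤ + + 2 * M) + + 2
          lem = solve-∀
        polynomial (inj₂ refl) = lem n τ M
          where
          lem : ∀ n τ M → M * (+ 2 * ((n + 1ℤ) * 1ℤ + 1ℤ) + + 2 * (n + 1ℤ) * (M - 1ℤ)) + (M + 1ℤ) * (+ 2 * ((1ℤ + + 2 * M) * (n + 1ℤ) + 1ℤ) + (τ - + 2) * (M + 1ℤ - 1ℤ)) +
            (1ℤ + M) * (+ 2 * (+ 2 * n * M + τ * (M + 1ℤ) + 1ℤ) + (τ - + 2 * n) * (1ℤ + M - 1ℤ)) ≡
            (+ 2 * n + (τ + + 3) - + 2) * ((1ℤ + + 2 * M) * (1ℤ + + 2 * M)) + (τ + + 3) * (1ℤ + + 2 * M) + + 2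
          lem = solve-∀

      counted : ε ≡ 0 ⊎ ε ≡ 1 → Σ ℕ λ c → Counts (Dilate T K) c × + 2 * + c ≡ (+ 2 * n + (τ + + 3) - + 2) * (K * K) + (τ + + 3) * K + + 2
      counted ε∈ = finish (counts-rows s k 1 total-rows ε (- M) (bound ε∈) start (ℕ.≤-trans (ℕ.n≤1+n _) (ℕ.≤-reflexive (trans (ℕ.+-comm 2 (suc k ℕ.* 3)) (sym size)))) (ℕ.≤-reflexive size))
        where
        bound : ε ≡ 0 ⊎ ε ≡ 1 → ε ℕ.≤ 1
        bound (inj₁ refl) = z≤n
        bound (inj₂ refl) = s≤s z≤n
        start : K * -1ℤ + ε′ ≡ + 2 * - M
        start = trans (cong (λ K → K * -1ℤ + ε′) (sym K≡)) (lem ε′ M)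
          where
          lem : ∀ ε M → (ε + + 2 * M) * -1ℤ + ε ≡ + 2 * - M
          lem = solve-∀
        finish : (Σ ℕ λ c → Counts (Dilate T K) c × + c ≡ Σ< total-rows (λ j → right-floor (ε ℕ.+ 2 ℕ.* j) + floor (suc k) 1 0ℤ left-edges (ε ℕ.+ 2 ℕ.* j) + 1ℤ)) → _
        finish (c , counts-c , c≡) = c , counts-c , trans (cong (λ s → + 2 * s) (trans c≡ (Σ<-cong total-rows row-count))) (total ε∈)

    counts : Enumerated T n (+ (t ℕ.+ 3))
    counts k with parity-of (suc k)
    ... | m , ε , ε∈ , eq = counted k m ε eq ε∈

    polygon : Polygon i (t ℕ.+ 3)
    polygon = 5 , halved T , interior T 0ℤ 0ℤ 1ℤ 1ℤ (inj₁ refl) (inj₁ refl) origin east north ,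
      ((5 , T , twice T) , not-lattice T 0ℤ -1ℤ 0ℤ support ((0ℤ , -1ℤ) , here refl , refl)) , ehrhart T i (t ℕ.+ 3) counts
      where
      bottom = hull-vertex {T = T} (here refl)
      top = hull-vertex {T = T} (there (there (there (there (here refl)))))
      origin : Hull T 0ℤ 0ℤ 1ℤ
      origin = hull-unscale (+ 3) (1≤+suc 2) (hull-mix (+ 2) 1ℤ (+m-nonneg 2) (+m-nonneg 1) (1≤+suc 2) bottom top)
      north : Hull T 0ℤ 1ℤ 1ℤ
      north = hull-unscale (+ 3) (1≤+suc 2) (hull-mix 1ℤ (+ 2) (+m-nonneg 1) (+m-nonneg 2) (1≤+suc 2) bottom top)
      east : Hull T 1ℤ 0ℤ 1ℤ
      east = hull-between (+m-nonneg 1) (≤-by (_⊗_ {+ 2} (+m-nonneg 2) 0≤n ⊕ +m-nonneg 1) (lem n)) origin (hull-vertex (there (here refl)))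
        where
        lem : ∀ n → + 2 * n + + 2 + (+ 2 * 0ℤ + 0ℤ) ≡ 1ℤ + (+ 2 * n + 1ℤ)
        lem = solve-∀
      support : ∀ u → u ∈ T → 0ℤ * proj₁ u + -1ℤ * proj₂ u ≤ + 2 * 0ℤ + 1ℤ
      support _ (here refl) = ≤-refl
      support _ (there (here refl)) = by-decision 0ℤ 1ℤ
      support _ (there (there (here refl))) = by-decision -1ℤ 1ℤ
      support _ (there (there (there (here refl)))) = by-decision (- (+ 2)) 1ℤ
      support _ (there (there (there (there (here refl))))) = by-decision (- (+ 2)) 1ℤ

  sufficiency : ∀ i b → Admissible i b → Polygon i b
  sufficiency _ _ (inj₁ (refl , refl)) = Triangle.polygon
  sufficiency i 0 (inj₂ (_ , () , _))
  sufficiency i 1 (inj₂ (_ , s≤s () , _))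
  sufficiency i 2 (inj₂ (1≤i , _ , _)) = Thin.polygon i 1≤i
  sufficiency i (suc (suc (suc t))) (inj₂ (1≤i , _ , b≤)) = subst (Polygon i) (ℕ.+-comm t 3)
    (Pentagon.polygon i t 1≤i (ℕ.+-cancelʳ-≤ 3 t (2 ℕ.* i ℕ.+ 4) (ℕ.≤-trans (ℕ.≤-reflexive (ℕ.+-comm t 3)) (ℕ.≤-trans b≤ (ℕ.≤-reflexive (sym (ℕ.+-assoc (2 ℕ.* i) 4 3)))))))

open import Defs
open import Data.Nat using (ℕ)
open import Data.Integer using (+_)
open import Data.Rational using (ℚ; 1ℚ; _/_; _+_; _-_)
open import Data.Product using (_×_; Σ; _,_)
open import Data.Vec using (Vec)
open import Function.Bundles using (_⇔_; mk⇔)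
open import Relation.Binary.PropositionalEquality using (_≡_; refl)

theorem1p6 : (e₂ e₁ e₀ : ℚ) →
    (Σ ℕ λ n → Σ (Vec Point n) λ S →
        RationalPolygon S × HasDenom2 S × IsEhrhartPolynomial S e₂ e₁ e₀)
    ⇔ (e₀ ≡ 1ℚ × Σ ℕ λ i → Σ ℕ λ b → Admissible i b ×
         e₂ ≡ (+ i / 1) + (+ b / 2) - 1ℚ × e₁ ≡ + b / 2)
theorem1p6 e₂ e₁ e₀ = mk⇔ (λ (_ , S , interior , denom , ehrhart) → Necessity.necessity S interior denom ehrhart)
  (λ { (refl , i , b , admissible , refl , refl) → Sufficiency.sufficiency i b admissible })
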